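{- For $g\ge 0$ and $n\ge 1$ let $c_{g,n}$ be the number of rooted hypermaps of genus $g$ with $n$ darts, and let $C_g(s)=\sum_{n\ge 2g+1}c_{g,n}s^n$. Substitute $s=t(1-2t)$, so that $C_g(t(1-2t))$ is a formal power series in $t$. Then, as formal power series in $t$ (equivalently, as expansions of rational functions at $t=0$), $$C_0(t(1-2t))=\frac{t(1-3t)}{(1-2t)^2},\qquad C_1(t(1-2t))=\frac{t^3}{(1-t)(1-4t)^2},$$ and for every $g\ge 2$ $$C_g(t(1-2t))=\frac{P_g(t)}{(1-t)^{4g-3}(1-4t)^{5g-3}},$$ where $P_g(t)=\sum_{i=2g+1}^{9g-7}p_{g,i}t^i$ is a polynomial with integer coefficients and $p_{g,2g+1}=\frac{(2g)!}{g+1}$. Moreover, the $C_g$ (hence the $P_g$) can be computed recursively: writing $C_i$ for $C_i(t(1-2t))$ and $\dot C_i=\frac{d}{dt}C_i(t(1-2t))$, for every $g\ge 1$ $$C_g(t(1-2t))=\frac{(1-2t)^2}{t(1-t)^3}\int_0^t \tau^3(1-\tau)\Big(D_\tau C_{g-1}+\frac{1}{(1-4\tau)^2}\sum_{i=1}^{g-1}\big(4(1-4\tau)C_i+6\tau(1-2\tau)\dot C_i\big)\dot C_{g-i}\Big)\,d\tau,$$ where $$D_t=\frac{t^2(1-2t)^2}{(1-4t)^3}\frac{d^3}{dt^3}+\frac{t(1-2t)(5-28t+56t^2)}{(1-4t)^4}\frac{d^2}{dt^2}+\frac{4(1-11t+58t^2-144t^3+144t^4)}{(1-4t)^5}\f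rac{d}{dt}.$$
   Context: A map is a finite connected graph with a prescribed cyclic order of half-edges at each vertex, equivalently the 1-skeleton of a polygonal decomposition of a closed orientable surface; its genus $g$ satisfies $2-2g=\#\text{vertices}-\#\text{edges}+\#\text{faces}$. A hypermap is a bicolored map, i.e. a map whose faces are properly colored white and black so that adjacent faces have different colors; its darts are its edges (equivalently, the edges of the dual bipartite ribbon graph, Grothendieck's dessin d'enfant). A rooted hypermap is a hypermap with a distinguished dart, counted up to root-preserving isomorphism. Equivalently, $c_{g,n}=\frac{1}{(n-1)!}\#\{(\sigma_0,\sigma_1)\in S_n\times S_n:\ \langle\sigma_0,\sigma_1\rangle \text{ transitive},\ z(\sigma_0)+z(\sigma_1)+z(\sigma_0\sigma_1)=n+2-2g\}$, where $z(\cdot)$ denotes the number of cycles. The integral $\int_0^t$ denotes the formal antiderivative vanishing at $t=0$. -}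

module Defs where

open import Data.Bool using (Bool; true; false; _∧_; _∨_; not; if_then_else_)
open import Data.Nat as ℕ using (ℕ; zero; suc; _∸_; _≤ᵇ_; _≡ᵇ_; _!)
open import Data.Nat.Properties using (_!≢0)
open import Data.Integer as ℤ using (ℤ; +_)
open import Data.Rational as ℚ using (ℚ; 0ℚ; 1ℚ)
open import Data.Fin as Fin using (Fin; toℕ)
open import Data.Vec as Vec using (Vec; []; _∷_; lookup)
open import Data.List as List using (List; []; _∷_; [_]; map; concatMap; foldr; filterᵇ; length; allFin; applyUpTo)
open import Data.Bool.ListAction using (all; any)
open import Data.Product using (_×_; _,_)
open import Relation.Binary.PropositionalEquality using (_≡_)
open import Relation.Nullary.Decidable using (⌊_⌋)

vecsOver : ∀ {A : Set} (m : ℕ) → List A → List (Vec A m)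
vecsOver zero    xs = [ [] ]
vecsOver (suc m) xs = concatMap (λ x → map (x ∷_) (vecsOver m xs)) xs

_==_ : ∀ {n} → Fin n → Fin n → Bool
i == j = ⌊ i Fin.≟ j ⌋

isPerm : ∀ {n} → Vec (Fin n) n → Bool
isPerm {n} v = all (λ i → all (λ j → not (lookup v i == lookup v j) ∨ (i == j)) (allFin n)) (allFin n)

-- the list of all elements of S_n (each exactly once)
perms : (n : ℕ) → List (Vec (Fin n) n)
perms n = filterᵇ isPerm (vecsOver n (allFin n))

compose : ∀ {n} → Vec (Fin n) n → Vec (Fin n) n → Vec (Fin n) n
compose σ τ = Vec.map (lookup σ) τ

iter : ∀ {n} → Vec (Fin n) n → ℕ → Fin n → Fin n
iter σ zero    i = i
iter σ (suc k) i = lookup σ (iter σ k i)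

-- i is the least element of its cycle (the cycle of i is {σ^k i | k < n})
isCycleMin : ∀ {n} → Vec (Fin n) n → Fin n → Bool
isCycleMin {n} σ i = all (λ k → toℕ i ≤ᵇ toℕ (iter σ k i)) (List.upTo n)

-- z(σ) : number of cycles of σ (= number of cycle minima)
z : ∀ {n} → Vec (Fin n) n → ℕ
z {n} σ = length (filterᵇ (isCycleMin σ) (allFin n))

subsets : (n : ℕ) → List (Vec Bool n)
subsets n = vecsOver n (true ∷ false ∷ [])

invariant : ∀ {n} → Vec Bool n → Vec (Fin n) n → Bool
invariant {n} S σ = all (λ i → not (lookup S i) ∨ lookup S (lookup σ i)) (allFin n)

nonempty full : ∀ {n} → Vec Bool n → Bool
nonempty {n} S = any (lookup S) (allFin n)
full     {n} S = all (lookup S) (allFin n)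

-- ⟨σ₀,σ₁⟩ is transitive: every nonempty subset invariant under both is everything
transitive : ∀ {n} → Vec (Fin n) n → Vec (Fin n) n → Bool
transitive {n} σ₀ σ₁ =
  all (λ S → not (nonempty S ∧ invariant S σ₀ ∧ invariant S σ₁) ∨ full S) (subsets n)

-- the condition defining pairs counted by c_{g,n}
-- z(σ₀)+z(σ₁)+z(σ₀σ₁) = n+2-2g  written without truncated subtraction
good : (g n : ℕ) → Vec (Fin n) n × Vec (Fin n) n → Bool
good g n (σ₀ , σ₁) = transitive σ₀ σ₁ ∧ ((z σ₀ ℕ.+ z σ₁ ℕ.+ z (compose σ₀ σ₁) ℕ.+ 2 ℕ.* g) ≡ᵇ (n ℕ.+ 2))

pairs : (n : ℕ) → List (Vec (Fin n) n × Vec (Fin n) n)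
pairs n = concatMap (λ a → map (a ,_) (perms n)) (perms n)

countPairs : (g n : ℕ) → ℕ
countPairs g n = length (filterᵇ (good g n) (pairs n))

-- c_{g,n} = countPairs g n / (n-1)!   (as a rational number; used for n ≥ 1)
c : (g n : ℕ) → ℚ
c g n = (+ countPairs g n) ℚ./ ((n ∸ 1) !) where instance _ = (n ∸ 1) !≢0

PS : Set
PS = ℕ → ℚ

_≈_ : PS → PS → Set
a ≈ b = ∀ k → a k ≡ b k
infix 4 _≈_

sumTo : ℕ → (ℕ → ℚ) → ℚ
sumTo zero    f = f 0
sumTo (suc k) f = sumTo k f ℚ.+ f (suc k)

_⊕_ : PS → PS → PS
(a ⊕ b) k = a k ℚ.+ b k
infixl 6 _⊕_

_⊗_ : PS → PS → PS
(a ⊗ b) k = sumTo k (λ j → a j ℚ.* b (k ∸ j))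
infixl 7 _⊗_

_·_ : ℚ → PS → PS
(q · a) k = q ℚ.* a k
infixr 8 _·_

ℤtoℚ : ℤ → ℚ
ℤtoℚ z = z ℚ./ 1

ℕtoℚ : ℕ → ℚ
ℕtoℚ n = + n ℚ./ 1

poly : List ℤ → PS
poly []       k       = 0ℚ
poly (x ∷ xs) zero    = ℤtoℚ x
poly (x ∷ xs) (suc k) = poly xs k

one : PS
one = poly (+ 1 ∷ [])

_^_ : PS → ℕ → PS
a ^ zero  = one
a ^ suc m = a ⊗ (a ^ m)
infixr 9 _^_

T : PS
T = poly (+ 0 ∷ + 1 ∷ [])

deriv : PS → PS
deriv a k = ℕtoℚ (suc k) ℚ.* a (suc k)

integral : PS → PS
integral a zero    = 0ℚ
integral a (suc k) = a k ℚ.* (+ 1 ℚ./ suc k)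

-- the expansion at t = 0 of 1/(1 - 4t), i.e. Σ 4^k t^k
inv1m4t : PS
inv1m4t k = ℕtoℚ (4 ℕ.^ k)

-- substitution a(s) ↦ a(t(1-2t)); since s = t(1-2t) has zero constant term,
-- only the terms n ≤ k of a contribute to the coefficient of t^k
S : PS
S = poly (+ 0 ∷ + 1 ∷ ℤ.- (+ 2) ∷ [])

subst-s : PS → PS
subst-s a k = sumTo k (λ n → a n ℚ.* (S ^ n) k)

Cs : ℕ → PS
Cs g n = if (suc (2 ℕ.* g) ≤ᵇ n) then c g n else 0ℚ

Ct : ℕ → PS
Ct g = subst-s (Cs g)

sumPS : List PS → PS
sumPS = foldr _⊕_ (poly [])

Dop : PS → PS
Dop a =
    (T ^ 2 ⊗ (poly (+ 1 ∷ ℤ.- (+ 2) ∷ [])) ^ 2 ⊗ inv1m4t ^ 3 ⊗ deriv (deriv (deriv a)))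
  ⊕ (T ⊗ poly (+ 1 ∷ ℤ.- (+ 2) ∷ []) ⊗ poly (+ 5 ∷ ℤ.- (+ 28) ∷ + 56 ∷ []) ⊗ inv1m4t ^ 4
       ⊗ deriv (deriv a))
  ⊕ (poly (+ 4 ∷ ℤ.- (+ 44) ∷ + 232 ∷ ℤ.- (+ 576) ∷ + 576 ∷ []) ⊗ inv1m4t ^ 5 ⊗ deriv a)

recIntegrand : ℕ → PS
recIntegrand g =
  T ^ 3 ⊗ poly (+ 1 ∷ ℤ.- (+ 1) ∷ []) ⊗
    ( Dop (Ct (g ∸ 1))
    ⊕ inv1m4t ^ 2 ⊗
        sumPS (applyUpTo (λ j → let i = suc j in
                 ( (poly (+ 4 ∷ ℤ.- (+ 16) ∷ []) ⊗ Ct i)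
                 ⊕ (poly (+ 0 ∷ + 6 ∷ ℤ.- (+ 12) ∷ []) ⊗ deriv (Ct i)) )
                 ⊗ deriv (Ct (g ∸ i)))
               (g ∸ 1)) )

{-# OPTIONS --safe #-}
-- Z_N(s) = Σ sⁿ/n! Σ N^(z(σ₀)+z(σ₁)+z(σ₀σ₁)) counts invariant colourings and is the vacuum value of a flow of
-- alternating functions. Cleared Lagrange interpolation gives the Toda equation N³ s Z_{N+1} Z_{N-1} = Z θ²Z - (θZ)²,
-- which yields an ODE for θ log Z_N. By the exponential formula its expansion in N is a recursion for c_{g,n}.
-- The potential of this ODE determines C_g from lower genera and, in t, the orders of its poles.
module Submission where

import Defs as D
open import Defs using (vecsOver; _==_; isPerm; perms; compose; iter; isCycleMin; subsets; invariant; nonempty; full; transitive; good; pairs; countPairs; ℤtoℚ; ℕtoℚ)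
import Algebra.Solver.Ring as RingSolver
open import Algebra.Bundles using (CommutativeRing)
open import Algebra.Solver.Ring.AlmostCommutativeRing using (fromCommutativeRing; _-Raw-AlmostCommutative⟶_)
open import Algebra.Structures using (IsCommutativeRing)
open import Data.Bool as Bool using (Bool; true; false; if_then_else_; _∧_; _∨_; not) renaming (T to True)
import Data.Bool.ListAction
open import Data.Bool.Properties using (T?)
open import Data.Empty using (⊥; ⊥-elim)
open import Data.Fin as Fin using (Fin; zero; suc; toℕ; punchIn; punchOut; _↑ˡ_; _↑ʳ_)
import Data.Fin.Properties as FP
open import Data.Integer as Z using (ℤ)
import Data.Integer.Properties as ZP
open import Data.List as List using (List; []; _∷_; [_]; map; concatMap; filterᵇ; length; allFin; tabulate; applyUpTo)
import Data.List.Properties as LP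
open import Data.List.Membership.Propositional using (_∈_)
import Data.List.Membership.Propositional.Properties as ∈P
open import Data.List.Membership.Propositional.Properties.WithK using (unique∧set⇒bag)
open import Data.List.Relation.Binary.BagAndSetEquality using (∼bag⇒↭)
open import Data.List.Relation.Binary.Permutation.Propositional as ↭ using (_↭_)
import Data.List.Relation.Binary.Permutation.Propositional.Properties as ↭P
open import Data.List.Relation.Unary.All as All using (All; []; _∷_)
import Data.List.Relation.Unary.All.Properties as AP
open import Data.List.Relation.Unary.AllPairs as AllPairs using ([]; _∷_)
open import Data.List.Relation.Unary.Any as Any using (Any; here; there)
open import Data.List.Relation.Unary.Unique.Propositional using (Unique)
import Data.List.Relation.Unary.Unique.Propositional.Properties as UP
open import Data.Maybe using (Maybe; just; nothing)
open import Data.Nat as N using (ℕ; zero; suc; _∸_; z≤n; s≤s; _<_; _!; _≤ᵇ_; _≡ᵇ_; NonZero)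
import Data.Nat.Induction as NI
open import Data.Nat.Induction using (<-rec)
import Data.Nat.Properties as NP
import Data.Nat.Solver
open import Data.Product using (_×_; _,_; proj₁; proj₂; ∃)
open import Data.Product.Properties using (,-injective)
open import Data.Rational as ℚ using (ℚ)
import Data.Rational.Properties as ℚP
import Data.Rational.Unnormalised as ℚᵘ
import Data.Rational.Unnormalised.Properties as ℚᵘP
open import Data.Sum using (_⊎_; inj₁; inj₂)
open import Data.Unit using (tt)
open import Data.Vec as Vec using (Vec; []; _∷_; _[_]≔_; _++_) renaming (lookup to get)
import Data.Vec.Properties as VP
open import Function using (_∘_; id; mk⇔; Equivalence)
open import Level using (0ℓ)
open import Relation.Binary using (tri<; tri≈; tri>)
open import Relation.Binary.PropositionalEquality as ≡ using (_≡_; refl; sym; cong; cong₂; subst; subst₂; module ≡-Reasoning) renaming (trans to by)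
import Relation.Binary.Reasoning.Setoid as SetoidReasoning
open import Relation.Nullary using (¬_; yes; no; Dec; _×-dec_)
open import Relation.Nullary.Decidable using (⌊_⌋; toWitness; fromWitness; ⌊⌋-map′)

-- The sum of N^(z(σ₀)+z(σ₁)) σ₀σ₁ over all pairs is a product of squares (N + J)² of shifted
-- Jucys-Murphy elements, and N + J acts as N + content when a box is added; in the coordinates ℓ_i
-- = λ_i + N - i this is ℓ_i + 1, whence the factor (ℓ_i + 1)² of the flow. Characters are avoided:
-- the trace over one inserted point is evaluated at the staircase (N-1, ..., 0) from commutators of
-- gl_N and antisymmetry alone. The Toda equation links three values of N. Two further relations,
-- propagated from N = 0 and N = 1, eliminate both neighbours and leave an equation K = 0 up to a
-- multiple of s θσ in its potential, which one coefficient excludes. The integral recursion alone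
-- shows neither rationality of C_g nor its poles, since integration may create logarithms. The
-- potential is free of integrals, and its derivative in θσ vanishes in genus 0, so each order in
-- N⁻² yields C_g on division by 4t(1-t)³. The degree bound 9g - 7 rests on cancellations at t = ∞,
-- exposed by adding 1/16 to C₁ and by the factor Θ + 1/2.

-- Fields of characteristic zero

record NumberField : Set₁ where
 infixl 6 _⊹_
 infixl 7 _✶_
 infix 8 ⊖_
 field
  Carrier : Set
  _⊹_ _✶_ : Carrier -> Carrier -> Carrier
  ⊖_ : Carrier -> Carrier
  0# 1# : Carrier
  isCommutativeRing : IsCommutativeRing _≡_ _⊹_ _✶_ ⊖_ 0# 1#
  _≟_ : (x y : Carrier) -> Dec (x ≡ y)
  inverse : ∀ x -> ¬ x ≡ 0# -> ∃ \ y -> x ✶ y ≡ 1#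
  int : ℤ -> Carrier
  int-+ : ∀ i j -> int (i Z.+ j) ≡ int i ⊹ int j
  int-* : ∀ i j -> int (i Z.* j) ≡ int i ✶ int j
  int-neg : ∀ i -> int (Z.- i) ≡ ⊖ int i
  int-0 : int (Z.+ 0) ≡ 0#
  int-1 : int (Z.+ 1) ≡ 1#
  int-injective : ∀ {i j} -> int i ≡ int j -> i ≡ j

module FieldProperties (J : NumberField) where

 open NumberField J public
  renaming (Carrier to F; _⊹_ to infixl 6 _+_; _✶_ to infixl 7 _*_; ⊖_ to infix 8 -_)

 open IsCommutativeRing isCommutativeRing public
  using (+-assoc; +-comm; *-assoc; *-comm; distribˡ; distribʳ; zeroˡ; zeroʳ; -‿inverseˡ; -‿inverseʳ)
  renaming (+-identityˡ to +-idˡ; +-identityʳ to +-idʳ; *-identityˡ to *-idˡ; *-identityʳ to *-idʳ)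

 infixl 6 _-_
 _-_ : F -> F -> F
 x - y = x + - y

 commutativeRing : CommutativeRing 0ℓ 0ℓ
 commutativeRing = record { isCommutativeRing = isCommutativeRing }

 fromℤ-homo : Z.+-*-rawRing -Raw-AlmostCommutative⟶ fromCommutativeRing commutativeRing
 fromℤ-homo = record
  { ⟦_⟧ = int
  ; +-homo = int-+
  ; *-homo = int-*
  ; -‿homo = int-neg
  ; 0-homo = int-0
  ; 1-homo = int-1
  }

 int-weaklyDec : ∀ (i j : ℤ) -> Maybe (int i ≡ int j)
 int-weaklyDec i j with i ZP.≟ j
 ... | yes refl = just refl
 ... | no _ = nothing

 -- The coefficients of the solver are integers, compared in ℤ. An identity that must treat `0#` or
 -- `1#` as a numeral first rewrites it by `int-0` or `int-1`; otherwise it is an atom.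
 module Solver = RingSolver Z.+-*-rawRing (fromCommutativeRing commutativeRing) fromℤ-homo int-weaklyDec

 nat : ℕ -> F
 nat n = int (Z.+ n)

 nat-+ : ∀ m n -> nat (m N.+ n) ≡ nat m + nat n
 nat-+ m n = int-+ (Z.+ m) (Z.+ n)

 nat-* : ∀ m n -> nat (m N.* n) ≡ nat m * nat n
 nat-* m n = by (cong int (ZP.pos-* m n)) (int-* (Z.+ m) (Z.+ n))

 nat-suc : ∀ n -> nat (suc n) ≡ 1# + nat n
 nat-suc n = by (nat-+ 1 n) (cong (_+ nat n) int-1)

 nat-injective : ∀ {m n} -> nat m ≡ nat n -> m ≡ n
 nat-injective e = ZP.+-injective (int-injective e)

 nat-suc≢0 : ∀ n -> ¬ (nat (suc n) ≡ 0#)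
 nat-suc≢0 n e with nat-injective {suc n} {0} (by e (sym int-0))
 ... | ()

 cancel-≢0 : ∀ r {p q} -> ¬ r ≡ 0# -> r * p ≡ r * q -> p ≡ q
 cancel-≢0 r {p} {q} r≢0 e with inverse r r≢0
 ... | s , rs = by (sym (lem p)) (by (cong (s *_) e) (lem q))
  where
  lem : ∀ x -> s * (r * x) ≡ x
  lem x = by (sym (*-assoc s r x)) (by (cong (_* x) (by (*-comm s r) rs)) (*-idˡ x))

 *-≡0 : ∀ p q -> p * q ≡ 0# -> p ≡ 0# ⊎ q ≡ 0#
 *-≡0 p q e with p ≟ 0#
 ... | yes p0 = inj₁ p0
 ... | no p0 = inj₂ (cancel-≢0 p p0 (by e (sym (zeroʳ p))))

 -- Characteristic different from 2 turns antisymmetry into vanishing; every collision of two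
 -- coordinates is concluded in this way.
 x≡-x⇒x≡0 : ∀ {x} -> x ≡ - x -> x ≡ 0#
 x≡-x⇒x≡0 {x} e = cancel-≢0 (nat 2) (nat-suc≢0 1)
  (by (solve 1 (\ a -> con (Z.+ 2) :* a := a :+ a) refl x)
  (by (cong (\ y -> x + y) e) (by (-‿inverseʳ x) (sym (zeroʳ (nat 2))))))
  where open Solver

 x-y≡0⇒x≡y : ∀ {x y} -> x - y ≡ 0# -> x ≡ y
 x-y≡0⇒x≡y {x} {y} e = by (solve 2 (\ a b -> a := (a :- b) :+ b) refl x y) (by (cong (_+ y) e) (+-idˡ y))
  where open Solver

-- The rational numbers

module RationalField where

 open import Defs using (ℤtoℚ; ℕtoℚ)
 open import Data.Nat as N using (ℕ; zero; suc)
 import Data.Nat.Properties as NP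
 open import Data.Integer as Z using (ℤ; +_; -[1+_])
 import Data.Integer.Properties as ZP
 open import Data.Rational as ℚ using (ℚ; mkℚ; 0ℚ; 1ℚ; _+_; _*_; -_; _-_)
 import Data.Rational.Properties as ℚP
 import Data.Rational.Unnormalised as ℚᵘ
 import Data.Rational.Unnormalised.Properties as ℚᵘP
 open import Algebra.Solver.Ring.AlmostCommutativeRing using (fromCommutativeRing; _-Raw-AlmostCommutative⟶_)
 import Algebra.Solver.Ring as RingSolver
 open import Algebra.Structures using (IsCommutativeRing)
 open import Algebra.Bundles using (CommutativeRing)
 open import Level using (0ℓ)
 open import Data.Maybe using (Maybe; just; nothing)
 open import Data.Empty using (⊥; ⊥-elim)
 open import Data.Sum using (_⊎_; inj₁; inj₂)
 open import Data.Product using (_×_; _,_; proj₁; proj₂; ∃)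
 open import Relation.Nullary using (¬_; yes; no; Dec)

 toℚᵘ-ℤtoℚ : ∀ i -> ℚ.toℚᵘ (ℤtoℚ i) ℚᵘ.≃ ℚᵘ.mkℚᵘ i 0
 toℚᵘ-ℤtoℚ i = ℚP.toℚᵘ-fromℚᵘ (ℚᵘ.mkℚᵘ i 0)

 ℤtoℚ-+ : ∀ i j -> ℤtoℚ (i Z.+ j) ≡ ℤtoℚ i + ℤtoℚ j
 ℤtoℚ-+ i j = ℚP.toℚᵘ-injective (begin
  ℚ.toℚᵘ (ℤtoℚ (i Z.+ j)) ≈⟨ toℚᵘ-ℤtoℚ (i Z.+ j) ⟩
  ℚᵘ.mkℚᵘ (i Z.+ j) 0 ≈⟨ ℚᵘ.*≡* (cong (Z._* + 1) (cong₂ Z._+_ (sym (ZP.*-identityʳ i)) (sym (ZP.*-identityʳ j)))) ⟩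
  ℚᵘ.mkℚᵘ i 0 ℚᵘ.+ ℚᵘ.mkℚᵘ j 0 ≈⟨ ℚᵘP.+-cong (toℚᵘ-ℤtoℚ i) (toℚᵘ-ℤtoℚ j) ⟨
  ℚ.toℚᵘ (ℤtoℚ i) ℚᵘ.+ ℚ.toℚᵘ (ℤtoℚ j) ≈⟨ ℚP.toℚᵘ-homo-+ (ℤtoℚ i) (ℤtoℚ j) ⟨
  ℚ.toℚᵘ (ℤtoℚ i + ℤtoℚ j) ∎)
  where open ℚᵘP.≃-Reasoning

 ℤtoℚ-* : ∀ i j -> ℤtoℚ (i Z.* j) ≡ ℤtoℚ i * ℤtoℚ j
 ℤtoℚ-* i j = ℚP.toℚᵘ-injective (begin
  ℚ.toℚᵘ (ℤtoℚ (i Z.* j)) ≈⟨ toℚᵘ-ℤtoℚ (i Z.* j) ⟩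
  ℚᵘ.mkℚᵘ i 0 ℚᵘ.* ℚᵘ.mkℚᵘ j 0 ≈⟨ ℚᵘP.*-cong (toℚᵘ-ℤtoℚ i) (toℚᵘ-ℤtoℚ j) ⟨
  ℚ.toℚᵘ (ℤtoℚ i) ℚᵘ.* ℚ.toℚᵘ (ℤtoℚ j) ≈⟨ ℚP.toℚᵘ-homo-* (ℤtoℚ i) (ℤtoℚ j) ⟨
  ℚ.toℚᵘ (ℤtoℚ i * ℤtoℚ j) ∎)
  where open ℚᵘP.≃-Reasoning

 ℤtoℚ-neg : ∀ i -> ℤtoℚ (Z.- i) ≡ - ℤtoℚ i
 ℤtoℚ-neg i = ℚP.toℚᵘ-injective (begin
  ℚ.toℚᵘ (ℤtoℚ (Z.- i)) ≈⟨ toℚᵘ-ℤtoℚ (Z.- i) ⟩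
  ℚᵘ.- ℚᵘ.mkℚᵘ i 0 ≈⟨ ℚᵘP.-‿cong (toℚᵘ-ℤtoℚ i) ⟨
  ℚᵘ.- ℚ.toℚᵘ (ℤtoℚ i) ≈⟨ ℚP.toℚᵘ-homo‿- (ℤtoℚ i) ⟨
  ℚ.toℚᵘ (- ℤtoℚ i) ∎)
  where open ℚᵘP.≃-Reasoning

 ℤtoℚ-injective : ∀ {i j} -> ℤtoℚ i ≡ ℤtoℚ j -> i ≡ j
 ℤtoℚ-injective {i} {j} e with ℚᵘP.≃-trans (ℚᵘP.≃-sym (toℚᵘ-ℤtoℚ i)) (ℚᵘP.≃-trans (ℚP.toℚᵘ-cong e) (toℚᵘ-ℤtoℚ j))
 ... | ℚᵘ.*≡* q = by (sym (ZP.*-identityʳ i)) (by q (ZP.*-identityʳ j))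

 ℚ-field : NumberField
 ℚ-field = record
  { Carrier = ℚ
  ; _⊹_ = _+_
  ; _✶_ = _*_
  ; ⊖_ = -_
  ; 0# = 0ℚ
  ; 1# = 1ℚ
  ; isCommutativeRing = CommutativeRing.isCommutativeRing ℚP.+-*-commutativeRing
  ; _≟_ = ℚP._≟_
  ; inverse           = \ p p≢0 -> let instance _ = ℚ.≢-nonZero p≢0 in ℚ.1/ p , ℚP.*-inverseʳ p
  ; int = ℤtoℚ
  ; int-+ = ℤtoℚ-+
  ; int-* = ℤtoℚ-*
  ; int-neg = ℤtoℚ-neg
  ; int-0 = refl
  ; int-1 = refl
  ; int-injective = ℤtoℚ-injective
  }

open RationalField

-- Enumerations and finite sums

module _ {A : Set} where

 vecsOver-unique : ∀ m {xs : List A} -> Unique xs -> Unique (vecsOver m xs)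
 vecsOver-unique zero u = [] ∷ []
 vecsOver-unique (suc m) {xs} u = subst Unique (sym (cong-concat xs)) (UP.cartesianProductWith⁺ _∷_ VP.∷-injective u (vecsOver-unique m u))
  where
  cong-concat : ∀ ys -> concatMap (\ x -> map (x ∷_) (vecsOver m xs)) ys ≡ List.cartesianProductWith _∷_ ys (vecsOver m xs)
  cong-concat [] = refl
  cong-concat (y ∷ ys) = cong (map (y ∷_) (vecsOver m xs) List.++_) (cong-concat ys)

 ∈-vecsOver : ∀ {m} {xs : List A} -> (∀ x -> x ∈ xs) -> (v : Vec A m) -> v ∈ vecsOver m xs
 ∈-vecsOver c [] = here refl
 ∈-vecsOver {suc m} {xs} c (x ∷ v) = ∈P.∈-concatMap⁺ (\ y -> map (y ∷_) (vecsOver m xs)) (go (c x))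
  where
  go : ∀ {ys} -> x ∈ ys -> Any (\ y -> (x ∷ v) ∈ map (y ∷_) (vecsOver m xs)) ys
  go (here refl) = here (∈P.∈-map⁺ (x ∷_) (∈-vecsOver c v))
  go (there p) = there (go p)

cols : (N n : ℕ) -> List (Vec (Fin N) n)
cols N n = vecsOver n (allFin N)

cols-unique : ∀ N n -> Unique (cols N n)
cols-unique N n = vecsOver-unique n (UP.allFin⁺ N)

∈-cols : ∀ {N n} (c : Vec (Fin N) n) -> c ∈ cols N n
∈-cols = ∈-vecsOver ∈P.∈-allFin

module Sums (J : NumberField) where

 open FieldProperties J

 ∑ : ∀ {A : Set} -> List A -> (A -> F) -> F
 ∑ [] f = 0#
 ∑ (x ∷ xs) f = f x + ∑ xs f

 module _ {A : Set} where

  ∑-cong-∈ : ∀ (xs : List A) {f g : A -> F} -> (∀ {x} -> x ∈ xs -> f x ≡ g x) -> ∑ xs f ≡ ∑ xs g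
  ∑-cong-∈ [] e = refl
  ∑-cong-∈ (x ∷ xs) e = cong₂ _+_ (e (here refl)) (∑-cong-∈ xs (e ∘ there))

  ∑-cong : ∀ (xs : List A) {f g : A -> F} -> (∀ x -> f x ≡ g x) -> ∑ xs f ≡ ∑ xs g
  ∑-cong xs e = ∑-cong-∈ xs (\ {x} _ -> e x)

  ∑-0 : ∀ (xs : List A) -> ∑ xs (\ _ -> 0#) ≡ 0#
  ∑-0 [] = refl
  ∑-0 (x ∷ xs) = by (+-idˡ _) (∑-0 xs)

  ∑-≡0 : ∀ (xs : List A) {f : A -> F} -> (∀ {x} -> x ∈ xs -> f x ≡ 0#) -> ∑ xs f ≡ 0#
  ∑-≡0 xs e = by (∑-cong-∈ xs e) (∑-0 xs)

  ∑-+ : ∀ (xs : List A) (f g : A -> F) -> ∑ xs (\ x -> f x + g x) ≡ ∑ xs f + ∑ xs g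
  ∑-+ [] f g = sym (+-idˡ 0#)
  ∑-+ (x ∷ xs) f g = by (cong (_ +_) (∑-+ xs f g))
   (solve 4 (\ a b c d -> (a :+ b) :+ (c :+ d) := (a :+ c) :+ (b :+ d)) refl (f x) (g x) _ _)
   where open Solver

  ∑-*ˡ : ∀ (xs : List A) q (f : A -> F) -> ∑ xs (\ x -> q * f x) ≡ q * ∑ xs f
  ∑-*ˡ [] q f = sym (zeroʳ q)
  ∑-*ˡ (x ∷ xs) q f = by (cong (_ +_) (∑-*ˡ xs q f)) (sym (distribˡ q _ _))

  ∑-*ʳ : ∀ (xs : List A) q (f : A -> F) -> ∑ xs (\ x -> f x * q) ≡ ∑ xs f * q
  ∑-*ʳ xs q f = by (∑-cong xs (\ x -> *-comm (f x) q)) (by (∑-*ˡ xs q f) (*-comm q _))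

  ∑-neg : ∀ (xs : List A) (f : A -> F) -> ∑ xs (\ x -> - f x) ≡ - ∑ xs f
  ∑-neg [] f = by (sym (-‿inverseʳ 0#)) (+-idˡ _)
  ∑-neg (x ∷ xs) f = by (cong (- f x +_) (∑-neg xs f))
   (solve 2 (\ a b -> :- a :+ :- b := :- (a :+ b)) refl (f x) (∑ xs f))
   where open Solver

  ∑-- : ∀ (xs : List A) (f g : A -> F) -> ∑ xs (\ x -> f x - g x) ≡ ∑ xs f - ∑ xs g
  ∑-- xs f g = by (∑-+ xs f (\ x -> - g x)) (cong (∑ xs f +_) (∑-neg xs g))

  ∑-++ : ∀ (xs ys : List A) f -> ∑ (xs List.++ ys) f ≡ ∑ xs f + ∑ ys f
  ∑-++ [] ys f = sym (+-idˡ _)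
  ∑-++ (x ∷ xs) ys f = by (cong (f x +_) (∑-++ xs ys f)) (sym (+-assoc (f x) _ _))

  ∑-↭ : ∀ {xs ys : List A} -> xs ↭ ys -> ∀ f -> ∑ xs f ≡ ∑ ys f
  ∑-↭ ↭.refl f = refl
  ∑-↭ (↭.prep x p) f = cong (f x +_) (∑-↭ p f)
  ∑-↭ (↭.swap x y p) f = by (cong (\ r -> f x + (f y + r)) (∑-↭ p f))
   (solve 3 (\ a b c -> a :+ (b :+ c) := b :+ (a :+ c)) refl (f x) (f y) _)
   where open Solver
  ∑-↭ (↭.trans p q) f = by (∑-↭ p f) (∑-↭ q f)

  ∑-length : ∀ (xs : List A) -> ∑ xs (\ _ -> 1#) ≡ nat (length xs)
  ∑-length [] = sym int-0
  ∑-length (x ∷ xs) = by (cong (1# +_) (∑-length xs)) (sym (nat-suc (length xs)))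

  ∑-const : ∀ (xs : List A) q -> ∑ xs (\ _ -> q) ≡ nat (length xs) * q
  ∑-const xs q = by (∑-cong xs (\ _ -> sym (*-idˡ q))) (by (∑-*ʳ xs q _) (cong (_* q) (∑-length xs)))

 ∑-map : ∀ {A B : Set} (h : A -> B) (xs : List A) f -> ∑ (map h xs) f ≡ ∑ xs (f ∘ h)
 ∑-map h [] f = refl
 ∑-map h (x ∷ xs) f = cong (f (h x) +_) (∑-map h xs f)

 ∑-concatMap : ∀ {A B : Set} (h : A -> List B) (xs : List A) f -> ∑ (concatMap h xs) f ≡ ∑ xs (\ x -> ∑ (h x) f)
 ∑-concatMap h [] f = refl
 ∑-concatMap h (x ∷ xs) f = by (∑-++ (h x) (concatMap h xs) f) (cong (∑ (h x) f +_) (∑-concatMap h xs f))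

 ∑-swap : ∀ {A B : Set} (xs : List A) (ys : List B) (f : A -> B -> F) -> ∑ xs (\ x -> ∑ ys (f x)) ≡ ∑ ys (\ y -> ∑ xs (\ x -> f x y))
 ∑-swap [] ys f = sym (∑-0 ys)
 ∑-swap (x ∷ xs) ys f = by (cong (∑ ys (f x) +_) (∑-swap xs ys f)) (sym (∑-+ ys (f x) _))

 module _ {A B : Set} {f : A -> B} where

  map-unique : ∀ {xs} -> (∀ {x y} -> x ∈ xs -> y ∈ xs -> f x ≡ f y -> x ≡ y) -> Unique xs -> Unique (map f xs)
  map-unique inj [] = []
  map-unique inj (x∉ ∷ u) =
   AP.map⁺ (All.tabulate (\ y∈ e -> All.lookup x∉ y∈ (inj (here refl) (there y∈) e)))
   ∷ map-unique (\ x∈ y∈ -> inj (there x∈) (there y∈)) u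

 -- Duplicate-free lists with the same elements are permutations of each other, so a sum depends
 -- only on its set of indices.
 ∑-bij-surjective : ∀ {A B : Set} {xs : List A} {ys : List B} -> Unique xs -> Unique ys -> (f : A -> B) ->
  (∀ {x} -> x ∈ xs -> f x ∈ ys) -> (∀ {x y} -> x ∈ xs -> y ∈ xs -> f x ≡ f y -> x ≡ y) ->
  (∀ {y} -> y ∈ ys -> ∃ \ x -> x ∈ xs × f x ≡ y) -> ∀ F -> ∑ ys F ≡ ∑ xs (F ∘ f)
 ∑-bij-surjective {xs = xs} {ys} uxs uys f f∈ inj surj F = by (sym (∑-↭ perm F)) (∑-map f xs F)
  where
  to : ∀ {y} -> y ∈ map f xs -> y ∈ ys
  to y∈ with ∈P.∈-map⁻ f y∈
  ... | x , x∈ , refl = f∈ x∈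
  from : ∀ {y} -> y ∈ ys -> y ∈ map f xs
  from y∈ = let (_ , x∈ , e) = surj y∈ in subst (_∈ map f xs) e (∈P.∈-map⁺ f x∈)
  perm : map f xs ↭ ys
  perm = ∼bag⇒↭ (unique∧set⇒bag (map-unique inj uxs) uys (mk⇔ to from))

 ∑-bij : ∀ {A B : Set} {xs : List A} {ys : List B} -> Unique xs -> Unique ys -> (f : A -> B) (g : B -> A) ->
  (∀ {x} -> x ∈ xs -> f x ∈ ys) -> (∀ {y} -> y ∈ ys -> g y ∈ xs) ->
  (∀ {x} -> x ∈ xs -> g (f x) ≡ x) -> (∀ {y} -> y ∈ ys -> f (g y) ≡ y) ->
  ∀ F -> ∑ ys F ≡ ∑ xs (F ∘ f)
 ∑-bij uxs uys f g f∈ g∈ gf fg = ∑-bij-surjective uxs uys f f∈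
  (\ x∈ y∈ e -> by (sym (gf x∈)) (by (cong g e) (gf y∈))) (\ {y} y∈ -> g y , g∈ y∈ , fg y∈)

 ind : ∀ {P : Set} -> Dec P -> F
 ind (yes _) = 1#
 ind (no _) = 0#

 ind-yes : ∀ {P : Set} (d : Dec P) -> P -> ind d ≡ 1#
 ind-yes (yes _) _ = refl
 ind-yes (no ¬p) p = ⊥-elim (¬p p)

 ind-no : ∀ {P : Set} (d : Dec P) -> ¬ P -> ind d ≡ 0#
 ind-no (yes p) ¬p = ⊥-elim (¬p p)
 ind-no (no _) _ = refl

 ind-cong : ∀ {P Q : Set} (d : Dec P) (e : Dec Q) -> (P -> Q) -> (Q -> P) -> ind d ≡ ind e
 ind-cong (yes p) e f g = sym (ind-yes e (f p))
 ind-cong (no ¬p) e f g = sym (ind-no e (¬p ∘ g))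

 ind-× : ∀ {P Q : Set} (d : Dec P) (e : Dec Q) -> ind (d ×-dec e) ≡ ind d * ind e
 ind-× (yes p) e = by (ind-cong (yes p ×-dec e) e proj₂ (p ,_)) (sym (*-idˡ _))
 ind-× (no ¬p) e = by (ind-no (no ¬p ×-dec e) (¬p ∘ proj₁)) (sym (zeroˡ _))

 ind-*-cong : ∀ {P : Set} (d : Dec P) {x y} -> (P -> x ≡ y) -> ind d * x ≡ ind d * y
 ind-*-cong (yes p) e = cong (1# *_) (e p)
 ind-*-cong (no _) e = by (zeroˡ _) (sym (zeroˡ _))

 indᵇ : Bool -> F
 indᵇ b = if b then 1# else 0#

 ∑-filterᵇ : ∀ {A : Set} (p : A -> Bool) xs f -> ∑ (filterᵇ p xs) f ≡ ∑ xs (\ x -> indᵇ (p x) * f x)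
 ∑-filterᵇ p [] f = refl
 ∑-filterᵇ p (x ∷ xs) f with p x
 ... | true = cong₂ _+_ (sym (*-idˡ _)) (∑-filterᵇ p xs f)
 ... | false = by (∑-filterᵇ p xs f) (by (sym (+-idˡ _)) (cong (_+ ∑ xs (\ y -> indᵇ (p y) * f y)) (sym (zeroˡ (f x)))))

 ∑-allFin-suc : ∀ n (f : Fin (suc n) -> F) -> ∑ (allFin (suc n)) f ≡ f zero + ∑ (allFin n) (f ∘ suc)
 ∑-allFin-suc n f = cong (f zero +_) (by (cong (\ l -> ∑ l f) (sym (LP.map-tabulate id suc))) (∑-map suc (allFin n) f))

 ∑-ind-≟ : ∀ {n} (j : Fin n) (f : Fin n -> F) -> ∑ (allFin n) (\ i -> ind (i Fin.≟ j) * f i) ≡ f j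
 ∑-ind-≟ {suc n} zero f = by (∑-allFin-suc n _)
  (by (cong₂ _+_ (*-idˡ _) (∑-≡0 (allFin n) (\ {i} _ -> zeroˡ (f (suc i))))) (+-idʳ _))
 ∑-ind-≟ {suc n} (suc j) f = by (∑-allFin-suc n _)
  (by (cong₂ _+_ (zeroˡ (f zero)) (by
  (∑-cong (allFin n) (\ i -> cong (_* f (suc i)) (ind-cong (suc i Fin.≟ suc j) (i Fin.≟ j) FP.suc-injective (cong suc))))
  (∑-ind-≟ j (f ∘ suc)))) (+-idˡ _))

 ∑-reindex : ∀ {n} (π π⁻¹ : Fin n -> Fin n) -> (∀ i -> π⁻¹ (π i) ≡ i) -> (∀ i -> π (π⁻¹ i) ≡ i) ->
  ∀ f -> ∑ (allFin n) (f ∘ π) ≡ ∑ (allFin n) f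
 ∑-reindex {n} π π⁻¹ l r f = sym (∑-bij (UP.allFin⁺ n) (UP.allFin⁺ n) π π⁻¹
  (\ _ -> ∈P.∈-allFin _) (\ _ -> ∈P.∈-allFin _) (\ {i} _ -> l i) (\ {i} _ -> r i) f)

 module _ {A : Set} where

  ∑-vecsOver-suc : ∀ m (xs : List A) f -> ∑ (vecsOver (suc m) xs) f ≡ ∑ xs (\ x -> ∑ (vecsOver m xs) (\ v -> f (x ∷ v)))
  ∑-vecsOver-suc m xs f = by (∑-concatMap _ xs f) (∑-cong xs (\ x -> ∑-map (x ∷_) (vecsOver m xs) f))

 -- Changing the colour at p is a bijection between the colourings with c p = i and those with c p = j.
 ∑-recolour : ∀ {N n} (p : Fin n) (i j : Fin N) (Φ : Vec (Fin N) n -> F) ->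
  ∑ (cols N n) (\ c -> ind (get c p Fin.≟ j) * Φ c) ≡
  ∑ (cols N n) (\ c -> ind (get c p Fin.≟ i) * Φ (c [ p ]≔ j))
 ∑-recolour {N} {suc n} zero i j Φ = begin
  ∑ (cols N (suc n)) (\ c -> ind (get c zero Fin.≟ j) * Φ c)
  ≡⟨ ∑-vecsOver-suc n (allFin N) _ ⟩ _
  ≡⟨ ∑-cong (allFin N) (\ x -> ∑-*ˡ C _ _) ⟩ _
  ≡⟨ ∑-ind-≟ j _ ⟩
  ∑ C (\ v -> Φ (j ∷ v))
  ≡⟨ ∑-ind-≟ i (\ _ -> ∑ C (\ v -> Φ (j ∷ v))) ⟨ _
  ≡⟨ ∑-cong (allFin N) (\ x -> ∑-*ˡ C _ _) ⟨ _
  ≡⟨ ∑-vecsOver-suc n (allFin N) _ ⟨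
  ∑ (cols N (suc n)) (\ c -> ind (get c zero Fin.≟ i) * Φ (c [ zero ]≔ j)) ∎
  where
  open ≡-Reasoning
  C = cols N n
 ∑-recolour {N} {suc n} (suc p) i j Φ =
  by (∑-vecsOver-suc n (allFin N) _)
  (by (∑-cong (allFin N) (\ x -> ∑-recolour p i j (\ v -> Φ (x ∷ v))))
  (sym (∑-vecsOver-suc n (allFin N) _)))

-- Permutations as words

Word : ℕ -> Set
Word n = Vec (Fin n) n

-- Injectivity suffices on a finite set. As a record, a proof determines the word `v` it speaks
-- about.
record Perm {n} (v : Word n) : Set where
 field
  injective : ∀ {i j} -> get v i ≡ get v j -> i ≡ j

open Perm public

lookup-ext : ∀ {A : Set} {n} {u v : Vec A n} -> (∀ i -> get u i ≡ get v i) -> u ≡ v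
lookup-ext {u = u} {v} e = by (sym (VP.tabulate∘lookup u)) (by (VP.tabulate-cong e) (VP.tabulate∘lookup v))

T-all⁺ : ∀ {n} (p : Fin n -> Bool) -> True (Data.Bool.ListAction.all p (allFin n)) -> ∀ i -> True (p i)
T-all⁺ p t i = All.lookup (AP.all⁺ p _ t) (∈P.∈-allFin i)

T-all⁻ : ∀ {n} (p : Fin n -> Bool) -> (∀ i -> True (p i)) -> True (Data.Bool.ListAction.all p (allFin n))
T-all⁻ {n} p t = AP.all⁻ p (All.universal t (allFin n))

isPerm⇒Perm : ∀ {n} (v : Word n) -> True (isPerm v) -> Perm v
injective (isPerm⇒Perm v t) {i} {j} e with T-all⁺ _ (T-all⁺ _ t i) j
... | q with get v i Fin.≟ get v j
... | yes _ = toWitness q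
... | no ¬e = ⊥-elim (¬e e)

Perm⇒isPerm : ∀ {n} (v : Word n) -> Perm v -> True (isPerm v)
Perm⇒isPerm v p = T-all⁻ _ (\ i -> T-all⁻ _ (\ j -> go i j))
 where
 go : ∀ i j -> True (not (get v i == get v j) ∨ (i == j))
 go i j with get v i Fin.≟ get v j
 ... | yes e = fromWitness (injective p e)
 ... | no _ = _

∈-perms⁺ : ∀ {n} {v : Word n} -> Perm v -> v ∈ perms n
∈-perms⁺ {n} {v} p = ∈P.∈-filter⁺ _ (∈-cols v) (Perm⇒isPerm v p)

∈-perms⁻ : ∀ {n} {v : Word n} -> v ∈ perms n -> Perm v
∈-perms⁻ {n} {v} v∈ = isPerm⇒Perm v (proj₂ (∈P.∈-filter⁻ _ {xs = vecsOver n (allFin n)} v∈))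

perms-unique : ∀ n -> Unique (perms n)
perms-unique n = UP.filter⁺ _ (cols-unique n n)

lookup-compose : ∀ {n} (σ τ : Word n) i -> get (compose σ τ) i ≡ get σ (get τ i)
lookup-compose σ τ i = VP.lookup-map i (get σ) τ

compose-assoc : ∀ {n} (ρ σ τ : Word n) -> compose (compose ρ σ) τ ≡ compose ρ (compose σ τ)
compose-assoc ρ σ τ = lookup-ext \ i -> by (lookup-compose (compose ρ σ) τ i) (by (lookup-compose ρ σ _)
 (sym (by (lookup-compose ρ (compose σ τ) i) (cong (get ρ) (lookup-compose σ τ i)))))

Perm-compose : ∀ {n} {σ τ : Word n} -> Perm σ -> Perm τ -> Perm (compose σ τ)
injective (Perm-compose {σ = σ} {τ} p q) {i} {j} e = injective q (injective p (by (sym (lookup-compose σ τ i)) (by e (lookup-compose σ τ j))))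

idp : ∀ {n} -> Word n
idp {n} = Vec.allFin n

lookup-idp : ∀ {n} (i : Fin n) -> get idp i ≡ i
lookup-idp = VP.lookup-allFin

Perm-idp : ∀ {n} -> Perm (idp {n})
injective Perm-idp {i} {j} e = by (sym (lookup-idp i)) (by e (lookup-idp j))

Perm-surjective : ∀ {n} {v : Word n} -> Perm v -> ∀ j -> ∃ \ i -> get v i ≡ j
Perm-surjective {suc n} {v} p j with FP.any? (\ i -> get v i Fin.≟ j)
... | yes r = r
... | no ¬r with FP.pigeonhole (NP.n<1+n n) (\ i -> punchOut {i = j} (\ e -> ¬r (i , sym e)))
... | i , k , i<k , e = ⊥-elim (FP.<⇒≢ i<k (injective p (FP.punchOut-injective (\ e₁ -> ¬r (i , sym e₁)) (\ e₁ -> ¬r (k , sym e₁)) e)))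

preimage : ∀ {n} -> Word n -> Fin n -> Fin n
preimage v j with FP.any? (\ i -> get v i Fin.≟ j)
... | yes (i , _) = i
... | no _ = j

lookup-preimage : ∀ {n} {v : Word n} -> Perm v -> ∀ j -> get v (preimage v j) ≡ j
lookup-preimage {v = v} p j with FP.any? (\ i -> get v i Fin.≟ j)
... | yes (_ , e) = e
... | no ¬e = ⊥-elim (¬e (Perm-surjective p j))

preimage-lookup : ∀ {n} {v : Word n} -> Perm v -> ∀ i -> preimage v (get v i) ≡ i
preimage-lookup p i = injective p (lookup-preimage p _)

inv : ∀ {n} -> Word n -> Word n
inv v = Vec.tabulate (preimage v)

lookup-inv : ∀ {n} {v : Word n} -> Perm v -> ∀ i -> get v (get (inv v) i) ≡ i
lookup-inv {v = v} p i = by (cong (get v) (VP.lookup∘tabulate (preimage v) i)) (lookup-preimage p i)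

inv-lookup : ∀ {n} {v : Word n} -> Perm v -> ∀ i -> get (inv v) (get v i) ≡ i
inv-lookup {v = v} p i = by (VP.lookup∘tabulate (preimage v) _) (preimage-lookup p i)

Perm-inv : ∀ {n} {v : Word n} -> Perm v -> Perm (inv v)
injective (Perm-inv {v = v} p) {i} {j} e = by (sym (lookup-inv p i)) (by (cong (get v) e) (lookup-inv p j))

lift : ∀ {n} -> Word n -> Word (suc n)
lift σ = zero ∷ Vec.map suc σ

lookup-lift : ∀ {n} (σ : Word n) i -> get (lift σ) (suc i) ≡ suc (get σ i)
lookup-lift σ i = VP.lookup-map i suc σ

Perm-lift : ∀ {n} {σ : Word n} -> Perm σ -> Perm (lift σ)
injective (Perm-lift p) {zero} {zero} e = refl
injective (Perm-lift {σ = σ} p) {zero} {suc j} e = ⊥-elim (FP.0≢1+n (by e (lookup-lift σ j)))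
injective (Perm-lift {σ = σ} p) {suc i} {zero} e = ⊥-elim (FP.0≢1+n (by (sym e) (lookup-lift σ i)))
injective (Perm-lift {σ = σ} p) {suc i} {suc j} e =
 cong suc (injective p (FP.suc-injective (by (sym (lookup-lift σ i)) (by e (lookup-lift σ j)))))

lift-compose : ∀ {n} (σ τ : Word n) -> compose (lift σ) (lift τ) ≡ lift (compose σ τ)
lift-compose σ τ = lookup-ext \
 { zero -> refl
 ; (suc i) -> by (lookup-compose (lift σ) (lift τ) (suc i)) (by (cong (get (lift σ)) (lookup-lift τ i))
 (by (lookup-lift σ _) (sym (by (lookup-lift (compose σ τ) i) (cong suc (lookup-compose σ τ i)))))) }

-- sw t exchanges zero and t; in particular sw zero is the identity.
sw : ∀ {n} -> Fin (suc n) -> Word (suc n)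
sw zero = idp
sw (suc m) = suc m ∷ (Vec.tabulate suc [ m ]≔ zero)

sw-0 : ∀ {n} (t : Fin (suc n)) -> get (sw t) zero ≡ t
sw-0 zero = refl
sw-0 (suc m) = refl

sw-t : ∀ {n} (t : Fin (suc n)) -> get (sw t) t ≡ zero
sw-t zero = refl
sw-t {suc n} (suc m) = VP.lookup∘update m (Vec.tabulate suc) zero

sw-other : ∀ {n} (t : Fin (suc n)) i -> ¬ i ≡ zero -> ¬ i ≡ t -> get (sw t) i ≡ i
sw-other t zero i≢0 _ = ⊥-elim (i≢0 refl)
sw-other zero (suc i) _ _ = lookup-idp (suc i)
sw-other (suc m) (suc i) _ i≢t = by (VP.lookup∘update′ (i≢t ∘ cong suc) (Vec.tabulate suc) zero) (VP.lookup∘tabulate suc i)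

sw-involutive : ∀ {n} (t : Fin (suc n)) i -> get (sw t) (get (sw t) i) ≡ i
sw-involutive t i with i Fin.≟ zero | i Fin.≟ t
... | yes refl | _ = by (cong (get (sw t)) (sw-0 t)) (sw-t t)
... | no _ | yes refl = by (cong (get (sw t)) (sw-t t)) (sw-0 t)
... | no i≢0 | no i≢t = by (cong (get (sw t)) (sw-other t i i≢0 i≢t)) (sw-other t i i≢0 i≢t)

Perm-sw : ∀ {n} (t : Fin (suc n)) -> Perm (sw t)
injective (Perm-sw t) {i} {j} e = by (sym (sw-involutive t i)) (by (cong (get (sw t)) e) (sw-involutive t j))

-- σ (0 τ(t)) commutes past lift: (0 σ m) σ = σ (0 m).
sw-lift : ∀ {n} {σ : Word n} -> Perm σ -> ∀ t ->
 compose (sw (get (lift σ) t)) (lift σ) ≡ compose (lift σ) (sw t)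
sw-lift {σ = σ} p t = lookup-ext \ i -> by (lookup-compose (sw (get (lift σ) t)) (lift σ) i)
 (by (go i) (sym (lookup-compose (lift σ) (sw t) i)))
 where
 go : ∀ i -> get (sw (get (lift σ) t)) (get (lift σ) i) ≡ get (lift σ) (get (sw t) i)
 go i with i Fin.≟ zero | i Fin.≟ t
 ... | yes refl | _ = by (sw-0 (get (lift σ) t)) (cong (get (lift σ)) (sym (sw-0 t)))
 ... | no _ | yes refl = by (sw-t (get (lift σ) i)) (cong (get (lift σ)) (sym (sw-t i)))
 ... | no i≢0 | no i≢t = by (sw-other (get (lift σ) t) _ (i≢0 ∘ injective (Perm-lift p)) (i≢t ∘ injective (Perm-lift p)))
  (cong (get (lift σ)) (sym (sw-other t i i≢0 i≢t)))

private
 predOr : ∀ {n} -> Fin n -> Fin (suc n) -> Fin n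
 predOr d zero = d
 predOr d (suc j) = j

 suc-predOr : ∀ {n} {d : Fin n} {j : Fin (suc n)} -> ¬ j ≡ zero -> suc (predOr d j) ≡ j
 suc-predOr {j = zero} j≢0 = ⊥-elim (j≢0 refl)
 suc-predOr {j = suc j} _ = refl

unlift : ∀ {n} -> Word (suc n) -> Word n
unlift v = Vec.tabulate (\ i -> predOr i (get v (suc i)))

lookup-unlift : ∀ {n} {v : Word (suc n)} -> Perm v -> get v zero ≡ zero ->
 ∀ i -> suc (get (unlift v) i) ≡ get v (suc i)
lookup-unlift {v = v} p v0 i = by (cong suc (VP.lookup∘tabulate (\ j -> predOr j (get v (suc j))) i))
 (suc-predOr (\ e -> FP.0≢1+n (injective p (by v0 (sym e)))))

lift-unlift : ∀ {n} {v : Word (suc n)} -> Perm v -> get v zero ≡ zero -> lift (unlift v) ≡ v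
lift-unlift {v = v} p v0 = lookup-ext \
 { zero -> sym v0
 ; (suc i) -> by (lookup-lift (unlift v) i) (lookup-unlift p v0 i) }

unlift-lift : ∀ {n} (σ : Word n) -> unlift (lift σ) ≡ σ
unlift-lift σ = lookup-ext \ i -> by (VP.lookup∘tabulate (\ j -> predOr j (get (lift σ) (suc j))) i) (cong (predOr i) (lookup-lift σ i))

Perm-unlift : ∀ {n} {v : Word (suc n)} -> Perm v -> get v zero ≡ zero -> Perm (unlift v)
injective (Perm-unlift p v0) {i} {j} e = FP.suc-injective
 (injective p (by (sym (lookup-unlift p v0 i)) (by (cong suc e) (lookup-unlift p v0 j))))

compose-sw-sw : ∀ {n} (v : Word (suc n)) t -> compose (compose v (sw t)) (sw t) ≡ v
compose-sw-sw v t = lookup-ext \ i -> by (lookup-compose (compose v (sw t)) (sw t) i)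
 (by (lookup-compose v (sw t) _) (cong (get v) (sw-involutive t i)))

pairList : ∀ {A B : Set} -> List A -> List B -> List (A × B)
pairList xs ys = concatMap (\ a -> map (a ,_) ys) xs

module _ {A B : Set} where

 pairList-unique : {xs : List A} {ys : List B} -> Unique xs -> Unique ys -> Unique (pairList xs ys)
 pairList-unique {xs} {ys} ux uy = subst Unique (sym (go xs)) (UP.cartesianProductWith⁺ _,_ ,-injective ux uy)
  where
  go : ∀ zs -> concatMap (\ x -> map (x ,_) ys) zs ≡ List.cartesianProductWith _,_ zs ys
  go [] = refl
  go (z ∷ zs) = cong (map (z ,_) ys List.++_) (go zs)

 ∈-pairList⁺ : {xs : List A} {ys : List B} -> ∀ {a b} -> a ∈ xs -> b ∈ ys -> (a , b) ∈ pairList xs ys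
 ∈-pairList⁺ {xs} {ys} {a} {b} a∈ b∈ = ∈P.∈-concatMap⁺ (\ x -> map (x ,_) ys) (go a∈)
  where
  go : ∀ {zs} -> a ∈ zs -> Any (\ x -> (a , b) ∈ map (x ,_) ys) zs
  go (here refl) = here (∈P.∈-map⁺ _ b∈)
  go (there p) = there (go p)

 ∈-pairList⁻ : {xs : List A} {ys : List B} -> ∀ {p} -> p ∈ pairList xs ys -> proj₁ p ∈ xs × proj₂ p ∈ ys
 ∈-pairList⁻ {xs} {ys} {p} p∈ = go (∈P.∈-concatMap⁻ (\ x -> map (x ,_) ys) {xs = xs} p∈)
  where
  go : ∀ {zs} -> Any (\ x -> p ∈ map (x ,_) ys) zs -> proj₁ p ∈ zs × proj₂ p ∈ ys
  go (here q) with ∈P.∈-map⁻ _ q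
  ... | b , b∈ , refl = here refl , b∈
  go (there q) = let (a , b) = go q in there a , b

-- Let t be the preimage of 0. Exchanging 0 and t beforehand gives a permutation that fixes 0, hence
-- a lift, and `sw t` is its own inverse. This is one Jucys-Murphy step.
Perm-decompose : ∀ {n} {v : Word (suc n)} -> Perm v ->
 ∃ \ σ -> ∃ \ t -> Perm σ × v ≡ compose (lift σ) (sw t)
Perm-decompose {v = v} p = unlift w , t , Perm-unlift w-perm w0 ,
 sym (by (cong (\ u -> compose u (sw t)) (lift-unlift w-perm w0)) (compose-sw-sw v t))
 where
 t = preimage v zero
 w = compose v (sw t)
 w-perm : Perm w
 w-perm = Perm-compose {σ = v} p (Perm-sw t)
 w0 : get w zero ≡ zero
 w0 = by (lookup-compose v (sw t) zero) (by (cong (get v) (sw-0 t)) (lookup-preimage p zero))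

module PermSums (J : NumberField) where

 open FieldProperties J
 open Sums J

 ∑-pairList : ∀ {A B : Set} (xs : List A) (ys : List B) (f : A × B -> F) ->
  ∑ (pairList xs ys) f ≡ ∑ xs (\ a -> ∑ ys (\ b -> f (a , b)))
 ∑-pairList xs ys f = by (∑-concatMap _ xs f) (∑-cong xs (\ a -> ∑-map (a ,_) ys f))

 -- The transpositions `sw t` represent the cosets of the stabiliser of 0.
 ∑-perms-suc : ∀ n (G : Word (suc n) -> F) ->
  ∑ (perms (suc n)) G ≡ ∑ (perms n) (\ σ -> ∑ (allFin (suc n)) (\ t -> G (compose (lift σ) (sw t))))
 ∑-perms-suc n G = by
  (∑-bij (pairList-unique (perms-unique n) (UP.allFin⁺ (suc n))) (perms-unique (suc n)) f g f∈ g∈ gf fg G)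
  (∑-pairList (perms n) (allFin (suc n)) (G ∘ f))
  where
  f : Word n × Fin (suc n) -> Word (suc n)
  f (σ , t) = compose (lift σ) (sw t)
  g : Word (suc n) -> Word n × Fin (suc n)
  g v = unlift (compose v (sw (preimage v zero))) , preimage v zero
  v0 : ∀ {v} -> Perm v -> get (compose v (sw (preimage v zero))) zero ≡ zero
  v0 {v} p = by (lookup-compose v (sw (preimage v zero)) zero)
   (by (cong (get v) (sw-0 (preimage v zero))) (lookup-preimage p zero))
  f∈ : ∀ {x} -> x ∈ pairList (perms n) (allFin (suc n)) -> f x ∈ perms (suc n)
  f∈ {σ , t} x∈ = ∈-perms⁺ (Perm-compose {σ = lift σ} (Perm-lift (∈-perms⁻ (proj₁ (∈-pairList⁻ x∈)))) (Perm-sw t))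
  g∈ : ∀ {v} -> v ∈ perms (suc n) -> g v ∈ pairList (perms n) (allFin (suc n))
  g∈ {v} v∈ = let p = ∈-perms⁻ v∈ in
   ∈-pairList⁺ (∈-perms⁺ (Perm-unlift (Perm-compose {σ = v} p (Perm-sw (preimage v zero))) (v0 p))) (∈P.∈-allFin _)
  fg : ∀ {v} -> v ∈ perms (suc n) -> f (g v) ≡ v
  fg {v} v∈ = let p = ∈-perms⁻ v∈ in
   by (cong (\ w -> compose w (sw (preimage v zero))) (lift-unlift (Perm-compose {σ = v} p (Perm-sw (preimage v zero))) (v0 p)))
    (compose-sw-sw v (preimage v zero))
  gf : ∀ {x} -> x ∈ pairList (perms n) (allFin (suc n)) -> g (f x) ≡ x
  gf {σ , t} x∈ = cong₂ _,_ (by (cong (\ u -> unlift (compose (f (σ , t)) (sw u))) et)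
   (by (cong unlift (compose-sw-sw (lift σ) t)) (unlift-lift σ))) et
   where
   pf = ∈-perms⁻ (f∈ x∈)
   et : preimage (f (σ , t)) zero ≡ t
   et = by (cong (preimage (f (σ , t))) (sym (by (lookup-compose (lift σ) (sw t) t) (cong (get (lift σ)) (sw-t t)))))
    (preimage-lookup pf t)

-- Colourings and alternating functions

act : ∀ {A : Set} {m n} -> Vec A n -> Vec (Fin n) m -> Vec A m
act c v = Vec.map (get c) v

lookup-act : ∀ {A : Set} {m n} (c : Vec A n) (v : Vec (Fin n) m) i -> get (act c v) i ≡ get c (get v i)
lookup-act c v i = VP.lookup-map i (get c) v

_≟ᵥ_ : ∀ {N n} (u v : Vec (Fin N) n) -> Dec (u ≡ v)
_≟ᵥ_ = VP.≡-dec Fin._≟_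

tr : ∀ {n} -> Fin n -> Fin n -> Fin n -> Fin n
tr a b k with k Fin.≟ a | k Fin.≟ b
... | yes _ | _ = b
... | no _ | yes _ = a
... | no _ | no _ = k

module _ {n} (a b : Fin n) where

 tr-l : tr a b a ≡ b
 tr-l with a Fin.≟ a
 ... | yes _ = refl
 ... | no ¬e = ⊥-elim (¬e refl)

 tr-r : tr a b b ≡ a
 tr-r with b Fin.≟ a | b Fin.≟ b
 ... | yes e | _ = e
 ... | no _ | yes _ = refl
 ... | no _ | no ¬e = ⊥-elim (¬e refl)

 tr-other : ∀ {k} -> ¬ k ≡ a -> ¬ k ≡ b -> tr a b k ≡ k
 tr-other {k} k≢a k≢b with k Fin.≟ a | k Fin.≟ b
 ... | yes e | _ = ⊥-elim (k≢a e)
 ... | no _ | yes e = ⊥-elim (k≢b e)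
 ... | no _ | no _ = refl

 tr-involutive : ∀ k -> tr a b (tr a b k) ≡ k
 tr-involutive k with k Fin.≟ a | k Fin.≟ b
 ... | yes refl | _ = tr-r
 ... | no _ | yes refl = tr-l
 ... | no k≢a | no k≢b = tr-other k≢a k≢b

-- Recolouring p from i to j on one side of an equation is recolouring it back on the other side.
flip⁺ : ∀ {N n} {p : Fin n} {i j : Fin N} {u w : Vec (Fin N) n} ->
 get u p ≡ i -> u [ p ]≔ j ≡ w -> get w p ≡ j × u ≡ w [ p ]≔ i
flip⁺ {p = p} {j = j} {u} refl refl = VP.lookup∘update p u j ,
 sym (by (VP.[]≔-idempotent u p) (VP.[]≔-lookup u p))

module Colourings (J : NumberField) (N : ℕ) where

 open FieldProperties J
 open Sums J

 -- States are shifted weights λ + ρ of gl_N with entries in the field. A colouring is a basis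
 -- tensor of the n-th tensor power, and `ℓ ▷ c` adds its weight, the number of occurrences of each
 -- colour.
 State : Set
 State = Fin N -> F

 e : Fin N -> Fin N -> F
 e i k = ind (i Fin.≟ k)

 e-same : ∀ i -> e i i ≡ 1#
 e-same i = ind-yes (i Fin.≟ i) refl

 e-diff : ∀ {i k} -> ¬ i ≡ k -> e i k ≡ 0#
 e-diff {i} {k} = ind-no (i Fin.≟ k)

 infixl 6 _+e_ _▷_
 _+e_ : State -> Fin N -> State
 (ℓ +e i) k = ℓ k + e i k

 # : ∀ {n} -> Vec (Fin N) n -> Fin N -> F
 # {n} c i = ∑ (allFin n) (\ m -> e (get c m) i)

 _▷_ : ∀ {n} -> State -> Vec (Fin N) n -> State
 (ℓ ▷ c) k = ℓ k + # c k

 #-∷ : ∀ {n} i (c : Vec (Fin N) n) k -> # (i ∷ c) k ≡ e i k + # c k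
 #-∷ {n} i c k = ∑-allFin-suc n _

 #-recolour : ∀ {n} (c : Vec (Fin N) n) m {i} j -> get c m ≡ i -> ∀ k ->
  # (c [ m ]≔ j) k + e i k ≡ # c k + e j k
 #-recolour (x ∷ c) zero {i} j refl k = by (cong (_+ e i k) (#-∷ j c k)) (by
  (solve 3 (\ a b s -> (a :+ s) :+ b := (b :+ s) :+ a) refl (e j k) (e i k) (# c k))
  (cong (_+ e j k) (sym (#-∷ i c k))))
  where open Solver
 #-recolour (x ∷ c) (suc m) {i} j eq k = by (cong (_+ e i k) (#-∷ x (c [ m ]≔ j) k)) (by (+-assoc _ _ _)
  (by (cong (\ r -> e x k + r) (#-recolour c m j eq k))
  (by (sym (+-assoc _ _ _)) (cong (_+ e j k) (sym (#-∷ x c k))))))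

 -- States are functions, so compatibility with pointwise equality is part of the notion.
 record Alternating (h : State -> F) : Set where
  field
   ext : ∀ {ℓ ℓ'} -> (∀ k -> ℓ k ≡ ℓ' k) -> h ℓ ≡ h ℓ'
   swap : ∀ {a b} -> ¬ a ≡ b -> ∀ ℓ -> h (ℓ ∘ tr a b) ≡ - h ℓ

 -- Traces of gl_N operators twisted by a permutation

 module Traces {n} (σ : Word n) (σ-perm : Perm σ) {h : State -> F} (alt : Alternating h) where

  open Alternating alt
  open ≡-Reasoning

  C : List (Vec (Fin N) n)
  C = cols N n

  M : List (Fin n)
  M = allFin n

  inv? : (c : Vec (Fin N) n) -> Dec (act c σ ≡ c)
  inv? c = act c σ ≟ᵥ c

  -- With T_ij the sum over all positions of the matrix unit E_ij, `B`, `D i` and `t i j` are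
  -- traces, over the n-th tensor power, of σ and h(ℓ + weight) together with the identity, the
  -- number operator T_ii, and a product of T_ij and T_ji.
  B : State -> F
  B ℓ = ∑ C (\ c -> ind (inv? c) * h (ℓ ▷ c))

  d : Fin N -> Fin n -> State -> F
  d i m ℓ = ∑ C (\ c -> ind (get c m Fin.≟ i) * (ind (inv? c) * h (ℓ ▷ c)))

  D : Fin N -> State -> F
  D i ℓ = ∑ M (\ m -> d i m ℓ)

  -- Colourings a such that a ∘ σ is obtained from a by recolouring m′ from j to i and then m from i to j.
  t0 : Fin N -> Fin N -> Fin n -> Fin n -> State -> F
  t0 i j m' m ℓ = ∑ C (\ a -> ind (get a m' Fin.≟ j) * (ind (get (a [ m' ]≔ i) m Fin.≟ i)
   * (ind (act a σ ≟ᵥ (a [ m' ]≔ i [ m ]≔ j)) * h (ℓ ▷ a))))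

  t : Fin N -> Fin N -> State -> F
  t i j ℓ = ∑ M (\ m' -> ∑ M (\ m -> t0 i j m' m ℓ))

  ▷-cong : ∀ {k} {ℓ ℓ' : State} -> (∀ k -> ℓ k ≡ ℓ' k) -> (c : Vec (Fin N) k) -> h (ℓ ▷ c) ≡ h (ℓ' ▷ c)
  ▷-cong q c = ext (\ k -> cong (_+ # c k) (q k))

  B-cong : ∀ {ℓ ℓ'} -> (∀ k -> ℓ k ≡ ℓ' k) -> B ℓ ≡ B ℓ'
  B-cong q = ∑-cong C (\ c -> cong (\ r -> ind (inv? c) * r) (▷-cong q c))

  D-cong : ∀ i {ℓ ℓ'} -> (∀ k -> ℓ k ≡ ℓ' k) -> D i ℓ ≡ D i ℓ'
  D-cong i q = ∑-cong M (\ m -> ∑-cong C (\ c -> cong (\ r -> ind (get c m Fin.≟ i) * (ind (inv? c) * r)) (▷-cong q c)))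

  t-cong : ∀ i j {ℓ ℓ'} -> (∀ k -> ℓ k ≡ ℓ' k) -> t i j ℓ ≡ t i j ℓ'
  t-cong i j q = ∑-cong M (\ m' -> ∑-cong M (\ m -> ∑-cong C (\ a ->
   cong (\ r -> ind (get a m' Fin.≟ j) * (ind (get (a [ m' ]≔ i) m Fin.≟ i)
   * (ind (act a σ ≟ᵥ (a [ m' ]≔ i [ m ]≔ j)) * r))) (▷-cong q a))))

  ind-exchange : ∀ {A P X W Y : Set} (a : Dec A) (p : Dec P) (x : Dec X) (w : Dec W) (y : Dec Y) r ->
   (A × X -> W × Y) -> (W × Y -> A × X) ->
   ind a * (ind p * (ind x * r)) ≡ ind p * (ind w * (ind y * r))
  ind-exchange a p x w y r f g = begin
   ind a * (ind p * (ind x * r)) ≡⟨ solve 4 (\ a p x r -> a :* (p :* (x :* r)) := p :* ((a :* x) :* r)) refl (ind a) (ind p) (ind x) r ⟩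
   ind p * ((ind a * ind x) * r) ≡⟨ cong (\ q -> ind p * (q * r)) (by (sym (ind-× a x)) (by (ind-cong (a ×-dec x) (w ×-dec y) f g) (ind-× w y))) ⟩
   ind p * ((ind w * ind y) * r) ≡⟨ cong (\ q -> ind p * q) (*-assoc (ind w) (ind y) r) ⟩
   ind p * (ind w * (ind y * r)) ∎
   where open Solver

  act-recolour : ∀ (a : Vec (Fin N) n) p j -> act (a [ get σ p ]≔ j) σ ≡ act a σ [ p ]≔ j
  act-recolour a p j = lookup-ext \ q -> by (lookup-act (a [ get σ p ]≔ j) σ q) (go q (q Fin.≟ p))
   where
   go : ∀ q -> Dec (q ≡ p) -> get (a [ get σ p ]≔ j) (get σ q) ≡ get (act a σ [ p ]≔ j) q
   go q (yes refl) = by (VP.lookup∘update (get σ q) a j) (sym (VP.lookup∘update q (act a σ) j))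
   go q (no q≢p) = by (VP.lookup∘update′ (q≢p ∘ injective σ-perm) a j)
    (sym (by (VP.lookup∘update′ q≢p (act a σ) j) (lookup-act a σ q)))

  -- Cyclicity for one pair of positions. Summing over the colouring with σ(p) already recoloured
  -- carries that change past σ, where it becomes a change at p; the state compensates by ℓ' = ℓ +
  -- e_j - e_i.
  t0-shift : ∀ i j p m {ℓ ℓ'} -> (∀ k -> ℓ' k + e i k ≡ ℓ k + e j k) -> t0 i j (get σ p) m ℓ ≡ t0 j i m p ℓ'
  t0-shift i j p m {ℓ} {ℓ'} q = begin
   t0 i j m' m ℓ
   ≡⟨ ∑-recolour m' i j (\ a -> ind (get (a [ m' ]≔ i) m Fin.≟ i) * (ind (act a σ ≟ᵥ (a [ m' ]≔ i [ m ]≔ j)) * h (ℓ ▷ a))) ⟩ _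
   ≡⟨ ∑-cong C (\ a -> ind-*-cong (get a m' Fin.≟ i) (back a)) ⟩ _
   ≡⟨ ∑-cong C (\ a -> ind-exchange (get a m' Fin.≟ i) (get a m Fin.≟ i) ((act a σ [ p ]≔ j) ≟ᵥ (a [ m ]≔ j))
   (get (a [ m ]≔ j) p Fin.≟ j) (act a σ ≟ᵥ (a [ m ]≔ j [ p ]≔ i)) (h (ℓ' ▷ a)) (to a) (from a)) ⟩
   t0 j i m p ℓ' ∎
   where
   m' = get σ p
   back : ∀ a -> get a m' ≡ i ->
    ind (get (a [ m' ]≔ j [ m' ]≔ i) m Fin.≟ i)
    * (ind (act (a [ m' ]≔ j) σ ≟ᵥ (a [ m' ]≔ j [ m' ]≔ i [ m ]≔ j)) * h (ℓ ▷ (a [ m' ]≔ j)))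
    ≡ ind (get a m Fin.≟ i) * (ind ((act a σ [ p ]≔ j) ≟ᵥ (a [ m ]≔ j)) * h (ℓ' ▷ a))
   back a am' = cong₂ _*_ (cong (\ v -> ind (get v m Fin.≟ i)) restore)
    (cong₂ _*_ (cong₂ (\ u v -> ind (u ≟ᵥ v)) (act-recolour a p j) (cong (_[ m ]≔ j) restore)) (ext shift))
    where
    restore : a [ m' ]≔ j [ m' ]≔ i ≡ a
    restore = by (VP.[]≔-idempotent a m') (by (cong (a [ m' ]≔_) (sym am')) (VP.[]≔-lookup a m'))
    open Solver
    shift : ∀ k -> ℓ k + # (a [ m' ]≔ j) k ≡ ℓ' k + # a k
    shift k = x-y≡0⇒x≡y (begin
     (ℓ k + # (a [ m' ]≔ j) k) - (ℓ' k + # a k)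
     ≡⟨ solve 6 (\ l l' s s' u v -> (l :+ s') :- (l' :+ s) := ((s' :+ u) :- (s :+ v)) :- ((l' :+ u) :- (l :+ v))) refl
     (ℓ k) (ℓ' k) (# a k) (# (a [ m' ]≔ j) k) (e i k) (e j k) ⟩ _
     ≡⟨ cong₂ (\ x y -> (x - (# a k + e j k)) - (y - (ℓ k + e j k))) (#-recolour a m' j am' k) (q k) ⟩ _
     ≡⟨ solve 2 (\ x y -> (x :- x) :- (y :- y) := con (Z.+ 0)) refl (# a k + e j k) (ℓ k + e j k) ⟩
     int (Z.+ 0) ≡⟨ int-0 ⟩
     0# ∎)
   to : ∀ a -> get a m' ≡ i × act a σ [ p ]≔ j ≡ a [ m ]≔ j -> get (a [ m ]≔ j) p ≡ j × act a σ ≡ a [ m ]≔ j [ p ]≔ i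
   to a (x , y) = flip⁺ (by (lookup-act a σ p) x) y
   from : ∀ a -> get (a [ m ]≔ j) p ≡ j × act a σ ≡ a [ m ]≔ j [ p ]≔ i -> get a m' ≡ i × act a σ [ p ]≔ j ≡ a [ m ]≔ j
   from a (x , y) = let (u , v) = flip⁺ x (sym y) in by (sym (lookup-act a σ p)) u , sym v

  -- The trace identity Tr(σ T_ij T_ji h) = Tr(σ T_ji h T_ij).
  t-shift : ∀ i j {ℓ ℓ'} -> (∀ k -> ℓ' k + e i k ≡ ℓ k + e j k) -> t i j ℓ ≡ t j i ℓ'
  t-shift i j {ℓ} {ℓ'} q = begin
   ∑ M (\ m' -> ∑ M (\ m -> t0 i j m' m ℓ))
   ≡⟨ ∑-reindex (get σ) (preimage σ) (preimage-lookup σ-perm) (lookup-preimage σ-perm) (\ m' -> ∑ M (\ m -> t0 i j m' m ℓ)) ⟨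
   ∑ M (\ p -> ∑ M (\ m -> t0 i j (get σ p) m ℓ)) ≡⟨ ∑-cong M (\ p -> ∑-cong M (\ m -> t0-shift i j p m q)) ⟩
   ∑ M (\ p -> ∑ M (\ m -> t0 j i m p ℓ')) ≡⟨ ∑-swap M M (\ p m -> t0 j i m p ℓ') ⟩
   ∑ M (\ m -> ∑ M (\ p -> t0 j i m p ℓ')) ∎

  -- At a single position the two recolourings undo each other and leave the projection to colour j.
  -- This is the only source of the commutator, since distinct positions commute by `t0-comm`.
  t0-diag : ∀ i j m ℓ -> t0 i j m m ℓ ≡ d j m ℓ
  t0-diag i j m ℓ = ∑-cong C (\ a -> ind-*-cong (get a m Fin.≟ j) (\
   { refl -> by (cong (_* (ind (act a σ ≟ᵥ (a [ m ]≔ i [ m ]≔ get a m)) * h (ℓ ▷ a))) (ind-yes (get (a [ m ]≔ i) m Fin.≟ i) (VP.lookup∘update m a i)))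
   (by (*-idˡ _) (cong (\ v -> ind (act a σ ≟ᵥ v) * h (ℓ ▷ a))
   (by (VP.[]≔-idempotent a m) (VP.[]≔-lookup a m)))) }))

  t0-comm : ∀ i j {m' m} -> ¬ m ≡ m' -> ∀ ℓ -> t0 i j m' m ℓ ≡ t0 j i m m' ℓ
  t0-comm i j {m'} {m} m≢m' ℓ = ∑-cong C (\ a -> step a)
   where
   open Solver
   step : ∀ a -> ind (get a m' Fin.≟ j) * (ind (get (a [ m' ]≔ i) m Fin.≟ i)
    * (ind (act a σ ≟ᵥ (a [ m' ]≔ i [ m ]≔ j)) * h (ℓ ▷ a)))
    ≡ ind (get a m Fin.≟ i) * (ind (get (a [ m ]≔ j) m' Fin.≟ j)
    * (ind (act a σ ≟ᵥ (a [ m ]≔ j [ m' ]≔ i)) * h (ℓ ▷ a)))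
   step a = by (cong (\ x -> ind (get a m' Fin.≟ j) * x) (cong₂ _*_ (cong (\ x -> ind (x Fin.≟ i)) (VP.lookup∘update′ m≢m' a i))
    (cong (\ v -> ind (act a σ ≟ᵥ v) * h (ℓ ▷ a)) (VP.[]≔-commutes a m' m (m≢m' ∘ sym)))))
    (by (solve 3 (\ x y z -> x :* (y :* z) := y :* (x :* z)) refl (ind (get a m' Fin.≟ j)) (ind (get a m Fin.≟ i)) _)
    (cong (\ x -> ind (get a m Fin.≟ i) * (ind (x Fin.≟ j) * (ind (act a σ ≟ᵥ (a [ m ]≔ j [ m' ]≔ i)) * h (ℓ ▷ a))))
    (sym (VP.lookup∘update′ (m≢m' ∘ sym) a j))))

  -- The commutator [T_ij , T_ji] = T_ii - T_jj.
  t-comm : ∀ i j ℓ -> t i j ℓ + D i ℓ ≡ t j i ℓ + D j ℓ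
  t-comm i j ℓ = begin
   t i j ℓ + D i ℓ
   ≡⟨ cong (t i j ℓ +_) (∑-cong M (\ m' -> ∑-ind-≟ m' (\ m -> d i m ℓ))) ⟨ _
   ≡⟨ ∑-+ M _ _ ⟨ _
   ≡⟨ ∑-cong M (\ m' -> ∑-+ M _ _) ⟨ _
   ≡⟨ ∑-cong M (\ m' -> ∑-cong M (\ m -> step m' m (m Fin.≟ m'))) ⟩ _
   ≡⟨ ∑-cong M (\ m' -> ∑-+ M _ _) ⟩ _
   ≡⟨ ∑-+ M _ _ ⟩ _
   ≡⟨ cong₂ _+_ (∑-swap M M (\ m' m -> t0 j i m m' ℓ)) (∑-cong M (\ m' -> ∑-ind-≟ m' (\ m -> d j m ℓ))) ⟩
   t j i ℓ + D j ℓ ∎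
   where
   step : ∀ m' m (q : Dec (m ≡ m')) -> t0 i j m' m ℓ + ind q * d i m ℓ ≡ t0 j i m m' ℓ + ind q * d j m ℓ
   step m' m (yes refl) = by (cong₂ _+_ (t0-diag i j m ℓ) (*-idˡ _))
    (by (+-comm _ _) (sym (cong₂ _+_ (t0-diag j i m ℓ) (*-idˡ _))))
   step m' m (no m≢m') = cong₂ _+_ (t0-comm i j m≢m' ℓ) (by (zeroˡ _) (sym (zeroˡ _)))

  module Swap {a b : Fin N} (a≢b : ¬ a ≡ b) where

   π : Fin N -> Fin N
   π = tr a b

   πᵥ : ∀ {k} -> Vec (Fin N) k -> Vec (Fin N) k
   πᵥ = Vec.map π

   πᵥ-involutive : ∀ {k} (c : Vec (Fin N) k) -> πᵥ (πᵥ c) ≡ c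
   πᵥ-involutive c = by (sym (VP.map-∘ π π c)) (by (VP.map-cong (tr-involutive a b) c) (VP.map-id c))

   ∑-πᵥ : ∀ Φ -> ∑ C Φ ≡ ∑ C (Φ ∘ πᵥ)
   ∑-πᵥ = ∑-bij (cols-unique N n) (cols-unique N n) πᵥ πᵥ
    (\ {c} _ -> ∈-cols (πᵥ c)) (\ {c} _ -> ∈-cols (πᵥ c)) (\ {c} _ -> πᵥ-involutive c) (\ {c} _ -> πᵥ-involutive c)

   e-π : ∀ i k -> e (π i) k ≡ e i (π k)
   e-π i k = ind-cong (π i Fin.≟ k) (i Fin.≟ π k) (\ q -> by (sym (tr-involutive a b i)) (cong π q))
    (\ q -> by (cong π q) (tr-involutive a b k))

   #-πᵥ : (c : Vec (Fin N) n) -> ∀ k -> # (πᵥ c) k ≡ # c (π k)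
   #-πᵥ c k = ∑-cong M (\ m -> by (cong (\ x -> e x k) (VP.lookup-map m π c)) (e-π (get c m) k))

   h-πᵥ : ∀ ℓ (c : Vec (Fin N) n) -> h ((ℓ ∘ π) ▷ πᵥ c) ≡ - h (ℓ ▷ c)
   h-πᵥ ℓ c = by (ext (\ k -> cong (ℓ (π k) +_) (#-πᵥ c k))) (swap a≢b (ℓ ▷ c))

   ind-π : ∀ (c : Vec (Fin N) n) m i -> ind (get (πᵥ c) m Fin.≟ i) ≡ ind (get c m Fin.≟ π i)
   ind-π c m i = by (cong (\ x -> ind (x Fin.≟ i)) (VP.lookup-map m π c)) (e-π (get c m) i)

   act-πᵥ : ∀ (c : Vec (Fin N) n) -> act (πᵥ c) σ ≡ πᵥ (act c σ)
   act-πᵥ c = lookup-ext \ i -> by (lookup-act (πᵥ c) σ i) (by (VP.lookup-map _ π c)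
    (sym (by (VP.lookup-map i π (act c σ)) (cong π (lookup-act c σ i)))))

   ind-πᵥ : ∀ (u v : Vec (Fin N) n) -> ind (πᵥ u ≟ᵥ πᵥ v) ≡ ind (u ≟ᵥ v)
   ind-πᵥ u v = ind-cong (πᵥ u ≟ᵥ πᵥ v) (u ≟ᵥ v)
    (\ q -> by (sym (πᵥ-involutive u)) (by (cong πᵥ q) (πᵥ-involutive v))) (cong πᵥ)

   ind-inv : ∀ c -> ind (inv? (πᵥ c)) ≡ ind (inv? c)
   ind-inv c = by (cong (\ v -> ind (v ≟ᵥ πᵥ c)) (act-πᵥ c)) (ind-πᵥ (act c σ) c)

   update-π : ∀ (c : Vec (Fin N) n) m i -> πᵥ c [ m ]≔ i ≡ πᵥ (c [ m ]≔ π i)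
   update-π c m i = sym (by (VP.map-[]≔ π c m) (cong (πᵥ c [ m ]≔_) (tr-involutive a b i)))

   *-neg : ∀ x y -> x * - y ≡ - (x * y)
   *-neg = solve 2 (\ x y -> x :* :- y := :- (x :* y)) refl
    where open Solver

   -- Renaming colours by π permutes the σ-invariant colourings, so the traces inherit the
   -- antisymmetry of h, with their own indices renamed along.
   B-π : ∀ ℓ -> B (ℓ ∘ π) ≡ - B ℓ
   B-π ℓ = by (∑-πᵥ _) (by (∑-cong C (\ c -> by (cong₂ _*_ (ind-inv c) (h-πᵥ ℓ c)) (*-neg _ _))) (∑-neg C _))

   D-π : ∀ i ℓ -> D i (ℓ ∘ π) ≡ - D (π i) ℓ
   D-π i ℓ = by (∑-cong M (\ m -> by (∑-πᵥ _) (by (∑-cong C (\ c ->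
    by (cong₂ _*_ (ind-π c m i) (by (cong₂ _*_ (ind-inv c) (h-πᵥ ℓ c)) (*-neg _ _))) (*-neg _ _))) (∑-neg C _)))) (∑-neg M _)

   t-π : ∀ i j ℓ -> t i j (ℓ ∘ π) ≡ - t (π i) (π j) ℓ
   t-π i j ℓ = by (∑-cong M (\ m' -> by (∑-cong M (\ m -> by (∑-πᵥ _) (by (∑-cong C (\ c -> step m' m c)) (∑-neg C _)))) (∑-neg M _))) (∑-neg M _)
    where
    upd : ∀ (c : Vec (Fin N) n) m' m -> πᵥ c [ m' ]≔ i [ m ]≔ j ≡ πᵥ (c [ m' ]≔ π i [ m ]≔ π j)
    upd c m' m = by (cong (_[ m ]≔ j) (update-π c m' i)) (update-π (c [ m' ]≔ π i) m j)
    step : ∀ m' m c ->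
     ind (get (πᵥ c) m' Fin.≟ j) * (ind (get (πᵥ c [ m' ]≔ i) m Fin.≟ i)
     * (ind (act (πᵥ c) σ ≟ᵥ (πᵥ c [ m' ]≔ i [ m ]≔ j)) * h ((ℓ ∘ π) ▷ πᵥ c)))
     ≡ - (ind (get c m' Fin.≟ π j) * (ind (get (c [ m' ]≔ π i) m Fin.≟ π i)
     * (ind (act c σ ≟ᵥ (c [ m' ]≔ π i [ m ]≔ π j)) * h (ℓ ▷ c))))
    step m' m c = by (cong₂ _*_ (ind-π c m' j) (by (cong₂ _*_
     (by (cong (\ v -> ind (get v m Fin.≟ i)) (update-π c m' i)) (ind-π (c [ m' ]≔ π i) m i))
     (by (cong₂ _*_ (by (cong₂ (\ u v -> ind (u ≟ᵥ v)) (act-πᵥ c) (upd c m' m)) (ind-πᵥ (act c σ) _)) (h-πᵥ ℓ c))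
     (*-neg _ _))) (*-neg _ _))) (*-neg _ _)

  -- Equal coordinates are exchanged by a transposition that fixes the state.
  module Collision {a b : Fin N} (a≢b : ¬ a ≡ b) {ℓ : State} (eq : ℓ a ≡ ℓ b) where

   open Swap a≢b

   fixed : ∀ k -> ℓ k ≡ ℓ (π k)
   fixed k with k Fin.≟ a | k Fin.≟ b
   ... | yes refl | _ = eq
   ... | no _ | yes refl = sym eq
   ... | no _ | no _ = refl

   B≡0 : B ℓ ≡ 0#
   B≡0 = x≡-x⇒x≡0 (by (B-cong fixed) (B-π ℓ))

   -- The swap fixes only the indices other than a and b; it exchanges `D a` with `D b`, about which
   -- antisymmetry alone says nothing more.
   D≡0 : ∀ {i} -> ¬ i ≡ a -> ¬ i ≡ b -> D i ℓ ≡ 0#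
   D≡0 {i} i≢a i≢b = x≡-x⇒x≡0 (by (D-cong i fixed) (by (D-π i ℓ) (cong (\ x -> - D x ℓ) (tr-other a b i≢a i≢b))))

-- The staircase state and the flow

-- Indices run from the top level N - 1 downwards, so that passing from N to N + 1 adds a new
-- largest level at the head and leaves the others alone.
level : ∀ {N} -> Fin N -> ℕ
level {suc N} zero = N
level {suc N} (suc i) = level i

level<N : ∀ {N} (i : Fin N) -> level i < N
level<N {suc N} zero = NP.≤-refl
level<N {suc N} (suc i) = NP.m≤n⇒m≤1+n (level<N i)

level-injective : ∀ {N} {i j : Fin N} -> level i ≡ level j -> i ≡ j
level-injective {suc N} {zero} {zero} q = refl
level-injective {suc N} {zero} {suc j} q = ⊥-elim (NP.<-irrefl (sym q) (level<N j))
level-injective {suc N} {suc i} {zero} q = ⊥-elim (NP.<-irrefl q (level<N i))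
level-injective {suc N} {suc i} {suc j} q = cong suc (level-injective q)

atLevel : ∀ {N k} -> k < N -> ∃ \ (i : Fin N) -> level i ≡ k
atLevel {suc N} {k} k<1+N with k N.≟ N
... | yes refl = zero , refl
... | no k≢N   = let (i , q) = atLevel (NP.≤∧≢⇒< (NP.≤-pred k<1+N) k≢N) in suc i , q

module Vacuum (J : NumberField) (N : ℕ) where

 open FieldProperties J
 open Sums J
 open Colourings J N

 -- The Weyl vector (N-1, ..., 0): the empty partition in the coordinates λ_i + N - i.
 δ : State
 δ i = nat (level i)

 ∑-above : ∀ {n} (i : Fin n) -> ∑ (allFin n) (\ j -> ind (level i N.<? level j)) + (nat (level i) + 1#) ≡ nat n
 ∑-above {suc n} zero = by (cong (_+ (nat n + 1#)) (by (∑-allFin-suc n _)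
  (by (cong₂ _+_ (ind-no (n N.<? n) (NP.<-irrefl refl))
  (∑-≡0 (allFin n) (\ {j} _ -> ind-no (n N.<? level j) (\ q -> NP.<-asym q (level<N j))))) (+-idˡ 0#))))
  (by (+-idˡ _) (by (+-comm _ _) (sym (nat-suc n))))
 ∑-above {suc n} (suc i) = by (cong (_+ (nat (level i) + 1#)) (by (∑-allFin-suc n _)
  (cong (_+ ∑ (allFin n) (\ j -> ind (level i N.<? level j))) (ind-yes (level i N.<? n) (level<N i)))))
  (by (+-assoc _ _ _) (by (cong (\ r -> 1# + r) (∑-above i)) (sym (nat-suc n))))

 -- Adding a box in row i. The number ℓ_i + 1 is N plus the content of that box, and it is squared
 -- because σ₀ and σ₁ contribute it once each.
 raise : (State -> F) -> State -> F
 raise h ℓ = ∑ (allFin N) (\ i -> (ℓ i + 1#) * (ℓ i + 1#) * h (ℓ +e i))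

 raise-alternating : ∀ {h} -> Alternating h -> Alternating (raise h)
 raise-alternating {h} alt = record
  { ext = \ q -> ∑-cong (allFin N) (\ i -> cong₂ (\ x y -> (x + 1#) * (x + 1#) * y) (q i) (ext (\ k -> cong (_+ e i k) (q k))))
  ; swap = \ {a} {b} a≢b ℓ -> by
   (sym (∑-reindex (tr a b) (tr a b) (tr-involutive a b) (tr-involutive a b) _))
   (by (∑-cong (allFin N) (\ i -> by
   (cong₂ (\ x y -> (x + 1#) * (x + 1#) * y) (cong ℓ (tr-involutive a b i))
   (by (ext (\ k -> cong (ℓ (tr a b k) +_) (ind-cong (tr a b i Fin.≟ k) (i Fin.≟ tr a b k)
   (\ q -> by (sym (tr-involutive a b i)) (cong (tr a b) q))
   (\ q -> by (cong (tr a b) q) (tr-involutive a b k)))))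
   (swap a≢b (ℓ +e i))))
   (solve 2 (\ x y -> x :* :- y := :- (x :* y)) refl ((ℓ i + 1#) * (ℓ i + 1#)) (h (ℓ +e i)))))
   (∑-neg (allFin N) _))
  }
  where
  open Alternating alt
  open Solver

 module Evaluation {n} (σ : Word n) (σ-perm : Perm σ) {h : State -> F} (alt : Alternating h) where

  open Traces σ σ-perm alt
  open Alternating alt
  open ≡-Reasoning

  V : Fin N -> Fin N -> State -> F
  V i j ℓ = t i j ℓ + D i ℓ

  -- The states on the segment between δ + e_i and its reflection in i and j.
  path : Fin N -> Fin N -> ℕ -> State
  path i j q k = δ k + (1# + nat q) * e i k - nat q * e j k

  module Reflect {i j : Fin N} {r : ℕ} (r-gap : level j ≡ suc (level i N.+ r)) where

   open Solver

   i≢j : ¬ i ≡ j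
   i≢j refl = NP.<-irrefl r-gap (s≤s (NP.m≤m+n (level i) r))

   path-i : ∀ q -> path i j q i ≡ nat (suc (level i N.+ q))
   path-i q = by (cong₂ (\ x y -> δ i + (1# + nat q) * x - nat q * y) (e-same i) (e-diff (i≢j ∘ sym)))
    (by (cong₂ (\ u z -> δ i + (u + nat q) * u - nat q * z) (sym int-1) (sym int-0))
    (by (solve 2 (\ d q -> d :+ (con (Z.+ 1) :+ q) :* con (Z.+ 1) :- q :* con (Z.+ 0) := con (Z.+ 1) :+ (d :+ q)) refl (δ i) (nat q))
    (by (cong (_+ (δ i + nat q)) int-1) (by (cong (1# +_) (sym (nat-+ (level i) q))) (sym (nat-suc _))))))

   path-j : ∀ q -> q N.≤ r -> path i j q j ≡ nat (suc (level i N.+ (r ∸ q)))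
   path-j q q≤r = by (cong₂ (\ x y -> δ j + (1# + nat q) * x - nat q * y) (e-diff i≢j) (e-same j))
    (by (cong₂ (\ u z -> δ j + (u + nat q) * z - nat q * u) (sym int-1) (sym int-0))
    (by (solve 2 (\ d q -> d :+ (con (Z.+ 1) :+ q) :* con (Z.+ 0) :- q :* con (Z.+ 1) := d :- q) refl (δ j) (nat q))
    (by (cong (\ x -> nat x - nat q) (by r-gap split))
    (by (cong (_- nat q) (nat-+ _ q)) (solve 2 (\ a b -> a :+ b :- b := a) refl _ _)))))
    where
    split : suc (level i N.+ r) ≡ suc (level i N.+ (r ∸ q)) N.+ q
    split = cong suc (by (cong (level i N.+_) (sym (NP.m∸n+n≡m q≤r))) (sym (NP.+-assoc (level i) (r ∸ q) q)))

   path-k : ∀ q {k} -> ¬ k ≡ i -> ¬ k ≡ j -> path i j q k ≡ δ k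
   path-k q {k} k≢i k≢j = by (cong₂ (\ x y -> δ k + (1# + nat q) * x - nat q * y) (e-diff (k≢i ∘ sym)) (e-diff (k≢j ∘ sym)))
    (by (cong₂ (\ u z -> δ k + (u + nat q) * z - nat q * z) (sym int-1) (sym int-0))
    (solve 2 (\ d q -> d :+ (con (Z.+ 1) :+ q) :* con (Z.+ 0) :- q :* con (Z.+ 0) := d) refl (δ k) (nat q)))

   between : ∀ q -> q < r -> ∃ \ k -> level k ≡ suc (level i N.+ q) × ¬ k ≡ i × ¬ k ≡ j
   between q q<r = k , lk , (\ k≡i -> NP.<-irrefl (by (cong level (sym k≡i)) lk) (s≤s (NP.m≤m+n (level i) q)))
    , (\ k≡j -> NP.<-irrefl (by (sym lk) (by (cong level k≡j) r-gap)) (s≤s (NP.+-monoʳ-< (level i) q<r)))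
    where
    got = atLevel {N} {suc (level i N.+ q)} (NP.<-trans (subst (suc (level i N.+ q) <_) (sym r-gap) (s≤s (NP.+-monoʳ-< (level i) q<r))) (level<N j))
    k = proj₁ got
    lk = proj₂ got

   -- The coordinate i of the path runs through the values level i + 1 + q. For q < r such a value
   -- is the level of a third index k, so i and k collide.
   D-j-path : ∀ q -> q < r -> D j (path i j q) ≡ 0#
   D-j-path q q<r = let (k , lk , k≢i , k≢j) = between q q<r in
    Collision.D≡0 {i} {k} (k≢i ∘ sym) {path i j q}
     (by (path-i q) (sym (by (path-k q k≢i k≢j) (cong nat lk)))) (i≢j ∘ sym) (k≢j ∘ sym)

   D-i-path : ∀ q -> q < r -> D i (path i j (suc q)) ≡ 0#
   D-i-path q q<r = let (k , lk , k≢i , k≢j) = between (r ∸ suc q) (NP.∸-monoʳ-< {r} {suc q} {0} (s≤s z≤n) q<r) in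
    Collision.D≡0 {j} {k} (k≢j ∘ sym) {path i j (suc q)}
     (by (path-j (suc q) q<r) (sym (by (path-k (suc q) k≢i k≢j) (cong nat lk)))) i≢j (k≢i ∘ sym)

   -- The commutator turns t_ij into t_ji, and cyclicity turns it back while one unit moves from
   -- coordinate j to coordinate i. The terms D j before and D i after the step vanish by
   -- collisions.
   V-step : ∀ q -> q < r -> V i j (path i j q) ≡ V i j (path i j (suc q))
   V-step q q<r = begin
    t i j (path i j q) + D i (path i j q) ≡⟨ t-comm i j (path i j q) ⟩
    t j i (path i j q) + D j (path i j q) ≡⟨ cong₂ _+_ (sym (t-shift i j sh)) (D-j-path q q<r) ⟩
    t i j (path i j (suc q)) + 0# ≡⟨ cong (t i j (path i j (suc q)) +_) (D-i-path q q<r) ⟨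
    t i j (path i j (suc q)) + D i (path i j (suc q)) ∎
    where
    sh : ∀ k -> path i j q k + e i k ≡ path i j (suc q) k + e j k
    sh k = by (cong₂ (\ u x -> δ k + (u + nat q) * e i k - nat q * e j k + x) (sym int-1) refl)
     (by (solve 4 (\ d q a b -> d :+ (con (Z.+ 1) :+ q) :* a :- q :* b :+ a
     := d :+ (con (Z.+ 1) :+ (con (Z.+ 1) :+ q)) :* a :- (con (Z.+ 1) :+ q) :* b :+ b) refl (δ k) (nat q) (e i k) (e j k))
     (cong₂ (\ u v -> δ k + (u + v) * e i k - v * e j k + e j k) int-1
     (by (cong (_+ nat q) int-1) (sym (nat-suc q)))))

   V-const : ∀ q -> q N.≤ r -> V i j (path i j 0) ≡ V i j (path i j q)
   V-const zero _ = refl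
   V-const (suc q) q<r = by (V-const q (NP.<⇒≤ q<r)) (V-step q q<r)

   path-reflect : ∀ k -> path i j r k ≡ path i j 0 (tr i j k)
   path-reflect k with k Fin.≟ i | k Fin.≟ j
   ... | yes refl | _ = by (path-i r) (by (cong nat (cong suc refl)) (sym (path-j 0 z≤n)))
   ... | no _ | yes refl = by (path-j r NP.≤-refl) (by (cong (\ x -> nat (suc (level i N.+ x))) (NP.n∸n≡0 r)) (sym (path-i 0)))
   ... | no k≢i | no k≢j = by (path-k r k≢i k≢j) (sym (path-k 0 k≢i k≢j))

   -- The path ends at the reflection of its start, where antisymmetry gives the negative with i and
   -- j exchanged; one more commutator exchanges them back, so V is its own negative.
   V≡0 : V i j (path i j 0) ≡ 0#
   V≡0 = x≡-x⇒x≡0 (begin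
    V i j (path i j 0) ≡⟨ V-const r NP.≤-refl ⟩
    V i j (path i j r) ≡⟨ cong₂ _+_ (t-cong i j path-reflect) (D-cong i path-reflect) ⟩
    V i j (path i j 0 ∘ tr i j) ≡⟨ cong₂ _+_ (t-π i j (path i j 0)) (D-π i (path i j 0)) ⟩
    - t (tr i j i) (tr i j j) (path i j 0) + - D (tr i j i) (path i j 0)
    ≡⟨ cong₂ (\ x y -> - t x y (path i j 0) + - D x (path i j 0)) (tr-l i j) (tr-r i j) ⟩ _
    ≡⟨ solve 2 (\ a b -> :- a :+ :- b := :- (a :+ b)) refl (t j i (path i j 0)) (D j (path i j 0)) ⟩
    - (t j i (path i j 0) + D j (path i j 0)) ≡⟨ cong -_ (t-comm i j (path i j 0)) ⟨
    - V i j (path i j 0) ∎)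
    where open Swap i≢j

   path-0 : ∀ k -> path i j 0 k ≡ (δ +e i) k
   path-0 k = by (cong₂ (\ u z -> δ k + (u + z) * e i k - z * e j k) (sym int-1) refl)
    (solve 3 (\ d a b -> d :+ (con (Z.+ 1) :+ con (Z.+ 0)) :* a :- con (Z.+ 0) :* b := d :+ a) refl (δ k) (e i k) (e j k))

   t+D≡0 : t i j (δ +e i) + D i (δ +e i) ≡ 0#
   t+D≡0 = by (sym (cong₂ _+_ (t-cong i j path-0) (D-cong i path-0))) V≡0

  𝒟 : Fin N -> F
  𝒟 i = D i (δ +e i)

  private
   x+y≡0 : ∀ {x y} -> x + y ≡ 0# -> x ≡ - y
   x+y≡0 {x} {y} q = x-y≡0⇒x≡y (by (solve 2 (\ x y -> x :- :- y := x :+ y) refl x y) q)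
    where open Solver

   gap : ∀ {a b} -> a < b -> b ≡ suc (a N.+ (b ∸ suc a))
   gap {a} {b} a<b = sym (NP.m+[n∸m]≡n a<b)

  t-below : ∀ {i j} -> level i < level j -> t i j (δ +e i) ≡ - 𝒟 i
  t-below i<j = x+y≡0 (Reflect.t+D≡0 (gap i<j))

  -- Cyclicity exchanges δ + e_i with δ + e_j and reduces to the case where the first index is the
  -- lower one.
  t-above : ∀ {i j} -> level j < level i -> t i j (δ +e i) ≡ - 𝒟 j
  t-above {i} {j} j<i = by (t-shift i j sh) (x+y≡0 (Reflect.t+D≡0 (gap j<i)))
   where
   sh : ∀ k -> (δ +e j) k + e i k ≡ (δ +e i) k + e j k
   sh k = solve 3 (\ d a b -> d :+ b :+ a := d :+ a :+ b) refl (δ k) (e i k) (e j k)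
    where open Solver

  t-split : ∀ i j -> t i j (δ +e i) ≡
   ind (j Fin.≟ i) * t j j (δ +e i) - ind (level i N.<? level j) * 𝒟 i - ind (level j N.<? level i) * 𝒟 j
  t-split i j with NP.<-cmp (level i) (level j)
  ... | tri< i<j i≢j _ = by (t-below i<j) (sym (by (cong₂ _-_ (cong₂ _-_
   (cong (_* t j j (δ +e i)) (ind-no (j Fin.≟ i) (\ { refl -> i≢j refl })))
   (cong (_* 𝒟 i) (ind-yes (level i N.<? level j) i<j)))
   (cong (_* 𝒟 j) (ind-no (level j N.<? level i) (NP.<-asym i<j))))
   (by (cong₂ (\ o z -> z * t j j (δ +e i) - o * 𝒟 i - z * 𝒟 j) (sym int-1) (sym int-0))
   (solve 3 (\ x y z -> con (Z.+ 0) :* x :- con (Z.+ 1) :* y :- con (Z.+ 0) :* z := :- y) refl (t j j (δ +e i)) (𝒟 i) (𝒟 j)))))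
   where open Solver
  ... | tri> _ j≢i j<i = by (t-above j<i) (sym (by (cong₂ _-_ (cong₂ _-_
   (cong (_* t j j (δ +e i)) (ind-no (j Fin.≟ i) (\ { refl -> j≢i refl })))
   (cong (_* 𝒟 i) (ind-no (level i N.<? level j) (NP.<-asym j<i))))
   (cong (_* 𝒟 j) (ind-yes (level j N.<? level i) j<i)))
   (by (cong₂ (\ o z -> z * t j j (δ +e i) - z * 𝒟 i - o * 𝒟 j) (sym int-1) (sym int-0))
   (solve 3 (\ x y z -> con (Z.+ 0) :* x :- con (Z.+ 0) :* y :- con (Z.+ 1) :* z := :- z) refl (t j j (δ +e i)) (𝒟 i) (𝒟 j)))))
   where open Solver
  ... | tri≈ i≮j q j≮i with level-injective {N} {i} {j} q
  ... | refl = sym (by (cong₂ _-_ (cong₂ _-_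
   (cong (_* t j j (δ +e i)) (ind-yes (j Fin.≟ i) refl))
   (cong (_* 𝒟 i) (ind-no (level i N.<? level j) i≮j)))
   (cong (_* 𝒟 j) (ind-no (level j N.<? level i) j≮i)))
   (by (cong₂ (\ o z -> o * t j j (δ +e i) - z * 𝒟 i - z * 𝒟 j) (sym int-1) (sym int-0))
   (solve 2 (\ x y -> con (Z.+ 1) :* x :- con (Z.+ 0) :* y :- con (Z.+ 0) :* y := x) refl (t j j (δ +e i)) (𝒟 j))))
   where open Solver

  κ : Fin N -> F
  κ i = ∑ (allFin N) (\ j -> ind (level i N.<? level j))

  I : List (Fin N)
  I = allFin N

  -- For each i, every level above it yields -𝒟 i twice: once from `t-below`, and once from
  -- `t-above` with the roles exchanged.
  ∑-t : ∑ I (\ i -> ∑ I (\ j -> t i j (δ +e i))) ≡ ∑ I (\ i -> t i i (δ +e i) - nat 2 * (κ i * 𝒟 i))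
  ∑-t = begin
   ∑ I (\ i -> ∑ I (\ j -> t i j (δ +e i)))
   ≡⟨ ∑-cong I (\ i -> by (∑-cong I (\ j -> t-split i j)) (by (∑-- I _ _) (cong (_- ∑ I (\ j -> ind (level j N.<? level i) * 𝒟 j))
   (by (∑-- I _ _) (cong₂ _-_ (∑-ind-≟ i (\ j -> t j j (δ +e i))) (∑-*ʳ I (𝒟 i) _)))))) ⟩ _
   ≡⟨ ∑-- I _ _ ⟩ _
   ≡⟨ cong (\ r -> ∑ I (\ i -> t i i (δ +e i) - κ i * 𝒟 i) - r) (by (∑-swap I I _) (∑-cong I (\ j -> ∑-*ʳ I (𝒟 j) _))) ⟩ _
   ≡⟨ ∑-- I _ _ ⟨ _
   ≡⟨ ∑-cong I (\ i -> solve 2 (\ a b -> a :- b :- b := a :- con (Z.+ 2) :* b) refl (t i i (δ +e i)) (κ i * 𝒟 i)) ⟩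
   ∑ I (\ i -> t i i (δ +e i) - nat 2 * (κ i * 𝒟 i)) ∎
   where open Solver

  t-ii : ∀ i ℓ -> t i i ℓ ≡ ∑ C (\ c -> ind (inv? c) * (# c i * # c i * h (ℓ ▷ c)))
  t-ii i ℓ = begin
   ∑ M (\ m' -> ∑ M (\ m -> t0 i i m' m ℓ))
   ≡⟨ ∑-cong M (\ m' -> ∑-cong M (\ m -> ∑-cong C (\ a -> step m' m a))) ⟩ _
   ≡⟨ ∑-cong M (\ m' -> ∑-swap M C _) ⟩ _
   ≡⟨ ∑-swap M C _ ⟩ _
   ≡⟨ ∑-cong C (\ a -> by (∑-cong M (\ m' -> by (∑-*ˡ M _ _) (cong (\ r -> e (get a m') i * r) (∑-*ʳ M _ _))))
   (by (∑-*ʳ M _ _) (solve 3 (\ x y z -> x :* (x :* (y :* z)) := y :* (x :* x :* z)) refl (# a i) (ind (inv? a)) (h (ℓ ▷ a))))) ⟩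
   ∑ C (\ c -> ind (inv? c) * (# c i * # c i * h (ℓ ▷ c))) ∎
   where
   open Solver
   step : ∀ m' m a -> ind (get a m' Fin.≟ i) * (ind (get (a [ m' ]≔ i) m Fin.≟ i) * (ind (act a σ ≟ᵥ (a [ m' ]≔ i [ m ]≔ i)) * h (ℓ ▷ a)))
    ≡ e (get a m') i * (e (get a m) i * (ind (inv? a) * h (ℓ ▷ a)))
   step m' m a = ind-*-cong (get a m' Fin.≟ i) (\ q ->
    by (cong (\ v -> ind (get v m Fin.≟ i) * (ind (act a σ ≟ᵥ (v [ m ]≔ i)) * h (ℓ ▷ a))) (same m' q))
    (ind-*-cong (get a m Fin.≟ i) (\ q' -> cong (\ v -> ind (act a σ ≟ᵥ v) * h (ℓ ▷ a)) (same m q'))))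
    where
    same : ∀ m -> get a m ≡ i -> a [ m ]≔ i ≡ a
    same m refl = VP.[]≔-lookup a m

  D-# : ∀ i ℓ -> D i ℓ ≡ ∑ C (\ c -> ind (inv? c) * (# c i * h (ℓ ▷ c)))
  D-# i ℓ = by (∑-swap M C _) (∑-cong C (\ c -> by (∑-*ʳ M _ _)
   (solve 3 (\ x y z -> x :* (y :* z) := y :* (x :* z)) refl (# c i) (ind (inv? c)) (h (ℓ ▷ c)))))
   where open Solver

  -- B vanishes at δ + e_i unless i is the top level.
  B-top : ∀ i -> (nat N * nat N) * B (δ +e i) ≡ ((δ i + 1#) * (δ i + 1#)) * B (δ +e i)
  B-top i with suc (level i) N.≟ N
  ... | yes q = cong (\ x -> (x * x) * B (δ +e i)) (by (cong nat (sym q)) (by (nat-suc (level i)) (+-comm _ _)))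
  ... | no q = by (cong (nat N * nat N *_) b0) (by (zeroʳ _) (sym (by (cong ((δ i + 1#) * (δ i + 1#) *_) b0) (zeroʳ _))))
   where
   got = atLevel (NP.≤∧≢⇒< (level<N i) q)
   k = proj₁ got
   i≢k : ¬ i ≡ k
   i≢k i≡k = NP.<-irrefl (by (cong level i≡k) (proj₂ got)) NP.≤-refl
   b0 : B (δ +e i) ≡ 0#
   b0 = Collision.B≡0 i≢k {δ +e i} (by (cong (δ i +_) (e-same i)) (sym (by (cong (δ k +_) (e-diff i≢k))
    (by (+-idʳ _) (by (cong nat (proj₂ got)) (by (nat-suc (level i)) (+-comm _ _)))))))

  private
   b : State -> Vec (Fin N) n -> F
   b ℓ c = ind (inv? c) * h (ℓ ▷ c)

  -- At ℓ = δ + #c the square (ℓ_i + 1)² expands into (δ_i + 1)² B + 2 (δ_i + 1) D i + t_ii. Here N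
  -- - (δ_i + 1) is the number κ_i of levels above i, and the off-diagonal t supply exactly -2 κ_i 𝒟
  -- i; for B the replacement of δ_i + 1 by N is `B-top`.
  B-raise : ∑ C (\ c -> ind (inv? c) * raise h (δ ▷ c)) ≡
   ∑ I (\ i -> nat N * nat N * B (δ +e i) + nat 2 * nat N * D i (δ +e i) + ∑ I (\ j -> t i j (δ +e i)))
  B-raise = sym (begin
   ∑ I (\ i -> nat N * nat N * B (δ +e i) + nat 2 * nat N * 𝒟 i + ∑ I (\ j -> t i j (δ +e i)))
   ≡⟨ by (∑-+ I _ _) (by (cong (∑ I (\ i -> nat N * nat N * B (δ +e i) + nat 2 * nat N * 𝒟 i) +_) ∑-t) (sym (∑-+ I _ _))) ⟩ _
   ≡⟨ ∑-cong I (\ i -> step i) ⟩ _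
   ≡⟨ ∑-swap I C _ ⟩ _
   ≡⟨ ∑-cong C (\ c -> ∑-*ˡ I (ind (inv? c)) _) ⟩
   ∑ C (\ c -> ind (inv? c) * raise h (δ ▷ c)) ∎)
   where
   open Solver
   step : ∀ i -> nat N * nat N * B (δ +e i) + nat 2 * nat N * 𝒟 i + (t i i (δ +e i) - nat 2 * (κ i * 𝒟 i))
    ≡ ∑ C (\ c -> ind (inv? c) * (((δ ▷ c) i + 1#) * ((δ ▷ c) i + 1#) * h ((δ ▷ c) +e i)))
   step i = begin
    nat N * nat N * B (δ +e i) + nat 2 * nat N * 𝒟 i + (t i i (δ +e i) - nat 2 * (κ i * 𝒟 i))
    ≡⟨ cong₂ (\ x y -> x + nat 2 * y * 𝒟 i + (t i i (δ +e i) - nat 2 * (κ i * 𝒟 i))) (B-top i) (sym (∑-above i)) ⟩ _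
    ≡⟨ solve 5 (\ s b k d t -> s :* s :* b :+ con (Z.+ 2) :* (k :+ s) :* d :+ (t :- con (Z.+ 2) :* (k :* d))
    := s :* s :* b :+ con (Z.+ 2) :* s :* d :+ t) refl s (B (δ +e i)) (κ i) (𝒟 i) (t i i (δ +e i)) ⟩ _
    ≡⟨ cong₂ (\ x y -> s * s * B (δ +e i) + nat 2 * s * x + y) (D-# i (δ +e i)) (t-ii i (δ +e i)) ⟩ _
    ≡⟨ by (∑-+ C _ _) (cong₂ _+_ (by (∑-+ C _ _) (cong₂ _+_ (∑-*ˡ C _ _) (∑-*ˡ C _ _))) refl) ⟨ _
    ≡⟨ ∑-cong C (\ c -> by (solve 5 (\ d o v i h -> (d :+ o) :* (d :+ o) :* (i :* h) :+ con (Z.+ 2) :* (d :+ o) :* (i :* (v :* h)) :+ i :* (v :* v :* h)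
    := i :* ((d :+ v :+ o) :* (d :+ v :+ o) :* h)) refl (δ i) 1# (# c i) (ind (inv? c)) (h ((δ +e i) ▷ c)))
    (cong (\ r -> ind (inv? c) * (((δ ▷ c) i + 1#) * ((δ ▷ c) i + 1#) * r))
    (ext (\ k -> solve 3 (\ x y z -> x :+ y :+ z := x :+ z :+ y) refl (δ k) (e i k) (# c k))))) ⟩
    ∑ C (\ c -> ind (inv? c) * (((δ ▷ c) i + 1#) * ((δ ▷ c) i + 1#) * h ((δ ▷ c) +e i))) ∎
    where s = δ i + 1#

-- Inserting a point into a pair of permutations

module _ {A : Set} where

 act-compose : ∀ {n} (c : Vec A n) (u v : Word n) -> act c (compose u v) ≡ act (act c u) v
 act-compose c u v = lookup-ext \ i -> by (lookup-act c (compose u v) i)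
  (by (cong (get c) (lookup-compose u v i)) (sym (by (lookup-act (act c u) v i) (lookup-act c u _))))

 act-sw-sw : ∀ {n} (c : Vec A (suc n)) t -> act (act c (sw t)) (sw t) ≡ c
 act-sw-sw c t = lookup-ext \ i -> by (lookup-act (act c (sw t)) (sw t) i)
  (by (lookup-act c (sw t) _) (cong (get c) (sw-involutive t i)))

 act-lift : ∀ {n} i (c : Vec A n) σ -> act (i ∷ c) (lift σ) ≡ i ∷ act c σ
 act-lift i c σ = cong (i ∷_) (sym (VP.map-∘ (get (i ∷ c)) suc σ))

 act-sw-zero : ∀ {n} (c : Vec A (suc n)) -> act c (sw zero) ≡ c
 act-sw-zero c = VP.map-lookup-allFin c

 act-sw-suc : ∀ {n} i (c : Vec A n) m -> act (i ∷ c) (sw (suc m)) ≡ get c m ∷ (c [ m ]≔ i)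
 act-sw-suc i c m = cong (get c m ∷_) (by (VP.map-[]≔ (get (i ∷ c)) (Vec.tabulate suc) m)
  (cong (_[ m ]≔ i) (by (sym (VP.tabulate-∘ (get (i ∷ c)) suc)) (VP.tabulate∘lookup c))))

module Insertion (J : NumberField) (N : ℕ) where

 open FieldProperties J
 open Sums J
 open PermSums J
 open Colourings J N
 open Vacuum J N
 open ≡-Reasoning

 I : List (Fin N)
 I = allFin N

 trace : ∀ {n} -> Word n -> (State -> F) -> State -> F
 trace {n} τ h ℓ = ∑ (cols N n) (\ c -> ind (act c τ ≟ᵥ c) * h (ℓ ▷ c))

 fix : ∀ {n} -> Word n -> F
 fix {n} τ = ∑ (cols N n) (\ c -> ind (act c τ ≟ᵥ c))

 -- Inserting 0 as a fixed point creates a cycle, hence a factor N; inserting it into an existing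
 -- cycle creates none.
 wt : ∀ {n} -> Fin (suc n) -> F
 wt zero = nat N
 wt (suc _) = 1#

 ∑-ind-≟ʳ : ∀ {n} (j : Fin n) (f : Fin n -> F) -> ∑ (allFin n) (\ i -> ind (j Fin.≟ i) * f i) ≡ f j
 ∑-ind-≟ʳ j f = by (∑-cong (allFin _) (\ i -> cong (_* f i) (ind-cong (j Fin.≟ i) (i Fin.≟ j) sym sym))) (∑-ind-≟ j f)

 ind-∷ : ∀ {n} (i k : Fin N) (u w : Vec (Fin N) n) -> ind ((i ∷ u) ≟ᵥ (k ∷ w)) ≡ ind (k Fin.≟ i) * ind (u ≟ᵥ w)
 ind-∷ i k u w = by (ind-cong ((i ∷ u) ≟ᵥ (k ∷ w)) ((k Fin.≟ i) ×-dec (u ≟ᵥ w))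
  (\ q -> let (x , y) = VP.∷-injective q in sym x , y) (\ { (refl , refl) -> refl })) (ind-× (k Fin.≟ i) (u ≟ᵥ w))

 ∑-I-1 : ∑ I (\ _ -> 1#) ≡ nat N
 ∑-I-1 = by (∑-length I) (cong nat (LP.length-tabulate (\ i -> i)))

 ▷-∷ : ∀ {n} ℓ i (c : Vec (Fin N) n) k -> (ℓ ▷ (i ∷ c)) k ≡ ((ℓ +e i) ▷ c) k
 ▷-∷ ℓ i c k = by (cong (ℓ k +_) (#-∷ i c k)) (sym (+-assoc _ _ _))

 module _ {n} (σ : Word n) where

  C : List (Vec (Fin N) n)
  C = cols N n

  ind-lift-sw : ∀ t t' (c : Vec (Fin N) (suc n)) ->
   ind (act c (compose (compose (lift σ) (sw t)) (sw t')) ≟ᵥ c) ≡ ind (act c (lift σ) ≟ᵥ act (act c (sw t')) (sw t))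
  ind-lift-sw t t' c = ind-cong (_ ≟ᵥ c) (_ ≟ᵥ _)
   (\ q -> by (sym (act-sw-sw (act c (lift σ)) t)) (cong (\ v -> act v (sw t))
   (by (sym (act-sw-sw (act (act c (lift σ)) (sw t)) t')) (cong (\ v -> act v (sw t')) (by (sym expand) q)))))
   (\ q -> by expand (by (cong (\ v -> act (act v (sw t)) (sw t')) q)
   (by (cong (\ v -> act v (sw t')) (act-sw-sw (act c (sw t')) t)) (act-sw-sw c t'))))
   where
   expand : act c (compose (compose (lift σ) (sw t)) (sw t')) ≡ act (act (act c (lift σ)) (sw t)) (sw t')
   expand = by (act-compose c (compose (lift σ) (sw t)) (sw t')) (cong (\ v -> act v (sw t')) (act-compose c (lift σ) (sw t)))

  fix-lift-sw : ∀ t -> fix (compose (lift σ) (sw t)) ≡ wt t * fix σ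
  fix-lift-sw t = begin
   ∑ (cols N (suc n)) (\ c -> ind (act c (compose (lift σ) (sw t)) ≟ᵥ c))
   ≡⟨ ∑-cong (cols N (suc n)) (\ c -> ind-cong (_ ≟ᵥ c) (_ ≟ᵥ act c (sw t))
   (\ q -> by (sym (act-sw-sw (act c (lift σ)) t)) (cong (\ v -> act v (sw t)) (by (sym (act-compose c (lift σ) (sw t))) q)))
   (\ q -> by (act-compose c (lift σ) (sw t)) (by (cong (\ v -> act v (sw t)) q) (act-sw-sw c t)))) ⟩ _
   ≡⟨ ∑-vecsOver-suc n I _ ⟩ _
   ≡⟨ go t ⟩
   wt t * fix σ ∎
   where
   go : ∀ t -> ∑ I (\ i -> ∑ C (\ c -> ind (act (i ∷ c) (lift σ) ≟ᵥ act (i ∷ c) (sw t)))) ≡ wt t * fix σ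
   go zero = by (∑-cong I (\ i -> by (∑-cong C (\ c -> by (cong₂ (\ u v -> ind (u ≟ᵥ v)) (act-lift i c σ) (act-sw-zero (i ∷ c)))
    (by (ind-∷ i i (act c σ) c) (by (cong (_* ind (act c σ ≟ᵥ c)) (ind-yes (i Fin.≟ i) refl)) (*-idˡ _)))))
    (sym (*-idˡ (fix σ))))) (by (∑-*ʳ I (fix σ) _) (cong (_* fix σ) ∑-I-1))
   go (suc m) = by (∑-cong I (\ i -> ∑-cong C (\ c -> by (cong₂ (\ u v -> ind (u ≟ᵥ v)) (act-lift i c σ) (act-sw-suc i c m))
    (by (ind-∷ i (get c m) (act c σ) (c [ m ]≔ i)) (ind-*-cong (get c m Fin.≟ i)
    (\ { refl -> cong (\ v -> ind (act c σ ≟ᵥ v)) (VP.[]≔-lookup c m) }))))))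
    (by (∑-swap I C _) (by (∑-cong C (\ c -> ∑-ind-≟ʳ (get c m) (\ _ -> ind (act c σ ≟ᵥ c)))) (sym (*-idˡ _))))

 module _ {n} (σ : Word n) (σ-perm : Perm σ) {h : State -> F} (alt : Alternating h) where

  open Traces σ σ-perm alt using (B; D; d; t; t0; inv?; M)
  open Alternating alt

  private
   T : List (Fin (suc n))
   T = allFin (suc n)

   τ : Fin (suc n) -> Fin (suc n) -> Word (suc n)
   τ s s' = compose (compose (lift σ) (sw s)) (sw s')

   trace-τ : ∀ s s' -> trace (τ s s') h δ ≡
    ∑ I (\ i -> ∑ (C σ) (\ c -> ind ((i ∷ act c σ) ≟ᵥ act (act (i ∷ c) (sw s')) (sw s)) * h ((δ +e i) ▷ c)))
   trace-τ s s' = by (∑-vecsOver-suc n I _) (∑-cong I (\ i -> ∑-cong (C σ) (\ c ->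
    cong₂ _*_ (by (ind-lift-sw σ s s' (i ∷ c)) (cong (\ v -> ind (v ≟ᵥ act (act (i ∷ c) (sw s')) (sw s))) (act-lift i c σ)))
    (ext (▷-∷ δ i c)))))

   case-00 : trace (τ zero zero) h δ ≡ ∑ I (\ i -> B (δ +e i))
   case-00 = by (trace-τ zero zero) (∑-cong I (\ i -> ∑-cong (C σ) (\ c -> cong (_* h ((δ +e i) ▷ c))
    (by (cong (\ v -> ind ((i ∷ act c σ) ≟ᵥ v)) (by (act-sw-zero (act (i ∷ c) (sw zero))) (act-sw-zero (i ∷ c))))
    (by (ind-∷ i i (act c σ) c) (by (cong (_* ind (inv? c)) (ind-yes (i Fin.≟ i) refl)) (*-idˡ _)))))))

   single : ∀ i m c -> ind ((i ∷ act c σ) ≟ᵥ (get c m ∷ (c [ m ]≔ i))) * h ((δ +e i) ▷ c)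
    ≡ ind (get c m Fin.≟ i) * (ind (inv? c) * h ((δ +e i) ▷ c))
   single i m c = by (cong (_* h ((δ +e i) ▷ c)) (ind-∷ i (get c m) (act c σ) (c [ m ]≔ i))) (by (*-assoc _ _ _)
    (ind-*-cong (get c m Fin.≟ i) (\ { refl -> cong (\ v -> ind (act c σ ≟ᵥ v) * h ((δ +e get c m) ▷ c)) (VP.[]≔-lookup c m) })))

   case-0s : ∀ m -> trace (τ zero (suc m)) h δ ≡ ∑ I (\ i -> d i m (δ +e i))
   case-0s m = by (trace-τ zero (suc m)) (∑-cong I (\ i -> ∑-cong (C σ) (\ c -> by
    (cong (\ v -> ind ((i ∷ act c σ) ≟ᵥ v) * h ((δ +e i) ▷ c)) (by (act-sw-zero (act (i ∷ c) (sw (suc m)))) (act-sw-suc i c m)))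
    (single i m c))))

   case-s0 : ∀ m -> trace (τ (suc m) zero) h δ ≡ ∑ I (\ i -> d i m (δ +e i))
   case-s0 m = by (trace-τ (suc m) zero) (∑-cong I (\ i -> ∑-cong (C σ) (\ c -> by
    (cong (\ v -> ind ((i ∷ act c σ) ≟ᵥ v) * h ((δ +e i) ▷ c)) (by (cong (\ v -> act v (sw (suc m))) (act-sw-zero (i ∷ c))) (act-sw-suc i c m)))
    (single i m c))))

   case-ss : ∀ m m' -> trace (τ (suc m) (suc m')) h δ ≡ ∑ I (\ i -> ∑ I (\ j -> t0 i j m' m (δ +e i)))
   case-ss m m' = by (trace-τ (suc m) (suc m')) (∑-cong I (\ i -> by (∑-cong (C σ) (\ c -> begin
    ind ((i ∷ act c σ) ≟ᵥ act (act (i ∷ c) (sw (suc m'))) (sw (suc m))) * h ((δ +e i) ▷ c)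
    ≡⟨ cong (\ v -> ind ((i ∷ act c σ) ≟ᵥ v) * h ((δ +e i) ▷ c))
    (by (cong (\ v -> act v (sw (suc m))) (act-sw-suc i c m')) (act-sw-suc (get c m') (c [ m' ]≔ i) m)) ⟩ _
    ≡⟨ by (cong (_* h ((δ +e i) ▷ c)) (ind-∷ i (get (c [ m' ]≔ i) m) (act c σ) _)) (*-assoc _ _ _) ⟩
    G i c (get c m')
    ≡⟨ ∑-ind-≟ʳ (get c m') (G i c) ⟨
    ∑ I (\ j -> ind (get c m' Fin.≟ j) * G i c j) ∎)) (∑-swap (C σ) I _)))
    where
    G : Fin N -> Vec (Fin N) n -> Fin N -> F
    G i c j = ind (get (c [ m' ]≔ i) m Fin.≟ i) * (ind (act c σ ≟ᵥ (c [ m' ]≔ i [ m ]≔ j)) * h ((δ +e i) ▷ c))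

   𝟙 : F
   𝟙 = 1#

  -- This is the partial trace of (N + J)² over the inserted point, J being the sum of the
  -- transpositions of 0 with the other points. The product N · N gives N² B, the two mixed terms
  -- give N D each, and J² gives t.
  ∑-insertions : ∑ T (\ s -> ∑ T (\ s' -> wt s * wt s' * trace (τ s s') h δ)) ≡ trace σ (raise h) δ
  ∑-insertions = begin
   ∑ T (\ s -> ∑ T (\ s' -> wt s * wt s' * trace (τ s s') h δ))
   ≡⟨ by (∑-allFin-suc n _) (cong₂ _+_ (∑-allFin-suc n _) (∑-cong M (\ m -> ∑-allFin-suc n _))) ⟩ _
   ≡⟨ cong₂ _+_ (cong₂ _+_ (cong (nat N * nat N *_) case-00)
   (by (∑-cong M (\ m' -> cong₂ _*_ (*-idʳ (nat N)) (case-0s m'))) (∑-*ˡ M (nat N) _)))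
   (by (∑-+ M _ _) (cong₂ _+_
   (by (∑-cong M (\ m -> cong₂ _*_ (*-idˡ (nat N)) (case-s0 m))) (∑-*ˡ M (nat N) _))
   (∑-cong M (\ m -> ∑-cong M (\ m' -> by (cong (_* trace (τ (suc m) (suc m')) h δ) (*-idˡ 𝟙)) (by (*-idˡ _) (case-ss m m'))))))) ⟩ _
   ≡⟨ cong₂ _+_ (cong₂ _+_ refl (cong (nat N *_) (∑-swap M I _))) (cong₂ _+_ (cong (nat N *_) (∑-swap M I _)) reorder) ⟩ _
   ≡⟨ solve 4 (\ N b d t -> (N :* N :* b :+ N :* d) :+ (N :* d :+ t) := N :* N :* b :+ con (Z.+ 2) :* N :* d :+ t) refl (nat N) _ _ _ ⟩ _
   ≡⟨ by (∑-+ I _ _) (cong₂ _+_ (by (∑-+ I _ _) (cong₂ _+_ (∑-*ˡ I _ _) (∑-*ˡ I _ _))) refl) ⟨ _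
   ≡⟨ Evaluation.B-raise σ σ-perm alt ⟨
   trace σ (raise h) δ ∎
   where
   open Solver
   reorder : ∑ M (\ m -> ∑ M (\ m' -> ∑ I (\ i -> ∑ I (\ j -> t0 i j m' m (δ +e i))))) ≡ ∑ I (\ i -> ∑ I (\ j -> t i j (δ +e i)))
   reorder = begin
    ∑ M (\ m -> ∑ M (\ m' -> ∑ I (\ i -> ∑ I (\ j -> t0 i j m' m (δ +e i)))))
    ≡⟨ ∑-swap M M _ ⟩ _
    ≡⟨ ∑-cong M (\ m' -> ∑-swap M I _) ⟩ _
    ≡⟨ ∑-swap M I _ ⟩ _
    ≡⟨ ∑-cong I (\ i -> by (∑-cong M (\ m' -> ∑-swap M I _)) (∑-swap M I _)) ⟩
    ∑ I (\ i -> ∑ I (\ j -> t i j (δ +e i))) ∎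

 pairTrace : ℕ -> (State -> F) -> F
 pairTrace n h = ∑ (perms n) (\ σ0 -> ∑ (perms n) (\ σ1 -> fix σ0 * fix σ1 * trace (compose σ0 σ1) h δ))

 -- Both permutations are factored through the stabiliser of 0. The transposition belonging to σ₀ is
 -- carried past σ₁ by `sw-lift`, at the price of reindexing its sum by σ₁, so that both
 -- transpositions stand to the right of one lifted product.
 pairTrace-suc : ∀ n {h} -> Alternating h -> pairTrace (suc n) h ≡ pairTrace n (raise h)
 pairTrace-suc n {h} alt = begin
  ∑ (perms (suc n)) (\ σ0 -> ∑ (perms (suc n)) (\ σ1 -> fix σ0 * fix σ1 * trace (compose σ0 σ1) h δ))
  ≡⟨ by (∑-perms-suc n _) (∑-cong P (\ σ0 -> ∑-cong T (\ s -> ∑-perms-suc n _))) ⟩ _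
  ≡⟨ ∑-cong P (\ σ0 -> ∑-swap T P _) ⟩ _
  ≡⟨ ∑-cong-∈ P (\ {σ0} σ0∈ -> ∑-cong-∈ P (\ {σ1} σ1∈ -> inner (∈-perms⁻ σ0∈) (∈-perms⁻ σ1∈))) ⟩
  pairTrace n (raise h) ∎
  where
  open Solver
  P = perms n
  T = allFin (suc n)
  X : Word n -> Word n -> Fin (suc n) -> Fin (suc n) -> F
  X σ0 σ1 s s' = fix (compose (lift σ0) (sw s)) * fix (compose (lift σ1) (sw s'))
   * trace (compose (compose (lift σ0) (sw s)) (compose (lift σ1) (sw s'))) h δ

  wt-lift : ∀ {σ1 : Word n} s -> wt (get (lift σ1) s) ≡ wt s
  wt-lift {σ1} zero = refl
  wt-lift {σ1} (suc s) = cong wt (lookup-lift σ1 s)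

  move : ∀ σ0 {σ1} -> Perm σ1 -> ∀ s s' -> compose (compose (lift σ0) (sw (get (lift σ1) s))) (compose (lift σ1) (sw s'))
   ≡ compose (compose (lift (compose σ0 σ1)) (sw s)) (sw s')
  move σ0 {σ1} p s s' = begin
   compose (compose (lift σ0) w) (compose (lift σ1) (sw s')) ≡⟨ compose-assoc (compose (lift σ0) w) (lift σ1) (sw s') ⟨
   compose (compose (compose (lift σ0) w) (lift σ1)) (sw s') ≡⟨ cong (\ v -> compose v (sw s')) (compose-assoc (lift σ0) w (lift σ1)) ⟩
   compose (compose (lift σ0) (compose w (lift σ1))) (sw s') ≡⟨ cong (\ v -> compose (compose (lift σ0) v) (sw s')) (sw-lift p s) ⟩
   compose (compose (lift σ0) (compose (lift σ1) (sw s))) (sw s')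
   ≡⟨ cong (\ v -> compose v (sw s')) (by (sym (compose-assoc (lift σ0) (lift σ1) (sw s))) (cong (\ v -> compose v (sw s)) (lift-compose σ0 σ1))) ⟩
   compose (compose (lift (compose σ0 σ1)) (sw s)) (sw s') ∎
   where w = sw (get (lift σ1) s)

  inner : ∀ {σ0 σ1} -> Perm σ0 -> Perm σ1 ->
   ∑ T (\ s -> ∑ T (\ s' -> X σ0 σ1 s s')) ≡ fix σ0 * fix σ1 * trace (compose σ0 σ1) (raise h) δ
  inner {σ0} {σ1} p₀ p1 = begin
   ∑ T (\ s -> ∑ T (\ s' -> X σ0 σ1 s s'))
   ≡⟨ ∑-reindex (get (lift σ1)) (preimage (lift σ1)) (preimage-lookup (Perm-lift p1)) (lookup-preimage (Perm-lift p1)) _ ⟨ _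
   ≡⟨ ∑-cong T (\ s -> ∑-cong T (\ s' -> by
   (cong₂ _*_ (cong₂ _*_ (by (fix-lift-sw σ0 (get (lift σ1) s)) (cong (_* fix σ0) (wt-lift {σ1} s))) (fix-lift-sw σ1 s'))
   (cong (\ v -> trace v h δ) (move σ0 p1 s s')))
   (solve 5 (\ a f b g x -> a :* f :* (b :* g) :* x := f :* g :* (a :* b :* x)) refl (wt s) (fix σ0) (wt s') (fix σ1) _))) ⟩ _
   ≡⟨ by (∑-cong T (\ s -> ∑-*ˡ T _ _)) (∑-*ˡ T _ _) ⟩ _
   ≡⟨ cong (fix σ0 * fix σ1 *_) (∑-insertions (compose σ0 σ1) (Perm-compose {σ = σ0} p₀ p1) alt) ⟩
   fix σ0 * fix σ1 * trace (compose σ0 σ1) (raise h) δ ∎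

-- Vandermonde products and Lagrange interpolation

module Vandermonde (J : NumberField) where

 open FieldProperties J
 open Sums J

 ∏ : ∀ {n} -> (Fin n -> F) -> F
 ∏ {zero} f = 1#
 ∏ {suc n} f = f zero * ∏ (f ∘ suc)

 ∏-cong : ∀ {n} {f g : Fin n -> F} -> (∀ i -> f i ≡ g i) -> ∏ f ≡ ∏ g
 ∏-cong {zero} q = refl
 ∏-cong {suc n} q = cong₂ _*_ (q zero) (∏-cong (q ∘ suc))

 ∏ˡ : List F -> F
 ∏ˡ [] = 1#
 ∏ˡ (x ∷ xs) = x * ∏ˡ xs

 ∏ˡ-↭ : ∀ {xs ys} -> xs ↭ ys -> ∏ˡ xs ≡ ∏ˡ ys
 ∏ˡ-↭ ↭.refl = refl
 ∏ˡ-↭ (↭.prep x p) = cong (x *_) (∏ˡ-↭ p)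
 ∏ˡ-↭ (↭.swap {xs} {ys} x y p) = by (cong (\ r -> x * (y * r)) (∏ˡ-↭ p))
  (solve 3 (\ a b c -> a :* (b :* c) := b :* (a :* c)) refl x y (∏ˡ ys))
  where open Solver
 ∏ˡ-↭ (↭.trans p q) = by (∏ˡ-↭ p) (∏ˡ-↭ q)

 ∏-tabulate : ∀ {n} (f : Fin n -> F) -> ∏ f ≡ ∏ˡ (tabulate f)
 ∏-tabulate {zero} f = refl
 ∏-tabulate {suc n} f = cong (f zero *_) (∏-tabulate (f ∘ suc))

 ∏-reindex : ∀ {n} (π π⁻¹ : Fin n -> Fin n) -> (∀ i -> π⁻¹ (π i) ≡ i) -> (∀ i -> π (π⁻¹ i) ≡ i) ->
  ∀ f -> ∏ (f ∘ π) ≡ ∏ f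
 ∏-reindex {n} π π⁻¹ l r f = begin
  ∏ (f ∘ π) ≡⟨ ∏-tabulate (f ∘ π) ⟩
  ∏ˡ (tabulate (f ∘ π)) ≡⟨ cong ∏ˡ (LP.map-tabulate π f) ⟨
  ∏ˡ (map f (tabulate π)) ≡⟨ ∏ˡ-↭ (↭P.map⁺ f perm) ⟩
  ∏ˡ (map f (allFin n)) ≡⟨ cong ∏ˡ (LP.map-tabulate id f) ⟩
  ∏ˡ (tabulate f) ≡⟨ ∏-tabulate f ⟨
  ∏ f ∎
  where
  open ≡-Reasoning
  perm : tabulate π ↭ allFin n
  perm = ∼bag⇒↭ (unique∧set⇒bag
   (UP.tabulate⁺ (\ {i} {j} q -> by (sym (l i)) (by (cong π⁻¹ q) (l j)))) (UP.allFin⁺ n)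
   (mk⇔ (\ _ -> ∈P.∈-allFin _) hit))
   where
   hit : ∀ {i} -> i ∈ allFin n -> i ∈ tabulate π
   hit {i} _ = subst (_∈ tabulate π) (r i) (∈P.∈-tabulate⁺ (π⁻¹ i))

 ∏-punchIn : ∀ {n} (f : Fin (suc n) -> F) k -> f k * ∏ (f ∘ punchIn k) ≡ ∏ f
 ∏-punchIn f zero = refl
 ∏-punchIn {suc n} f (suc k) = by (solve 3 (\ a b c -> a :* (b :* c) := b :* (a :* c)) refl (f (suc k)) (f zero) _)
  (cong (f zero *_) (∏-punchIn (f ∘ suc) k))
  where open Solver

 Δ : ∀ {n} -> (Fin n -> F) -> F
 Δ {zero} ℓ = 1#
 Δ {suc n} ℓ = ∏ (\ j -> ℓ zero - ℓ (suc j)) * Δ (ℓ ∘ suc)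

 Δ-cong : ∀ {n} {ℓ ℓ' : Fin n -> F} -> (∀ i -> ℓ i ≡ ℓ' i) -> Δ ℓ ≡ Δ ℓ'
 Δ-cong {zero} q = refl
 Δ-cong {suc n} q = cong₂ _*_ (∏-cong (\ j -> cong₂ _-_ (q zero) (q (suc j)))) (Δ-cong (q ∘ suc))

 Δ-swap-01 : ∀ {n} (ℓ : Fin (suc (suc n)) -> F) -> Δ (ℓ ∘ tr zero (suc zero)) ≡ - Δ ℓ
 Δ-swap-01 {n} ℓ = solve 5 (\ x y p q r -> (y :- x) :* q :* (p :* r) := :- ((x :- y) :* p :* (q :* r))) refl
  (ℓ zero) (ℓ (suc zero)) (∏ (\ j -> ℓ zero - ℓ (suc (suc j)))) (∏ (\ j -> ℓ (suc zero) - ℓ (suc (suc j)))) (Δ (\ k -> ℓ (suc (suc k))))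
  where open Solver

 private
  one : ∀ {n} -> Fin (suc (suc n))
  one = suc zero

  tr-suc : ∀ {n} (a b : Fin n) k -> tr (suc a) (suc b) (suc k) ≡ suc (tr a b k)
  tr-suc a b k with k Fin.≟ a | k Fin.≟ b
  ... | yes _ | _ = refl
  ... | no _ | yes _ = refl
  ... | no _ | no _ = refl

  tr-conj : ∀ {n} (b : Fin n) k ->
   tr zero (suc (suc b)) k ≡ tr one (suc (suc b)) (tr zero one (tr one (suc (suc b)) k))
  tr-conj b zero = sym (tr-l one (suc (suc b)))
  tr-conj b (suc zero) = sym (by (cong (\ x -> tr one c (tr zero one x)) (tr-l one c)) (tr-r one c))
   where c = suc (suc b)
  tr-conj b (suc (suc k)) with k Fin.≟ b
  ... | yes refl = refl
  ... | no k≢b = sym (tr-other one (suc (suc b)) (\ ()) (\ q -> k≢b (FP.suc-injective (FP.suc-injective q))))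

  tr-comm : ∀ {n} (a b k : Fin n) -> tr a b k ≡ tr b a k
  tr-comm a b k with k Fin.≟ a | k Fin.≟ b
  ... | yes p | yes q = by (sym q) p
  ... | yes _ | no _ = refl
  ... | no _ | yes _ = refl
  ... | no _ | no _ = refl

 private
  Δ-swap-suc : ∀ {n} {a b : Fin n} -> (∀ ℓ -> Δ (ℓ ∘ tr a b) ≡ - Δ ℓ) ->
   ∀ ℓ -> Δ (ℓ ∘ tr (suc a) (suc b)) ≡ - Δ ℓ
  Δ-swap-suc {n} {a} {b} ih ℓ = by
   (cong₂ _*_ (by (∏-cong (\ j -> cong (\ x -> ℓ zero - ℓ x) (tr-suc a b j)))
   (∏-reindex (tr a b) (tr a b) (tr-involutive a b) (tr-involutive a b) (\ j -> ℓ zero - ℓ (suc j))))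
   (by (Δ-cong (\ j -> cong ℓ (tr-suc a b j))) (ih (ℓ ∘ suc))))
   (solve 2 (\ x y -> x :* :- y := :- (x :* y)) refl (∏ (\ j -> ℓ zero - ℓ (suc j))) (Δ (ℓ ∘ suc)))
   where open Solver

  Δ-swap-conj : ∀ {n} (b : Fin n) -> (∀ ℓ -> Δ (ℓ ∘ tr zero (suc b)) ≡ - Δ ℓ) ->
   ∀ ℓ -> Δ (ℓ ∘ tr zero (suc (suc b))) ≡ - Δ ℓ
  Δ-swap-conj b ih ℓ = begin
   Δ (ℓ ∘ tr zero c) ≡⟨ Δ-cong (\ k -> cong ℓ (tr-conj b k)) ⟩
   Δ (ℓ ∘ tr one c ∘ tr zero one ∘ tr one c) ≡⟨ Δ-swap-suc {a = zero} {b = suc b} ih (ℓ ∘ tr one c ∘ tr zero one) ⟩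
   - Δ (ℓ ∘ tr one c ∘ tr zero one) ≡⟨ cong -_ (Δ-swap-01 (ℓ ∘ tr one c)) ⟩
   - - Δ (ℓ ∘ tr one c) ≡⟨ cong (\ x -> - - x) (Δ-swap-suc {a = zero} {b = suc b} ih ℓ) ⟩
   - - - Δ ℓ ≡⟨ solve 1 (\ x -> :- :- :- x := :- x) refl (Δ ℓ) ⟩
   - Δ ℓ ∎
   where
   open ≡-Reasoning
   open Solver
   c = suc (suc b)

  Δ-swap-zero : ∀ {n} (b : Fin n) ℓ -> Δ (ℓ ∘ tr zero (suc b)) ≡ - Δ ℓ
  Δ-swap-zero zero = Δ-swap-01
  Δ-swap-zero (suc b) = Δ-swap-conj b (Δ-swap-zero b)

 -- Only the exchange of the first two coordinates is computed. An exchange not involving the first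
 -- coordinate comes from the tail, and (0 b) is conjugate to (0 1) by (1 b).
 Δ-swap : ∀ {n} (a b : Fin n) -> ¬ a ≡ b -> ∀ ℓ -> Δ (ℓ ∘ tr a b) ≡ - Δ ℓ
 Δ-swap zero zero a≢b ℓ = ⊥-elim (a≢b refl)
 Δ-swap zero (suc b) a≢b ℓ = Δ-swap-zero b ℓ
 Δ-swap (suc a) zero a≢b ℓ = by (Δ-cong (\ k -> cong ℓ (tr-comm (suc a) zero k))) (Δ-swap-zero a ℓ)
 Δ-swap (suc a) (suc b) a≢b ℓ = Δ-swap-suc {a = a} {b = b} (Δ-swap a b (a≢b ∘ cong suc)) ℓ

 Δ-alternating : ∀ {N} -> Colourings.Alternating J N Δ
 Δ-alternating = record { ext = Δ-cong ; swap = \ {a} {b} -> Δ-swap a b }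

 alt : ∀ {n} -> (Fin n -> F) -> F
 alt {zero} f = 0#
 alt {suc n} f = f zero - alt (f ∘ suc)

 alt-cong : ∀ {n} {f g : Fin n -> F} -> (∀ i -> f i ≡ g i) -> alt f ≡ alt g
 alt-cong {zero} q = refl
 alt-cong {suc n} q = cong₂ _-_ (q zero) (alt-cong (q ∘ suc))

 alt-+ : ∀ {n} (f g : Fin n -> F) -> alt (\ i -> f i + g i) ≡ alt f + alt g
 alt-+ {zero} f g = sym (+-idˡ 0#)
 alt-+ {suc n} f g = by (cong (\ r -> f zero + g zero - r) (alt-+ (f ∘ suc) (g ∘ suc)))
  (solve 4 (\ a b c d -> a :+ b :- (c :+ d) := (a :- c) :+ (b :- d)) refl (f zero) (g zero) _ _)
  where open Solver

 alt-*ˡ : ∀ {n} q (f : Fin n -> F) -> alt (\ i -> q * f i) ≡ q * alt f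
 alt-*ˡ {zero} q f = sym (zeroʳ q)
 alt-*ˡ {suc n} q f = by (cong (\ r -> q * f zero - r) (alt-*ˡ q (f ∘ suc)))
  (solve 3 (\ a b c -> a :* b :- a :* c := a :* (b :- c)) refl q (f zero) _)
  where open Solver

 alt-∑ : ∀ {A : Set} {n} (xs : List A) (f : Fin n -> A -> F) -> alt (\ i -> ∑ xs (f i)) ≡ ∑ xs (\ x -> alt (\ i -> f i x))
 alt-∑ {n = zero} xs f = sym (∑-0 xs)
 alt-∑ {n = suc n} xs f = by (cong (\ r -> ∑ xs (f zero) - r) (alt-∑ xs (f ∘ suc))) (sym (∑-- xs _ _))

 sg : ∀ {n} -> Fin n -> F
 sg zero = 1#
 sg (suc i) = - sg i

 alt-∑-sg : ∀ {n} (f : Fin n -> F) -> alt f ≡ ∑ (allFin n) (\ i -> sg i * f i)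
 alt-∑-sg {zero} f = refl
 alt-∑-sg {suc n} f = sym (by (∑-allFin-suc n _) (cong₂ _+_ (*-idˡ (f zero))
  (by (by (∑-cong (allFin n) (\ i -> solve 2 (\ s x -> :- s :* x := :- (s :* x)) refl (sg i) (f (suc i)))) (∑-neg (allFin n) _))
  (cong -_ (sym (alt-∑-sg (f ∘ suc)))))))
  where open Solver

 infixl 9 _∖_
 _∖_ : ∀ {n} -> (Fin (suc n) -> F) -> Fin (suc n) -> Fin n -> F
 (ℓ ∖ k) j = ℓ (punchIn k j)

 linear : List F -> F -> F
 linear [] y = 1#
 linear (a ∷ as) y = (y - a) * linear as y

 module _ {n} (ℓ : Fin (suc (suc n)) -> F) where

  private
   P : F
   P = ∏ (\ j -> ℓ zero - ℓ (suc j))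

  Δ-∖-suc : ∀ k -> Δ (ℓ ∖ suc k) * (ℓ (suc k) - ℓ zero) ≡ - (P * Δ ((ℓ ∘ suc) ∖ k))
  Δ-∖-suc k = by
   (solve 4 (\ p r x y -> p :* r :* (x :- y) := :- ((y :- x) :* p :* r)) refl
   (∏ (\ j -> ℓ zero - ℓ (suc (punchIn k j)))) (Δ ((ℓ ∘ suc) ∖ k)) (ℓ (suc k)) (ℓ zero))
   (cong (\ p -> - (p * Δ ((ℓ ∘ suc) ∖ k))) (∏-punchIn (\ j -> ℓ zero - ℓ (suc j)) k))
   where open Solver

  -- Splitting y - a = (y - ℓ₀) + (ℓ₀ - a) removes the point ℓ₀ from the first summand.
  alt-step : ∀ a (q : F -> F) ->
   alt (\ k -> Δ (ℓ ∖ k) * ((ℓ k - a) * q (ℓ k))) ≡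
   P * alt (\ k -> Δ ((ℓ ∘ suc) ∖ k) * q (ℓ (suc k))) + (ℓ zero - a) * alt (\ k -> Δ (ℓ ∖ k) * q (ℓ k))
  alt-step a q = begin
   alt (\ k -> Δ (ℓ ∖ k) * ((ℓ k - a) * q (ℓ k)))
   ≡⟨ alt-cong (\ k -> solve 5 (\ d x z a r -> d :* ((x :- a) :* r) := d :* (x :- z) :* r :+ (z :- a) :* (d :* r)) refl
   (Δ (ℓ ∖ k)) (ℓ k) (ℓ zero) a (q (ℓ k))) ⟩ _
   ≡⟨ by (alt-+ (\ k -> Δ (ℓ ∖ k) * (ℓ k - ℓ zero) * q (ℓ k)) (\ k -> (ℓ zero - a) * (Δ (ℓ ∖ k) * q (ℓ k)))) (cong₂ _+_ first (alt-*ˡ (ℓ zero - a) (\ k -> Δ (ℓ ∖ k) * q (ℓ k)))) ⟩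
   P * alt (\ k -> Δ ((ℓ ∘ suc) ∖ k) * q (ℓ (suc k))) + (ℓ zero - a) * alt (\ k -> Δ (ℓ ∖ k) * q (ℓ k)) ∎
   where
   open ≡-Reasoning
   open Solver
   first : alt (\ k -> Δ (ℓ ∖ k) * (ℓ k - ℓ zero) * q (ℓ k)) ≡ P * alt (\ k -> Δ ((ℓ ∘ suc) ∖ k) * q (ℓ (suc k)))
   first = begin
    Δ (ℓ ∘ suc) * (ℓ zero - ℓ zero) * q (ℓ zero) - alt (\ k -> Δ (ℓ ∖ suc k) * (ℓ (suc k) - ℓ zero) * q (ℓ (suc k)))
    ≡⟨ cong (\ r -> Δ (ℓ ∘ suc) * (ℓ zero - ℓ zero) * q (ℓ zero) - r)
    (by (alt-cong (\ k -> by (cong (_* q (ℓ (suc k))) (Δ-∖-suc k))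
    (solve 3 (\ p d r -> :- (p :* d) :* r := :- p :* (d :* r)) refl P (Δ ((ℓ ∘ suc) ∖ k)) (q (ℓ (suc k))))))
    (alt-*ˡ (- P) (\ k -> Δ ((ℓ ∘ suc) ∖ k) * q (ℓ (suc k))))) ⟩ _
    ≡⟨ solve 5 (\ d z r p s -> d :* (z :- z) :* r :- (:- p) :* s := p :* s) refl (Δ (ℓ ∘ suc)) (ℓ zero) (q (ℓ zero)) P (alt (\ k -> Δ ((ℓ ∘ suc) ∖ k) * q (ℓ (suc k)))) ⟩
    P * alt (\ k -> Δ ((ℓ ∘ suc) ∖ k) * q (ℓ (suc k))) ∎

 Δ-swap-∖ : ∀ {n} (ℓ : Fin (suc (suc n)) -> F) k -> Δ ((ℓ ∘ tr zero one) ∖ suc (suc k)) ≡ - Δ (ℓ ∖ suc (suc k))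
 Δ-swap-∖ {suc n} ℓ k = by (Δ-cong {ℓ = (ℓ ∘ tr zero one) ∖ suc (suc k)} {(ℓ ∖ suc (suc k)) ∘ tr zero one} (\ { zero -> refl ; (suc zero) -> refl ; (suc (suc j)) -> refl }))
  (Δ-swap-01 (ℓ ∖ suc (suc k)))

 alt-Δ-swap : ∀ {n} (ℓ : Fin (suc (suc n)) -> F) (q : F -> F) ->
  alt (\ k -> Δ ((ℓ ∘ tr zero one) ∖ k) * q (ℓ (tr zero one k))) ≡ - alt (\ k -> Δ (ℓ ∖ k) * q (ℓ k))
 alt-Δ-swap ℓ q = begin
  Δ (ℓ' ∖ zero) * q (ℓ one) - (Δ (ℓ' ∖ one) * q (ℓ zero) - alt (\ k -> Δ (ℓ' ∖ suc (suc k)) * q (ℓ (suc (suc k)))))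
  ≡⟨ cong₂ _-_ (cong (_* q (ℓ one)) (Δ-cong e0)) (cong₂ _-_ (cong (_* q (ℓ zero)) (Δ-cong e1))
  (by (alt-cong (\ k -> by (cong (_* q (ℓ (suc (suc k)))) (e2 k))
  (solve 2 (\ a b -> :- a :* b := (:- con (Z.+ 1)) :* (a :* b)) refl (Δ (ℓ ∖ suc (suc k))) (q (ℓ (suc (suc k)))))))
  (alt-*ˡ (- int (Z.+ 1)) (\ k -> Δ (ℓ ∖ suc (suc k)) * q (ℓ (suc (suc k))))))) ⟩ _
  ≡⟨ solve 3 (\ a b r -> a :- (b :- (:- con (Z.+ 1)) :* r) := :- (b :- (a :- r))) refl (Δ (ℓ ∖ one) * q (ℓ one)) (Δ (ℓ ∖ zero) * q (ℓ zero)) R ⟩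
  - alt (\ k -> Δ (ℓ ∖ k) * q (ℓ k)) ∎
  where
  open ≡-Reasoning
  open Solver
  ℓ' = ℓ ∘ tr zero one
  R = alt (\ k -> Δ (ℓ ∖ suc (suc k)) * q (ℓ (suc (suc k))))
  e0 : ∀ j -> (ℓ' ∖ zero) j ≡ (ℓ ∖ one) j
  e0 zero = refl
  e0 (suc j) = refl
  e1 : ∀ j -> (ℓ' ∖ one) j ≡ (ℓ ∖ zero) j
  e1 zero = refl
  e1 (suc j) = refl
  e2 : ∀ k -> Δ (ℓ' ∖ suc (suc k)) ≡ - Δ (ℓ ∖ suc (suc k))
  e2 = Δ-swap-∖ ℓ

 -- The sum with the extra factor y is evaluated in two ways, splitting off ℓ₀ or, after exchanging
 -- the first two points, ℓ₁. The difference is (ℓ₁ - ℓ₀) times the sum in question; if ℓ₀ = ℓ₁,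
 -- antisymmetry applies instead.
 alt-Δ≡0 : ∀ {n} (ℓ : Fin (suc (suc n)) -> F) -> alt (\ k -> Δ (ℓ ∖ k) * 1#) ≡ 0#
 alt-Δ≡0 {zero} ℓ = by (cong (\ z -> 1# * 1# * 1# - (1# * 1# * 1# - z)) (sym int-0))
  (by (solve 1 (\ o -> o :- (o :- con (Z.+ 0)) := con (Z.+ 0)) refl (1# * 1# * 1#)) int-0)
  where open Solver
 alt-Δ≡0 {suc n} ℓ = conclude (*-≡0 (ℓ one - ℓ zero) A difference)
  where
  open ≡-Reasoning
  open Solver
  A A1 : F
  A = alt (\ k -> Δ (ℓ ∖ k) * 1#)
  A1 = alt (\ k -> Δ (ℓ ∖ k) * ((ℓ k - 0#) * 1#))
  ℓ' = ℓ ∘ tr zero one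
  first : ∀ (m : Fin (suc (suc (suc n))) -> F) ->
   alt (\ k -> Δ (m ∖ k) * ((m k - 0#) * 1#)) ≡ (m zero - 0#) * alt (\ k -> Δ (m ∖ k) * 1#)
  first m = by (alt-step m 0# (\ _ -> 1#)) (by (cong (_+ (m zero - 0#) * alt (\ k -> Δ (m ∖ k) * 1#))
   (by (cong (∏ (\ j -> m zero - m (suc j)) *_) (alt-Δ≡0 (m ∘ suc))) (zeroʳ (∏ (\ j -> m zero - m (suc j)))))) (+-idˡ _))
  second : A1 ≡ (ℓ one - 0#) * A
  second = begin
   A1 ≡⟨ solve 1 (\ x -> x := :- :- x) refl A1 ⟩
   - - A1 ≡⟨ cong -_ (alt-Δ-swap ℓ (\ y -> (y - 0#) * 1#)) ⟨
   - alt (\ k -> Δ (ℓ' ∖ k) * ((ℓ' k - 0#) * 1#)) ≡⟨ cong -_ (first ℓ') ⟩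
   - ((ℓ one - 0#) * alt (\ k -> Δ (ℓ' ∖ k) * 1#)) ≡⟨ cong (\ r -> - ((ℓ one - 0#) * r)) (alt-Δ-swap ℓ (\ _ -> 1#)) ⟩
   - ((ℓ one - 0#) * - A) ≡⟨ solve 2 (\ x y -> :- (x :* :- y) := x :* y) refl (ℓ one - 0#) A ⟩
   (ℓ one - 0#) * A ∎
  difference : (ℓ one - ℓ zero) * A ≡ 0#
  difference = begin
   (ℓ one - ℓ zero) * A ≡⟨ solve 4 (\ x y z a -> (x :- y) :* a := (x :- z) :* a :- (y :- z) :* a) refl (ℓ one) (ℓ zero) 0# A ⟩
   (ℓ one - 0#) * A - (ℓ zero - 0#) * A ≡⟨ cong₂ _-_ (sym second) (sym (first ℓ)) ⟩
   A1 - A1 ≡⟨ -‿inverseʳ A1 ⟩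
   0# ∎
  fixed : ℓ one - ℓ zero ≡ 0# -> ∀ k -> ℓ' k ≡ ℓ k
  fixed q zero = x-y≡0⇒x≡y q
  fixed q (suc zero) = sym (x-y≡0⇒x≡y q)
  fixed q (suc (suc k)) = refl
  conclude : (ℓ one - ℓ zero ≡ 0#) ⊎ (A ≡ 0#) -> A ≡ 0#
  conclude (inj₂ q) = q
  conclude (inj₁ q) = x≡-x⇒x≡0 (by (sym (alt-cong (\ k -> cong (_* 1#) (Δ-cong (\ j -> fixed q (punchIn k j)))))) (alt-Δ-swap ℓ (\ _ -> 1#)))

 -- Lagrange interpolation with the denominators cleared: the divided difference of Π (y - a) at n + 1 points.
 lagrange-< : ∀ {n} (ℓ : Fin (suc n) -> F) as -> length as < n -> alt (\ k -> Δ (ℓ ∖ k) * linear as (ℓ k)) ≡ 0#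
 lagrange-< {suc n} ℓ [] _ = alt-Δ≡0 ℓ
 lagrange-< {suc n} ℓ (a ∷ as) (s≤s lt) = by (alt-step ℓ a (linear as)) (by
  (cong₂ _+_ (by (cong (∏ (\ j -> ℓ zero - ℓ (suc j)) *_) (lagrange-< (ℓ ∘ suc) as lt)) (zeroʳ _))
  (by (cong ((ℓ zero - a) *_) (lagrange-< ℓ as (NP.m<n⇒m<1+n lt))) (zeroʳ _))) (+-idˡ 0#))

 lagrange-≡ : ∀ {n} (ℓ : Fin (suc n) -> F) as -> length as ≡ n -> alt (\ k -> Δ (ℓ ∖ k) * linear as (ℓ k)) ≡ Δ ℓ
 lagrange-≡ {zero} ℓ [] refl = by (cong (\ z -> 1# * 1# - z) (sym int-0)) (solve 1 (\ o -> o :- con (Z.+ 0) := o) refl (1# * 1#))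
  where open Solver
 lagrange-≡ {suc n} ℓ (a ∷ as) refl = by (alt-step ℓ a (linear as)) (by
  (cong₂ _+_ (cong (∏ (\ j -> ℓ zero - ℓ (suc j)) *_) (lagrange-≡ (ℓ ∘ suc) as refl))
  (by (cong ((ℓ zero - a) *_) (lagrange-< ℓ as NP.≤-refl)) (zeroʳ _))) (+-idʳ _))

 sumˡ : List F -> F
 sumˡ as = ∑ as id

 -- One degree above the monic case, the divided difference is the sum of the points plus the next
 -- coefficient of the polynomial, which is minus the sum of its roots.
 lagrange-suc : ∀ {n} (ℓ : Fin (suc n) -> F) as -> length as ≡ suc n ->
  alt (\ k -> Δ (ℓ ∖ k) * linear as (ℓ k)) ≡ (∑ (allFin (suc n)) ℓ - sumˡ as) * Δ ℓ
 lagrange-suc {zero} ℓ (a ∷ []) refl = by (cong₂ (\ o z -> o * ((ℓ zero - a) * o) - z) (sym int-1) (sym int-0))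
  (by (solve 2 (\ x a -> con (Z.+ 1) :* ((x :- a) :* con (Z.+ 1)) :- con (Z.+ 0)
  := (x :+ con (Z.+ 0) :- (a :+ con (Z.+ 0))) :* (con (Z.+ 1) :* con (Z.+ 1))) refl (ℓ zero) a)
  (cong₂ (\ o z -> (ℓ zero + z - (a + z)) * (o * o)) int-1 int-0))
  where open Solver
 lagrange-suc {suc n} ℓ (a ∷ as) eq = by (alt-step ℓ a (linear as)) (by
  (cong₂ _+_ (cong (∏ (\ j -> ℓ zero - ℓ (suc j)) *_) (lagrange-suc (ℓ ∘ suc) as (NP.suc-injective eq)))
  (cong ((ℓ zero - a) *_) (lagrange-≡ ℓ as (NP.suc-injective eq))))
  (by (solve 6 (\ p s t d z a -> p :* ((s :- t) :* d) :+ (z :- a) :* (p :* d) := (z :+ s :- (a :+ t)) :* (p :* d)) refl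
  (∏ (\ j -> ℓ zero - ℓ (suc j))) (∑ (allFin (suc n)) (ℓ ∘ suc)) (sumˡ as) (Δ (ℓ ∘ suc)) (ℓ zero) a)
  (cong (\ r -> (r - (a + sumˡ as)) * Δ ℓ) (sym (∑-allFin-suc (suc n) ℓ)))))
  where open Solver

 Δ-extract : ∀ {n} (ℓ : Fin (suc n) -> F) i -> Δ ℓ ≡ sg i * (Δ (ℓ ∖ i) * ∏ (\ j -> ℓ i - ℓ (punchIn i j)))
 Δ-extract ℓ zero = by (*-comm _ _) (sym (*-idˡ _))
 Δ-extract {suc n} ℓ (suc i) = by
  (cong₂ _*_ (sym (∏-punchIn (\ j -> ℓ zero - ℓ (suc j)) i)) (Δ-extract (ℓ ∘ suc) i))
  (solve 6 (\ x y p s d q -> ((x :- y) :* p) :* (s :* (d :* q)) := (:- s) :* ((p :* d) :* ((y :- x) :* q))) refl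
  (ℓ zero) (ℓ (suc i)) (∏ (\ j -> ℓ zero - ℓ (suc (punchIn i j)))) (sg i) (Δ ((ℓ ∘ suc) ∖ i)) (∏ (\ j -> ℓ (suc i) - ℓ (suc (punchIn i j)))))
  where open Solver

-- Fixed colourings weighted by a Vandermonde product

module FixedColourings (J : NumberField) (N : ℕ) where

 open FieldProperties J
 open Sums J
 open Colourings J N
 open Vacuum J N
 open Insertion J N
 open Vandermonde J
 open ≡-Reasoning

 linear-tabulate : ∀ {n} (f : Fin n -> F) y -> linear (tabulate f) y ≡ ∏ (\ j -> y - f j)
 linear-tabulate {zero} f y = refl
 linear-tabulate {suc n} f y = cong ((y - f zero) *_) (linear-tabulate (f ∘ suc) y)

 sumˡ-tabulate : ∀ {n} (f : Fin n -> F) -> sumˡ (tabulate f) ≡ ∑ (allFin n) f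
 sumˡ-tabulate {n} f = by (cong sumˡ (sym (LP.map-tabulate id f))) (∑-map f (allFin n) id)

 -- Only the leading two coefficients of the interpolated polynomial Π (y + k - ℓ_j) enter.
 ∑-Δ-shift : ∀ {n} (ℓ : Fin n -> F) k -> ∑ (allFin n) (\ i -> Δ (\ j -> ℓ j + k * ind (i Fin.≟ j))) ≡ nat n * Δ ℓ
 ∑-Δ-shift {zero} ℓ k = sym (by (cong (_* 1#) int-0) (zeroˡ 1#))
 ∑-Δ-shift {suc n} ℓ k with k ≟ 0#
 ... | yes refl = by (∑-cong (allFin (suc n)) (\ i -> Δ-cong (\ j -> by (cong (ℓ j +_) (zeroˡ (ind (i Fin.≟ j)))) (+-idʳ (ℓ j)))))
  (by (∑-const (allFin (suc n)) (Δ ℓ)) (cong (\ m -> nat m * Δ ℓ) (LP.length-tabulate {n = suc n} id)))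
 -- Multiplication by k, the missing factor ℓ_i - (ℓ_i - k), completes the product over j ≠ i to one
 -- over all j, as interpolation requires.
 ... | no k≢0 = cancel-≢0 k k≢0 (begin
  k * ∑ (allFin (suc n)) (\ i -> Δ (\ j -> ℓ j + k * ind (i Fin.≟ j)))
  ≡⟨ ∑-*ˡ (allFin (suc n)) k _ ⟨ _
  ≡⟨ ∑-cong (allFin (suc n)) step ⟩ _
  ≡⟨ alt-∑-sg (\ i -> Δ (ℓ ∖ i) * linear (tabulate f) (ℓ i)) ⟨ _
  ≡⟨ lagrange-suc ℓ (tabulate f) (LP.length-tabulate f) ⟩ _
  ≡⟨ cong (\ x -> (∑ (allFin (suc n)) ℓ - x) * Δ ℓ) (by (sumˡ-tabulate f) (by (∑-- (allFin (suc n)) ℓ (\ _ -> k))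
  (cong (\ x -> ∑ (allFin (suc n)) ℓ - x) (by (∑-const (allFin (suc n)) k) (cong (\ m -> nat m * k) (LP.length-tabulate {n = suc n} id)))))) ⟩ _
  ≡⟨ solve 4 (\ s m k d -> (s :- (s :- m :* k)) :* d := k :* (m :* d)) refl (∑ (allFin (suc n)) ℓ) (nat (suc n)) k (Δ ℓ) ⟩
  k * (nat (suc n) * Δ ℓ) ∎)
  where
  open Solver
  f : Fin (suc n) -> F
  f j = ℓ j - k
  at : ∀ i -> ℓ i + k * ind (i Fin.≟ i) ≡ ℓ i + k
  at i = cong (ℓ i +_) (by (cong (k *_) (ind-yes (i Fin.≟ i) refl)) (*-idʳ k))
  off : ∀ i j -> ℓ (punchIn i j) + k * ind (i Fin.≟ punchIn i j) ≡ ℓ (punchIn i j)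
  off i j = by (cong (ℓ (punchIn i j) +_) (by (cong (k *_) (ind-no (i Fin.≟ punchIn i j) (\ q -> FP.punchInᵢ≢i i j (sym q)))) (zeroʳ k))) (+-idʳ _)
  step : ∀ i -> k * Δ (\ j -> ℓ j + k * ind (i Fin.≟ j)) ≡ sg i * (Δ (ℓ ∖ i) * linear (tabulate f) (ℓ i))
  step i = begin
   k * Δ (\ j -> ℓ j + k * ind (i Fin.≟ j))
   ≡⟨ cong (k *_) (Δ-extract (\ j -> ℓ j + k * ind (i Fin.≟ j)) i) ⟩ _
   ≡⟨ cong (\ x -> k * (sg i * x)) (cong₂ _*_ (Δ-cong (off i)) (∏-cong (\ j -> by (cong₂ _-_ (at i) (off i j))
   (solve 3 (\ a b k -> a :+ k :- b := a :- (b :- k)) refl (ℓ i) (ℓ (punchIn i j)) k)))) ⟩ _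
   ≡⟨ solve 5 (\ k s d p x -> k :* (s :* (d :* p)) := s :* (d :* ((x :- (x :- k)) :* p))) refl k (sg i) (Δ (ℓ ∖ i)) (∏ (\ j -> ℓ i - f (punchIn i j))) (ℓ i) ⟩ _
   ≡⟨ cong (\ x -> sg i * (Δ (ℓ ∖ i) * x)) (by (∏-punchIn (\ j -> ℓ i - f j) i) (sym (linear-tabulate f (ℓ i)))) ⟩
   sg i * (Δ (ℓ ∖ i) * linear (tabulate f) (ℓ i)) ∎

 infixl 6 _▷⟨_⟩_
 _▷⟨_⟩_ : ∀ {n} -> State -> (Fin n -> F) -> Vec (Fin N) n -> State
 _▷⟨_⟩_ {n} ℓ w c k = ℓ k + ∑ (allFin n) (\ m -> w m * e (get c m) k)

 -- Contracting an element adds its weight to another one, so the induction needs arbitrary weights.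
 wtrace-Δ : ∀ {n} {σ : Word n} -> Perm σ -> ∀ w ℓ ->
  ∑ (cols N n) (\ c -> ind (act c σ ≟ᵥ c) * Δ (ℓ ▷⟨ w ⟩ c)) ≡ fix σ * Δ ℓ
 wtrace-Δ {zero} {[]} p w ℓ = by (cong (\ x -> ind (act {A = Fin N} {n = zero} [] [] ≟ᵥ []) * x + 0#) (Δ-cong (\ k -> +-idʳ (ℓ k))))
  (by (+-idʳ _) (cong (_* Δ ℓ) (sym (+-idʳ (ind (act {A = Fin N} {n = zero} [] [] ≟ᵥ []))))))
 wtrace-Δ {suc n} {v} p w ℓ with Perm-decompose p
 ... | σ , t , pσ , refl = begin
  ∑ (cols N (suc n)) (\ c -> ind (act c v ≟ᵥ c) * Δ (ℓ ▷⟨ w ⟩ c))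
  ≡⟨ ∑-cong (cols N (suc n)) (\ c -> cong (_* Δ (ℓ ▷⟨ w ⟩ c)) (ind-cong (act c v ≟ᵥ c) (act c (lift σ) ≟ᵥ act c (sw t))
  (\ q -> by (sym (act-sw-sw (act c (lift σ)) t)) (cong (\ v -> act v (sw t)) (by (sym (act-compose c (lift σ) (sw t))) q)))
  (\ q -> by (act-compose c (lift σ) (sw t)) (by (cong (\ v -> act v (sw t)) q) (act-sw-sw c t))))) ⟩ _
  ≡⟨ ∑-vecsOver-suc n I _ ⟩ _
  ≡⟨ go t ⟩
  wt t * fix σ * Δ ℓ
  ≡⟨ cong (_* Δ ℓ) (fix-lift-sw σ t) ⟨
  fix (compose (lift σ) (sw t)) * Δ ℓ ∎
  where
  open Solver
  expand : ∀ i (c : Vec (Fin N) n) k -> (ℓ ▷⟨ w ⟩ (i ∷ c)) k ≡ ((\ j -> ℓ j + w zero * e i j) ▷⟨ w ∘ suc ⟩ c) k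
  expand i c k = by (cong (ℓ k +_) (∑-allFin-suc n _)) (sym (+-assoc _ _ _))
  go : ∀ t -> ∑ I (\ i -> ∑ (C σ) (\ c -> ind (act (i ∷ c) (lift σ) ≟ᵥ act (i ∷ c) (sw t)) * Δ (ℓ ▷⟨ w ⟩ (i ∷ c)))) ≡ wt t * fix σ * Δ ℓ
  go zero = begin
   ∑ I (\ i -> ∑ (C σ) (\ c -> ind (act (i ∷ c) (lift σ) ≟ᵥ act (i ∷ c) (sw zero)) * Δ (ℓ ▷⟨ w ⟩ (i ∷ c))))
   ≡⟨ ∑-cong I (\ i -> ∑-cong (C σ) (\ c -> cong₂ _*_ (by (cong₂ (\ u v -> ind (u ≟ᵥ v)) (act-lift i c σ) (act-sw-zero (i ∷ c)))
   (by (ind-∷ i i (act c σ) c) (by (cong (_* ind (act c σ ≟ᵥ c)) (ind-yes (i Fin.≟ i) refl)) (*-idˡ _)))) (Δ-cong (expand i c)))) ⟩ _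
   ≡⟨ ∑-cong I (\ i -> wtrace-Δ pσ (w ∘ suc) (\ j -> ℓ j + w zero * e i j)) ⟩ _
   ≡⟨ by (∑-*ˡ I (fix σ) _) (cong (fix σ *_) (∑-Δ-shift ℓ (w zero))) ⟩
   fix σ * (nat N * Δ ℓ)
   ≡⟨ solve 3 (\ f n d -> f :* (n :* d) := n :* f :* d) refl (fix σ) (nat N) (Δ ℓ) ⟩
   nat N * fix σ * Δ ℓ ∎
  go (suc m) = begin
   ∑ I (\ i -> ∑ (C σ) (\ c -> ind (act (i ∷ c) (lift σ) ≟ᵥ act (i ∷ c) (sw (suc m))) * Δ (ℓ ▷⟨ w ⟩ (i ∷ c))))
   ≡⟨ ∑-cong I (\ i -> ∑-cong (C σ) (\ c -> by (cong (_* Δ (ℓ ▷⟨ w ⟩ (i ∷ c))) (by (cong₂ (\ u v -> ind (u ≟ᵥ v)) (act-lift i c σ) (act-sw-suc i c m))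
   (ind-∷ i (get c m) (act c σ) (c [ m ]≔ i)))) (by (*-assoc _ _ _) (ind-*-cong (get c m Fin.≟ i)
   (\ { refl -> cong₂ _*_ (cong (\ v -> ind (act c σ ≟ᵥ v)) (VP.[]≔-lookup c m)) (Δ-cong (merge c)) }))))) ⟩ _
   ≡⟨ by (∑-swap I (C σ) _) (∑-cong (C σ) (\ c -> ∑-ind-≟ʳ (get c m) (\ _ -> ind (act c σ ≟ᵥ c) * Δ (ℓ ▷⟨ w' ⟩ c)))) ⟩ _
   ≡⟨ wtrace-Δ pσ w' ℓ ⟩
   fix σ * Δ ℓ
   ≡⟨ cong (_* Δ ℓ) (*-idˡ (fix σ)) ⟨
   1# * fix σ * Δ ℓ ∎
   where
   w' : Fin n -> F
   w' q = w (suc q) + ind (q Fin.≟ m) * w zero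
   merge : ∀ (c : Vec (Fin N) n) k -> (ℓ ▷⟨ w ⟩ (get c m ∷ c)) k ≡ (ℓ ▷⟨ w' ⟩ c) k
   merge c k = cong (ℓ k +_) (begin
    ∑ (allFin (suc n)) (\ q -> w q * e (get (get c m ∷ c) q) k)
    ≡⟨ ∑-allFin-suc n _ ⟩ _
    ≡⟨ +-comm _ _ ⟩ _
    ≡⟨ cong (∑ (allFin n) (\ q -> w (suc q) * e (get c q) k) +_) (∑-ind-≟ m (\ q -> w zero * e (get c q) k)) ⟨ _
    ≡⟨ ∑-+ (allFin n) _ _ ⟨ _
    ≡⟨ ∑-cong (allFin n) (\ q -> solve 4 (\ a b i z -> a :* b :+ i :* (z :* b) := (a :+ i :* z) :* b) refl (w (suc q)) (e (get c q) k) (ind (q Fin.≟ m)) (w zero)) ⟩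
    ∑ (allFin n) (\ q -> w' q * e (get c q) k) ∎)

 trace-Δ : ∀ {n} {σ : Word n} -> Perm σ -> ∀ ℓ -> trace σ Δ ℓ ≡ fix σ * Δ ℓ
 trace-Δ {n} {σ} p ℓ = by (∑-cong (cols N n) (\ c -> cong (ind (act c σ ≟ᵥ c) *_)
  (Δ-cong (\ k -> cong (ℓ k +_) (∑-cong (allFin n) (\ m -> sym (*-idˡ _))))))) (wtrace-Δ p (\ _ -> 1#) ℓ)

 -- n! [s^n] Z_N
 partition : ℕ -> F
 partition n = ∑ (perms n) (\ σ0 -> ∑ (perms n) (\ σ1 -> fix σ0 * fix σ1 * fix (compose σ0 σ1)))

 iterate : ℕ -> (State -> F) -> State -> F
 iterate zero h = h
 iterate (suc n) h = raise (iterate n h)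

 iterate-raise : ∀ n h -> iterate n (raise h) ≡ raise (iterate n h)
 iterate-raise zero h = refl
 iterate-raise (suc n) h = cong raise (iterate-raise n h)

 pairTrace-iterate : ∀ n {h} -> Alternating h -> pairTrace n h ≡ iterate n h δ
 pairTrace-iterate zero {h} alt = by (cong₂ (\ o z -> (o + z) * (o + z) * (o * h (δ ▷ []) + z) + z + z) (by (ind-yes (act {A = Fin N} {n = zero} [] [] ≟ᵥ []) refl) (sym int-1)) (sym int-0))
  (by (solve 1 (\ x -> (con (Z.+ 1) :+ con (Z.+ 0)) :* (con (Z.+ 1) :+ con (Z.+ 0)) :* (con (Z.+ 1) :* x :+ con (Z.+ 0)) :+ con (Z.+ 0) :+ con (Z.+ 0) := x) refl (h (δ ▷ [])))
  (Alternating.ext alt (\ k -> +-idʳ (δ k))))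
  where open Solver
 pairTrace-iterate (suc n) {h} alt = by (pairTrace-suc n alt) (by (pairTrace-iterate n (raise-alternating alt))
  (cong (\ f -> f δ) (iterate-raise n h)))

 -- One trace evaluated twice: by n insertions it is the flow at the vacuum, and since Δ behaves
 -- like a dimension (`trace-Δ`) it is also the sum over pairs times Δ δ.
 iterate-Δ : ∀ n -> iterate n Δ δ ≡ partition n * Δ δ
 iterate-Δ n = by (sym (pairTrace-iterate n Δ-alternating)) (by
  (∑-cong-∈ (perms n) (\ {σ0} σ0∈ -> by (∑-cong-∈ (perms n) (\ {σ1} σ1∈ ->
  by (cong (fix σ0 * fix σ1 *_) (trace-Δ (Perm-compose {σ = σ0} {σ1} (∈-perms⁻ σ0∈) (∈-perms⁻ σ1∈)) δ))
  (sym (*-assoc _ _ _)))) (∑-*ʳ (perms n) (Δ δ) _)))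
  (∑-*ʳ (perms n) (Δ δ) _))

-- Formal power series

record ℤ-Algebra : Set₁ where
 field
  commutativeRing : CommutativeRing 0ℓ 0ℓ
  fromℤ-homo : Z.+-*-rawRing -Raw-AlmostCommutative⟶ fromCommutativeRing commutativeRing

module ℤ-AlgebraProperties (A : ℤ-Algebra) where

 open ℤ-Algebra A
 open CommutativeRing commutativeRing public
  using (Carrier; _≈_; _+_; _*_; -_; _-_; 0#; 1#; +-cong; *-cong; -‿cong; setoid; reflexive
   ; +-assoc; +-comm; *-assoc; *-comm; zeroˡ; zeroʳ
   ; distribˡ; distribʳ; -‿inverseʳ; -‿inverseˡ)
  renaming (refl to rfl; sym to ≈-sym; trans to tra; +-identityˡ to +-idˡ; +-identityʳ to +-idʳ; *-identityˡ to *-idˡ; *-identityʳ to *-idʳ)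
 open _-Raw-AlmostCommutative⟶_ fromℤ-homo public renaming (⟦_⟧ to ι)

 κ : ℕ -> Carrier
 κ n = ι (Z.+ n)

 ι-weaklyDec : ∀ i j -> Maybe (ι i ≈ ι j)
 ι-weaklyDec i j with i ZP.≟ j
 ... | yes refl = just rfl
 ... | no _ = nothing

 module Solver = RingSolver Z.+-*-rawRing (fromCommutativeRing commutativeRing) fromℤ-homo ι-weaklyDec

 ι-0 : κ 0 ≈ 0#
 ι-0 = 0-homo

 ι-1 : κ 1 ≈ 1#
 ι-1 = 1-homo

 x-y≈0⇒x≈y : ∀ {x y} -> x - y ≈ 0# -> x ≈ y
 x-y≈0⇒x≈y {x} {y} q = tra (solve 2 (\ a b -> a := (a :- b) :+ b) rfl x y) (tra (+-cong q rfl) (+-idˡ y))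
  where open Solver

 ≈⇒-≈0 : ∀ {x y} -> x ≈ y -> x - y ≈ 0#
 ≈⇒-≈0 {x} {y} q = tra (+-cong q rfl) (-‿inverseʳ y)

module Series (J : NumberField) where

 open FieldProperties J

 Ser : Set
 Ser = ℕ -> F

 infix 4 _≈_
 _≈_ : Ser -> Ser -> Set
 a ≈ b = ∀ k -> a k ≡ b k

 sumTo : ℕ -> (ℕ -> F) -> F
 sumTo zero f = f 0
 sumTo (suc k) f = sumTo k f + f (suc k)

 infixl 6 _⊕_
 infixl 7 _·_
 infix 8 ⊝_
 _⊕_ _·_ : Ser -> Ser -> Ser
 (a ⊕ b) k = a k + b k
 (a · b) k = sumTo k (\ j -> a j * b (k ∸ j))

 ⊝_ : Ser -> Ser
 (⊝ a) k = - a k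

 const : F -> Ser
 const x zero = x
 const x (suc k) = 0#

 𝟘 𝟙 X : Ser
 𝟘 k = 0#
 𝟙 = const 1#
 X zero = 0#
 X (suc k) = 𝟙 k

 tail : Ser -> Ser
 tail a k = a (suc k)

 sumTo-cong : ∀ k {f g : ℕ -> F} -> (∀ j -> j N.≤ k -> f j ≡ g j) -> sumTo k f ≡ sumTo k g
 sumTo-cong zero q = q 0 z≤n
 sumTo-cong (suc k) q = cong₂ _+_ (sumTo-cong k (\ j j≤k -> q j (NP.m≤n⇒m≤1+n j≤k))) (q (suc k) NP.≤-refl)

 sumTo-+ : ∀ k (f g : ℕ -> F) -> sumTo k (\ j -> f j + g j) ≡ sumTo k f + sumTo k g
 sumTo-+ zero f g = refl
 sumTo-+ (suc k) f g = by (cong (_+ (f (suc k) + g (suc k))) (sumTo-+ k f g))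
  (solve 4 (\ a b c d -> (a :+ b) :+ (c :+ d) := (a :+ c) :+ (b :+ d)) refl (sumTo k f) (sumTo k g) (f (suc k)) (g (suc k)))
  where open Solver

 sumTo-*ˡ : ∀ k q (f : ℕ -> F) -> sumTo k (\ j -> q * f j) ≡ q * sumTo k f
 sumTo-*ˡ zero q f = refl
 sumTo-*ˡ (suc k) q f = by (cong (_+ q * f (suc k)) (sumTo-*ˡ k q f)) (sym (distribˡ q _ _))

 sumTo-0 : ∀ k {f : ℕ -> F} -> (∀ j -> j N.≤ k -> f j ≡ 0#) -> sumTo k f ≡ 0#
 sumTo-0 zero q = q 0 z≤n
 sumTo-0 (suc k) q = by (cong₂ _+_ (sumTo-0 k (\ j j≤k -> q j (NP.m≤n⇒m≤1+n j≤k))) (q (suc k) NP.≤-refl)) (+-idˡ 0#)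

 sumTo-suc : ∀ k (f : ℕ -> F) -> sumTo (suc k) f ≡ f 0 + sumTo k (f ∘ suc)
 sumTo-suc zero f = refl
 sumTo-suc (suc k) f = by (cong (_+ f (suc (suc k))) (sumTo-suc k f)) (+-assoc _ _ _)

 ·-suc : ∀ a b k -> (a · b) (suc k) ≡ a 0 * b (suc k) + (tail a · b) k
 ·-suc a b k = sumTo-suc k (\ j -> a j * b (suc k ∸ j))

 ·-sucʳ : ∀ a b k -> (a · b) (suc k) ≡ (a · tail b) k + a (suc k) * b 0
 ·-sucʳ a b k = cong₂ _+_ (sumTo-cong k (\ j j≤k -> cong (\ i -> a j * b i) (NP.+-∸-assoc 1 j≤k)))
  (cong (\ i -> a (suc k) * b i) (NP.n∸n≡0 k))

 ·-cong : ∀ {a a' b b'} -> a ≈ a' -> b ≈ b' -> a · b ≈ a' · b'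
 ·-cong p q k = sumTo-cong k (\ j _ -> cong₂ _*_ (p j) (q (k ∸ j)))

 ·-comm : ∀ a b -> a · b ≈ b · a
 ·-comm a b zero = *-comm (a 0) (b 0)
 ·-comm a b (suc k) = by (·-suc a b k) (by (cong (\ r -> a 0 * b (suc k) + r) (·-comm (tail a) b k))
  (by (by (+-comm _ _) (cong ((b · tail a) k +_) (*-comm _ _))) (sym (·-sucʳ b a k))))

 ·-distribʳ : ∀ c a b -> (a ⊕ b) · c ≈ a · c ⊕ b · c
 ·-distribʳ c a b k = by (sumTo-cong k (\ j _ -> distribʳ (c (k ∸ j)) (a j) (b j))) (sumTo-+ k _ _)

 ·-scale : ∀ q a b k -> ((\ j -> q * a j) · b) k ≡ q * (a · b) k
 ·-scale q a b k = by (sumTo-cong k (\ j _ -> *-assoc q (a j) _)) (sumTo-*ˡ k q _)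

 ·-assoc : ∀ a b c -> (a · b) · c ≈ a · (b · c)
 ·-assoc a b c zero = *-assoc (a 0) (b 0) (c 0)
 ·-assoc a b c (suc k) = begin
  ((a · b) · c) (suc k)
  ≡⟨ ·-suc (a · b) c k ⟩ _
  ≡⟨ cong (a 0 * b 0 * c (suc k) +_) (by (·-cong {b = c} (·-suc a b) (\ _ -> refl) k)
  (by (·-distribʳ c (\ j -> a 0 * b (suc j)) (tail a · b) k) (cong₂ _+_ (·-scale (a 0) (tail b) c k) (·-assoc (tail a) b c k)))) ⟩ _
  ≡⟨ solve 5 (\ a b c d e -> a :* b :* c :+ (a :* d :+ e) := a :* (b :* c :+ d) :+ e) refl (a 0) (b 0) (c (suc k)) ((tail b · c) k) ((tail a · (b · c)) k) ⟩ _
  ≡⟨ cong (\ r -> a 0 * r + (tail a · (b · c)) k) (·-suc b c k) ⟨ _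
  ≡⟨ ·-suc a (b · c) k ⟨
  (a · (b · c)) (suc k) ∎
  where
  open ≡-Reasoning
  open Solver

 ·-const : ∀ x a -> const x · a ≈ (\ k -> x * a k)
 ·-const x a zero = refl
 ·-const x a (suc k) = by (·-suc (const x) a k) (by (cong (x * a (suc k) +_) (sumTo-0 k (\ j _ -> zeroˡ _))) (+-idʳ _))

 ·-identityˡ : ∀ a -> 𝟙 · a ≈ a
 ·-identityˡ a k = by (·-const 1# a k) (*-idˡ (a k))

 seriesRing : CommutativeRing 0ℓ 0ℓ
 seriesRing = record
  { Carrier = Ser ; _≈_ = _≈_ ; _+_ = _⊕_ ; _*_ = _·_ ; -_ = ⊝_ ; 0# = 𝟘 ; 1# = 𝟙
  ; isCommutativeRing = record
   { isRing = record
    { +-isAbelianGroup = record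
     { isGroup = record
      { isMonoid = record
       { isSemigroup = record
        { isMagma = record
         { isEquivalence = record
          { refl = \ _ -> refl
          ; sym = \ p k -> sym (p k)
          ; trans = \ p q k -> by (p k) (q k) }
         ; ∙-cong = \ p q k -> cong₂ _+_ (p k) (q k) }
        ; assoc = \ a b c k -> +-assoc (a k) (b k) (c k) }
       ; identity = (\ a k -> +-idˡ (a k)) , (\ a k -> +-idʳ (a k)) }
      ; inverse = (\ a k -> -‿inverseˡ (a k)) , (\ a k -> -‿inverseʳ (a k))
      ; ⁻¹-cong = \ p k -> cong -_ (p k) }
     ; comm = \ a b k -> +-comm (a k) (b k) }
    ; *-cong = \ {a} {a'} {b} {b'} -> ·-cong {a} {a'} {b} {b'}
    ; *-assoc = ·-assoc
    ; *-identity = ·-identityˡ , (\ a k -> by (·-comm a 𝟙 k) (·-identityˡ a k))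
    ; distrib = (\ c a b k -> by (·-comm c (a ⊕ b) k) (by (·-distribʳ c a b k)
     (cong₂ _+_ (·-comm a c k) (·-comm b c k)))) , ·-distribʳ }
   ; *-comm = ·-comm } }

 serAlg : ℤ-Algebra
 serAlg = record
  { commutativeRing = seriesRing
  ; fromℤ-homo = record
   { ⟦_⟧ = \ i -> const (int i)
   ; +-homo = \ { i j zero -> int-+ i j ; i j (suc k) -> sym (+-idˡ 0#) }
   ; *-homo = \ { i j zero -> int-* i j ; i j (suc k) -> sym (by (·-const (int i) (const (int j)) (suc k)) (zeroʳ _)) }
   ; -‿homo = \ { i zero -> int-neg i ; i (suc k) -> sym -0≡0 }
   ; 0-homo = \ { zero -> int-0 ; (suc k) -> refl }
   ; 1-homo = \ { zero -> int-1 ; (suc k) -> refl } } }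
  where
  -0≡0 : - 0# ≡ 0#
  -0≡0 = by (sym (+-idˡ _)) (-‿inverseʳ 0#)

 X·-zero : ∀ a -> (X · a) 0 ≡ 0#
 X·-zero a = zeroˡ (a 0)

 X·-suc : ∀ a k -> (X · a) (suc k) ≡ a k
 X·-suc a k = by (·-suc X a k) (by (cong₂ _+_ (zeroˡ (a (suc k))) (·-identityˡ a k)) (+-idˡ (a k)))

 ϑ : Ser -> Ser
 ϑ a k = nat k * a k

 ϑ-cong : ∀ {a b} -> a ≈ b -> ϑ a ≈ ϑ b
 ϑ-cong q k = cong (nat k *_) (q k)

 ϑ-⊕ : ∀ a b -> ϑ (a ⊕ b) ≈ ϑ a ⊕ ϑ b
 ϑ-⊕ a b k = distribˡ (nat k) (a k) (b k)

 ϑ-· : ∀ a b -> ϑ (a · b) ≈ ϑ a · b ⊕ a · ϑ b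
 ϑ-· a b k = by (sym (sumTo-*ˡ k (nat k) _)) (by (sumTo-cong k (\ j j≤k ->
  by (cong (\ n -> nat n * (a j * b (k ∸ j))) (sym (NP.m+[n∸m]≡n j≤k))) (by (cong (_* (a j * b (k ∸ j))) (nat-+ j (k ∸ j)))
  (solve 4 (\ m n x y -> (m :+ n) :* (x :* y) := m :* x :* y :+ x :* (n :* y)) refl (nat j) (nat (k ∸ j)) (a j) (b (k ∸ j))))))
  (sumTo-+ k _ _))
  where open Solver

 ϑ-const : ∀ x -> ϑ (const x) ≈ 𝟘
 ϑ-const x zero = by (cong (_* x) int-0) (zeroˡ x)
 ϑ-const x (suc k) = zeroʳ _

 ϑ-X : ϑ X ≈ X
 ϑ-X zero = zeroʳ _
 ϑ-X (suc zero) = by (cong (_* 1#) int-1) (*-idˡ 1#)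
 ϑ-X (suc (suc k)) = zeroʳ _

 record HasOrder (m : ℕ) (a : Ser) : Set where
  field
   below : ∀ j -> j N.< m -> a j ≡ 0#
   leading : ¬ a m ≡ 0#

 -- Removing the m leading zeros of a makes its head nonzero; then the coefficients of b vanish one
 -- after another.
 ·-cancel-0 : ∀ m {a} -> HasOrder m a -> ∀ b -> a · b ≈ 𝟘 -> b ≈ 𝟘
 ·-cancel-0 zero {a} o b q k = go k b q
  where
  head : ∀ b -> a · b ≈ 𝟘 -> b 0 ≡ 0#
  head b q with *-≡0 (a 0) (b 0) (q 0)
  ... | inj₁ e = ⊥-elim (HasOrder.leading o e)
  ... | inj₂ e = e
  go : ∀ k b -> a · b ≈ 𝟘 -> b k ≡ 0#
  go zero b q = head b q
  go (suc k) b q = go k (tail b) (\ j -> by (sym (by (·-sucʳ a b j)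
   (by (cong (\ x -> (a · tail b) j + a (suc j) * x) (head b q)) (by (cong ((a · tail b) j +_) (zeroʳ _)) (+-idʳ _))))) (q (suc j)))
 ·-cancel-0 (suc m) {a} o b q = ·-cancel-0 m {tail a}
  (record { below = \ j j<m -> HasOrder.below o (suc j) (s≤s j<m) ; leading = HasOrder.leading o }) b
  (\ k -> by (sym (by (·-suc a b k) (by (cong (\ x -> x * b (suc k) + (tail a · b) k) (HasOrder.below o 0 (s≤s z≤n)))
   (by (cong (_+ (tail a · b) k) (zeroˡ _)) (+-idˡ _))))) (q (suc k)))

 ·-cancelˡ : ∀ m {a} -> HasOrder m a -> ∀ b c -> a · b ≈ a · c -> b ≈ c
 ·-cancelˡ m {a} o b c q = A.x-y≈0⇒x≈y (·-cancel-0 m o (b A.- c)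
  (A.tra (A.Solver.solve 3 (\ a b c -> a A.Solver.:* (b A.Solver.:- c) A.Solver.:= a A.Solver.:* b A.Solver.:- a A.Solver.:* c) A.rfl a b c)
  (A.≈⇒-≈0 q)))
  where module A = ℤ-AlgebraProperties serAlg

-- The bilinear identity and the Toda equation

module Toda (J : NumberField) where

 open FieldProperties J
 open Sums J
 open Vandermonde J
 open Series J
 open ≡-Reasoning
 module R = ℤ-AlgebraProperties serAlg

 private
  raise : ∀ {N} -> ((Fin N -> F) -> F) -> (Fin N -> F) -> F
  raise {N} = Vacuum.raise J N

  δ : ∀ {N} -> Fin N -> F
  δ {N} = Vacuum.δ J N

  infixl 6 _+e_
  _+e_ : ∀ {N} -> (Fin N -> F) -> Fin N -> Fin N -> F
  _+e_ {N} = Colourings._+e_ J N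

  iterate : ∀ {N} -> ℕ -> (Fin N -> F) -> F
  iterate {N} n = FixedColourings.iterate J N n Δ

 Alt : ∀ {N} -> ((Fin N -> F) -> F) -> Set
 Alt {N} = Colourings.Alternating J N

 iterate-alternating : ∀ {N} n -> Alt {N} (iterate n)
 iterate-alternating zero = Δ-alternating
 iterate-alternating (suc n) = Vacuum.raise-alternating J _ (iterate-alternating n)

 collision : ∀ {N} {h : (Fin N -> F) -> F} -> Alt h -> ∀ {a b ℓ} -> ¬ a ≡ b -> ℓ a ≡ ℓ b -> h ℓ ≡ 0#
 collision {h = h} altn {a} {b} {ℓ} a≢b q = x≡-x⇒x≡0 (by (Colourings.Alternating.ext altn fixed) (Colourings.Alternating.swap altn a≢b ℓ))
  where
  fixed : ∀ k -> ℓ k ≡ ℓ (tr a b k)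
  fixed k with k Fin.≟ a | k Fin.≟ b
  ... | yes refl | _ = q
  ... | no _ | yes refl = sym q
  ... | no _ | no _ = refl

 -- The reciprocal factorials 1/n!.
 rf : ℕ -> F
 rf zero = 1#
 rf (suc n) = proj₁ (inverse (nat (suc n)) (nat-suc≢0 n)) * rf n

 rf-suc : ∀ n -> nat (suc n) * rf (suc n) ≡ rf n
 rf-suc n = let (y , q) = inverse (nat (suc n)) (nat-suc≢0 n) in
  by (sym (*-assoc _ y (rf n))) (by (cong (_* rf n) q) (*-idˡ (rf n)))

 ∣_∣ : ∀ {N} -> (Fin N -> F) -> F
 ∣_∣ {N} ℓ = ∑ (allFin N) ℓ

 ∣+e∣ : ∀ {N} (ℓ : Fin N -> F) i -> ∣ ℓ +e i ∣ ≡ ∣ ℓ ∣ + 1#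
 ∣+e∣ {N} ℓ i = by (∑-+ (allFin N) ℓ _) (cong (∣ ℓ ∣ +_)
  (by (∑-cong (allFin N) (\ k -> by (ind-cong (i Fin.≟ k) (k Fin.≟ i) sym sym) (sym (*-idʳ _)))) (∑-ind-≟ i (\ _ -> 1#))))

 -- `H ℓ` is the exponential of s times `raise`, applied to Δ at ℓ. Raising adds 1 to |ℓ| and
 -- consumes one power of s, so |ℓ| + n is conserved and `H̃`, which is |ℓ| + s d/ds applied to
 -- `H ℓ`, follows the same flow.
 H H̃ : ∀ {N} -> (Fin N -> F) -> Ser
 H ℓ n = rf n * iterate n ℓ
 H̃ ℓ n = (∣ ℓ ∣ + nat n) * H ℓ n

 deriv : Ser -> Ser
 deriv a k = nat (suc k) * a (suc k)

 ϑ-deriv : ∀ a -> ϑ a ≈ X · deriv a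
 ϑ-deriv a zero = by (by (cong (_* a 0) int-0) (zeroˡ _)) (sym (X·-zero (deriv a)))
 ϑ-deriv a (suc k) = sym (X·-suc (deriv a) k)

 deriv-· : ∀ a b -> deriv (a · b) ≈ deriv a · b ⊕ a · deriv b
 deriv-· a b n = begin
  ϑ (a · b) (suc n) ≡⟨ ϑ-· a b (suc n) ⟩
  (ϑ a · b ⊕ a · ϑ b) (suc n) ≡⟨ R.+-cong (R.*-cong (ϑ-deriv a) (R.rfl {b})) (R.*-cong (R.rfl {a}) (ϑ-deriv b)) (suc n) ⟩
  ((X · deriv a) · b ⊕ a · (X · deriv b)) (suc n) ≡⟨ R.Solver.solve 5 (\ x a a' b b' -> x R.Solver.:* a' R.Solver.:* b R.Solver.:+ a R.Solver.:* (x R.Solver.:* b')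
  R.Solver.:= x R.Solver.:* (a' R.Solver.:* b R.Solver.:+ a R.Solver.:* b')) R.rfl X a (deriv a) b (deriv b) (suc n) ⟩
  (X · (deriv a · b ⊕ a · deriv b)) (suc n) ≡⟨ X·-suc (deriv a · b ⊕ a · deriv b) n ⟩
  (deriv a · b ⊕ a · deriv b) n ∎

 raise-*ˡ : ∀ {N} q (h : (Fin N -> F) -> F) ℓ -> raise (\ ℓ -> q * h ℓ) ℓ ≡ q * raise h ℓ
 raise-*ˡ {N} q h ℓ = by (∑-cong (allFin N) (\ i -> solve 3 (\ x q h -> x :* (q :* h) := q :* (x :* h)) refl ((ℓ i + 1#) * (ℓ i + 1#)) q (h (ℓ +e i))))
  (∑-*ˡ (allFin N) q _)
  where open Solver

 H-suc : ∀ {N} (ℓ : Fin N -> F) n -> deriv (H ℓ) n ≡ raise (\ ℓ' -> H ℓ' n) ℓ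
 H-suc ℓ n = by (sym (*-assoc _ _ _)) (by (cong (_* iterate (suc n) ℓ) (rf-suc n)) (sym (raise-*ˡ (rf n) (iterate n) ℓ)))

 H̃-suc : ∀ {N} (ℓ : Fin N -> F) n -> deriv (H̃ ℓ) n ≡ raise (\ ℓ' -> H̃ ℓ' n) ℓ
 H̃-suc {N} ℓ n = begin
  nat (suc n) * ((∣ ℓ ∣ + nat (suc n)) * H ℓ (suc n))
  ≡⟨ solve 3 (\ a b c -> a :* (b :* c) := b :* (a :* c)) refl (nat (suc n)) (∣ ℓ ∣ + nat (suc n)) (H ℓ (suc n)) ⟩ _
  ≡⟨ cong ((∣ ℓ ∣ + nat (suc n)) *_) (H-suc ℓ n) ⟩ _
  ≡⟨ ∑-*ˡ (allFin N) _ _ ⟨ _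
  ≡⟨ ∑-cong (allFin N) (\ i -> by
  (solve 3 (\ a b c -> a :* (b :* c) := b :* (a :* c)) refl (∣ ℓ ∣ + nat (suc n)) ((ℓ i + 1#) * (ℓ i + 1#)) (H (ℓ +e i) n))
  (cong (\ x -> (ℓ i + 1#) * (ℓ i + 1#) * (x * H (ℓ +e i) n))
  (by (cong (∣ ℓ ∣ +_) (nat-suc n)) (by (sym (+-assoc _ _ _)) (cong (_+ nat n) (sym (∣+e∣ ℓ i))))))) ⟩
  raise (\ ℓ' -> H̃ ℓ' n) ℓ ∎
  where open Solver

 raise-· : ∀ {N} (a : (Fin N -> F) -> Ser) (b : Ser) ℓ n ->
  ((\ k -> raise (\ ℓ' -> a ℓ' k) ℓ) · b) n ≡ raise (\ ℓ' -> (a ℓ' · b) n) ℓ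
 raise-· {N} a b ℓ n = go (allFin N)
  where
  go : ∀ xs -> ((\ k -> ∑ xs (\ i -> (ℓ i + 1#) * (ℓ i + 1#) * a (ℓ +e i) k)) · b) n ≡ ∑ xs (\ i -> (ℓ i + 1#) * (ℓ i + 1#) * (a (ℓ +e i) · b) n)
  go [] = sumTo-0 n (\ j _ -> zeroˡ _)
  go (i ∷ xs) = by (·-distribʳ b (\ k -> (ℓ i + 1#) * (ℓ i + 1#) * a (ℓ +e i) k) (\ k -> ∑ xs (\ i -> (ℓ i + 1#) * (ℓ i + 1#) * a (ℓ +e i) k)) n)
   (cong₂ _+_ (·-scale ((ℓ i + 1#) * (ℓ i + 1#)) (a (ℓ +e i)) b n) (go xs))

 -- Leibniz rule for two families that evolve by raising their states.
 evolve-· : ∀ {N M} (a : (Fin N -> F) -> Ser) (b : (Fin M -> F) -> Ser) ->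
  (∀ ℓ n -> deriv (a ℓ) n ≡ raise (\ ℓ' -> a ℓ' n) ℓ) -> (∀ ℓ n -> deriv (b ℓ) n ≡ raise (\ ℓ' -> b ℓ' n) ℓ) ->
  ∀ ℓ m n -> deriv (a ℓ · b m) n ≡ raise (\ ℓ' -> (a ℓ' · b m) n) ℓ + raise (\ m' -> (a ℓ · b m') n) m
 evolve-· a b qa qb ℓ m n = by (deriv-· (a ℓ) (b m) n) (cong₂ _+_
  (by (·-cong {b = b m} (qa ℓ) (\ _ -> refl) n) (raise-· a (b m) ℓ n))
  (by (·-comm (a ℓ) (deriv (b m)) n) (by (·-cong {b = a ℓ} (qb m) (\ _ -> refl) n) (by (raise-· b (a ℓ) m n)
  (∑-cong (allFin _) (\ i -> cong ((m i + 1#) * (m i + 1#) *_) (·-comm (b (m +e i)) (a ℓ) n)))))))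

 cons : ∀ {N} -> F -> (Fin N -> F) -> Fin (suc N) -> F
 cons x m zero = x
 cons x m (suc j) = m j

 H-ext : ∀ {N} {ℓ ℓ' : Fin N -> F} -> (∀ k -> ℓ k ≡ ℓ' k) -> H ℓ ≈ H ℓ'
 H-ext q n = cong (rf n *_) (Colourings.Alternating.ext (iterate-alternating n) q)

 H̃-ext : ∀ {N} {ℓ ℓ' : Fin N -> F} -> (∀ k -> ℓ k ≡ ℓ' k) -> H̃ ℓ ≈ H̃ ℓ'
 H̃-ext {N} q n = cong₂ (\ x y -> (x + nat n) * y) (∑-cong (allFin N) q) (H-ext q n)

 ∑-punchIn : ∀ {n} (f : Fin (suc n) -> F) k -> ∑ (allFin (suc n)) f ≡ f k + ∑ (allFin n) (f ∘ punchIn k)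
 ∑-punchIn f zero = ∑-allFin-suc _ f
 ∑-punchIn {suc n} f (suc k) = by (∑-allFin-suc _ f) (by (cong (f zero +_) (∑-punchIn (f ∘ suc) k))
  (by (solve 3 (\ a b c -> a :+ (b :+ c) := b :+ (a :+ c)) refl (f zero) (f (suc k)) _) (cong (f (suc k) +_) (sym (∑-allFin-suc n _)))))
  where open Solver

 term : ∀ {N} -> (Fin (suc (suc N)) -> F) -> (Fin N -> F) -> ℕ -> Fin (suc (suc N)) -> F
 term ℓ m n k = (H (ℓ ∖ k) · H̃ (cons (ℓ k) m)) n

 -- The coordinate ℓ_k is raised inside the second factor and the other coordinates of ℓ inside the
 -- first. The weight depends on the coordinate alone, so together they form `raise` on all of ℓ.
 term-evolve : ∀ {N} (ℓ : Fin (suc (suc N)) -> F) (m : Fin N -> F) n k ->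
  nat (suc n) * term ℓ m (suc n) k ≡ raise (\ ℓ' -> term ℓ' m n k) ℓ + raise (\ m' -> term ℓ m' n k) m
 term-evolve {N} ℓ m n k = begin
  nat (suc n) * term ℓ m (suc n) k
  ≡⟨ evolve-· H H̃ H-suc H̃-suc (ℓ ∖ k) (cons (ℓ k) m) n ⟩ _
  ≡⟨ cong₂ _+_ (∑-cong (allFin (suc N)) (\ j -> cong (sq (ℓ (punchIn k j)) *_) (sym (·-cong (H-ext (off j)) (H̃-ext (same j)) n))))
  (by (∑-allFin-suc N _) (cong₂ _+_ (cong (sq (ℓ k) *_) (sym (·-cong (H-ext at) (H̃-ext cons0) n)))
  (∑-cong (allFin N) (\ j -> cong (sq (m j) *_) (·-cong {H (ℓ ∖ k)} (\ _ -> refl) (H̃-ext (consₛ j)) n))))) ⟩ _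
  ≡⟨ solve 3 (\ a b c -> a :+ (b :+ c) := b :+ a :+ c) refl _ _ _ ⟩ _
  ≡⟨ cong (_+ raise (\ m' -> term ℓ m' n k) m) (∑-punchIn (\ i -> sq (ℓ i) * term (ℓ +e i) m n k) k) ⟨
  raise (\ ℓ' -> term ℓ' m n k) ℓ + raise (\ m' -> term ℓ m' n k) m ∎
  where
  open Solver
  sq : F -> F
  sq x = (x + 1#) * (x + 1#)
  off : ∀ j i -> ((ℓ +e punchIn k j) ∖ k) i ≡ ((ℓ ∖ k) +e j) i
  off j i = cong (ℓ (punchIn k i) +_) (ind-cong (punchIn k j Fin.≟ punchIn k i) (j Fin.≟ i) (FP.punchIn-injective k j i) (cong (punchIn k)))
  same : ∀ j i -> cons ((ℓ +e punchIn k j) k) m i ≡ cons (ℓ k) m i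
  same j zero = by (cong (ℓ k +_) (ind-no (punchIn k j Fin.≟ k) (FP.punchInᵢ≢i k j))) (+-idʳ _)
  same j (suc i) = refl
  at : ∀ i -> ((ℓ +e k) ∖ k) i ≡ (ℓ ∖ k) i
  at i = by (cong (ℓ (punchIn k i) +_) (ind-no (k Fin.≟ punchIn k i) (FP.punchInᵢ≢i k i ∘ sym))) (+-idʳ _)
  cons0 : ∀ i -> cons ((ℓ +e k) k) m i ≡ (cons (ℓ k) m +e zero) i
  cons0 zero = cong (ℓ k +_) (by (ind-yes (k Fin.≟ k) refl) (sym (ind-yes (zero {N} Fin.≟ zero) refl)))
  cons0 (suc i) = sym (by (cong (m i +_) (ind-no (zero {N} Fin.≟ suc i) (\ ()))) (+-idʳ _))
  consₛ : ∀ j i -> (cons (ℓ k) m +e suc j) i ≡ cons (ℓ k) (m +e j) i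
  consₛ j zero = by (cong (ℓ k +_) (ind-no (suc j Fin.≟ zero) (\ ()))) (+-idʳ _)
  consₛ j (suc i) = cong (m i +_) (ind-cong (suc j Fin.≟ suc i) (j Fin.≟ i) FP.suc-injective (cong suc))

 -- A Plücker-type relation transported by the flow. At s = 0 it is Lagrange interpolation of (y +
 -- |m|) Π (y - m_j): the linear factor, supplied by `H̃`, makes the degree N + 1 fit the N + 2
 -- points. Both sides then obey the same evolution equation.
 bilinear : ∀ {N} n (ℓ : Fin (suc (suc N)) -> F) (m : Fin N -> F) -> (H ℓ · H m) n ≡ alt (term ℓ m n)
 bilinear {N} zero ℓ m = sym (begin
  alt (\ k -> (rf 0 * Δ (ℓ ∖ k)) * ((∣ cons (ℓ k) m ∣ + nat 0) * (rf 0 * Δ (cons (ℓ k) m))))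
  ≡⟨ alt-cong (\ k -> by (cong₂ (\ s d -> (rf 0 * Δ (ℓ ∖ k)) * (s * (rf 0 * (d * Δ m))))
  (by (cong₂ _+_ (∑-allFin-suc N (cons (ℓ k) m)) int-0) (by (+-idʳ _) (solve 2 (\ a b -> a :+ b := a :- :- b) refl (ℓ k) ∣ m ∣)))
  (sym (FixedColourings.linear-tabulate J N m (ℓ k))))
  (solve 5 (\ r d s p m -> (r :* d) :* (s :* (r :* (p :* m))) := (r :* r :* m) :* (d :* (s :* p))) refl (rf 0) (Δ (ℓ ∖ k)) (ℓ k - - ∣ m ∣) (linear (tabulate m) (ℓ k)) (Δ m))) ⟩ _
  ≡⟨ alt-*ˡ (rf 0 * rf 0 * Δ m) (\ k -> Δ (ℓ ∖ k) * linear (- ∣ m ∣ ∷ tabulate m) (ℓ k)) ⟩ _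
  ≡⟨ cong ((rf 0 * rf 0 * Δ m) *_) (lagrange-≡ ℓ (- ∣ m ∣ ∷ tabulate m) (cong suc (LP.length-tabulate m))) ⟩
  (rf 0 * rf 0 * Δ m) * Δ ℓ
  ≡⟨ solve 3 (\ r m l -> (r :* r :* m) :* l := (r :* l) :* (r :* m)) refl (rf 0) (Δ m) (Δ ℓ) ⟩
  (rf 0 * Δ ℓ) * (rf 0 * Δ m) ∎)
  where open Solver
 bilinear {N} (suc n) ℓ m = cancel-≢0 (nat (suc n)) (nat-suc≢0 n) (begin
  nat (suc n) * (H ℓ · H m) (suc n)
  ≡⟨ evolve-· H H H-suc H-suc ℓ m n ⟩ _
  ≡⟨ cong₂ _+_ (∑-cong (allFin _) (\ i -> cong ((ℓ i + 1#) * (ℓ i + 1#) *_) (bilinear n (ℓ +e i) m)))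
  (∑-cong (allFin _) (\ j -> cong ((m j + 1#) * (m j + 1#) *_) (bilinear n ℓ (m +e j)))) ⟩ _
  ≡⟨ cong₂ _+_ (by (∑-cong (allFin _) (\ i -> sym (alt-*ˡ ((ℓ i + 1#) * (ℓ i + 1#)) (term (ℓ +e i) m n)))) (sym (alt-∑ (allFin _) (\ k i -> (ℓ i + 1#) * (ℓ i + 1#) * term (ℓ +e i) m n k))))
  (by (∑-cong (allFin _) (\ j -> sym (alt-*ˡ ((m j + 1#) * (m j + 1#)) (term ℓ (m +e j) n)))) (sym (alt-∑ (allFin _) (\ k j -> (m j + 1#) * (m j + 1#) * term ℓ (m +e j) n k)))) ⟩ _
  ≡⟨ alt-+ (\ k -> raise (\ ℓ' -> term ℓ' m n k) ℓ) (\ k -> raise (\ m' -> term ℓ m' n k) m) ⟨ _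
  ≡⟨ alt-cong (\ k -> sym (term-evolve ℓ m n k)) ⟩ _
  ≡⟨ alt-*ˡ (nat (suc n)) (term ℓ m (suc n)) ⟩
  nat (suc n) * alt (term ℓ m (suc n)) ∎)

 alt-0 : ∀ {n} {f : Fin n -> F} -> (∀ i -> f i ≡ 0#) -> alt f ≡ 0#
 alt-0 {n} {f} q = by (alt-∑-sg f) (∑-≡0 (allFin n) (\ {i} _ -> by (cong (sg i *_) (q i)) (zeroʳ _)))

 δ⁺ : ∀ {M} -> Fin (suc M) -> F
 δ⁺ = δ +e zero

 private
  level+1 : ∀ M -> nat (suc M) ≡ nat M + 1#
  level+1 M = by (nat-suc M) (+-comm _ _)

 δ⁺-cons : ∀ {M} k -> cons (nat (suc M)) (δ {M}) k ≡ δ⁺ k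
 δ⁺-cons {M} zero = by (level+1 M) (cong (nat M +_) (sym (ind-yes (zero {M} Fin.≟ zero) refl)))
 δ⁺-cons {M} (suc k) = sym (by (cong (δ k +_) (ind-no (zero {M} Fin.≟ suc k) (\ ()))) (+-idʳ _))

 H̃-collision : ∀ {N} {ℓ : Fin N -> F} {a b} -> ¬ a ≡ b -> ℓ a ≡ ℓ b -> ∀ n -> H̃ ℓ n ≡ 0#
 H̃-collision {ℓ = ℓ} a≢b q n = by (cong (\ x -> (∣ ℓ ∣ + nat n) * (rf n * x)) (collision (iterate-alternating n) a≢b q))
  (by (cong ((∣ ℓ ∣ + nat n) *_) (zeroʳ (rf n))) (zeroʳ (∣ ℓ ∣ + nat n)))

 -- At the vacuum only the two largest points survive in the bilinear identity.
 bilinear-vacuum : ∀ M -> H (δ {suc (suc M)}) · H (δ {M}) ≈ H (δ {suc M}) · H̃ δ⁺ R.- H δ⁺ · H̃ (δ {suc M})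
 bilinear-vacuum M n = begin
  (H (δ {suc (suc M)}) · H (δ {M})) n
  ≡⟨ bilinear n δ δ ⟩ _
  ≡⟨ cong₂ _-_ (·-cong {H (δ {suc M})} (\ _ -> refl) (H̃-ext δ⁺-cons) n)
  (cong₂ _-_ (·-cong (H-ext (\ { zero -> δ⁺-cons {M} zero ; (suc k) -> δ⁺-cons {M} (suc k) })) (H̃-ext (\ { zero -> refl ; (suc k) -> refl })) n)
  (alt-0 vanish)) ⟩ _
  ≡⟨ cong (\ z -> (H (δ {suc M}) · H̃ δ⁺) n - ((H δ⁺ · H̃ (δ {suc M})) n - z)) (sym int-0) ⟩ _
  ≡⟨ solve 2 (\ a b -> a :- (b :- con (Z.+ 0)) := a :- b) refl ((H (δ {suc M}) · H̃ δ⁺) n) ((H δ⁺ · H̃ (δ {suc M})) n) ⟩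
  (H (δ {suc M}) · H̃ δ⁺) n - (H δ⁺ · H̃ (δ {suc M})) n ∎
  where
  open Solver
  vanish : ∀ k -> term (δ {suc (suc M)}) (δ {M}) n (suc (suc k)) ≡ 0#
  vanish k = sumTo-0 n (\ j _ -> by (cong (H (δ {suc (suc M)} ∖ suc (suc k)) j *_)
   (H̃-collision {ℓ = cons (δ {suc (suc M)} (suc (suc k))) (δ {M})} {zero} {suc k} (\ ()) refl (n ∸ j))) (zeroʳ (H (δ {suc (suc M)} ∖ suc (suc k)) j)))

 ν : ℕ -> Ser
 ν N = const (nat N)

 -- Raising any level but the top one lands on the next level and collides with it.
 ϑ-vacuum : ∀ M -> ϑ (H (δ {suc M})) ≈ X · (ν (suc M) · ν (suc M) · H δ⁺)
 ϑ-vacuum M = R.tra (ϑ-deriv (H (δ {suc M}))) (R.*-cong (R.rfl {X}) (\ n -> begin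
  deriv (H (δ {suc M})) n
  ≡⟨ by (H-suc (δ {suc M}) n) (∑-allFin-suc M _) ⟩ _
  ≡⟨ cong₂ _+_ (cong (\ x -> x * x * H δ⁺ n) (sym (level+1 M))) (∑-≡0 (allFin M) (\ {i} _ -> by (cong ((δ i + 1#) * (δ i + 1#) *_) (vanish n i)) (zeroʳ _))) ⟩ _
  ≡⟨ by (+-idʳ _) (by (*-assoc _ _ _) (sym (by (R.*-assoc (ν (suc M)) (ν (suc M)) (H δ⁺) n) (by (·-const (nat (suc M)) (ν (suc M) · H δ⁺) n)
  (cong (nat (suc M) *_) (·-const (nat (suc M)) (H δ⁺) n)))))) ⟩
  (ν (suc M) · ν (suc M) · H δ⁺) n ∎))
  where
  vanish : ∀ n (i : Fin M) -> H (δ {suc M} +e suc i) n ≡ 0#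
  vanish n i = by (cong (rf n *_) (collision (iterate-alternating n) {suc i} {k} i≢k
   (by (cong (δ (suc i) +_) (ind-yes (suc i Fin.≟ suc i) refl)) (sym (by (cong (δ k +_) (ind-no (suc i Fin.≟ k) i≢k))
   (by (+-idʳ _) (by (cong nat lk) (level+1 (level i))))))))) (zeroʳ _)
   where
   got = atLevel {suc M} {suc (level i)} (N.s≤s (level<N i))
   k = proj₁ got
   lk = proj₂ got
   i≢k : ¬ suc i ≡ k
   i≢k q = NP.<-irrefl (by (cong level q) lk) NP.≤-refl

 H̃-ϑ : ∀ {N} (ℓ : Fin N -> F) -> H̃ ℓ ≈ const ∣ ℓ ∣ · H ℓ ⊕ ϑ (H ℓ)
 H̃-ϑ ℓ n = by (distribʳ (H ℓ n) ∣ ℓ ∣ (nat n)) (cong (_+ nat n * H ℓ n) (sym (·-const ∣ ℓ ∣ (H ℓ) n)))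

 -- The multiples of |δ| in the two `H̃` cancel. The extra 1 in |δ⁺| = |δ| + 1 matches the term that
 -- arises from differentiating the factor X of `ϑ-vacuum`.
 toda-H : ∀ M -> X · (ν (suc M) · ν (suc M)) · (H (δ {suc (suc M)}) · H (δ {M})) ≈
  H (δ {suc M}) · ϑ (ϑ (H (δ {suc M}))) R.- ϑ (H (δ {suc M})) · ϑ (H (δ {suc M}))
 toda-H M = R.tra (R.*-cong (R.rfl {X · (ν (suc M) · ν (suc M))}) (R.tra (bilinear-vacuum M)
  (R.+-cong (R.*-cong (R.rfl {h}) (R.tra (H̃-ϑ δ⁺) (R.+-cong (R.*-cong const⁺ (R.rfl {h⁺})) (R.rfl {ϑ h⁺})))) (R.-‿cong (R.*-cong (R.rfl {h⁺}) (H̃-ϑ (δ {suc M})))))))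
  (R.tra (solve 8 (\ x n h h⁺ t th th⁺ o -> x :* (n :* n) :* (h :* ((t :+ o) :* h⁺ :+ th⁺) :- h⁺ :* (t :* h :+ th))
  := h :* (x :* (n :* n :* th⁺) :+ o :* (x :* (n :* n :* h⁺))) :- x :* (n :* n :* h⁺) :* th) R.rfl X n h h⁺ t (ϑ h) (ϑ h⁺) 𝟙)
  (R.+-cong (R.*-cong (R.rfl {h}) (R.tra (R.+-cong (R.rfl {X · (n · n · ϑ h⁺)}) (R.*-idˡ (X · (n · n · h⁺)))) (R.≈-sym ϑϑ)))
  (R.-‿cong (R.*-cong (R.≈-sym (ϑ-vacuum M)) (R.rfl {ϑ h})))))
  where
  open R.Solver
  n = ν (suc M)
  h = H (δ {suc M})
  h⁺ = H δ⁺
  t = const ∣ δ {suc M} ∣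
  const⁺ : const ∣ δ⁺ {M} ∣ ≈ t ⊕ 𝟙
  const⁺ zero = ∣+e∣ (δ {suc M}) zero
  const⁺ (suc k) = sym (+-idˡ 0#)
  ϑn : ϑ n ≈ 𝟘
  ϑn = ϑ-const (nat (suc M))
  ϑϑ : ϑ (ϑ h) ≈ X · (n · n · ϑ h⁺) ⊕ X · (n · n · h⁺)
  ϑϑ = R.tra (ϑ-cong (ϑ-vacuum M)) (R.tra (ϑ-· X (n · n · h⁺)) (R.tra (R.+-cong (R.*-cong ϑ-X (R.rfl {n · n · h⁺}))
   (R.*-cong (R.rfl {X}) (R.tra (ϑ-· (n · n) h⁺) (R.+-cong (R.*-cong (R.tra (ϑ-· n n) (R.+-cong (R.*-cong ϑn (R.rfl {n})) (R.*-cong (R.rfl {n}) ϑn))) (R.rfl {h⁺})) (R.rfl {n · n · ϑ h⁺})))))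
   (R.tra (R.+-cong (R.rfl {X · (n · n · h⁺)}) (R.*-cong (R.rfl {X}) (R.tra (R.+-cong (R.*-cong (R.tra (R.+-cong (R.zeroˡ n) (R.zeroʳ n)) (R.+-idˡ 𝟘)) (R.rfl {h⁺})) (R.rfl {n · n · ϑ h⁺}))
   (R.tra (R.+-cong (R.zeroˡ h⁺) (R.rfl {n · n · ϑ h⁺})) (R.+-idˡ (n · n · ϑ h⁺)))))) (R.+-comm (X · (n · n · h⁺)) (X · (n · n · ϑ h⁺))))))

 -- The falling factorial x (x - 1) ... (x - M + 1). Its value M! at x = M is the ratio of Δ δ for M
 -- + 1 levels to Δ δ for M levels.
 falling : ℕ -> F -> F
 falling M x = ∏ (\ (j : Fin M) -> x - δ j)

 falling-suc : ∀ M x -> falling (suc M) x ≡ x * falling M (x - 1#)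
 falling-suc zero x = cong (_* 1#) (by (cong (\ z -> x - z) int-0) (by (cong (x +_) (by (sym (+-idˡ _)) (-‿inverseʳ 0#))) (+-idʳ x)))
 falling-suc (suc M) x = by (cong ((x - nat (suc M)) *_) (falling-suc M x)) (by
  (cong (\ y -> (x - y) * (x * falling M (x - 1#))) (nat-suc M))
  (solve 4 (\ x o m r -> (x :- (o :+ m)) :* (x :* r) := x :* ((x :- o :- m) :* r)) refl x 1# (nat M) (falling M (x - 1#))))
  where open Solver

 falling-self : ∀ M -> falling (suc M) (nat (suc M)) ≡ nat (suc M) * falling M (nat M)
 falling-self M = by (falling-suc M (nat (suc M))) (cong (\ y -> nat (suc M) * falling M y)
  (by (cong (_- 1#) (level+1 M)) (solve 2 (\ a o -> a :+ o :- o := a) refl (nat M) 1#)))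
  where open Solver

 falling≢0 : ∀ M -> ¬ falling M (nat M) ≡ 0#
 falling≢0 zero q = nat-suc≢0 0 (by int-1 q)
 falling≢0 (suc M) q with *-≡0 (nat (suc M)) (falling M (nat M)) (by (sym (falling-self M)) q)
 ... | inj₁ e = nat-suc≢0 M e
 ... | inj₂ e = falling≢0 M e

 Δδ≢0 : ∀ N -> ¬ Δ (δ {N}) ≡ 0#
 Δδ≢0 zero q = nat-suc≢0 0 (by int-1 q)
 Δδ≢0 (suc N) q with *-≡0 (falling N (nat N)) (Δ (δ {N})) q
 ... | inj₁ e = falling≢0 N e
 ... | inj₂ e = Δδ≢0 N e

 Z : ℕ -> Ser
 Z N n = rf n * FixedColourings.partition J N n

 H-Z : ∀ N -> H (δ {N}) ≈ const (Δ (δ {N})) · Z N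
 H-Z N n = by (cong (rf n *_) (FixedColourings.iterate-Δ J N n)) (by
  (solve 3 (\ r p d -> r :* (p :* d) := d :* (r :* p)) refl (rf n) (FixedColourings.partition J N n) (Δ (δ {N})))
  (sym (·-const (Δ (δ {N})) (Z N) n)))
  where open Solver

 const-* : ∀ x y -> const (x * y) ≈ const x · const y
 const-* x y zero = refl
 const-* x y (suc k) = sym (by (·-const x (const y) (suc k)) (zeroʳ x))

 -- Passing from H to Z divides by Δ δ for three consecutive numbers of levels; this contributes
 -- N!/(N-1)! = N and turns N² into N³.
 toda : ∀ M -> let N = suc M in
  X · (ν N · ν N · ν N) · (Z (suc N) · Z M) ≈ Z N · ϑ (ϑ (Z N)) R.- ϑ (Z N) · ϑ (Z N)
 toda M = ·-cancelˡ 0 {d · d} (record { below = \ _ () ; leading = d≢0 }) _ _ (R.tra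
   (R.≈-sym (R.tra (R.*-cong (R.rfl {X · (n · n)}) (R.*-cong (R.tra (H-Z (suc N)) (R.*-cong d⁺-eq (R.rfl {Z (suc N)}))) (H-Z M)))
    (R.tra (solve 7 (\ x n f d⁻ d z z⁻ -> x :* (n :* n) :* ((n :* f :* d :* z) :* (d⁻ :* z⁻)) := (x :* (n :* n :* n) :* (z :* z⁻)) :* (d :* (f :* d⁻))) R.rfl X n f d⁻ d (Z (suc N)) (Z M))
    (R.tra (R.*-cong (R.rfl {X · (n · n · n) · (Z (suc N) · Z M)}) (R.*-cong (R.rfl {d}) (R.≈-sym (const-* (falling M (nat M)) (Δ (δ {M}))))))
    (R.*-comm (X · (n · n · n) · (Z (suc N) · Z M)) (d · d))))))
   (R.tra (toda-H M) (R.tra (R.+-cong (R.*-cong (H-Z N) (R.tra (ϑ-cong ϑh) ϑdZ)) (R.-‿cong (R.*-cong ϑh ϑh)))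
    (solve 4 (\ d z t u -> (d :* z) :* (d :* u) :- (d :* t) :* (d :* t) := (d :* d) :* (z :* u :- t :* t)) R.rfl d (Z N) (ϑ (Z N)) (ϑ (ϑ (Z N)))))))
  where
  open R.Solver
  N = suc M
  n = ν N
  d = const (Δ (δ {N}))
  d⁻ = const (Δ (δ {M}))
  f = const (falling M (nat M))
  d≢0 : ¬ (d · d) 0 ≡ 0#
  d≢0 q with *-≡0 (Δ (δ {N})) (Δ (δ {N})) q
  ... | inj₁ e = Δδ≢0 N e
  ... | inj₂ e = Δδ≢0 N e
  d⁺-eq : const (Δ (δ {suc N})) ≈ n · f · d
  d⁺-eq = R.tra (const-* (falling N (nat N)) (Δ (δ {N}))) (R.*-cong (R.tra (\ k -> cong (\ x -> const x k) (falling-self M)) (const-* (nat N) (falling M (nat M)))) (R.rfl {d}))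
  scale : ∀ x a -> ϑ (const x · a) ≈ const x · ϑ a
  scale x a = R.tra (ϑ-· (const x) a) (R.tra (R.+-cong (R.tra (R.*-cong (ϑ-const x) (R.rfl {a})) (R.zeroˡ a)) (R.rfl {const x · ϑ a})) (R.+-idˡ (const x · ϑ a)))
  ϑh : ϑ (H (δ {N})) ≈ d · ϑ (Z N)
  ϑh = R.tra (ϑ-cong (H-Z N)) (scale (Δ (δ {N})) (Z N))
  ϑdZ : ϑ (d · ϑ (Z N)) ≈ d · ϑ (ϑ (Z N))
  ϑdZ = scale (Δ (δ {N})) (ϑ (Z N))

-- The Toda chain in a differential ring

record DifferentialAlgebra : Set₁ where
 field
  algebra : ℤ-Algebra
 open ℤ-AlgebraProperties algebra
 field
  θ : Carrier -> Carrier
  θ-cong : ∀ {x y} -> x ≈ y -> θ x ≈ θ y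
  θ-+ : ∀ x y -> θ (x + y) ≈ θ x + θ y
  θ-* : ∀ x y -> θ (x * y) ≈ θ x * y + x * θ y
  θ-ι : ∀ i -> θ (ι i) ≈ 0#

module DifferentialProperties (D : DifferentialAlgebra) where

 open DifferentialAlgebra D public using (θ; θ-cong; θ-+; θ-*; θ-ι)
 open ℤ-AlgebraProperties (DifferentialAlgebra.algebra D) public

 θ-0 : θ 0# ≈ 0#
 θ-0 = tra (θ-cong (≈-sym ι-0)) (θ-ι (Z.+ 0))

 θ-neg : ∀ x -> θ (- x) ≈ - θ x
 θ-neg x = tra (solve 2 (\ a b -> a := (a :+ b) :- b) rfl (θ (- x)) (θ x))
  (tra (+-cong (tra (≈-sym (θ-+ (- x) x)) (tra (θ-cong (-‿inverseˡ x)) θ-0)) rfl) (+-idˡ _))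
  where open Solver

 θ-- : ∀ x y -> θ (x - y) ≈ θ x - θ y
 θ-- x y = tra (θ-+ x (- y)) (+-cong rfl (θ-neg y))

 θ-constˡ : ∀ {c} -> θ c ≈ 0# -> ∀ x -> θ (c * x) ≈ c * θ x
 θ-constˡ {c} q x = tra (θ-* c x) (tra (+-cong (tra (*-cong q rfl) (zeroˡ x)) rfl) (+-idˡ _))

 θ-sq : ∀ x -> θ (x * x) ≈ κ 2 * (x * θ x)
 θ-sq x = tra (θ-* x x) (solve 2 (\ a b -> b :* a :+ a :* b := con (Z.+ 2) :* (a :* b)) rfl x (θ x))
  where open Solver

module Chain (D : DifferentialAlgebra) where

 open DifferentialProperties D
 open Solver

 -- With σ = θ log Z the Toda equation reads θσ = N³ s Z₊ Z₋ / Z², and this is its logarithmic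
 -- derivative.
 IsToda : Carrier -> Carrier -> Carrier -> Set
 IsToda σ₋ σ σ+ = θ (θ σ) ≈ θ σ * (κ 1 + σ+ + σ₋ - κ 2 * σ)

 module _ (s : Carrier) (θ-s : θ s ≈ s) where

  -- Two relations between neighbouring σ that supplement the Toda equation; n stands for the
  -- constant N. They hold at the start of the chain, and the steps below carry the pair from N to N
  -- + 1.
  EqI : Carrier -> Carrier -> Carrier -> Carrier -> Set
  EqI n σ₋ σ σ+ = σ ≈ θ σ * (κ 1 - s * (σ+ - σ₋ + κ 3 * n))

  rhsII : Carrier -> Carrier -> Carrier -> Carrier
  rhsII n σ σ+ = θ σ+ + θ σ + (n + σ+ - σ) * (n + σ+ - σ) + (n + κ 2) * (n + σ+ - σ) + σ + n * n + n + κ 1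

  EqII : Carrier -> Carrier -> Carrier -> Set
  EqII n σ σ+ = σ+ - σ ≈ s * rhsII n σ σ+

  θ-κ : ∀ n -> θ (κ n) ≈ 0#
  θ-κ n = θ-ι (Z.+ n)

  module _ {n : Carrier} (θ-n : θ n ≈ 0#) where

   θ-EqII : ∀ {σ σ+} -> EqII n σ σ+ -> θ σ+ - θ σ ≈ s * rhsII n σ σ+
    + s * (θ (θ σ+) + θ (θ σ) + (κ 2 * (n + σ+ - σ) + (n + κ 2)) * (θ σ+ - θ σ) + θ σ)
   θ-EqII {σ} {σ+} II = tra (≈-sym (θ-- σ+ σ)) (tra (θ-cong II) (tra (θ-* s (rhsII n σ σ+))
    (+-cong (*-cong θ-s rfl) (*-cong rfl θE))))
    where
    y = n + σ+ - σ
    θy : θ y ≈ θ σ+ - θ σ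
    θy = tra (θ-- (n + σ+) σ) (+-cong (tra (θ-+ n σ+) (tra (+-cong θ-n rfl) (+-idˡ _))) rfl)
    θnn : θ (n * n) ≈ 0#
    θnn = tra (θ-constˡ θ-n n) (tra (*-cong rfl θ-n) (zeroʳ n))
    θn2 : θ (n + κ 2) ≈ 0#
    θn2 = tra (θ-+ n (κ 2)) (tra (+-cong θ-n (θ-κ 2)) (+-idˡ 0#))
    θE : θ (rhsII n σ σ+) ≈ θ (θ σ+) + θ (θ σ) + (κ 2 * y + (n + κ 2)) * (θ σ+ - θ σ) + θ σ
    θE = tra (θ-+ _ (κ 1)) (tra (+-cong (tra (θ-+ _ n) (+-cong (tra (θ-+ _ (n * n)) (+-cong (tra (θ-+ _ σ)
     (+-cong (tra (θ-+ _ ((n + κ 2) * y)) (+-cong (tra (θ-+ _ (y * y)) (+-cong (θ-+ (θ σ+) (θ σ)) (tra (θ-sq y) (*-cong rfl (*-cong rfl θy)))))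
     (tra (θ-constˡ θn2 y) (*-cong rfl θy)))) rfl)) θnn)) θ-n)) (θ-κ 1))
     (tra (+-cong (+-cong (+-cong rfl (≈-sym ι-0)) (≈-sym ι-0)) (≈-sym ι-0))
     (solve 6 (\ a b y d m c -> a :+ b :+ con (Z.+ 2) :* (y :* d) :+ m :* d :+ c :+ con (Z.+ 0) :+ con (Z.+ 0) :+ con (Z.+ 0)
     := a :+ b :+ (con (Z.+ 2) :* y :+ m) :* d :+ c) rfl (θ (θ σ+)) (θ (θ σ)) y (θ σ+ - θ σ) (n + κ 2) (θ σ))))

   -- EqII minus its θ-derivative, added to EqI, has the first derivatives of the new relation; the
   -- two Toda equations remove the second derivatives of σ and σ₊.
   step-I : ∀ {σ₋ σ σ+ σ++} -> IsToda σ₋ σ σ+ -> IsToda σ σ+ σ++ -> EqI n σ₋ σ σ+ -> EqII n σ σ+ -> EqI (n + κ 1) σ σ+ σ++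
   step-I {σ₋} {σ} {σ+} {σ++} T T+ I II = x-y≈0⇒x≈y (tra identity vanish)
    where
    a = θ σ
    a+ = θ σ+
    E = rhsII n σ σ+
    p1 = (σ+ - σ) - s * E
    p2 = σ - a * (κ 1 - s * (σ+ - σ₋ + κ 3 * n))
    p3 = (a+ - a) - (s * E + s * (θ a+ + θ a + (κ 2 * (n + σ+ - σ) + (n + κ 2)) * (a+ - a) + a))
    q = θ a - a * (κ 1 + σ+ + σ₋ - κ 2 * σ)
    q+ = θ a+ - a+ * (κ 1 + σ++ + σ - κ 2 * σ+)
    identity : σ+ - a+ * (κ 1 - s * (σ++ - σ + κ 3 * (n + κ 1))) ≈ p1 + p2 - p3 - s * q - s * q+
    identity = solve 11 (\ s n σ₋ σ σ+ σ++ a a+ t t+ E ->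
     σ+ :- a+ :* (con (Z.+ 1) :- s :* (σ++ :- σ :+ con (Z.+ 3) :* (n :+ con (Z.+ 1))))
     := ((σ+ :- σ) :- s :* E) :+ (σ :- a :* (con (Z.+ 1) :- s :* (σ+ :- σ₋ :+ con (Z.+ 3) :* n)))
     :- ((a+ :- a) :- (s :* E :+ s :* (t+ :+ t :+ (con (Z.+ 2) :* (n :+ σ+ :- σ) :+ (n :+ con (Z.+ 2))) :* (a+ :- a) :+ a)))
     :- s :* (t :- a :* (con (Z.+ 1) :+ σ+ :+ σ₋ :- con (Z.+ 2) :* σ))
     :- s :* (t+ :- a+ :* (con (Z.+ 1) :+ σ++ :+ σ :- con (Z.+ 2) :* σ+)))
     rfl s n σ₋ σ σ+ σ++ a a+ (θ a) (θ a+) E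
    vanish : p1 + p2 - p3 - s * q - s * q+ ≈ 0#
    vanish = tra (+-cong (+-cong (+-cong (+-cong (≈⇒-≈0 II) (≈⇒-≈0 I)) (-‿cong (≈⇒-≈0 (θ-EqII II))))
     (-‿cong (*-cong rfl (≈⇒-≈0 T)))) (-‿cong (*-cong rfl (≈⇒-≈0 T+))))
     (tra (+-cong (+-cong (+-cong (+-cong (≈-sym ι-0) (≈-sym ι-0)) (-‿cong (≈-sym ι-0))) (-‿cong (*-cong rfl (≈-sym ι-0)))) (-‿cong (*-cong rfl (≈-sym ι-0))))
     (tra (solve 1 (\ s -> con (Z.+ 0) :+ con (Z.+ 0) :- con (Z.+ 0) :- s :* con (Z.+ 0) :- s :* con (Z.+ 0) := con (Z.+ 0)) rfl s) ι-0))

   -- Differentiating the new EqI and removing θ²σ₊ by Toda leaves θσ₊ times a bracket. That bracket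
   -- is exactly the difference between EqII at n and at n + 1, and θσ₊ may be cancelled.
   step-II : ∀ {σ σ+ σ++} -> (∀ x -> θ σ+ * x ≈ 0# -> x ≈ 0#) -> IsToda σ σ+ σ++ ->
    EqII n σ σ+ -> EqI (n + κ 1) σ σ+ σ++ -> EqII (n + κ 1) σ+ σ++
   step-II {σ} {σ+} {σ++} cancel T II I = x-y≈0⇒x≈y (tra identity
    (tra (+-cong (≈⇒-≈0 II) (-‿cong (cancel br br≈0))) (tra (+-cong (≈-sym ι-0) (-‿cong (≈-sym ι-0)))
    (tra (solve 0 (con (Z.+ 0) :- con (Z.+ 0) := con (Z.+ 0)) rfl) ι-0))))
    where
    a = θ σ
    a+ = θ σ+
    a++ = θ σ++
    Σ = σ++ - σ + κ 3 * (n + κ 1)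
    w = κ 1 + σ++ + σ - κ 2 * σ+
    br = κ 1 - w * (κ 1 - s * Σ) + s * (Σ + (a++ - a))
    θn3 : θ (κ 3 * (n + κ 1)) ≈ 0#
    θn3 = tra (θ-constˡ (θ-κ 3) _) (tra (*-cong rfl (tra (θ-+ n (κ 1)) (tra (+-cong θ-n (θ-κ 1)) (+-idˡ 0#)))) (zeroʳ _))
    θΣ : θ Σ ≈ a++ - a
    θΣ = tra (θ-+ (σ++ - σ) _) (tra (+-cong (θ-- σ++ σ) θn3) (+-idʳ _))
    θI : a+ ≈ θ a+ * (κ 1 - s * Σ) + a+ * (0# - (s * Σ + s * (a++ - a)))
    θI = tra (θ-cong I) (tra (θ-* a+ (κ 1 - s * Σ)) (+-cong rfl (*-cong rfl (tra (θ-- (κ 1) (s * Σ))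
     (+-cong (θ-κ 1) (-‿cong (tra (θ-* s Σ) (+-cong (*-cong θ-s rfl) (*-cong rfl θΣ)))))))))
    br≈0 : a+ * br ≈ 0#
    br≈0 = tra (solve 6 (\ s a+ w Σ d t ->
     a+ :* (con (Z.+ 1) :- w :* (con (Z.+ 1) :- s :* Σ) :+ s :* (Σ :+ d))
     := (a+ :- (t :* (con (Z.+ 1) :- s :* Σ) :+ a+ :* (con (Z.+ 0) :- (s :* Σ :+ s :* d)))) :+ (t :- a+ :* w) :* (con (Z.+ 1) :- s :* Σ))
     rfl s a+ w Σ (a++ - a) (θ a+))
     (tra (+-cong (≈⇒-≈0 (tra θI (+-cong rfl (*-cong rfl (+-cong (≈-sym ι-0) rfl))))) (*-cong (≈⇒-≈0 T) rfl))
     (tra (+-cong rfl (zeroˡ _)) (+-idˡ 0#)))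
    identity : (σ++ - σ+) - s * rhsII (n + κ 1) σ+ σ++ ≈ ((σ+ - σ) - s * rhsII n σ σ+) - br
    identity = solve 8 (\ s n σ σ+ σ++ a a+ a++ ->
     let y+ = n :+ con (Z.+ 1) :+ σ++ :- σ+
         y = n :+ σ+ :- σ
         Σ = σ++ :- σ :+ con (Z.+ 3) :* (n :+ con (Z.+ 1))
         w = con (Z.+ 1) :+ σ++ :+ σ :- con (Z.+ 2) :* σ+ in
      (σ++ :- σ+) :- s :* (a++ :+ a+ :+ y+ :* y+ :+ (n :+ con (Z.+ 1) :+ con (Z.+ 2)) :* y+ :+ σ+ :+ (n :+ con (Z.+ 1)) :* (n :+ con (Z.+ 1)) :+ (n :+ con (Z.+ 1)) :+ con (Z.+ 1))
     := ((σ+ :- σ) :- s :* (a+ :+ a :+ y :* y :+ (n :+ con (Z.+ 2)) :* y :+ σ :+ n :* n :+ n :+ con (Z.+ 1)))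
      :- (con (Z.+ 1) :- w :* (con (Z.+ 1) :- s :* Σ) :+ s :* (Σ :+ (a++ :- a))))
     rfl s n σ σ+ σ++ a a+ a++

  -- K is the differential equation to be proved and P its potential, with θP = 2 (θσ + θ²σ) K. The
  -- combination Q = 2 θσ K - P is what the chain relations kill directly once both neighbours are
  -- eliminated.
  Qform Kform Pform : Carrier -> Carrier -> Carrier
  Qform n σ = let a = θ σ; a1 = θ a; a2 = θ a1 in
   s * s * (κ 2 * (a * a2) - a1 * a1 + κ 2 * (a * a1) + a * a + κ 8 * (a * a * a) + κ 4 * (σ * (a * a)) + κ 3 * (n * n * (a * a)))
    + κ 6 * (n * s * (a * a)) + σ * σ - a * a
  Kform n σ = let a = θ σ; a1 = θ a; a2 = θ a1 in
   s * s * (κ 3 * (n * n * a) + a + κ 2 * a1 + a2 + κ 4 * (σ * a) + κ 6 * (a * a)) + κ 3 * (n * s * (κ 2 * a + σ)) + κ 2 * (n * n * n * s) - a - σ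
  Pform n σ = let a = θ σ; α = s * a; p = s * (a + θ a); w = a + σ in
   p * p + κ 4 * (α * α * w) + κ 3 * (n * n * (α * α)) + κ 4 * (n * n * n * α) + κ 6 * (n * (α * w)) - w * w

  QKP : ∀ n σ -> κ 2 * (θ σ * Kform n σ) - Pform n σ ≈ Qform n σ
  QKP n σ = solve 6 (\ s n σ a a1 a2 ->
   con (Z.+ 2) :* (a :* (s :* s :* (con (Z.+ 3) :* (n :* n :* a) :+ a :+ con (Z.+ 2) :* a1 :+ a2 :+ con (Z.+ 4) :* (σ :* a) :+ con (Z.+ 6) :* (a :* a))
   :+ con (Z.+ 3) :* (n :* s :* (con (Z.+ 2) :* a :+ σ)) :+ con (Z.+ 2) :* (n :* n :* n :* s) :- a :- σ))
   :- ((s :* (a :+ a1)) :* (s :* (a :+ a1)) :+ con (Z.+ 4) :* ((s :* a) :* (s :* a) :* (a :+ σ)) :+ con (Z.+ 3) :* (n :* n :* ((s :* a) :* (s :* a)))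
   :+ con (Z.+ 4) :* (n :* n :* n :* (s :* a)) :+ con (Z.+ 6) :* (n :* ((s :* a) :* (a :+ σ))) :- (a :+ σ) :* (a :+ σ))
   := s :* s :* (con (Z.+ 2) :* (a :* a2) :- a1 :* a1 :+ con (Z.+ 2) :* (a :* a1) :+ a :* a :+ con (Z.+ 8) :* (a :* a :* a) :+ con (Z.+ 4) :* (σ :* (a :* a)) :+ con (Z.+ 3) :* (n :* n :* (a :* a)))
   :+ con (Z.+ 6) :* (n :* s :* (a :* a)) :+ σ :* σ :- a :* a)
   rfl s n σ (θ σ) (θ (θ σ)) (θ (θ (θ σ)))

  θ-Pform : ∀ {n} -> θ n ≈ 0# -> ∀ σ -> θ (Pform n σ) ≈ κ 2 * ((θ σ + θ (θ σ)) * Kform n σ)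
  θ-Pform {n} θ-n σ = tra expand (solve 6 (\ s n σ a a1 a2 ->
    let α = s :* a ; p = s :* (a :+ a1) ; w = a :+ σ ; p' = p :+ s :* (a1 :+ a2) ; w' = a1 :+ a in
    con (Z.+ 2) :* (p :* p') :+ con (Z.+ 4) :* (con (Z.+ 2) :* (α :* p) :* w :+ α :* α :* w') :+ con (Z.+ 3) :* (n :* n :* (con (Z.+ 2) :* (α :* p)))
     :+ con (Z.+ 4) :* (n :* n :* n :* p) :+ con (Z.+ 6) :* (n :* (p :* w :+ α :* w')) :- con (Z.+ 2) :* (w :* w')
   := con (Z.+ 2) :* ((a :+ a1) :* (s :* s :* (con (Z.+ 3) :* (n :* n :* a) :+ a :+ con (Z.+ 2) :* a1 :+ a2 :+ con (Z.+ 4) :* (σ :* a) :+ con (Z.+ 6) :* (a :* a))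
    :+ con (Z.+ 3) :* (n :* s :* (con (Z.+ 2) :* a :+ σ)) :+ con (Z.+ 2) :* (n :* n :* n :* s) :- a :- σ)))
   rfl s n σ a a1 (θ a1))
   where
   a = θ σ
   a1 = θ a
   α = s * a
   p = s * (a + a1)
   w = a + σ
   p' = p + s * (a1 + θ a1)
   w' = a1 + a
   θα : θ α ≈ p
   θα = tra (θ-* s a) (tra (+-cong (*-cong θ-s rfl) rfl) (≈-sym (distribˡ s a a1)))
   θp : θ p ≈ p'
   θp = tra (θ-* s (a + a1)) (+-cong (*-cong θ-s rfl) (*-cong rfl (θ-+ a a1)))
   θw : θ w ≈ w'
   θw = θ-+ a σ
   θαα : θ (α * α) ≈ κ 2 * (α * p)
   θαα = tra (θ-sq α) (*-cong rfl (*-cong rfl θα))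
   θnn : θ (n * n) ≈ 0#
   θnn = tra (θ-constˡ θ-n n) (tra (*-cong rfl θ-n) (zeroʳ n))
   θnnn : θ (n * n * n) ≈ 0#
   θnnn = tra (θ-constˡ θnn n) (tra (*-cong rfl θ-n) (zeroʳ _))
   expand : θ (Pform n σ) ≈ κ 2 * (p * p') + κ 4 * (κ 2 * (α * p) * w + α * α * w') + κ 3 * (n * n * (κ 2 * (α * p)))
    + κ 4 * (n * n * n * p) + κ 6 * (n * (p * w + α * w')) - κ 2 * (w * w')
   expand = tra (θ-- _ (w * w)) (+-cong (tra (θ-+ _ _) (+-cong (tra (θ-+ _ _) (+-cong (tra (θ-+ _ _) (+-cong (tra (θ-+ _ _) (+-cong
    (tra (θ-sq p) (*-cong rfl (*-cong rfl θp)))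
    (tra (θ-constˡ (θ-κ 4) _) (*-cong rfl (tra (θ-* (α * α) w) (+-cong (*-cong θαα rfl) (*-cong rfl θw)))))))
    (tra (θ-constˡ (θ-κ 3) _) (*-cong rfl (tra (θ-constˡ θnn _) (*-cong rfl θαα))))))
    (tra (θ-constˡ (θ-κ 4) _) (*-cong rfl (tra (θ-constˡ θnnn _) (*-cong rfl θα))))))
    (tra (θ-constˡ (θ-κ 6) _) (*-cong rfl (tra (θ-constˡ θ-n _) (*-cong rfl (tra (θ-* α w) (+-cong (*-cong θα rfl) (*-cong rfl θw)))))))))
    (-‿cong (tra (θ-sq w) (*-cong rfl (*-cong rfl θw)))))

  -- Toda, its derivative and EqI remove θ³σ, θ²σ and σ² from Q. What remains is s (θσ)² times a
  -- bracket equal to -2 times the sum of EqII on both sides of σ.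
  Q-vanishes : ∀ {m σ₋ σ σ+} -> IsToda σ₋ σ σ+ -> EqI (m + κ 1) σ₋ σ σ+ ->
   EqII m σ₋ σ -> EqII (m + κ 1) σ σ+ -> Qform (m + κ 1) σ ≈ 0#
  Q-vanishes {m} {σ₋} {σ} {σ+} T I II₋ II = tra substituted (tra (+-cong (+-cong (+-cong
   (*-cong rfl (≈⇒-≈0 T2)) (*-cong rfl (≈⇒-≈0 T))) (*-cong rfl (≈⇒-≈0 I))) (*-cong rfl brack))
   (tra (+-cong (+-cong (+-cong (zeroʳ _) (zeroʳ _)) (zeroʳ _)) (zeroʳ _)) (tra (+-idʳ _) (tra (+-idʳ _) (+-idʳ _)))))
   where
   n = m + κ 1
   a = θ σ
   a₋ = θ σ₋
   a+ = θ σ+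
   w = κ 1 + σ+ + σ₋ - κ 2 * σ
   d = a+ + a₋ - κ 2 * a
   Σ = σ+ - σ₋ + κ 3 * n
   T2 : θ (θ a) ≈ θ a * w + a * d
   T2 = tra (θ-cong T) (tra (θ-* a w) (+-cong rfl (*-cong rfl
    (tra (θ-- _ (κ 2 * σ)) (+-cong (tra (θ-+ _ σ₋) (+-cong (tra (θ-+ (κ 1) σ+) (tra (+-cong (θ-κ 1) rfl) (+-idˡ _))) rfl)) (-‿cong (θ-constˡ (θ-κ 2) σ)))))))
   B : Carrier
   B = s * (w * w + κ 2 * d + κ 2 * w + κ 1 + κ 8 * a + κ 4 * σ + κ 3 * (n * n) + Σ * Σ) + κ 6 * n - κ 2 * Σ
   substituted : Qform n σ ≈ (κ 2 * (s * s * a)) * (θ (θ a) - (θ a * w + a * d))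
    + (s * s * (κ 2 * (a * w) - (θ a - a * w) - κ 2 * (a * w) + κ 2 * a)) * (θ a - a * w)
    + (σ + a * (κ 1 - s * Σ)) * (σ - a * (κ 1 - s * Σ)) + (s * (a * a)) * B
   substituted = solve 9 (\ s n σ a a1 a2 w d Σ ->
    s :* s :* (con (Z.+ 2) :* (a :* a2) :- a1 :* a1 :+ con (Z.+ 2) :* (a :* a1) :+ a :* a :+ con (Z.+ 8) :* (a :* a :* a) :+ con (Z.+ 4) :* (σ :* (a :* a)) :+ con (Z.+ 3) :* (n :* n :* (a :* a)))
    :+ con (Z.+ 6) :* (n :* s :* (a :* a)) :+ σ :* σ :- a :* a
    := (con (Z.+ 2) :* (s :* s :* a)) :* (a2 :- (a1 :* w :+ a :* d))
    :+ (s :* s :* (con (Z.+ 2) :* (a :* w) :- (a1 :- a :* w) :- con (Z.+ 2) :* (a :* w) :+ con (Z.+ 2) :* a)) :* (a1 :- a :* w)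
    :+ (σ :+ a :* (con (Z.+ 1) :- s :* Σ)) :* (σ :- a :* (con (Z.+ 1) :- s :* Σ))
    :+ (s :* (a :* a)) :* (s :* (w :* w :+ con (Z.+ 2) :* d :+ con (Z.+ 2) :* w :+ con (Z.+ 1) :+ con (Z.+ 8) :* a :+ con (Z.+ 4) :* σ :+ con (Z.+ 3) :* (n :* n) :+ Σ :* Σ) :+ con (Z.+ 6) :* n :- con (Z.+ 2) :* Σ))
    rfl s n σ a (θ a) (θ (θ a)) w d Σ
   brack : B ≈ 0#
   brack = tra (solve 8 (\ s m σ₋ σ σ+ a₋ a a+ ->
     let n = m :+ con (Z.+ 1)
         w = con (Z.+ 1) :+ σ+ :+ σ₋ :- con (Z.+ 2) :* σ
         d = a+ :+ a₋ :- con (Z.+ 2) :* a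
         Σ = σ+ :- σ₋ :+ con (Z.+ 3) :* n
         y = n :+ σ+ :- σ
         x = m :+ σ :- σ₋ in
     s :* (w :* w :+ con (Z.+ 2) :* d :+ con (Z.+ 2) :* w :+ con (Z.+ 1) :+ con (Z.+ 8) :* a :+ con (Z.+ 4) :* σ :+ con (Z.+ 3) :* (n :* n) :+ Σ :* Σ) :+ con (Z.+ 6) :* n :- con (Z.+ 2) :* Σ
     := :- con (Z.+ 2) :* (((σ+ :- σ) :- s :* (a+ :+ a :+ y :* y :+ (n :+ con (Z.+ 2)) :* y :+ σ :+ n :* n :+ n :+ con (Z.+ 1)))
      :+ ((σ :- σ₋) :- s :* (a :+ a₋ :+ x :* x :+ (m :+ con (Z.+ 2)) :* x :+ σ₋ :+ m :* m :+ m :+ con (Z.+ 1)))))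
     rfl s m σ₋ σ σ+ a₋ a a+)
    (tra (*-cong rfl (tra (+-cong (≈⇒-≈0 II) (≈⇒-≈0 II₋)) (+-idˡ 0#))) (zeroʳ _))

  module _ {c Z Z+ Z₋ σ σ+ σ₋ : Carrier} (θ-c : θ c ≈ c)
       (eZ : θ Z ≈ Z * σ) (eZ+ : θ Z+ ≈ Z+ * σ+) (eZ₋ : θ Z₋ ≈ Z₋ * σ₋)
       (toda : c * (Z+ * Z₋) ≈ Z * θ (θ Z) - θ Z * θ Z) where

   toda-σ : c * (Z+ * Z₋) ≈ Z * Z * θ σ
   toda-σ = tra toda (tra (+-cong (*-cong rfl (tra (θ-cong eZ) (tra (θ-* Z σ) (+-cong (*-cong eZ rfl) rfl)))) (-‿cong (*-cong eZ eZ)))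
    (solve 3 (\ z u a -> z :* (z :* u :* u :+ z :* a) :- (z :* u) :* (z :* u) := z :* z :* a) rfl Z σ (θ σ)))

   toda⇒IsToda : (∀ x y -> Z * Z * x ≈ Z * Z * y -> x ≈ y) -> IsToda σ₋ σ σ+
   toda⇒IsToda cancel = cancel _ _ (x-y≈0⇒x≈y (tra
    (solve 9 (\ c z z+ z₋ u u+ u₋ a t ->
    z :* z :* t :- z :* z :* (a :* (con (Z.+ 1) :+ u+ :+ u₋ :- con (Z.+ 2) :* u))
    := (con (Z.+ 2) :* (z :* (z :* u)) :* a :+ z :* z :* t :- (c :* (z+ :* z₋) :+ c :* (z+ :* u+ :* z₋ :+ z+ :* (z₋ :* u₋))))
    :+ (con (Z.+ 1) :+ u+ :+ u₋) :* (c :* (z+ :* z₋) :- z :* z :* a))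
    rfl c Z Z+ Z₋ σ σ+ σ₋ (θ σ) (θ (θ σ)))
    (tra (+-cong (≈⇒-≈0 (≈-sym differentiated)) (*-cong rfl (≈⇒-≈0 toda-σ))) (tra (+-cong rfl (zeroʳ _)) (+-idˡ 0#)))))
    where
    differentiated : c * (Z+ * Z₋) + c * (Z+ * σ+ * Z₋ + Z+ * (Z₋ * σ₋)) ≈ κ 2 * (Z * (Z * σ)) * θ σ + Z * Z * θ (θ σ)
    differentiated = tra (≈-sym (tra (θ-* c (Z+ * Z₋)) (+-cong (*-cong θ-c rfl) (*-cong rfl (tra (θ-* Z+ Z₋) (+-cong (*-cong eZ+ rfl) (*-cong rfl eZ₋)))))))
     (tra (θ-cong toda-σ) (tra (θ-* (Z * Z) (θ σ)) (+-cong (*-cong (tra (θ-sq Z) (*-cong rfl (*-cong rfl eZ))) rfl) rfl)))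

  -- The logarithmic derivative of f = 1 + s (θ + 1) f satisfies a Riccati equation.
  riccati : ∀ {f σ} -> θ f ≈ f * σ -> f ≈ κ 1 + s * (θ f + f) -> (∀ x -> f * x ≈ 0# -> x ≈ 0#) ->
   σ ≈ s * (θ σ + σ * σ + κ 2 * σ + κ 1)
  riccati {f} {σ} ef eq cancel = x-y≈0⇒x≈y (cancel _ (tra
   (solve 4 (\ s f u a -> f :* (u :- s :* (a :+ u :* u :+ con (Z.+ 2) :* u :+ con (Z.+ 1)))
   := f :* u :- (s :* (f :* u :+ f) :+ s :* (f :* u :* u :+ f :* a :+ f :* u))) rfl s f σ (θ σ))
   (≈⇒-≈0 differentiated)))
   where
   differentiated : f * σ ≈ s * (f * σ + f) + s * (f * σ * σ + f * θ σ + f * σ)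
   differentiated = tra (≈-sym ef) (tra (θ-cong (tra eq (+-cong rfl (*-cong rfl (+-cong ef rfl))))) (tra (θ-+ (κ 1) _)
    (tra (+-cong (θ-κ 1) (tra (θ-* s (f * σ + f)) (+-cong (*-cong θ-s rfl) (*-cong rfl (tra (θ-+ (f * σ) f)
    (+-cong (tra (θ-* f σ) (+-cong (*-cong ef rfl) rfl)) ef))))))
    (+-idˡ _))))

  EqII-base : ∀ {σ0 σ1} -> σ0 ≈ 0# -> σ1 ≈ s * (θ σ1 + σ1 * σ1 + κ 2 * σ1 + κ 1) -> EqII (κ 0) σ0 σ1
  EqII-base {σ0} {σ1} z r = x-y≈0⇒x≈y (tra
   (solve 5 (\ s u0 u1 a0 a1 ->
   (u1 :- u0) :- s :* (a1 :+ a0 :+ (con (Z.+ 0) :+ u1 :- u0) :* (con (Z.+ 0) :+ u1 :- u0) :+ (con (Z.+ 0) :+ con (Z.+ 2)) :* (con (Z.+ 0) :+ u1 :- u0)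
   :+ u0 :+ con (Z.+ 0) :* con (Z.+ 0) :+ con (Z.+ 0) :+ con (Z.+ 1))
   := (u1 :- s :* (a1 :+ u1 :* u1 :+ con (Z.+ 2) :* u1 :+ con (Z.+ 1))) :+ (:- s) :* a0 :+ (:- con (Z.+ 1) :- s :* (u0 :- con (Z.+ 2) :* u1 :- con (Z.+ 1))) :* u0)
   rfl s σ0 σ1 (θ σ0) (θ σ1))
   (tra (+-cong (+-cong (≈⇒-≈0 r) (*-cong rfl (tra (θ-cong z) θ-0))) (*-cong rfl z))
   (tra (+-cong (+-cong rfl (zeroʳ _)) (zeroʳ _)) (tra (+-idʳ _) (+-idʳ _)))))

  EqI-base : ∀ {n σ₋ σ0 σ1} -> σ0 ≈ 0# -> EqI n σ₋ σ0 σ1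
  EqI-base z = tra z (≈-sym (tra (*-cong (tra (θ-cong z) θ-0) rfl) (zeroˡ _)))

  IsToda-base : ∀ {σ₋ σ0 σ1} -> σ0 ≈ 0# -> IsToda σ₋ σ0 σ1
  IsToda-base z = tra (θ-cong (tra (θ-cong z) θ-0)) (tra θ-0 (≈-sym (tra (*-cong (tra (θ-cong z) θ-0) rfl) (zeroˡ _))))

-- The differential equation for θ log Z_N

module KP (J : NumberField) where

 open FieldProperties J using (F; nat; nat-+; int-0; int-1; nat-suc; nat-suc≢0; cancel-≢0)
 private module J = FieldProperties J
 open Series J
 open Toda J using (Z; ν; toda; rf; rf-suc)
 open Sums J
 open PermSums J

 seriesDifferential : DifferentialAlgebra
 seriesDifferential = record
  { algebra = serAlg
  ; θ = ϑ
  ; θ-cong = ϑ-cong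
  ; θ-+ = ϑ-⊕
  ; θ-* = ϑ-·
  ; θ-ι = \ i -> ϑ-const _
  }

 open DifferentialProperties seriesDifferential hiding (_≈_)
 open Chain seriesDifferential

 fix-1 : ∀ {n} {σ : Word n} -> Perm σ -> Insertion.fix J 1 σ ≡ J.1#
 fix-1 {zero} {[]} p = by (J.+-idʳ _) (ind-yes (act {A = Fin 1} {n = zero} [] [] ≟ᵥ []) refl)
 fix-1 {suc n} {v} p with Perm-decompose p
 ... | σ , t , pσ , refl = by (Insertion.fix-lift-sw J 1 σ t) (by (cong₂ J._*_ (wt-1 t) (fix-1 pσ)) (J.*-idˡ _))
  where
  wt-1 : ∀ t -> Insertion.wt J 1 {n} t ≡ J.1#
  wt-1 zero = int-1
  wt-1 (suc t) = refl

 permCount : ℕ -> F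
 permCount n = ∑ (perms n) (\ _ -> J.1#)

 permCount-suc : ∀ n -> permCount (suc n) ≡ nat (suc n) J.* permCount n
 permCount-suc n = by (∑-perms-suc n _) (by (∑-cong (perms n) (\ _ -> by (∑-length (allFin (suc n)))
  (by (cong nat (LP.length-tabulate {n = suc n} id)) (sym (J.*-idʳ _))))) (∑-*ˡ (perms n) (nat (suc n)) _))

 rf-permCount : ∀ n -> rf n J.* permCount n ≡ J.1#
 rf-permCount zero = by (J.*-idˡ _) (J.+-idʳ _)
 rf-permCount (suc n) = by (cong (rf (suc n) J.*_) (permCount-suc n)) (by
  (S.solve 3 (\ r f p -> r S.:* (f S.:* p) S.:= (f S.:* r) S.:* p) refl (rf (suc n)) (nat (suc n)) (permCount n))
  (by (cong (J._* permCount n) (rf-suc n)) (rf-permCount n)))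
  where module S = J.Solver

 -- With a single colour each of the (n!)² pairs has weight 1, so Z₁ = Σ n! sⁿ.
 Z-1 : ∀ n -> Z 1 n ≡ permCount n
 Z-1 n = by (cong (rf n J.*_) (by (∑-cong-∈ (perms n) (\ {σ0} σ0∈ -> ∑-cong-∈ (perms n) (\ {σ1} σ1∈ ->
  by (cong₂ J._*_ (cong₂ J._*_ (fix-1 (∈-perms⁻ σ0∈)) (fix-1 (∈-perms⁻ σ1∈))) (fix-1 (Perm-compose {σ = σ0} {σ1} (∈-perms⁻ σ0∈) (∈-perms⁻ σ1∈))))
  (by (cong (J._* J.1#) (J.*-idˡ J.1#)) (J.*-idˡ J.1#))))) (by (∑-cong (perms n) (\ _ -> sym (J.*-idʳ (permCount n)))) (∑-*ˡ (perms n) (permCount n) _))))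
  (by (sym (J.*-assoc _ _ _)) (by (cong (J._* permCount n) (rf-permCount n)) (J.*-idˡ _)))

 Z-head : ∀ N -> Z N 0 ≡ J.1#
 Z-head N = by (J.*-idˡ _) (by (cong₂ (\ o z -> (o J.+ z) J.* (o J.+ z) J.* (o J.+ z) J.+ z J.+ z)
  (by (ind-yes (act {A = Fin N} {n = zero} [] [] ≟ᵥ []) refl) (sym int-1)) (sym int-0))
  (by (S.solve 0 ((o S.:+ z) S.:* (o S.:+ z) S.:* (o S.:+ z) S.:+ z S.:+ z S.:= o) refl) int-1))
  where
  module S = J.Solver
  o z : ∀ {n} -> S.Polynomial n
  o = S.con (Z.+ 1)
  z = S.con (Z.+ 0)

 Z-0 : Z 0 ≈ 𝟙
 Z-0 zero = Z-head 0
 Z-0 (suc n) = by (cong (rf (suc n) J.*_) (∑-≡0 (perms (suc n)) (\ _ -> ∑-≡0 (perms (suc n)) (\ _ -> J.zeroʳ _)))) (J.zeroʳ _)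

 Z-order : ∀ N -> HasOrder 0 (Z N)
 Z-order N = record { below = \ _ () ; leading = \ q -> nat-suc≢0 0 (by int-1 (by (sym (Z-head N)) q)) }

 ·-low : ∀ a b k -> (∀ j -> j N.< k -> b j ≡ J.0#) -> (a · b) k ≡ a 0 J.* b k
 ·-low a b zero q = refl
 ·-low a b (suc k) q = by (·-suc a b k) (by (cong (a 0 J.* b (suc k) J.+_) (sumTo-0 k (\ j j≤k ->
  by (cong (a (suc j) J.*_) (q (k ∸ j) (s≤s (NP.m∸n≤m k j)))) (J.zeroʳ _)))) (J.+-idʳ _))

 arrange : ∀ v k t p -> (v J.* (k J.+ J.- t)) J.* p ≡ v J.* (k J.* p) J.+ J.- ((t J.* v) J.* p)
 arrange = S.solve 4 (\ v k t p -> (v S.:* (k S.:+ S.:- t)) S.:* p S.:= v S.:* (k S.:* p) S.:+ S.:- ((t S.:* v) S.:* p)) refl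
  where module S = J.Solver

 cube-identity : ∀ m -> J.int (Z.+ 4) J.* (m J.* m J.* m J.* (m J.* m J.* m)) J.+ J.- ((m J.* m J.* m J.+ m J.* m J.* m) J.* (m J.* m J.* m J.+ m J.* m J.* m)) ≡ J.0#
 cube-identity m = by (S.solve 1 (\ m -> S.con (Z.+ 4) S.:* (m S.:* m S.:* m S.:* (m S.:* m S.:* m)) S.:+ S.:- ((m S.:* m S.:* m S.:+ m S.:* m S.:* m) S.:* (m S.:* m S.:* m S.:+ m S.:* m S.:* m))
  S.:= S.con (Z.+ 0)) refl m) int-0
  where module S = J.Solver

 module _ (σ : ℕ -> Ser) (logDeriv : ∀ N -> ϑ (Z N) ≈ Z N · σ N) where

  nn : ℕ -> Ser
  nn zero = κ 0
  nn (suc N) = nn N ⊕ κ 1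

  nn-ν : ∀ N -> nn N ≈ ν N
  nn-ν zero k = refl
  nn-ν (suc N) zero = by (cong (J._+ J.int (Z.+ 1)) (nn-ν N 0)) (by (sym (nat-+ N 1)) (cong nat (NP.+-comm N 1)))
  nn-ν (suc N) (suc k) = by (cong (J._+ J.0#) (nn-ν N (suc k))) (J.+-idʳ _)

  ϑ-nn : ∀ N -> ϑ (nn N) ≈ 𝟘
  ϑ-nn N = tra (ϑ-cong (nn-ν N)) (ϑ-const _)

  cancelZZ : ∀ N x y -> Z N · Z N · x ≈ Z N · Z N · y -> x ≈ y
  cancelZZ N x y q = ·-cancelˡ 0 (Z-order N) x y (·-cancelˡ 0 (Z-order N) (Z N · x) (Z N · y)
   (tra (≈-sym (·-assoc (Z N) (Z N) x)) (tra q (·-assoc (Z N) (Z N) y))))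

  coupling : ℕ -> Ser
  coupling M = X · (ν (suc M) · ν (suc M) · ν (suc M))

  ϑ-coupling : ∀ M -> ϑ (coupling M) ≈ coupling M
  ϑ-coupling M = tra (ϑ-· X n³) (tra (+-cong (*-cong ϑ-X (rfl {n³})) (*-cong (rfl {X}) ϑn³)) (tra (+-cong (rfl {X · n³}) (zeroʳ X)) (+-idʳ (X · n³))))
   where
   n = ν (suc M)
   n³ = n · n · n
   ϑn : ϑ n ≈ 𝟘
   ϑn = ϑ-const _
   ϑn³ : ϑ n³ ≈ 𝟘
   ϑn³ = tra (θ-constˡ {n · n} (tra (θ-constˡ {n} ϑn n) (tra (*-cong (rfl {n}) ϑn) (zeroʳ n))) n) (tra (*-cong (rfl {n · n}) ϑn) (zeroʳ (n · n)))

  σ-toda : ∀ M -> coupling M · (Z (suc (suc M)) · Z M) ≈ Z (suc M) · Z (suc M) · ϑ (σ (suc M))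
  σ-toda M = toda-σ X ϑ-X {coupling M} {Z (suc M)} {Z (suc (suc M))} {Z M} {σ (suc M)} {σ (suc (suc M))} {σ M} (ϑ-coupling M) (logDeriv (suc M)) (logDeriv (suc (suc M))) (logDeriv M) (toda M)

  isToda : ∀ M -> IsToda (σ M) (σ (suc M)) (σ (suc (suc M)))
  isToda M = toda⇒IsToda X ϑ-X {coupling M} {Z (suc M)} {Z (suc (suc M))} {Z M} {σ (suc M)} {σ (suc (suc M))} {σ M} (ϑ-coupling M) (logDeriv (suc M)) (logDeriv (suc (suc M))) (logDeriv M) (toda M) (cancelZZ (suc M))

  ϑσ-head : ∀ N -> ϑ (σ N) 0 ≡ J.0#
  ϑσ-head N = by (cong (J._* σ N 0) int-0) (J.zeroˡ _)

  ϑσ-1 : ∀ M -> ϑ (σ (suc M)) 1 ≡ nat (suc M) J.* nat (suc M) J.* nat (suc M)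
  ϑσ-1 M = begin
   ϑ (σ N) 1 ≡⟨ J.*-idˡ _ ⟨
   J.1# J.* ϑ (σ N) 1 ≡⟨ cong (J._* ϑ (σ N) 1) (by (cong₂ J._*_ (Z-head N) (Z-head N)) (J.*-idˡ J.1#)) ⟨
   (Z N · Z N) 0 J.* ϑ (σ N) 1 ≡⟨ ·-low (Z N · Z N) (ϑ (σ N)) 1 (\ { zero _ -> ϑσ-head N ; (suc j) (s≤s ()) }) ⟨
   (Z N · Z N · ϑ (σ N)) 1 ≡⟨ σ-toda M 1 ⟨
   (coupling M · (Z (suc N) · Z M)) 1 ≡⟨ ·-assoc X (ν N · ν N · ν N) (Z (suc N) · Z M) 1 ⟩
   (X · (ν N · ν N · ν N · (Z (suc N) · Z M))) 1 ≡⟨ X·-suc (ν N · ν N · ν N · (Z (suc N) · Z M)) 0 ⟩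
   nat N J.* nat N J.* nat N J.* (Z (suc N) 0 J.* Z M 0)
   ≡⟨ cong (nat N J.* nat N J.* nat N J.*_) (by (cong₂ J._*_ (Z-head (suc N)) (Z-head M)) (J.*-idˡ J.1#)) ⟩
   nat N J.* nat N J.* nat N J.* J.1# ≡⟨ J.*-idʳ _ ⟩
   nat N J.* nat N J.* nat N ∎
   where
   open ≡.≡-Reasoning
   N = suc M

  cube≢0 : ∀ M -> ¬ nat (suc M) J.* nat (suc M) J.* nat (suc M) ≡ J.0#
  cube≢0 M q with J.*-≡0 _ _ q
  ... | inj₂ e = nat-suc≢0 M e
  ... | inj₁ e with J.*-≡0 _ _ e
  ... | inj₁ e' = nat-suc≢0 M e'
  ... | inj₂ e' = nat-suc≢0 M e'

  -- Z_N starts as 1 + N³ s, so θσ starts as N³ s. This nonzero coefficient is what allows θσ to be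
  -- cancelled, both along the chain and in 2 θσ K = P.
  ϑσ-order : ∀ M -> HasOrder 1 (ϑ (σ (suc M)))
  ϑσ-order M = record
   { below = \ { zero _ -> ϑσ-head (suc M) ; (suc j) (s≤s ()) }
   ; leading = \ q -> cube≢0 M (by (sym (ϑσ-1 M)) q) }

  σ-0 : σ 0 ≈ 𝟘
  σ-0 = ·-cancel-0 0 (Z-order 0) (σ 0) (tra (≈-sym (logDeriv 0)) (tra (ϑ-cong Z-0) (ϑ-const _)))

  riccati-1 : σ 1 ≈ X · (ϑ (σ 1) ⊕ σ 1 · σ 1 ⊕ κ 2 · σ 1 ⊕ κ 1)
  riccati-1 = riccati X ϑ-X {Z 1} (logDeriv 1) f-eq (·-cancel-0 0 (Z-order 1))
   where
   f-eq : Z 1 ≈ κ 1 ⊕ X · (ϑ (Z 1) ⊕ Z 1)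
   f-eq zero = by (Z-head 1) (by (sym int-1) (by (sym (J.+-idʳ _)) (cong (J.int (Z.+ 1) J.+_) (sym (X·-zero (ϑ (Z 1) ⊕ Z 1))))))
   f-eq (suc n) = by (Z-1 (suc n)) (by (permCount-suc n) (by (cong (nat (suc n) J.*_) (sym (Z-1 n)))
    (by (by (cong (J._* Z 1 n) (nat-suc n)) (by (J.distribʳ (Z 1 n) J.1# (nat n)) (by (J.+-comm _ _) (cong (nat n J.* Z 1 n J.+_) (J.*-idˡ _)))))
    (sym (by (J.+-idˡ _) (X·-suc (ϑ (Z 1) ⊕ Z 1) n))))))

  prev : ℕ -> Ser
  prev zero = 𝟘
  prev (suc N) = σ N

  -- The chain starts from Z₀ = 1 and the Riccati equation of Z₁. At N = 0 the relations EqI and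
  -- Toda hold with any left neighbour because σ₀ = 0; `prev` supplies the zero series there.
  chain : ∀ N -> EqI X ϑ-X (nn N) (prev N) (σ N) (σ (suc N)) × EqII X ϑ-X (nn N) (σ N) (σ (suc N))
  chain zero = EqI-base X ϑ-X {nn 0} {𝟘} {σ 0} {σ 1} σ-0 , EqII-base X ϑ-X {σ 0} {σ 1} σ-0 riccati-1
  chain (suc N) = I , step-II X ϑ-X {nn N} (ϑ-nn N) {σ N} {σ (suc N)} {σ (suc (suc N))} (\ x -> ·-cancel-0 1 (ϑσ-order N) x) (isToda N) (proj₂ (chain N)) I
   where
   todaN : ∀ N -> IsToda (prev N) (σ N) (σ (suc N))
   todaN zero = IsToda-base X ϑ-X {𝟘} {σ 0} {σ 1} σ-0
   todaN (suc N) = isToda N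
   I : EqI X ϑ-X (nn (suc N)) (σ N) (σ (suc N)) (σ (suc (suc N)))
   I = step-I X ϑ-X {nn N} (ϑ-nn N) {prev N} {σ N} {σ (suc N)} {σ (suc (suc N))} (todaN N) (isToda N) (proj₁ (chain N)) (proj₂ (chain N))

  module _ (M : ℕ) where

   private
    N = suc M
    n = nn N
    u = σ N
    a = ϑ u
    K = Kform X ϑ-X n u
    P = Pform X ϑ-X n u

   2aK≈P : κ 2 · (a · K) ≈ P
   2aK≈P = x-y≈0⇒x≈y (tra (QKP X ϑ-X n u)
    (Q-vanishes X ϑ-X {nn M} {σ M} {u} {σ (suc N)} (isToda M) (proj₁ (chain N)) (proj₂ (chain M)) (proj₂ (chain N))))

   -- Eliminating K from 2 a K = P and θP = 2 (a + θa) K gives a linear equation for P, whose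
   -- solutions are the multiples of s a.
   P-equation : a · ϑ P ≈ (a ⊕ ϑ a) · P
   P-equation = tra (*-cong (rfl {a}) (θ-Pform X ϑ-X {n} (ϑ-nn N) u)) (tra
    (solve 4 (\ a b k t -> a :* (t :* (b :* k)) := b :* (t :* (a :* k))) rfl a (a ⊕ ϑ a) K (κ 2))
    (*-cong (rfl {a ⊕ ϑ a}) 2aK≈P))
    where open Solver

   a-shift : a ≈ X · tail a
   a-shift zero = by (ϑσ-head N) (sym (X·-zero (tail a)))
   a-shift (suc k) = sym (X·-suc (tail a) k)

   -- With a = s v this says v ϑP = (2 v + ϑv) P, which is an equation (k - 2) P_k = … for the coefficients.
   P-recursion : ∀ k -> (∀ j -> j N.< k -> P j ≡ J.0#) -> tail a 0 J.* (nat k J.* P k) ≡ (nat 2 J.* tail a 0) J.* P k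
   P-recursion k low = by (sym (·-low v (ϑ P) k (\ j j<k -> by (cong (nat j J.*_) (low j j<k)) (J.zeroʳ _))))
    (by (reduced k) (by (·-low (κ 2 · v ⊕ ϑ v) P k low)
    (cong (J._* P k) (by (cong (nat 2 J.* v 0 J.+_) (by (cong (J._* v 0) int-0) (J.zeroˡ _))) (J.+-idʳ _)))))
    where
    open Solver
    v = tail a
    ϑa : ϑ a ≈ X · v ⊕ X · ϑ v
    ϑa = tra (ϑ-cong a-shift) (tra (ϑ-· X v) (+-cong (*-cong ϑ-X (rfl {v})) (rfl {X · ϑ v})))
    X-order : HasOrder 1 X
    X-order = record { below = \ { zero _ -> refl ; (suc j) (s≤s ()) } ; leading = \ q -> nat-suc≢0 0 (by int-1 q) }
    reduced : v · ϑ P ≈ (κ 2 · v ⊕ ϑ v) · P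
    reduced = ·-cancelˡ 1 X-order _ _ (tra (≈-sym (·-assoc X v (ϑ P))) (tra (*-cong (≈-sym a-shift) (rfl {ϑ P})) (tra P-equation
     (tra (*-cong (+-cong a-shift ϑa) (rfl {P})) (solve 4 (\ x v w p -> (x :* v :+ (x :* v :+ x :* w)) :* p := x :* ((con (Z.+ 2) :* v :+ w) :* p)) rfl X v (ϑ v) P)))))

   v₀ : tail a 0 ≡ nat N J.* nat N J.* nat N
   v₀ = ϑσ-1 M

   w : Ser
   w = a ⊕ u

   u-head : u 0 ≡ J.0#
   u-head = by (sym (J.*-idˡ _)) (by (cong (J._* u 0) (sym (Z-head N))) (by (sym (logDeriv N 0)) (by (cong (J._* Z N 0) int-0) (J.zeroˡ _))))

   w-shift : w ≈ X · tail w
   w-shift zero = by (cong₂ J._+_ (ϑσ-head N) u-head) (by (J.+-idˡ _) (sym (X·-zero (tail w))))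
   w-shift (suc k) = sym (X·-suc (tail w) k)

   -- Since s a begins at s², this is the one coefficient that `P-recursion` leaves open. It equals
   -- 4 N³ · N³ - (2 N³)².
   P-2 : P 2 ≡ J.0#
   P-2 = by (factored 2) (by (·-assoc X X G 2) (by (X·-suc (X · G) 1) (by (X·-suc G 0) G-0)))
    where
    open Solver
    v = tail a
    y = tail w
    b = tail (a ⊕ ϑ a)
    L = X · (b · b) ⊕ κ 4 · (X · (X · (v · v · y))) ⊕ κ 3 · (X · (n · n · (v · v))) ⊕ κ 6 · (n · (v · y))
    R = κ 4 · (n · n · n · v) - y · y
    G = X · L ⊕ R
    b-shift : a ⊕ ϑ a ≈ X · b
    b-shift zero = by (cong₂ J._+_ (ϑσ-head N) (by (cong (J._* a 0) int-0) (J.zeroˡ _))) (by (J.+-idˡ _) (sym (X·-zero b)))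
    b-shift (suc k) = sym (X·-suc b k)
    factored : P ≈ X · X · G
    factored = tra (+-cong (+-cong (+-cong (+-cong (+-cong
     (*-cong (*-cong (rfl {X}) b-shift) (*-cong (rfl {X}) b-shift))
     (*-cong (rfl {ι (Z.+ 4)}) (*-cong (*-cong αs αs) w-shift)))
     (*-cong (rfl {ι (Z.+ 3)}) (*-cong (rfl {n · n}) (*-cong αs αs))))
     (*-cong (rfl {ι (Z.+ 4)}) (*-cong (rfl {n · n · n}) αs)))
     (*-cong (rfl {ι (Z.+ 6)}) (*-cong (rfl {n}) (*-cong αs w-shift))))
     (-‿cong (*-cong w-shift w-shift)))
     (solve 5 (\ x n v y b ->
     (x :* (x :* b)) :* (x :* (x :* b)) :+ con (Z.+ 4) :* ((x :* (x :* v)) :* (x :* (x :* v)) :* (x :* y)) :+ con (Z.+ 3) :* (n :* n :* ((x :* (x :* v)) :* (x :* (x :* v))))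
     :+ con (Z.+ 4) :* (n :* n :* n :* (x :* (x :* v))) :+ con (Z.+ 6) :* (n :* ((x :* (x :* v)) :* (x :* y))) :- (x :* y) :* (x :* y)
     := x :* x :* (x :* (x :* (b :* b) :+ con (Z.+ 4) :* (x :* (x :* (v :* v :* y))) :+ con (Z.+ 3) :* (x :* (n :* n :* (v :* v))) :+ con (Z.+ 6) :* (n :* (v :* y)))
     :+ (con (Z.+ 4) :* (n :* n :* n :* v) :- y :* y)))
     rfl X n v y b)
     where
     αs : X · a ≈ X · (X · v)
     αs = *-cong (rfl {X}) a-shift
    G-0 : G 0 ≡ J.0#
    G-0 = by (cong₂ J._+_ (X·-zero L) (cong₂ (\ p q -> J.int (Z.+ 4) J.* (p J.* p J.* p J.* v 0) J.+ J.- (q J.* q)) (nn-ν N 0) y0))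
     (by (J.+-idˡ _) (by (cong (\ c -> J.int (Z.+ 4) J.* (m J.* m J.* m J.* c) J.+ J.- ((c J.+ c) J.* (c J.+ c))) v₀)
     (cube-identity m)))
     where
     m = nat N
     y0 : y 0 ≡ v 0 J.+ v 0
     y0 = cong (v 0 J.+_) (sym (by (cong (J._* u 1) int-1) (J.*-idˡ _)))

   -- By strong induction N³ (k - 2) P_k = 0, and the resonance k = 2 is settled by `P-2`.
   P≈0 : P ≈ 𝟘
   P≈0 = <-rec (\ k -> P k ≡ J.0#) step
    where
    v0' = tail a 0
    v0≢0 : ¬ v0' ≡ J.0#
    v0≢0 q = cube≢0 M (by (sym v₀) q)
    two≢ : ∀ k -> ¬ k ≡ 2 -> ¬ nat k J.+ J.- nat 2 ≡ J.0#
    two≢ k k≢2 q = k≢2 (J.nat-injective (J.x-y≡0⇒x≡y q))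
    factor : ∀ k -> (∀ j -> j N.< k -> P j ≡ J.0#) -> (v0' J.* (nat k J.+ J.- nat 2)) J.* P k ≡ J.0#
    factor k low = by (arrange v0' (nat k) (nat 2) (P k)) (by (cong (J._+ J.- ((nat 2 J.* v0') J.* P k)) (P-recursion k low)) (J.-‿inverseʳ _))
    cases : ∀ k -> ¬ k ≡ 2 -> (v0' J.* (nat k J.+ J.- nat 2) ≡ J.0#) ⊎ (P k ≡ J.0#) -> P k ≡ J.0#
    cases k k≢2 (inj₂ e) = e
    cases k k≢2 (inj₁ e) = ⊥-elim (two≢ k k≢2 (cancel-≢0 v0' v0≢0 (by e (sym (J.zeroʳ v0')))))
    decide : ∀ k -> Dec (k ≡ 2) -> (∀ j -> j N.< k -> P j ≡ J.0#) -> P k ≡ J.0#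
    decide k (yes e) low = subst (\ i -> P i ≡ J.0#) (sym e) P-2
    decide k (no k≢2) low = cases k k≢2 (J.*-≡0 (v0' J.* (nat k J.+ J.- nat 2)) (P k) (factor k low))
    step : ∀ k -> (∀ {j} -> j N.< k -> P j ≡ J.0#) -> P k ≡ J.0#
    step k low = decide k (k N.≟ 2) (\ j -> low)

   K≈0 : K ≈ 𝟘
   K≈0 = ·-cancel-0 1 (ϑσ-order M) K (·-cancel-0 0 (record { below = \ _ () ; leading = nat-suc≢0 1 }) (a · K) (tra 2aK≈P P≈0))

-- Orbits and transitivity

T-⇒⁺ : ∀ {a b} -> (True a -> True b) -> True (not a ∨ b)
T-⇒⁺ {true} f = f tt
T-⇒⁺ {false} f = tt

T-⇒⁻ : ∀ {a b} -> True (not a ∨ b) -> True a -> True b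
T-⇒⁻ {true} t _ = t

T-∧⁺ : ∀ {a b} -> True a -> True b -> True (a ∧ b)
T-∧⁺ {true} _ t = t

T-∧⁻ : ∀ {a b} -> True (a ∧ b) -> True a × True b
T-∧⁻ {true} t = tt , t

T-ext : ∀ {a b} -> (True a -> True b) -> (True b -> True a) -> a ≡ b
T-ext {true} {true} f g = refl
T-ext {false} {false} f g = refl
T-ext {true} {false} f g = ⊥-elim (f tt)
T-ext {false} {true} f g = ⊥-elim (g tt)

∈-subsets : ∀ {n} (S : Vec Bool n) -> S ∈ subsets n
∈-subsets = ∈-vecsOver (\ { true -> here refl ; false -> there (here refl) })

record Closed {n} (S : Vec Bool n) (σ : Word n) : Set where
 field
  stable : ∀ i -> True (get S i) -> True (get S (get σ i))

open Closed public

invariant⇒Closed : ∀ {n} {S : Vec Bool n} {σ} -> True (invariant S σ) -> Closed S σ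
stable (invariant⇒Closed t) i = T-⇒⁻ (T-all⁺ _ t i)

Closed⇒invariant : ∀ {n} {S : Vec Bool n} {σ} -> Closed S σ -> True (invariant S σ)
Closed⇒invariant c = T-all⁻ _ (\ i -> T-⇒⁺ (stable c i))

-- The orbit of 0 is taken as the intersection of all invariant subsets containing 0, which matches
-- the description of transitivity by subsets.
inOrbit : ∀ {n} -> Word (suc n) -> Word (suc n) -> Fin (suc n) -> Bool
inOrbit {n} σ0 σ1 i =
 Data.Bool.ListAction.all (\ S -> not (get S zero ∧ invariant S σ0 ∧ invariant S σ1) ∨ get S i) (subsets (suc n))

orbit : ∀ {n} -> Word (suc n) -> Word (suc n) -> Vec Bool (suc n)
orbit σ0 σ1 = Vec.tabulate (inOrbit σ0 σ1)

module _ {n} {σ0 σ1 : Word (suc n)} where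

 orbit⁻ : ∀ {i} -> True (get (orbit σ0 σ1) i) -> ∀ S -> True (get S zero) -> Closed S σ0 -> Closed S σ1 -> True (get S i)
 orbit⁻ {i} t S S0 c0 c1 = T-⇒⁻ (All.lookup (AP.all⁺ _ _ (subst True (VP.lookup∘tabulate (inOrbit σ0 σ1) i) t)) (∈-subsets S))
  (T-∧⁺ {get S zero} S0 (T-∧⁺ {invariant S σ0} (Closed⇒invariant c0) (Closed⇒invariant c1)))

 orbit⁺ : ∀ {i} -> (∀ S -> True (get S zero) -> Closed S σ0 -> Closed S σ1 -> True (get S i)) -> True (get (orbit σ0 σ1) i)
 orbit⁺ {i} f = subst True (sym (VP.lookup∘tabulate (inOrbit σ0 σ1) i)) (AP.all⁻ _ (All.universal (\ S -> T-⇒⁺ (\ t ->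
  let (a , b) = T-∧⁻ {get S zero} t ; (c , d) = T-∧⁻ {invariant S σ0} b in f S a (invariant⇒Closed c) (invariant⇒Closed d))) (subsets (suc n))))

 orbit-zero : True (get (orbit σ0 σ1) zero)
 orbit-zero = orbit⁺ {zero} (\ S S0 _ _ -> S0)

 orbit-closed0 : Closed (orbit σ0 σ1) σ0
 stable orbit-closed0 i t = orbit⁺ {get σ0 i} (\ S S0 c0 c1 -> stable c0 i (orbit⁻ {i} t S S0 c0 c1))

 orbit-closed1 : Closed (orbit σ0 σ1) σ1
 stable orbit-closed1 i t = orbit⁺ {get σ1 i} (\ S S0 c0 c1 -> stable c1 i (orbit⁻ {i} t S S0 c0 c1))

 orbit-unique : ∀ {S} -> True (get S zero) -> Closed S σ0 -> Closed S σ1 ->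
  (∀ {i} -> True (get S i) -> True (get (orbit σ0 σ1) i)) -> orbit σ0 σ1 ≡ S
 orbit-unique {S} S0 c0 c1 f = lookup-ext (\ i -> T-ext (\ t -> orbit⁻ {i} t S S0 c0 c1) (f {i}))

iter-injective : ∀ {n} {σ : Word n} -> Perm σ -> ∀ k {i j} -> iter σ k i ≡ iter σ k j -> i ≡ j
iter-injective p zero e = e
iter-injective p (suc k) e = iter-injective p k (injective p e)

iter-+ : ∀ {n} (σ : Word n) a b i -> iter σ (a N.+ b) i ≡ iter σ a (iter σ b i)
iter-+ σ zero b i = refl
iter-+ σ (suc a) b i = cong (get σ) (iter-+ σ a b i)

iter-period : ∀ {n} {σ : Word n} -> Perm σ -> ∀ i -> ∃ \ k -> k N.< n × iter σ (suc k) i ≡ i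
iter-period {n} {σ} p i with FP.pigeonhole (NP.n<1+n n) (\ (k : Fin (suc n)) -> iter σ (Fin.toℕ k) i)
... | a , b , a<b , e = d , d<n , iter-injective p (Fin.toℕ a) (by (sym (iter-+ σ (Fin.toℕ a) (suc d) i)) (by (cong (\ k -> iter σ k i) b≡) (sym e)))
 where
 d = Fin.toℕ b ∸ suc (Fin.toℕ a)
 b≡ : Fin.toℕ a N.+ suc d ≡ Fin.toℕ b
 b≡ = by (NP.+-suc (Fin.toℕ a) d) (NP.m+[n∸m]≡n a<b)
 d<n : d N.< n
 d<n = NP.<-≤-trans (subst (d N.<_) b≡ (NP.m≤n+m (suc d) (Fin.toℕ a))) (NP.≤-pred (FP.toℕ<n b))

Closed-iter : ∀ {n} {S : Vec Bool n} {σ} -> Closed S σ -> ∀ k {i} -> True (get S i) -> True (get S (iter σ k i))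
Closed-iter c zero t = t
Closed-iter c (suc k) t = stable c _ (Closed-iter c k t)

iter-suc : ∀ {n} (σ : Word n) k i -> iter σ (suc k) i ≡ iter σ k (get σ i)
iter-suc σ k i = by (cong (\ m -> iter σ m i) (NP.+-comm 1 k)) (iter-+ σ k 1 i)

-- Iterating σ from σ(i) returns to i, so stability under σ also gives stability under its inverse.
Closed-backwards : ∀ {n} {S : Vec Bool n} {σ} -> Perm σ -> Closed S σ -> ∀ i -> True (get S (get σ i)) -> True (get S i)
Closed-backwards {S = S} {σ} p c i t = let (k , _ , e) = iter-period p i in
 subst (True ∘ get S) (by (sym (iter-suc σ k i)) e) (Closed-iter c k t)

T-not⁻ : ∀ {a} -> True (not a) -> ¬ True a
T-not⁻ {false} _ ()

T-not⁺ : ∀ {a} -> ¬ True a -> True (not a)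
T-not⁺ {true} f = f tt
T-not⁺ {false} f = tt

T-any⁻ : ∀ {n} (p : Fin n -> Bool) -> True (Data.Bool.ListAction.any p (allFin n)) -> ∃ \ i -> True (p i)
T-any⁻ {n} p t = go (allFin n) t
 where
 go : ∀ xs -> True (Data.Bool.ListAction.any p xs) -> ∃ \ i -> True (p i)
 go (x ∷ xs) t with p x in eq
 ... | true = x , subst True (sym eq) tt
 ... | false = go xs t

T-any⁺ : ∀ {n} (p : Fin n -> Bool) i -> True (p i) -> True (Data.Bool.ListAction.any p (allFin n))
T-any⁺ {n} p i t = go (allFin n) (∈P.∈-allFin i)
 where
 go : ∀ xs -> i ∈ xs -> True (Data.Bool.ListAction.any p xs)
 go (x ∷ xs) i∈ with p x in eq
 go (x ∷ xs) i∈ | true = tt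
 go (x ∷ xs) (here refl) | false = ⊥-elim (subst True eq t)
 go (x ∷ xs) (there i∈) | false = go xs i∈

Transitive : ∀ {n} -> Word n -> Word n -> Set
Transitive {n} σ0 σ1 = ∀ S -> (∃ \ i -> True (get S i)) -> Closed S σ0 -> Closed S σ1 -> ∀ i -> True (get S i)

transitive⇒ : ∀ {n} {σ0 σ1 : Word n} -> True (transitive σ0 σ1) -> Transitive σ0 σ1
transitive⇒ {σ0 = σ0} t S (i , Si) c0 c1 = T-all⁺ _ (T-⇒⁻ (All.lookup (AP.all⁺ _ _ t) (∈-subsets S))
 (T-∧⁺ {nonempty S} (T-any⁺ _ i Si) (T-∧⁺ {invariant S σ0} (Closed⇒invariant c0) (Closed⇒invariant c1))))

⇒transitive : ∀ {n} {σ0 σ1 : Word n} -> Transitive σ0 σ1 -> True (transitive σ0 σ1)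
⇒transitive {n} {σ0} f = AP.all⁻ _ (All.universal (\ S -> T-⇒⁺ (\ t ->
 let (a , b) = T-∧⁻ {nonempty S} t ; (c , d) = T-∧⁻ {invariant S σ0} b in
 T-all⁻ _ (f S (T-any⁻ _ a) (invariant⇒Closed c) (invariant⇒Closed d)))) (subsets n))

-- An invariant S that misses 0 has an invariant complement containing 0; the complement is then
-- everything and S is empty.
orbit-full⇒Transitive : ∀ {n} {σ0 σ1 : Word (suc n)} -> Perm σ0 -> Perm σ1 ->
 (∀ i -> True (get (orbit σ0 σ1) i)) -> Transitive σ0 σ1
orbit-full⇒Transitive {n} {σ0} {σ1} p₀ p1 f S (i , Si) c0 c1 with get S zero in eq
... | true = \ j -> orbit⁻ {σ0 = σ0} {σ1} {j} (f j) S (subst True (sym eq) tt) c0 c1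
... | false = ⊥-elim (T-not⁻ (subst True (lookup-not i) (orbit⁻ {σ0 = σ0} {σ1} {i} (f i) S' (subst True (sym (by (lookup-not zero) (cong not eq))) tt) (comp p₀ c0) (comp p1 c1))) Si)
 where
 S' = Vec.map not S
 lookup-not : ∀ j -> get S' j ≡ not (get S j)
 lookup-not j = VP.lookup-map j not S
 comp : ∀ {σ} -> Perm σ -> Closed S σ -> Closed S' σ
 stable (comp {σ} p c) j t = subst True (sym (lookup-not (get σ j))) (T-not⁺ (\ u -> T-not⁻ (subst True (lookup-not j) t) (Closed-backwards p c j u)))

-- Conjugation and disjoint unions of permutations

conj : ∀ {n} -> Word n -> Word n -> Word n
conj π σ = compose (compose (inv π) σ) π

lookup-conj : ∀ {n} (π σ : Word n) i -> get (conj π σ) i ≡ get (inv π) (get σ (get π i))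
lookup-conj π σ i = by (lookup-compose (compose (inv π) σ) π i) (lookup-compose (inv π) σ _)

module _ {n} {π : Word n} (pπ : Perm π) where

 π-conj : ∀ σ i -> get π (get (conj π σ) i) ≡ get σ (get π i)
 π-conj σ i = by (cong (get π) (lookup-conj π σ i)) (lookup-inv pπ _)

 Perm-conj : ∀ {σ} -> Perm σ -> Perm (conj π σ)
 Perm-conj {σ} p = Perm-compose {σ = compose (inv π) σ} (Perm-compose {σ = inv π} (Perm-inv pπ) p) pπ

 conj-compose : ∀ σ τ -> conj π (compose σ τ) ≡ compose (conj π σ) (conj π τ)
 conj-compose σ τ = lookup-ext \ i -> injective pπ (begin
  get π (get (conj π (compose σ τ)) i) ≡⟨ by (π-conj (compose σ τ) i) (lookup-compose σ τ _) ⟩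
  get σ (get τ (get π i)) ≡⟨ cong (get σ) (π-conj τ i) ⟨
  get σ (get π (get (conj π τ) i)) ≡⟨ π-conj σ _ ⟨
  get π (get (conj π σ) (get (conj π τ) i)) ≡⟨ cong (get π) (lookup-compose (conj π σ) (conj π τ) i) ⟨
  get π (get (compose (conj π σ) (conj π τ)) i) ∎)
  where open ≡-Reasoning

 conj-inv : ∀ σ -> conj π (conj (inv π) σ) ≡ σ
 conj-inv σ = lookup-ext \ i -> injective pπ (by (π-conj (conj (inv π) σ) i)
  (by (by (lookup-conj (inv π) σ _) (cong (\ j -> get (inv (inv π)) (get σ j)) (inv-lookup pπ i))) (inv-inv (get σ i))))
  where
  inv-inv : ∀ i -> get (inv (inv π)) i ≡ get π i
  inv-inv i = injective (Perm-inv pπ) (by (lookup-inv (Perm-inv pπ) i) (sym (inv-lookup pπ i)))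

 inv-conj : ∀ σ -> conj (inv π) (conj π σ) ≡ σ
 inv-conj σ = lookup-ext \ i -> injective (Perm-inv pπ) (by (by (cong (get (inv π)) (lookup-conj (inv π) (conj π σ) i))
  (lookup-inv (Perm-inv pπ) _)) (by (lookup-conj π σ _) (cong (\ j -> get (inv π) (get σ j)) (lookup-inv pπ i))))

 Closed-conj : ∀ {S : Vec Bool n} {σ} -> Closed S σ -> Closed (act S π) (conj π σ)
 stable (Closed-conj {S} {σ} c) i t = subst True (sym (by (lookup-act S π _) (cong (get S) (π-conj σ i)))) (stable c _ (subst True (lookup-act S π i) t))

 act-inv-act : ∀ {A : Set} (c : Vec A n) -> act (act c π) (inv π) ≡ c
 act-inv-act c = lookup-ext \ i -> by (lookup-act (act c π) (inv π) i) (by (lookup-act c π _) (cong (get c) (lookup-inv pπ i)))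

 act-act-inv : ∀ {A : Set} (c : Vec A n) -> act (act c (inv π)) π ≡ c
 act-act-inv c = lookup-ext \ i -> by (lookup-act (act c (inv π)) π i) (by (lookup-act c (inv π) _) (cong (get c) (inv-lookup pπ i)))

 conj-fixes⁺ : ∀ {A : Set} {σ} {c : Vec A n} -> act c σ ≡ c -> act (act c π) (conj π σ) ≡ act c π
 conj-fixes⁺ {σ = σ} {c} e = lookup-ext \ i -> begin
  get (act (act c π) (conj π σ)) i ≡⟨ by (lookup-act (act c π) (conj π σ) i) (lookup-act c π _) ⟩
  get c (get π (get (conj π σ) i)) ≡⟨ cong (get c) (π-conj σ i) ⟩
  get c (get σ (get π i)) ≡⟨ lookup-act c σ _ ⟨
  get (act c σ) (get π i) ≡⟨ cong (\ v -> get v (get π i)) e ⟩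
  get c (get π i) ≡⟨ lookup-act c π i ⟨
  get (act c π) i ∎
  where open ≡-Reasoning

 conj-fixes⁻ : ∀ {A : Set} {σ} {c : Vec A n} -> act (act c π) (conj π σ) ≡ act c π -> act c σ ≡ c
 conj-fixes⁻ {σ = σ} {c} e = lookup-ext \ i -> begin
  get (act c σ) i
  ≡⟨ by (lookup-act c σ i) (cong (\ j -> get c (get σ j)) (sym (lookup-inv pπ i))) ⟩ _
  ≡⟨ cong (get c) (π-conj σ _) ⟨ _
  ≡⟨ by (lookup-act (act c π) (conj π σ) _) (lookup-act c π _) ⟨ _
  ≡⟨ by (cong (\ v -> get v (get (inv π) i)) e) (by (lookup-act c π _) (cong (get c) (lookup-inv pπ i))) ⟩
  get c i ∎
  where open ≡-Reasoning

Closed-conj⁻ : ∀ {n} {π : Word n} -> Perm π -> ∀ {S : Vec Bool n} {σ} -> Closed S (conj π σ) -> Closed (act S (inv π)) σ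
Closed-conj⁻ {π = π} p {S} {σ} c = subst (Closed (act S (inv π))) (inv-conj p σ) (Closed-conj (Perm-inv p) c)

Transitive-conj : ∀ {n} {π : Word n} -> Perm π -> ∀ {σ0 σ1} -> Transitive σ0 σ1 -> Transitive (conj π σ0) (conj π σ1)
Transitive-conj {π = π} p {σ0} {σ1} f S (i , t) c0 c1 j =
 subst True (by (lookup-act S (inv π) (get π j)) (cong (get S) (inv-lookup p j)))
 (f (act S (inv π)) (get π i , subst True (sym (by (lookup-act S (inv π) (get π i)) (cong (get S) (inv-lookup p i)))) t)
 (Closed-conj⁻ p c0) (Closed-conj⁻ p c1) (get π j))

orbit-conj : ∀ {n} {π : Word (suc n)} -> Perm π -> get π zero ≡ zero -> ∀ σ0 σ1 ->
 orbit (conj π σ0) (conj π σ1) ≡ act (orbit σ0 σ1) π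
orbit-conj {π = π} p π0 σ0 σ1 = orbit-unique {σ0 = conj π σ0} {conj π σ1} {act (orbit σ0 σ1) π}
 (subst True (sym (by (lookup-act (orbit σ0 σ1) π zero) (cong (get (orbit σ0 σ1)) π0))) (orbit-zero {σ0 = σ0} {σ1}))
 (Closed-conj p (orbit-closed0 {σ0 = σ0} {σ1})) (Closed-conj p (orbit-closed1 {σ0 = σ0} {σ1}))
 (\ {i} t -> orbit⁺ {σ0 = conj π σ0} {conj π σ1} {i} (\ S S0 c0 c1 ->
 subst True (by (lookup-act S (inv π) (get π i)) (cong (get S) (inv-lookup p i)))
 (orbit⁻ {σ0 = σ0} {σ1} {get π i} (subst True (lookup-act (orbit σ0 σ1) π i) t) (act S (inv π))
 (subst True (sym (by (lookup-act S (inv π) zero) (cong (get S) inv0))) S0) (Closed-conj⁻ p c0) (Closed-conj⁻ p c1))))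
 where
 inv0 : get (inv π) zero ≡ zero
 inv0 = by (cong (get (inv π)) (sym π0)) (inv-lookup p zero)

data Side {n k : ℕ} : Fin (n N.+ k) -> Set where
 inl : ∀ i -> Side (i ↑ˡ k)
 inr : ∀ i -> Side (n ↑ʳ i)

side : ∀ n {k} (x : Fin (n N.+ k)) -> Side {n} {k} x
side zero x = inr x
side (suc n) zero = inl zero
side (suc n) (suc x) with side n x
... | inl i = inl (suc i)
... | inr i = inr i

infixr 5 _⊎ₚ_
_⊎ₚ_ : ∀ {n k} -> Word n -> Word k -> Word (n N.+ k)
_⊎ₚ_ {n} {k} α β = Vec.map (_↑ˡ k) α ++ Vec.map (n ↑ʳ_) β

module _ {n k} (α : Word n) (β : Word k) where

 lookup-⊎ˡ : ∀ i -> get (α ⊎ₚ β) (i ↑ˡ k) ≡ get α i ↑ˡ k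
 lookup-⊎ˡ i = by (VP.lookup-++ˡ (Vec.map (_↑ˡ k) α) (Vec.map (n ↑ʳ_) β) i) (VP.lookup-map i (_↑ˡ k) α)

 lookup-⊎ʳ : ∀ i -> get (α ⊎ₚ β) (n ↑ʳ i) ≡ n ↑ʳ get β i
 lookup-⊎ʳ i = by (VP.lookup-++ʳ (Vec.map (_↑ˡ k) α) (Vec.map (n ↑ʳ_) β) i) (VP.lookup-map i (n ↑ʳ_) β)

 act-⊎ : ∀ {A : Set} (u : Vec A n) (v : Vec A k) -> act (u ++ v) (α ⊎ₚ β) ≡ act u α ++ act v β
 act-⊎ u v = lookup-ext \ x -> by (lookup-act (u ++ v) (α ⊎ₚ β) x) (go (side n x))
  where
  go : ∀ {x} -> Side {n} {k} x -> get (u ++ v) (get (α ⊎ₚ β) x) ≡ get (act u α ++ act v β) x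
  go (inl i) = by (cong (get (u ++ v)) (lookup-⊎ˡ i)) (by (VP.lookup-++ˡ u v (get α i))
   (sym (by (VP.lookup-++ˡ (act u α) (act v β) i) (lookup-act u α i))))
  go (inr i) = by (cong (get (u ++ v)) (lookup-⊎ʳ i)) (by (VP.lookup-++ʳ u v (get β i))
   (sym (by (VP.lookup-++ʳ (act u α) (act v β) i) (lookup-act v β i))))

↑ˡ≢↑ʳ : ∀ {n k} (i : Fin n) (j : Fin k) -> ¬ i ↑ˡ k ≡ n ↑ʳ j
↑ˡ≢↑ʳ zero j ()
↑ˡ≢↑ʳ (suc i) j e = ↑ˡ≢↑ʳ i j (FP.suc-injective e)

⊎-compose : ∀ {n k} (α α' : Word n) (β β' : Word k) ->
 compose (α ⊎ₚ β) (α' ⊎ₚ β') ≡ compose α α' ⊎ₚ compose β β'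
⊎-compose {n} {k} α α' β β' = lookup-ext \ x -> by (lookup-compose (α ⊎ₚ β) (α' ⊎ₚ β') x) (go (side n x))
 where
 go : ∀ {x} -> Side {n} {k} x -> get (α ⊎ₚ β) (get (α' ⊎ₚ β') x) ≡ get (compose α α' ⊎ₚ compose β β') x
 go (inl i) = by (cong (get (α ⊎ₚ β)) (lookup-⊎ˡ α' β' i)) (by (lookup-⊎ˡ α β (get α' i))
  (sym (by (lookup-⊎ˡ (compose α α') (compose β β') i) (cong (_↑ˡ k) (lookup-compose α α' i)))))
 go (inr i) = by (cong (get (α ⊎ₚ β)) (lookup-⊎ʳ α' β' i)) (by (lookup-⊎ʳ α β (get β' i))
  (sym (by (lookup-⊎ʳ (compose α α') (compose β β') i) (cong (n ↑ʳ_) (lookup-compose β β' i)))))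

Perm-⊎ : ∀ {n k} {α : Word n} {β : Word k} -> Perm α -> Perm β -> Perm (α ⊎ₚ β)
injective (Perm-⊎ {n} {k} {α} {β} p q) {x} {y} e = go (side n x) (side n y) e
 where
 go : ∀ {x y} -> Side {n} {k} x -> Side {n} {k} y -> get (α ⊎ₚ β) x ≡ get (α ⊎ₚ β) y -> x ≡ y
 go (inl i) (inl j) e = cong (_↑ˡ k) (injective p (FP.↑ˡ-injective k _ _ (by (sym (lookup-⊎ˡ α β i)) (by e (lookup-⊎ˡ α β j)))))
 go (inl i) (inr j) e = ⊥-elim (↑ˡ≢↑ʳ _ _ (by (sym (lookup-⊎ˡ α β i)) (by e (lookup-⊎ʳ α β j))))
 go (inr i) (inl j) e = ⊥-elim (↑ˡ≢↑ʳ _ _ (sym (by (sym (lookup-⊎ʳ α β i)) (by e (lookup-⊎ˡ α β j)))))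
 go (inr i) (inr j) e = cong (n ↑ʳ_) (injective q (FP.↑ʳ-injective n _ _ (by (sym (lookup-⊎ʳ α β i)) (by e (lookup-⊎ʳ α β j)))))

⊎-injective : ∀ {n k} {α α' : Word n} {β β' : Word k} -> α ⊎ₚ β ≡ α' ⊎ₚ β' -> α ≡ α' × β ≡ β'
⊎-injective {n} {k} {α} {α'} {β} {β'} e =
 lookup-ext (\ i -> FP.↑ˡ-injective k _ _ (by (sym (lookup-⊎ˡ α β i)) (by (cong (\ v -> get v (i ↑ˡ k)) e) (lookup-⊎ˡ α' β' i)))) ,
 lookup-ext (\ i -> FP.↑ʳ-injective n _ _ (by (sym (lookup-⊎ʳ α β i)) (by (cong (\ v -> get v (n ↑ʳ i)) e) (lookup-⊎ʳ α' β' i))))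

-- The subset {0, …, j - 1} of Fin m.
initial : ∀ m -> ℕ -> Vec Bool m
initial zero j = []
initial (suc m) zero = false ∷ initial m zero
initial (suc m) (suc j) = true ∷ initial m j

initial-↑ˡ : ∀ n {k} (i : Fin n) -> True (get (initial (n N.+ k) n) (i ↑ˡ k))
initial-↑ˡ (suc n) zero = tt
initial-↑ˡ (suc n) (suc i) = initial-↑ˡ n i

initial-↑ʳ : ∀ n {k} (i : Fin k) -> ¬ True (get (initial (n N.+ k) n) (n ↑ʳ i))
initial-↑ʳ zero zero ()
initial-↑ʳ zero (suc i) t = initial-↑ʳ zero i t
initial-↑ʳ (suc n) i t = initial-↑ʳ n i t

module _ (n k : ℕ) where

 block : Vec Bool (n N.+ k)
 block = initial (n N.+ k) n

 Closed-block-⊎ : ∀ α β -> Closed block (α ⊎ₚ β)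
 stable (Closed-block-⊎ α β) x t = go (side n x) t
  where
  go : ∀ {x} -> Side {n} {k} x -> True (get block x) -> True (get block (get (α ⊎ₚ β) x))
  go (inl i) _ = subst (True ∘ get block) (sym (lookup-⊎ˡ α β i)) (initial-↑ˡ n (get α i))
  go (inr i) t = ⊥-elim (initial-↑ʳ n i t)

 module _ {σ : Word (n N.+ k)} (p : Perm σ) (c : Closed block σ) where

  private
   onLeft : ∀ {x} -> Side {n} {k} x -> True (get block x) -> ∃ \ i -> x ≡ i ↑ˡ k
   onLeft (inl i) _ = i , refl
   onLeft (inr i) t = ⊥-elim (initial-↑ʳ n i t)
   onRight : ∀ {x} -> Side {n} {k} x -> ¬ True (get block x) -> ∃ \ i -> x ≡ n ↑ʳ i
   onRight (inl i) t = ⊥-elim (t (initial-↑ˡ n i))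
   onRight (inr i) _ = i , refl

  restrictˡ : ∀ i -> ∃ \ i' -> get σ (i ↑ˡ k) ≡ i' ↑ˡ k
  restrictˡ i = onLeft (side n _) (stable c _ (initial-↑ˡ n i))

  -- The complement of the block is preserved as well: a point of it mapped into the block would
  -- itself lie in the block by `Closed-backwards`.
  restrictʳ : ∀ i -> ∃ \ i' -> get σ (n ↑ʳ i) ≡ n ↑ʳ i'
  restrictʳ i = onRight (side n _) (\ t -> initial-↑ʳ n i (Closed-backwards p c _ t))

  blockˡ : Word n
  blockˡ = Vec.tabulate (proj₁ ∘ restrictˡ)

  blockʳ : Word k
  blockʳ = Vec.tabulate (proj₁ ∘ restrictʳ)

  lookup-blockˡ : ∀ i -> get blockˡ i ↑ˡ k ≡ get σ (i ↑ˡ k)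
  lookup-blockˡ i = by (cong (_↑ˡ k) (VP.lookup∘tabulate (proj₁ ∘ restrictˡ) i)) (sym (proj₂ (restrictˡ i)))

  lookup-blockʳ : ∀ i -> n ↑ʳ get blockʳ i ≡ get σ (n ↑ʳ i)
  lookup-blockʳ i = by (cong (n ↑ʳ_) (VP.lookup∘tabulate (proj₁ ∘ restrictʳ) i)) (sym (proj₂ (restrictʳ i)))

  block-⊎ : blockˡ ⊎ₚ blockʳ ≡ σ
  block-⊎ = lookup-ext (\ x -> go (side n x))
   where
   go : ∀ {x} -> Side {n} {k} x -> get (blockˡ ⊎ₚ blockʳ) x ≡ get σ x
   go (inl i) = by (lookup-⊎ˡ blockˡ blockʳ i) (lookup-blockˡ i)
   go (inr i) = by (lookup-⊎ʳ blockˡ blockʳ i) (lookup-blockʳ i)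

  Perm-blockˡ : Perm blockˡ
  injective Perm-blockˡ {i} {j} e = FP.↑ˡ-injective k i j (injective p
   (by (sym (lookup-blockˡ i)) (by (cong (_↑ˡ k) e) (lookup-blockˡ j))))

  Perm-blockʳ : Perm blockʳ
  injective Perm-blockʳ {i} {j} e = FP.↑ʳ-injective n i j (injective p
   (by (sym (lookup-blockʳ i)) (by (cong (n ↑ʳ_) e) (lookup-blockʳ j))))

module _ {n k} {α : Word n} {β : Word k} where

 Closed-++ : ∀ {S : Vec Bool n} -> Closed S α -> Closed (S ++ Vec.replicate k false) (α ⊎ₚ β)
 stable (Closed-++ {S} c) x t = go (side n x) t
  where
  S' = S ++ Vec.replicate k false
  go : ∀ {x} -> Side {n} {k} x -> True (get S' x) -> True (get S' (get (α ⊎ₚ β) x))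
  go (inl i) t = subst True (sym (by (cong (get S') (lookup-⊎ˡ α β i)) (VP.lookup-++ˡ S (Vec.replicate k false) (get α i))))
   (stable c i (subst True (VP.lookup-++ˡ S (Vec.replicate k false) i) t))
  go (inr i) t = ⊥-elim (subst True (by (VP.lookup-++ʳ S (Vec.replicate k false) i) (VP.lookup-replicate i false)) t)

 Closed-take : ∀ {S : Vec Bool (n N.+ k)} -> Closed S (α ⊎ₚ β) -> Closed (Vec.tabulate (\ i -> get S (i ↑ˡ k))) α
 stable (Closed-take {S} c) i t = subst True (sym (VP.lookup∘tabulate (\ i -> get S (i ↑ˡ k)) (get α i)))
  (subst (True ∘ get S) (lookup-⊎ˡ α β i) (stable c (i ↑ˡ k) (subst True (VP.lookup∘tabulate (\ i -> get S (i ↑ˡ k)) i) t)))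

module _ {j k} {α0 α1 : Word (suc j)} {β0 β1 : Word k} where

 orbit-block⇒Transitive : Perm α0 -> Perm α1 -> orbit (α0 ⊎ₚ β0) (α1 ⊎ₚ β1) ≡ block (suc j) k -> Transitive α0 α1
 orbit-block⇒Transitive p₀ p1 e = orbit-full⇒Transitive p₀ p1 (\ i -> orbit⁺ {σ0 = α0} {α1} {i} (\ S S0 c0 c1 ->
  subst True (VP.lookup-++ˡ S (Vec.replicate k false) i) (orbit⁻ {σ0 = α0 ⊎ₚ β0} {α1 ⊎ₚ β1} {i ↑ˡ k}
  (subst (\ v -> True (get v (i ↑ˡ k))) (sym e) (initial-↑ˡ (suc j) i)) (S ++ Vec.replicate k false)
  (subst True (sym (VP.lookup-++ˡ S (Vec.replicate k false) zero)) S0) (Closed-++ {β = β0} c0) (Closed-++ {β = β1} c1))))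

 Transitive⇒orbit-block : Transitive α0 α1 -> orbit (α0 ⊎ₚ β0) (α1 ⊎ₚ β1) ≡ block (suc j) k
 Transitive⇒orbit-block f = orbit-unique {σ0 = α0 ⊎ₚ β0} {α1 ⊎ₚ β1} {block (suc j) k} tt
  (Closed-block-⊎ (suc j) k α0 β0) (Closed-block-⊎ (suc j) k α1 β1) (\ {x} -> go (side (suc j) x))
  where
  go : ∀ {x} -> Side {suc j} {k} x -> True (get (block (suc j) k) x) -> True (get (orbit (α0 ⊎ₚ β0) (α1 ⊎ₚ β1)) x)
  go (inr i) t = ⊥-elim (initial-↑ʳ (suc j) i t)
  go (inl i) _ = orbit⁺ {σ0 = α0 ⊎ₚ β0} {α1 ⊎ₚ β1} {i ↑ˡ k} (\ S S0 c0 c1 ->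
   subst True (VP.lookup∘tabulate (\ i -> get S (i ↑ˡ k)) i)
   (f (Vec.tabulate (\ i -> get S (i ↑ˡ k))) (zero , S0) (Closed-take {β = β0} {S = S} c0) (Closed-take {β = β1} {S = S} c1) i))

Symmetric : ∀ {m} {A : Set} -> (Vec Bool m -> A) -> Set
Symmetric {m} f = ∀ {π : Word m} -> Perm π -> ∀ S -> f (act S π) ≡ f S

Symmetric-∷ : ∀ {m} {A : Set} {f : Vec Bool (suc m) -> A} -> Symmetric f -> ∀ b -> Symmetric (\ S -> f (b ∷ S))
Symmetric-∷ {f = f} sy b {π} p S = by (cong f (sym (act-lift b S π))) (sy (Perm-lift p) (b ∷ S))

-- A symmetric function cannot see where the single false entry stands; adjacent exchanges carry it
-- behind the initial segment.
insert-false : ∀ {m j} -> j N.≤ m -> {A : Set} {f : Vec Bool (suc m) -> A} -> Symmetric f ->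
 f (false ∷ initial m j) ≡ f (initial (suc m) j)
insert-false z≤n sy = refl
insert-false {suc m} {suc j} (s≤s j≤m) {f = f} sy = by
 (by (sym (sy (Perm-sw (suc zero)) (false ∷ true ∷ initial m j))) (cong f (act-sw-suc false (true ∷ initial m j) zero)))
 (insert-false j≤m (Symmetric-∷ {f = f} sy true))

-- The exponential formula

module Exponential (J : NumberField) where

 open FieldProperties J
 open Sums J
 open PermSums J
 open Series J
 open Toda J using (rf; rf-suc; Z)
 open ≡-Reasoning

 -- A symmetric function depends only on the size j of the subset, and there are m!/(j! (m-j)!) of
 -- them. The induction is Pascal's rule, in the form m + 1 = j + (m + 1 - j).
 ∑-subsets : ∀ m (f : Vec Bool m -> F) -> Symmetric f ->
  rf m * ∑ (subsets m) f ≡ sumTo m (\ j -> rf j * rf (m ∸ j) * f (initial m j))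
 ∑-subsets zero f sy = by (cong (rf 0 *_) (+-idʳ _)) (cong (_* f []) (sym (*-idˡ (rf 0))))
 ∑-subsets (suc m) f sy = cancel-≢0 (nat (suc m)) (nat-suc≢0 m) (begin
  nat (suc m) * (rf (suc m) * ∑ (subsets (suc m)) f)
  ≡⟨ sym (*-assoc _ _ _) ⟩ _
  ≡⟨ cong₂ _*_ (rf-suc m) (by (∑-vecsOver-suc m (true ∷ false ∷ []) f) (cong (∑ (subsets m) (\ S -> f (true ∷ S)) +_) (+-idʳ _))) ⟩ _
  ≡⟨ distribˡ _ _ _ ⟩ _
  ≡⟨ cong₂ _+_ (∑-subsets m _ (Symmetric-∷ {f = f} sy true)) (by (∑-subsets m _ (Symmetric-∷ {f = f} sy false))
  (sumTo-cong m (\ j j≤m -> cong (rf j * rf (m ∸ j) *_) (insert-false j≤m {f = f} sy)))) ⟩ _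
  ≡⟨ cong₂ _+_ first second ⟨ _
  ≡⟨ sumTo-+ (suc m) _ _ ⟨ _
  ≡⟨ sumTo-cong (suc m) (\ j j≤ -> by (sym (distribʳ (h j) _ _)) (cong (_* h j) (by (sym (nat-+ j (suc m ∸ j))) (cong nat (NP.m+[n∸m]≡n j≤))))) ⟩ _
  ≡⟨ sumTo-*ˡ (suc m) (nat (suc m)) h ⟩
  nat (suc m) * sumTo (suc m) h ∎)
  where
  open Solver
  g : ℕ -> F
  g j = f (initial (suc m) j)
  h : ℕ -> F
  h j = rf j * rf (suc m ∸ j) * g j
  first : sumTo (suc m) (\ j -> nat j * h j) ≡ sumTo m (\ j -> rf j * rf (m ∸ j) * g (suc j))
  first = by (sumTo-suc m (\ j -> nat j * h j)) (by (cong₂ _+_ (by (cong (_* h 0) int-0) (zeroˡ _))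
   (sumTo-cong m (\ j _ -> by (solve 4 (\ n a b c -> n :* (a :* b :* c) := (n :* a) :* b :* c) refl (nat (suc j)) (rf (suc j)) (rf (m ∸ j)) (g (suc j)))
   (cong (\ x -> x * rf (m ∸ j) * g (suc j)) (rf-suc j))))) (+-idˡ _))
  second : sumTo (suc m) (\ j -> nat (suc m ∸ j) * h j) ≡ sumTo m (\ j -> rf j * rf (m ∸ j) * g j)
  second = by (cong₂ _+_
   (sumTo-cong m (\ j j≤m -> by (solve 4 (\ n a b c -> n :* (a :* b :* c) := a :* (n :* b) :* c) refl (nat (suc m ∸ j)) (rf j) (rf (suc m ∸ j)) (g j))
   (cong (\ x -> rf j * x * g j) (by (cong (\ i -> nat i * rf i) (NP.+-∸-assoc 1 j≤m)) (rf-suc (m ∸ j))))))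
   (by (cong (\ i -> nat i * h (suc m)) (NP.n∸n≡0 (suc m))) (by (cong (_* h (suc m)) int-0) (zeroˡ _)))) (+-idʳ _)

 ∑-perms-conj : ∀ {n} {π : Word n} -> Perm π -> ∀ G -> ∑ (perms n) G ≡ ∑ (perms n) (G ∘ conj π)
 ∑-perms-conj {n} {π} p = ∑-bij (perms-unique n) (perms-unique n) (conj π) (conj (inv π))
  (\ σ∈ -> ∈-perms⁺ (Perm-conj p (∈-perms⁻ σ∈))) (\ σ∈ -> ∈-perms⁺ (Perm-conj (Perm-inv p) (∈-perms⁻ σ∈)))
  (\ {σ} _ -> inv-conj p σ) (\ {σ} _ -> conj-inv p σ)

 -- A permutation that preserves the block is the disjoint union of its two restrictions, in exactly
 -- one way.
 ∑-perms-block : ∀ n k (G : Word (n N.+ k) -> F) -> (∀ σ -> ¬ Closed (block n k) σ -> G σ ≡ 0#) ->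
  ∑ (perms (n N.+ k)) G ≡ ∑ (perms n) (\ α -> ∑ (perms k) (\ β -> G (α ⊎ₚ β)))
 ∑-perms-block n k G vanish = begin
  ∑ (perms (n N.+ k)) G
  ≡⟨ ∑-cong (perms (n N.+ k)) (\ σ -> only (invariant (block n k) σ) refl) ⟩ _
  ≡⟨ ∑-filterᵇ (invariant (block n k)) (perms (n N.+ k)) G ⟨
  ∑ preserving G
  ≡⟨ ∑-↭-map ⟩ _
  ≡⟨ ∑-pairList (perms n) (perms k) _ ⟩
  ∑ (perms n) (\ α -> ∑ (perms k) (\ β -> G (α ⊎ₚ β))) ∎
  where
  preserving = filterᵇ (invariant (block n k)) (perms (n N.+ k))
  only : ∀ {σ} b -> invariant (block n k) σ ≡ b -> G σ ≡ indᵇ b * G σ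
  only {σ} true e = sym (*-idˡ _)
  only {σ} false e = by (vanish σ (\ c -> subst True e (Closed⇒invariant c))) (sym (zeroˡ _))
  parts : ∀ {σ} -> σ ∈ preserving -> Perm σ × Closed (block n k) σ
  parts σ∈ = let (a , b) = ∈P.∈-filter⁻ (T? ∘ invariant (block n k)) {xs = perms (n N.+ k)} σ∈ in ∈-perms⁻ a , invariant⇒Closed b
  f : Word n × Word k -> Word (n N.+ k)
  f x = proj₁ x ⊎ₚ proj₂ x
  f∈ : ∀ {x} -> x ∈ pairList (perms n) (perms k) -> f x ∈ preserving
  f∈ {x} x∈ = let (a , b) = ∈-pairList⁻ x∈ in ∈P.∈-filter⁺ (T? ∘ invariant (block n k))
   (∈-perms⁺ (Perm-⊎ (∈-perms⁻ a) (∈-perms⁻ b))) (Closed⇒invariant (Closed-block-⊎ n k (proj₁ x) (proj₂ x)))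
  ∑-↭-map : ∑ preserving G ≡ ∑ (pairList (perms n) (perms k)) (\ x -> G (proj₁ x ⊎ₚ proj₂ x))
  ∑-↭-map = ∑-bij-surjective (pairList-unique (perms-unique n) (perms-unique k))
   (UP.filter⁺ (T? ∘ invariant (block n k)) (perms-unique (n N.+ k))) f
   f∈ (\ _ _ e -> let (a , b) = ⊎-injective {n} {k} e in cong₂ _,_ a b)
   (\ {σ} σ∈ -> let (p , c) = parts σ∈ in (blockˡ n k p c , blockʳ n k p c) ,
    ∈-pairList⁺ (∈-perms⁺ (Perm-blockˡ n k p c)) (∈-perms⁺ (Perm-blockʳ n k p c)) , block-⊎ n k p c) G

 module _ (N : ℕ) where

  open Insertion J N using (fix)
  open FixedColourings J N using (partition)

  weight : ∀ {n} -> Word n -> Word n -> F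
  weight σ0 σ1 = fix σ0 * fix σ1 * fix (compose σ0 σ1)

  fix-conj : ∀ {n} {π : Word n} -> Perm π -> ∀ σ -> fix (conj π σ) ≡ fix σ
  fix-conj {n} {π} p σ = by
   (∑-bij (cols-unique N n) (cols-unique N n) (\ c -> act c π) (\ c -> act c (inv π))
   (\ _ -> ∈-cols _) (\ _ -> ∈-cols _) (\ {c} _ -> act-inv-act p c) (\ {c} _ -> act-act-inv p c)
   (\ c -> ind (act c (conj π σ) ≟ᵥ c)))
   (∑-cong (cols N n) (\ c -> ind-cong (act (act c π) (conj π σ) ≟ᵥ act c π) (act c σ ≟ᵥ c)
   (conj-fixes⁻ p) (conj-fixes⁺ p)))

  weight-conj : ∀ {n} {π : Word n} -> Perm π -> ∀ σ0 σ1 -> weight (conj π σ0) (conj π σ1) ≡ weight σ0 σ1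
  weight-conj p σ0 σ1 = cong₂ _*_ (cong₂ _*_ (fix-conj p σ0) (fix-conj p σ1))
   (by (cong fix (sym (conj-compose p σ0 σ1))) (fix-conj p (compose σ0 σ1)))

  ∑-cols-++ : ∀ n k (G : Vec (Fin N) (n N.+ k) -> F) ->
   ∑ (cols N (n N.+ k)) G ≡ ∑ (cols N n) (\ u -> ∑ (cols N k) (\ v -> G (u ++ v)))
  ∑-cols-++ zero k G = sym (+-idʳ _)
  ∑-cols-++ (suc n) k G = by (∑-vecsOver-suc (n N.+ k) (allFin N) G)
   (by (∑-cong (allFin N) (\ x -> ∑-cols-++ n k (\ v -> G (x ∷ v)))) (sym (∑-vecsOver-suc n (allFin N) _)))

  fix-⊎ : ∀ {n k} (α : Word n) (β : Word k) -> fix (α ⊎ₚ β) ≡ fix α * fix β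
  fix-⊎ {n} {k} α β = begin
   fix (α ⊎ₚ β)
   ≡⟨ ∑-cols-++ n k _ ⟩ _
   ≡⟨ ∑-cong (cols N n) (\ u -> ∑-cong (cols N k) (\ v -> by
   (ind-cong (act (u ++ v) (α ⊎ₚ β) ≟ᵥ (u ++ v)) ((act u α ≟ᵥ u) ×-dec (act v β ≟ᵥ v))
   (\ e -> VP.++-injective (act u α) u (by (sym (act-⊎ α β u v)) e))
   (\ (e , e') -> by (act-⊎ α β u v) (cong₂ _++_ e e')))
   (ind-× (act u α ≟ᵥ u) (act v β ≟ᵥ v)))) ⟩ _
   ≡⟨ ∑-cong (cols N n) (\ u -> ∑-*ˡ (cols N k) _ _) ⟩ _
   ≡⟨ ∑-*ʳ (cols N n) (fix β) _ ⟩
   fix α * fix β ∎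

  weight-⊎ : ∀ {n k} (α0 α1 : Word n) (β0 β1 : Word k) ->
   weight (α0 ⊎ₚ β0) (α1 ⊎ₚ β1) ≡ weight α0 α1 * weight β0 β1
  weight-⊎ α0 α1 β0 β1 = by
   (cong₂ _*_ (cong₂ _*_ (fix-⊎ α0 β0) (fix-⊎ α1 β1)) (by (cong fix (⊎-compose α0 α1 β0 β1)) (fix-⊎ (compose α0 α1) (compose β0 β1))))
   (solve 6 (\ a b c d e f -> (a :* b) :* (c :* d) :* (e :* f) := (a :* c :* e) :* (b :* d :* f)) refl
   (fix α0) (fix β0) (fix α1) (fix β1) (fix (compose α0 α1)) (fix (compose β0 β1)))
   where open Solver

  connected : ℕ -> F
  connected n = ∑ (perms n) (\ σ0 -> ∑ (perms n) (\ σ1 -> indᵇ (transitive σ0 σ1) * weight σ0 σ1))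

  _≟ᵇ_ : ∀ {m} (u v : Vec Bool m) -> Dec (u ≡ v)
  _≟ᵇ_ = VP.≡-dec Bool._≟_

  -- S describes the orbit of 0 without 0 itself, which always belongs to it.
  withOrbit : ∀ m -> Vec Bool m -> F
  withOrbit m S = ∑ (perms (suc m)) (\ σ0 -> ∑ (perms (suc m)) (\ σ1 -> ind (orbit σ0 σ1 ≟ᵇ (true ∷ S)) * weight σ0 σ1))

  withOrbit-symmetric : ∀ m -> Symmetric (withOrbit m)
  withOrbit-symmetric m {π} p S = begin
   withOrbit m (act S π)
   ≡⟨ ∑-perms-conj pl _ ⟩ _
   ≡⟨ ∑-cong (perms (suc m)) (\ σ0 -> ∑-perms-conj pl _) ⟩ _
   ≡⟨ ∑-cong (perms (suc m)) (\ σ0 -> ∑-cong (perms (suc m)) (\ σ1 -> cong₂ _*_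
   (ind-cong (orbit (conj (lift π) σ0) (conj (lift π) σ1) ≟ᵇ (true ∷ act S π)) (orbit σ0 σ1 ≟ᵇ (true ∷ S)) (to σ0 σ1) (from σ0 σ1)) (weight-conj pl σ0 σ1))) ⟩
   withOrbit m S ∎
   where
   pl = Perm-lift p
   to : ∀ σ0 σ1 -> orbit (conj (lift π) σ0) (conj (lift π) σ1) ≡ true ∷ act S π -> orbit σ0 σ1 ≡ true ∷ S
   to σ0 σ1 e = by (sym (act-inv-act pl (orbit σ0 σ1))) (by (cong (\ v -> act v (inv (lift π)))
    (by (sym (orbit-conj pl refl σ0 σ1)) (by e (sym (act-lift true S π))))) (act-inv-act pl (true ∷ S)))
   from : ∀ σ0 σ1 -> orbit σ0 σ1 ≡ true ∷ S -> orbit (conj (lift π) σ0) (conj (lift π) σ1) ≡ true ∷ act S π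
   from σ0 σ1 e = by (orbit-conj pl refl σ0 σ1) (by (cong (\ v -> act v (lift π)) e) (act-lift true S π))

  -- When the orbit of 0 is an initial segment, both permutations split along it: the first blocks
  -- form a transitive pair, the second blocks are arbitrary, and the numbers of fixed colourings
  -- multiply.
  withOrbit-initial : ∀ j k -> withOrbit (j N.+ k) (initial (j N.+ k) j) ≡ connected (suc j) * partition k
  withOrbit-initial j k = begin
   withOrbit (j N.+ k) (initial (j N.+ k) j)
   ≡⟨ ∑-perms-block (suc j) k (\ σ0 -> ∑ (perms (suc (j N.+ k))) (G σ0)) (\ σ0 ¬c -> ∑-≡0 (perms (suc (j N.+ k))) (\ {σ1} _ -> zero0 σ0 σ1 ¬c)) ⟩ _
   ≡⟨ ∑-cong P (\ α0 -> ∑-cong Q (\ β0 -> ∑-perms-block (suc j) k (G (α0 ⊎ₚ β0)) (zero1 (α0 ⊎ₚ β0)))) ⟩ _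
   ≡⟨ ∑-cong-∈ P (\ {α0} α0∈ -> ∑-cong Q (\ β0 -> ∑-cong-∈ P (\ {α1} α1∈ -> ∑-cong Q (\ β1 -> term α0 α1 β0 β1 (∈-perms⁻ α0∈) (∈-perms⁻ α1∈))))) ⟩ _
   ≡⟨ ∑-cong P (\ α0 -> ∑-cong Q (\ β0 -> by (∑-cong P (\ α1 -> ∑-*ˡ Q (c α0 α1) (weight β0))) (∑-*ʳ P (∑ Q (weight β0)) (c α0)))) ⟩ _
   ≡⟨ by (∑-cong P (\ α0 -> ∑-*ˡ Q (∑ P (c α0)) (\ β0 -> ∑ Q (weight β0)))) (∑-*ʳ P (partition k) (\ α0 -> ∑ P (c α0))) ⟩
   connected (suc j) * partition k ∎
   where
   P = perms (suc j)
   Q = perms k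
   G : Word (suc (j N.+ k)) -> Word (suc (j N.+ k)) -> F
   G σ0 σ1 = ind (orbit σ0 σ1 ≟ᵇ block (suc j) k) * weight σ0 σ1
   c : Word (suc j) -> Word (suc j) -> F
   c α0 α1 = indᵇ (transitive α0 α1) * weight α0 α1
   zero0 : ∀ σ0 σ1 -> ¬ Closed (block (suc j) k) σ0 -> G σ0 σ1 ≡ 0#
   zero0 σ0 σ1 ¬c = by (cong (_* weight σ0 σ1) (ind-no (orbit σ0 σ1 ≟ᵇ block (suc j) k)
    (\ e -> ¬c (subst (\ S -> Closed S σ0) e (orbit-closed0 {σ0 = σ0} {σ1}))))) (zeroˡ _)
   zero1 : ∀ σ0 σ1 -> ¬ Closed (block (suc j) k) σ1 -> G σ0 σ1 ≡ 0#
   zero1 σ0 σ1 ¬c = by (cong (_* weight σ0 σ1) (ind-no (orbit σ0 σ1 ≟ᵇ block (suc j) k)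
    (\ e -> ¬c (subst (\ S -> Closed S σ1) e (orbit-closed1 {σ0 = σ0} {σ1}))))) (zeroˡ _)
   bool : ∀ {A : Set} (d : Dec A) b -> (A -> True b) -> (True b -> A) -> ind d ≡ indᵇ b
   bool d true f g = ind-yes d (g tt)
   bool d false f g = ind-no d f
   term : ∀ α0 α1 β0 β1 -> Perm α0 -> Perm α1 -> G (α0 ⊎ₚ β0) (α1 ⊎ₚ β1) ≡ c α0 α1 * weight β0 β1
   term α0 α1 β0 β1 p₀ p1 = by (cong₂ _*_ (bool (orbit (α0 ⊎ₚ β0) (α1 ⊎ₚ β1) ≟ᵇ block (suc j) k) (transitive α0 α1)
    (\ e -> ⇒transitive (orbit-block⇒Transitive {α0 = α0} {α1} {β0} {β1} p₀ p1 e)) (\ t -> Transitive⇒orbit-block {α0 = α0} {α1} {β0} {β1} (transitive⇒ t)))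
    (weight-⊎ α0 α1 β0 β1)) (sym (*-assoc _ _ _))

  ∑-withOrbit : ∀ m -> ∑ (subsets m) (withOrbit m) ≡ partition (suc m)
  ∑-withOrbit m = by (∑-swap (subsets m) (perms (suc m)) _) (∑-cong (perms (suc m)) (\ σ0 ->
   by (∑-swap (subsets m) (perms (suc m)) _) (∑-cong (perms (suc m)) (\ σ1 ->
   by (∑-*ʳ (subsets m) (weight σ0 σ1) _) (by (cong (_* weight σ0 σ1) (once (orbit σ0 σ1) (orbit-zero {σ0 = σ0} {σ1}))) (*-idˡ _))))))
   where
   once : ∀ {m} (O : Vec Bool (suc m)) -> True (get O zero) -> ∑ (subsets m) (\ S -> ind (O ≟ᵇ (true ∷ S))) ≡ 1#
   once (true ∷ O) _ = by (∑-cong (subsets _) (\ S -> ind-cong ((true ∷ O) ≟ᵇ (true ∷ S)) (O ≟ᵇ S) VP.∷-injectiveʳ (cong (true ∷_)))) (all O)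
    where
    all : ∀ {m} (O : Vec Bool m) -> ∑ (subsets m) (\ S -> ind (O ≟ᵇ S)) ≡ 1#
    all [] = by (+-idʳ _) (ind-yes ([] ≟ᵇ []) refl)
    all {suc m} (b ∷ O) = by (∑-vecsOver-suc m (true ∷ false ∷ []) (\ S -> ind ((b ∷ O) ≟ᵇ S))) (by (cong (∑ (subsets m) (\ S -> ind ((b ∷ O) ≟ᵇ (true ∷ S))) +_) (+-idʳ _)) (split b))
     where
     same : ∀ b -> ∑ (subsets m) (\ S -> ind ((b ∷ O) ≟ᵇ (b ∷ S))) ≡ 1#
     same b = by (∑-cong (subsets m) (\ S -> ind-cong ((b ∷ O) ≟ᵇ (b ∷ S)) (O ≟ᵇ S) VP.∷-injectiveʳ (cong (b ∷_)))) (all O)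
     diff : ∀ b b' -> ¬ b ≡ b' -> ∑ (subsets m) (\ S -> ind ((b ∷ O) ≟ᵇ (b' ∷ S))) ≡ 0#
     diff b b' ne = ∑-≡0 (subsets m) (\ {S} _ -> ind-no ((b ∷ O) ≟ᵇ (b' ∷ S)) (ne ∘ VP.∷-injectiveˡ))
     split : ∀ b -> ∑ (subsets m) (\ S -> ind ((b ∷ O) ≟ᵇ (true ∷ S))) + ∑ (subsets m) (\ S -> ind ((b ∷ O) ≟ᵇ (false ∷ S))) ≡ 1#
     split true = by (cong₂ _+_ (same true) (diff true false (\ ()))) (+-idʳ _)
     split false = by (cong₂ _+_ (diff false true (\ ())) (same false)) (+-idˡ _)

  -- n times the generating function of connected pairs, marked at 0.
  logZ : Ser
  logZ zero = 0#
  logZ (suc m) = rf m * connected (suc m)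

  -- Pairs on m + 1 points are sorted by the orbit of 0. If it has j + 1 points, choosing the other
  -- j gives a binomial coefficient that the reciprocal factorials absorb, and a convolution
  -- remains.
  ϑ-Z : ϑ (Z N) ≈ Z N · logZ
  ϑ-Z zero = by (cong (_* Z N 0) int-0) (by (zeroˡ _) (sym (zeroʳ _)))
  ϑ-Z (suc m) = begin
   nat (suc m) * (rf (suc m) * partition (suc m))
   ≡⟨ sym (*-assoc _ _ _) ⟩ _
   ≡⟨ cong₂ _*_ (rf-suc m) (sym (∑-withOrbit m)) ⟩
   rf m * ∑ (subsets m) (withOrbit m)
   ≡⟨ ∑-subsets m (withOrbit m) (withOrbit-symmetric m) ⟩ _
   ≡⟨ sumTo-cong m (\ j j≤m -> by (cong (rf j * rf (m ∸ j) *_) (at j j≤m))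
   (solve 4 (\ a b c d -> a :* b :* (c :* d) := (a :* c) :* (b :* d)) refl (rf j) (rf (m ∸ j)) (connected (suc j)) (partition (m ∸ j)))) ⟩
   (tail logZ · Z N) m
   ≡⟨ by (·-comm (tail logZ) (Z N) m) (sym (by (·-sucʳ (Z N) logZ m) (by (cong ((Z N · tail logZ) m +_) (zeroʳ _)) (+-idʳ _)))) ⟩
   (Z N · logZ) (suc m) ∎
   where
   open Solver
   at : ∀ j -> j N.≤ m -> withOrbit m (initial m j) ≡ connected (suc j) * partition (m ∸ j)
   at j j≤m = by (cong (\ i -> withOrbit i (initial i j)) (sym (NP.m+[n∸m]≡n j≤m))) (withOrbit-initial j (m ∸ j))

-- Cycles and fixed colourings

count : ∀ {n} -> (Fin n -> Bool) -> ℕ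
count {n} p = length (filterᵇ p (allFin n))

indicator : Bool -> ℕ
indicator true = 1
indicator false = 0

count-suc : ∀ {n} (p : Fin (suc n) -> Bool) -> count p ≡ indicator (p zero) N.+ count (p ∘ suc)
count-suc {n} p = by (head (p zero) refl) (cong (indicator (p zero) N.+_)
 (by (cong (length ∘ filterᵇ p) (sym (LP.map-tabulate id suc))) (mapped (allFin n))))
 where
 head : ∀ b -> p zero ≡ b -> count p ≡ indicator b N.+ length (filterᵇ p (List.tabulate suc))
 head b e with p zero
 head true refl | true = refl
 head false refl | false = refl
 mapped : ∀ xs -> length (filterᵇ p (map suc xs)) ≡ length (filterᵇ (p ∘ suc) xs)
 mapped [] = refl
 mapped (x ∷ xs) with p (suc x)
 ... | true = cong suc (mapped xs)
 ... | false = mapped xs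

count-cong : ∀ {n} {p q : Fin n -> Bool} -> (∀ i -> p i ≡ q i) -> count p ≡ count q
count-cong {n} {p} {q} e = go (allFin n)
 where
 go : ∀ xs -> length (filterᵇ p xs) ≡ length (filterᵇ q xs)
 go [] = refl
 go (x ∷ xs) with p x | q x | e x
 ... | true | .true | refl = cong suc (go xs)
 ... | false | .false | refl = go xs

module _ {n} {σ : Word n} (p : Perm σ) where

 iter-reduce : ∀ i k -> ∃ \ k' -> k' N.< n × iter σ k i ≡ iter σ k' i
 iter-reduce i k = let (k' , k'≤d , e) = go k in k' , NP.≤-<-trans k'≤d d<n , e
  where
  d = proj₁ (iter-period p i)
  d<n = proj₁ (proj₂ (iter-period p i))
  go : ∀ k -> ∃ \ k' -> k' N.≤ d × iter σ k i ≡ iter σ k' i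
  go zero = 0 , z≤n , refl
  go (suc k) with go k
  ... | k' , k'≤d , e with k' N.≟ d
  ... | yes refl = 0 , z≤n , by (cong (get σ) e) (proj₂ (proj₂ (iter-period p i)))
  ... | no k'≢d = suc k' , NP.≤∧≢⇒< k'≤d k'≢d , cong (get σ) e

least : ∀ {n} -> (ℕ -> Fin n) -> ℕ -> Fin n
least f zero = f 0
least f (suc k) with toℕ (f (suc k)) N.≤? toℕ (least f k)
... | yes _ = f (suc k)
... | no _ = least f k

least-attained : ∀ {n} (f : ℕ -> Fin n) k -> ∃ \ j -> least f k ≡ f j
least-attained f zero = 0 , refl
least-attained f (suc k) with toℕ (f (suc k)) N.≤? toℕ (least f k)
... | yes _ = suc k , refl
... | no _ = least-attained f k

least-≤ : ∀ {n} (f : ℕ -> Fin n) k {j} -> j N.≤ k -> toℕ (least f k) N.≤ toℕ (f j)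
least-≤ f zero z≤n = NP.≤-refl
least-≤ f (suc k) {j} j≤ with toℕ (f (suc k)) N.≤? toℕ (least f k) | j N.≟ suc k
... | yes _ | yes refl = NP.≤-refl
... | yes a | no ne = NP.≤-trans a (least-≤ f k (NP.≤-pred (NP.≤∧≢⇒< j≤ ne)))
... | no a | yes refl = NP.<⇒≤ (NP.≰⇒> a)
... | no _ | no ne = least-≤ f k (NP.≤-pred (NP.≤∧≢⇒< j≤ ne))

module Representative {n} (σ : Word n) (p : Perm σ) where

 -- The least element of the cycle, so that the fixed points of `rep` are the cycle minima counted
 -- by z.
 rep : Fin n -> Fin n
 rep i = least (\ k -> iter σ k i) n

 rep-attained : ∀ i -> ∃ \ k -> rep i ≡ iter σ k i
 rep-attained i = least-attained (\ k -> iter σ k i) n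

 rep-≤ : ∀ i k -> toℕ (rep i) N.≤ toℕ (iter σ k i)
 rep-≤ i k = let (k' , k'<n , e) = iter-reduce p i k in
  subst (\ x -> toℕ (rep i) N.≤ toℕ x) (sym e) (least-≤ (\ k -> iter σ k i) n (NP.<⇒≤ k'<n))

 rep-step : ∀ i -> rep (get σ i) ≡ rep i
 rep-step i = FP.toℕ-injective (NP.≤-antisym a b)
  where
  b : toℕ (rep i) N.≤ toℕ (rep (get σ i))
  b = let (k , e) = rep-attained (get σ i) in
   subst (\ x -> toℕ (rep i) N.≤ toℕ x) (by (iter-suc σ k i) (sym e)) (rep-≤ i (suc k))
  a : toℕ (rep (get σ i)) N.≤ toℕ (rep i)
  a = let (k , e) = rep-attained i ; (d , _ , e') = iter-period p i in
   subst (\ x -> toℕ (rep (get σ i)) N.≤ toℕ x)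
    (by (iter-+ σ k d (get σ i)) (by (cong (iter σ k) (by (sym (iter-suc σ d i)) e')) (sym e)))
    (rep-≤ (get σ i) (k N.+ d))

 isCycleMin⇔ : ∀ i -> isCycleMin σ i ≡ ⌊ rep i Fin.≟ i ⌋
 isCycleMin⇔ i = T-ext to from
  where
  to : True (isCycleMin σ i) -> True ⌊ rep i Fin.≟ i ⌋
  to t = fromWitness (FP.toℕ-injective (NP.≤-antisym (rep-≤ i 0) (let (k , e) = rep-attained i ; (k' , k'<n , e') = iter-reduce p i k in
   subst (\ x -> toℕ i N.≤ toℕ x) (sym (by e e'))
    (NP.≤ᵇ⇒≤ _ _ (All.lookup (AP.all⁺ _ _ t) (∈P.∈-upTo⁺ k'<n))))))
  from : True ⌊ rep i Fin.≟ i ⌋ -> True (isCycleMin σ i)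
  from t = AP.all⁻ _ (All.universal (\ k -> NP.≤⇒≤ᵇ (subst (\ x -> toℕ x N.≤ toℕ (iter σ k i)) (toWitness {a? = rep i Fin.≟ i} t) (rep-≤ i k))) (List.upTo n))

 invariant-iter : ∀ {A : Set} {c : Vec A n} -> act c σ ≡ c -> ∀ k i -> get c (iter σ k i) ≡ get c i
 invariant-iter e zero i = refl
 invariant-iter {c = c} e (suc k) i = by (sym (lookup-act c σ _)) (by (cong (\ v -> get v (iter σ k i)) e) (invariant-iter e k i))

 invariant⇒ : ∀ {A : Set} {c : Vec A n} -> act c σ ≡ c -> ∀ i -> get c i ≡ get c (rep i)
 invariant⇒ {c = c} e i = let (k , q) = rep-attained i in sym (by (cong (get c) q) (invariant-iter e k i))

 ⇒invariant : ∀ {A : Set} {c : Vec A n} -> (∀ i -> get c i ≡ get c (rep i)) -> act c σ ≡ c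
 ⇒invariant {c = c} f = lookup-ext \ i -> by (lookup-act c σ i)
  (by (f (get σ i)) (by (cong (get c) (rep-step i)) (sym (f i))))

module FixCycles (J : NumberField) (N : ℕ) where

 open FieldProperties J
 open Sums J
 open Insertion J N
 open ≡-Reasoning

 -- An entry of a colouring is prescribed either as a constant or as a copy of an entry. Constants
 -- arise when the induction fixes the first entry and its copies follow; an entry that copies
 -- itself is free.
 Rule : ℕ -> Set
 Rule n = Fin N ⊎ Fin n

 value : ∀ {n} -> Rule n -> Vec (Fin N) n -> Fin N
 value (inj₁ y) c = y
 value (inj₂ j) c = get c j

 bind : ∀ {n} -> Fin N -> Rule (suc n) -> Rule n
 bind x (inj₁ y) = inj₁ y
 bind x (inj₂ zero) = inj₁ x
 bind x (inj₂ (suc j)) = inj₂ j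

 value-bind : ∀ {n} x r (c : Vec (Fin N) n) -> value (bind x r) c ≡ value r (x ∷ c)
 value-bind x (inj₁ y) c = refl
 value-bind x (inj₂ zero) c = refl
 value-bind x (inj₂ (suc j)) c = refl

 isFree : ∀ {n} -> Fin n -> Rule n -> Bool
 isFree i (inj₁ _) = false
 isFree i (inj₂ j) = ⌊ j Fin.≟ i ⌋

 isFree-bind : ∀ {n} x (i : Fin n) r -> isFree i (bind x r) ≡ isFree (suc i) r
 isFree-bind x i (inj₁ y) = refl
 isFree-bind x i (inj₂ zero) = refl
 isFree-bind x i (inj₂ (suc j)) = sym (⌊⌋-map′ _ _ (j Fin.≟ i))

 Obeys : ∀ {n} -> (Fin n -> Rule n) -> Vec (Fin N) n -> Set
 Obeys ρ c = ∀ i -> get c i ≡ value (ρ i) c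

 obeys? : ∀ {n} (ρ : Fin n -> Rule n) c -> Dec (Obeys ρ c)
 obeys? ρ c = FP.all? (\ i -> get c i Fin.≟ value (ρ i) c)

 -- Copies refer to entries that do not come later, so the first entry is free or constant. After
 -- its colour is chosen, `bind` removes it from the remaining rules; each free entry contributes a
 -- factor N.
 ∑-obeys : ∀ n (ρ : Fin n -> Rule n) -> (∀ i j -> ρ i ≡ inj₂ j -> toℕ j N.≤ toℕ i) ->
  ∑ (cols N n) (\ c -> ind (obeys? ρ c)) ≡ nat (N N.^ count (\ i -> isFree i (ρ i)))
 ∑-obeys zero ρ below = by (+-idʳ _) (by (ind-yes (obeys? ρ []) \ ()) (sym int-1))
 ∑-obeys (suc n) ρ below = by (∑-vecsOver-suc n I _) (by (∑-cong I (\ x -> by (∑-cong (cols N n) (split x))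
  (by (∑-*ˡ (cols N n) _ _) (cong (ind (x Fin.≟ value (ρ zero) (x ∷ Vec.replicate n x)) *_) (rest x)))))
  (by (finish (ρ zero) refl) (cong (\ k -> nat (N N.^ k)) (sym (count-suc (\ i -> isFree i (ρ i)))))))
  where
  free = \ i -> isFree (suc i) (ρ (suc i))
  value-0 : ∀ x (c c' : Vec (Fin N) n) -> value (ρ zero) (x ∷ c) ≡ value (ρ zero) (x ∷ c')
  value-0 x c c' with ρ zero in e
  ... | inj₁ y = refl
  ... | inj₂ zero = refl
  ... | inj₂ (suc j) with below zero (suc j) e
  ... | ()
  split : ∀ x c -> ind (obeys? ρ (x ∷ c)) ≡ ind (x Fin.≟ value (ρ zero) (x ∷ Vec.replicate n x)) * ind (obeys? (bind x ∘ ρ ∘ suc) c)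
  split x c = by (ind-cong (obeys? ρ (x ∷ c)) ((x Fin.≟ value (ρ zero) (x ∷ Vec.replicate n x)) ×-dec obeys? (bind x ∘ ρ ∘ suc) c)
   (\ f -> by (f zero) (value-0 x c _) , \ i -> by (f (suc i)) (sym (value-bind x (ρ (suc i)) c)))
   (\ { (e , f) zero -> by e (value-0 x _ c) ; (e , f) (suc i) -> by (f i) (value-bind x (ρ (suc i)) c) }))
   (ind-× (x Fin.≟ value (ρ zero) (x ∷ Vec.replicate n x)) (obeys? (bind x ∘ ρ ∘ suc) c))
  rest : ∀ x -> ∑ (cols N n) (\ c -> ind (obeys? (bind x ∘ ρ ∘ suc) c)) ≡ nat (N N.^ count free)
  rest x = by (∑-obeys n (bind x ∘ ρ ∘ suc) (\ i j e -> lower i j (ρ (suc i)) refl e))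
   (cong (\ k -> nat (N N.^ k)) (count-cong (\ i -> isFree-bind x i (ρ (suc i)))))
   where
   lower : ∀ i j r -> ρ (suc i) ≡ r -> bind x r ≡ inj₂ j -> toℕ j N.≤ toℕ i
   lower i j (inj₂ (suc .j)) e refl = NP.≤-pred (below (suc i) (suc j) e)
  finish : ∀ r -> ρ zero ≡ r -> ∑ I (\ x -> ind (x Fin.≟ value (ρ zero) (x ∷ Vec.replicate n x)) * nat (N N.^ count free))
   ≡ nat (N N.^ (indicator (isFree zero (ρ zero)) N.+ count free))
  finish (inj₁ y) e rewrite e = ∑-ind-≟ y (\ _ -> nat (N N.^ count free))
  finish (inj₂ zero) e rewrite e = by (∑-cong I (\ x -> by (cong (_* nat (N N.^ count free)) (ind-yes (x Fin.≟ x) refl)) (*-idˡ _)))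
   (by (∑-const I _) (by (cong (\ k -> nat k * nat (N N.^ count free)) (LP.length-tabulate id)) (sym (nat-* N (N N.^ count free)))))
  finish (inj₂ (suc j)) e with below zero (suc j) e
  ... | ()

 fix-z : ∀ {n} {σ : Word n} -> Perm σ -> fix σ ≡ nat (N N.^ D.z σ)
 fix-z {n} {σ} p = by (∑-cong (cols N n) (\ c -> ind-cong (act c σ ≟ᵥ c) (obeys? (inj₂ ∘ rep) c) invariant⇒ ⇒invariant))
  (by (∑-obeys n (inj₂ ∘ rep) (\ { i j refl -> rep-≤ i 0 }))
  (cong (\ k -> nat (N N.^ k)) (count-cong (\ i -> sym (isCycleMin⇔ i)))))
  where open Representative σ p

-- Relabellings fixing the root, and divisibility by (n-1)!

conj-conj : ∀ {n} {π ρ : Word n} -> Perm π -> Perm ρ -> ∀ σ -> conj ρ (conj π σ) ≡ conj (compose π ρ) σ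
conj-conj {π = π} {ρ} p q σ = lookup-ext \ i -> injective pq (begin
 get (compose π ρ) (get (conj ρ (conj π σ)) i) ≡⟨ lookup-compose π ρ _ ⟩
 get π (get ρ (get (conj ρ (conj π σ)) i)) ≡⟨ cong (get π) (π-conj q (conj π σ) i) ⟩
 get π (get (conj π σ) (get ρ i)) ≡⟨ π-conj p σ (get ρ i) ⟩
 get σ (get π (get ρ i)) ≡⟨ cong (get σ) (lookup-compose π ρ i) ⟨
 get σ (get (compose π ρ) i) ≡⟨ π-conj pq σ i ⟨
 get (compose π ρ) (get (conj (compose π ρ) σ) i) ∎)
 where
 open ≡-Reasoning
 pq = Perm-compose {σ = π} p q

code : ∀ {k n} -> Vec (Fin n) k -> Fin (n N.^ k)
code [] = zero
code (x ∷ v) = Fin.combine x (code v)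

code-injective : ∀ {k n} (u v : Vec (Fin n) k) -> code u ≡ code v -> u ≡ v
code-injective [] [] e = refl
code-injective (x ∷ u) (y ∷ v) e = let (a , b) = FP.combine-injective x (code u) y (code v) e in cong₂ _∷_ a (code-injective u v b)

2^-injective : ∀ a b -> 2 N.^ a ≡ 2 N.^ b -> a ≡ b
2^-injective a b e with NP.<-cmp a b
... | tri< a<b _ _ = ⊥-elim (NP.<⇒≢ (NP.^-monoʳ-< 2 (N.s≤s (N.s≤s N.z≤n)) a<b) e)
... | tri≈ _ q _ = q
... | tri> _ _ b<a = ⊥-elim (NP.<⇒≢ (NP.^-monoʳ-< 2 (N.s≤s (N.s≤s N.z≤n)) b<a) (sym e))

minimum : ∀ {A : Set} (f : A -> ℕ) {x : A} {xs} -> x ∈ xs -> ∃ \ y -> y ∈ xs × (∀ {w} -> w ∈ xs -> f y N.≤ f w)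
minimum f {xs = x ∷ []} _ = x , here refl , \ { (here refl) -> NP.≤-refl }
minimum f {xs = x ∷ x' ∷ xs} _ with minimum f {xs = x' ∷ xs} (here refl)
... | y , y∈ , l with f x N.≤? f y
... | yes a = x , here refl , \ { (here refl) -> NP.≤-refl ; (there z∈) -> NP.≤-trans a (l z∈) }
... | no a = y , there y∈ , \ { (here refl) -> NP.<⇒≤ (NP.≰⇒> a) ; (there z∈) -> l z∈ }

Pair : ℕ -> Set
Pair n = Word n × Word n

conj2 : ∀ {n} -> Word n -> Pair n -> Pair n
conj2 π x = conj π (proj₁ x) , conj π (proj₂ x)

module Relabelling (J : NumberField) where

 open FieldProperties J
 open Sums J
 open PermSums J

 -- Conjugation preserves the number of fixed colourings. With two colours this number is 2 to the
 -- power z, which recovers z without transporting cycles.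
 z-conj : ∀ {n} {π σ : Word n} -> Perm π -> Perm σ -> D.z (conj π σ) ≡ D.z σ
 z-conj {π = π} {σ} p q = 2^-injective _ _ (nat-injective (by (sym (FixCycles.fix-z J 2 (Perm-conj p q)))
  (by (Exponential.fix-conj J 2 p σ) (FixCycles.fix-z J 2 q))))

 transitive-conj : ∀ {n} {π : Word n} -> Perm π -> ∀ σ0 σ1 -> transitive (conj π σ0) (conj π σ1) ≡ transitive σ0 σ1
 transitive-conj {π = π} p σ0 σ1 = T-ext
  (\ t -> ⇒transitive (subst₂ Transitive (inv-conj p σ0) (inv-conj p σ1) (Transitive-conj (Perm-inv p) {conj π σ0} {conj π σ1} (transitive⇒ t))))
  (\ t -> ⇒transitive (Transitive-conj p {σ0} {σ1} (transitive⇒ t)))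

 good-conj : ∀ g {n} {π : Word n} {x : Pair n} -> Perm π -> Perm (proj₁ x) -> Perm (proj₂ x) -> good g n (conj2 π x) ≡ good g n x
 good-conj g {n} {π} {σ0 , σ1} p p₀ p1 = cong₂ _∧_ (transitive-conj p σ0 σ1)
  (cong (\ k -> (k N.+ 2 N.* g) ≡ᵇ (n N.+ 2)) (cong₂ N._+_ (cong₂ N._+_ (z-conj p p₀) (z-conj p p1))
  (by (cong D.z (sym (conj-compose p σ0 σ1))) (z-conj p (Perm-compose {σ = σ0} p₀ p1)))))

 -- A relabelling fixing the root is determined by its effect on a transitive pair.
 relabelling-free : ∀ {m} {π ρ : Word m} {x : Pair (suc m)} -> Perm π -> Perm ρ -> True (transitive (proj₁ x) (proj₂ x)) ->
  conj2 (lift π) x ≡ conj2 (lift ρ) x -> π ≡ ρ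
 relabelling-free {m} {π} {ρ} {σ0 , σ1} p q t e = by (sym (unlift-lift π)) (by (cong unlift lifts) (unlift-lift ρ))
  where
  agree : Fin (suc m) -> Bool
  agree i = ⌊ get (lift π) i Fin.≟ get (lift ρ) i ⌋
  S = Vec.tabulate agree
  agree⁻ : ∀ i -> True (get S i) -> get (lift π) i ≡ get (lift ρ) i
  agree⁻ i Si = toWitness {a? = get (lift π) i Fin.≟ get (lift ρ) i} (subst True (VP.lookup∘tabulate agree i) Si)
  agree⁺ : ∀ i -> get (lift π) i ≡ get (lift ρ) i -> True (get S i)
  agree⁺ i q = subst True (sym (VP.lookup∘tabulate agree i)) (fromWitness {a? = get (lift π) i Fin.≟ get (lift ρ) i} q)
  closedS : ∀ σ -> conj (lift π) σ ≡ conj (lift ρ) σ -> Closed S (conj (lift π) σ)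
  stable (closedS σ e) i Si = agree⁺ (get (conj (lift π) σ) i)
   (by (π-conj (Perm-lift p) σ i) (by (cong (get σ) (agree⁻ i Si))
   (by (sym (π-conj (Perm-lift q) σ i)) (cong (\ τ -> get (lift ρ) (get τ i)) (sym e)))))
  everywhere : ∀ i -> True (get S i)
  everywhere = Transitive-conj (Perm-lift p) {σ0} {σ1} (transitive⇒ t) S (zero , agree⁺ zero refl)
   (closedS σ0 (cong proj₁ e)) (closedS σ1 (cong proj₂ e))
  lifts : lift π ≡ lift ρ
  lifts = lookup-ext {u = lift π} {lift ρ} (\ i -> agree⁻ i (everywhere i))

 code2 : ∀ {n} -> Pair n -> ℕ
 code2 x = toℕ (Fin.combine (code (proj₁ x)) (code (proj₂ x)))

 code2-injective : ∀ {n} {x y : Pair n} -> code2 x ≡ code2 y -> x ≡ y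
 code2-injective {x = x} {y} e = let (a , b) = FP.combine-injective (code (proj₁ x)) (code (proj₂ x)) (code (proj₁ y)) (code (proj₂ y)) (FP.toℕ-injective e) in
  cong₂ _,_ (code-injective (proj₁ x) (proj₁ y) a) (code-injective (proj₂ x) (proj₂ y) b)

 -- A choice of one pair in each class of relabellings: the one whose code, an injective numbering,
 -- is least.
 canonical : ∀ {m} -> Pair (suc m) -> Bool
 canonical {m} x = Data.Bool.ListAction.all (\ π -> code2 x ≤ᵇ code2 (conj2 (lift π) x)) (perms m)

 canonical⁺ : ∀ {m} {x : Pair (suc m)} -> (∀ {π} -> π ∈ perms m -> code2 x N.≤ code2 (conj2 (lift π) x)) -> True (canonical x)
 canonical⁺ f = AP.all⁻ _ (All.tabulate (NP.≤⇒≤ᵇ ∘ f))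

 canonical⁻ : ∀ {m} {x : Pair (suc m)} -> True (canonical x) -> ∀ {π} -> π ∈ perms m -> code2 x N.≤ code2 (conj2 (lift π) x)
 canonical⁻ t π∈ = NP.≤ᵇ⇒≤ _ _ (All.lookup (AP.all⁺ _ _ t) π∈)

 conj2-lift : ∀ {m} {π ρ : Word m} -> Perm π -> Perm ρ -> ∀ x -> conj2 (lift ρ) (conj2 (lift π) x) ≡ conj2 (lift (compose π ρ)) x
 conj2-lift {π = π} {ρ} p q x = cong₂ _,_ (at (proj₁ x)) (at (proj₂ x))
  where
  at : ∀ σ -> conj (lift ρ) (conj (lift π) σ) ≡ conj (lift (compose π ρ)) σ
  at σ = by (conj-conj (Perm-lift p) (Perm-lift q) σ) (cong (\ τ -> conj τ σ) (lift-compose π ρ))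

 compose-inv : ∀ {m} {π : Word m} -> Perm π -> ∀ ρ -> compose π (compose (inv π) ρ) ≡ ρ
 compose-inv {π = π} p ρ = lookup-ext \ i -> by (lookup-compose π (compose (inv π) ρ) i)
  (by (cong (get π) (lookup-compose (inv π) ρ i)) (lookup-inv p _))

 canonical-≤ : ∀ {m} {π ρ : Word m} -> Perm π -> Perm ρ -> ∀ {x : Pair (suc m)} -> True (canonical (conj2 (lift π) x)) ->
  code2 (conj2 (lift π) x) N.≤ code2 (conj2 (lift ρ) x)
 canonical-≤ {π = π} {ρ} p q {x} t = subst (code2 (conj2 (lift π) x) N.≤_)
  (cong code2 (by (conj2-lift p pr x) (cong (\ τ -> conj2 (lift τ) x) (compose-inv p ρ))))
  (canonical⁻ {x = conj2 (lift π) x} t (∈-perms⁺ pr))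
  where pr = Perm-compose {σ = inv π} (Perm-inv p) q

 canonical-exists : ∀ {m} (x : Pair (suc m)) -> ∃ \ π -> π ∈ perms m × True (canonical (conj2 (lift π) x))
 canonical-exists {m} x = let (π , π∈ , l) = minimum (\ π -> code2 (conj2 (lift π) x)) (∈-perms⁺ (Perm-idp {m})) in
  π , π∈ , canonical⁺ {x = conj2 (lift π) x} (\ {ρ} ρ∈ -> subst (code2 (conj2 (lift π) x) N.≤_)
   (cong code2 (sym (conj2-lift (∈-perms⁻ π∈) (∈-perms⁻ ρ∈) x))) (l (∈-perms⁺ (Perm-compose {σ = π} (∈-perms⁻ π∈) (∈-perms⁻ ρ∈)))))

 ∑-once : ∀ {A : Set} (p : A -> Bool) {y xs} -> Unique xs -> y ∈ xs -> True (p y) -> (∀ {x} -> x ∈ xs -> True (p x) -> x ≡ y) ->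
  ∑ xs (indᵇ ∘ p) ≡ 1#
 ∑-once p {y} {xs} u y∈ py uniq = by (∑-cong xs (\ x -> sym (*-idʳ _))) (by (sym (∑-filterᵇ p xs (\ _ -> 1#)))
  (by (∑-bij-surjective ([] ∷ []) (UP.filter⁺ (T? ∘ p) u) (\ _ -> y)
  (\ _ -> ∈P.∈-filter⁺ (T? ∘ p) y∈ py) (\ { (here refl) (here refl) _ -> refl })
   (\ {x} x∈ -> y , here refl , sym (let (a , b) = ∈P.∈-filter⁻ (T? ∘ p) {xs = xs} x∈ in uniq a b)) (\ _ -> 1#))
  (+-idʳ 1#)))

 module _ (g m : ℕ) where

  rooted : List (Pair (suc m))
  rooted = filterᵇ (good g (suc m)) (pairs (suc m))

  rooted⁻ : ∀ {x} -> x ∈ rooted -> Perm (proj₁ x) × Perm (proj₂ x) × True (good g (suc m) x)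
  rooted⁻ {x} x∈ = let (a , b) = ∈P.∈-filter⁻ (T? ∘ good g (suc m)) {xs = pairs (suc m)} x∈ ; (c , d) = ∈-pairList⁻ a in
   ∈-perms⁻ c , ∈-perms⁻ d , b

  rooted⁺ : ∀ {x} -> Perm (proj₁ x) -> Perm (proj₂ x) -> True (good g (suc m) x) -> x ∈ rooted
  rooted⁺ a b t = ∈P.∈-filter⁺ (T? ∘ good g (suc m)) (∈-pairList⁺ (∈-perms⁺ a) (∈-perms⁺ b)) t

  rooted-conj : ∀ {π} -> Perm π -> ∀ {x} -> x ∈ rooted -> conj2 π x ∈ rooted
  rooted-conj {π} p {x} x∈ = let (a , b , t) = rooted⁻ x∈ in
   rooted⁺ (Perm-conj p a) (Perm-conj p b) (subst True (sym (good-conj g {x = x} p a b)) t)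

  rooted-unique : Unique rooted
  rooted-unique = UP.filter⁺ (T? ∘ good g (suc m)) (pairList-unique (perms-unique (suc m)) (perms-unique (suc m)))

  permCount-! : ∀ n -> ∑ (perms n) (\ _ -> 1#) ≡ nat (n !)
  permCount-! zero = by (+-idʳ _) (sym int-1)
  permCount-! (suc n) = by (∑-perms-suc n _) (by (∑-cong (perms n) (\ _ -> by (∑-length (allFin (suc n)))
   (by (cong nat (LP.length-tabulate {n = suc n} (\ i -> i))) (sym (*-idʳ _)))))
   (by (∑-*ˡ (perms n) _ _) (by (cong (nat (suc n) *_) (permCount-! n)) (sym (nat-* (suc n) (n !))))))

  -- Relabellings of the m points other than the root act freely on transitive pairs, so every class
  -- has m! members. Counting (pair, relabelling) with canonical result in two ways gives the
  -- quotient; it makes the numerators P_g integral.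
  countPairs-divisible : ∃ \ k -> countPairs g (suc m) ≡ m ! N.* k
  countPairs-divisible = length (filterᵇ canonical rooted) , nat-injective (begin
   nat (length rooted)
   ≡⟨ ∑-length rooted ⟨
   ∑ rooted (\ _ -> 1#)
   ≡⟨ ∑-cong-∈ rooted once ⟨ _
   ≡⟨ ∑-swap rooted (perms m) _ ⟩ _
   ≡⟨ ∑-cong-∈ (perms m) (\ {π} π∈ -> sym (relabel (∈-perms⁻ π∈))) ⟩ _
   ≡⟨ by (∑-cong (perms m) (\ _ -> sym (*-idˡ _))) (∑-*ʳ (perms m) _ _) ⟩ _
   ≡⟨ cong₂ _*_ (permCount-! m) (by (∑-cong rooted (\ x -> sym (*-idʳ _))) (by (sym (∑-filterᵇ canonical rooted (\ _ -> 1#))) (∑-length (filterᵇ canonical rooted)))) ⟩ _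
   ≡⟨ nat-* (m !) _ ⟨
   nat (m ! N.* length (filterᵇ canonical rooted)) ∎)
   where
   open ≡-Reasoning
   once : ∀ {x} -> x ∈ rooted -> ∑ (perms m) (\ π -> indᵇ (canonical (conj2 (lift π) x))) ≡ 1#
   once {x} x∈ = let (π , π∈ , t) = canonical-exists x ; (_ , _ , gx) = rooted⁻ x∈ in
    ∑-once (\ π -> canonical (conj2 (lift π) x)) (perms-unique m) π∈ t (\ {ρ} ρ∈ s ->
     relabelling-free {x = x} (∈-perms⁻ ρ∈) (∈-perms⁻ π∈) (proj₁ (T-∧⁻ gx))
     (code2-injective (NP.≤-antisym (canonical-≤ (∈-perms⁻ ρ∈) (∈-perms⁻ π∈) {x} s) (canonical-≤ (∈-perms⁻ π∈) (∈-perms⁻ ρ∈) {x} t))))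
   relabel : ∀ {π} -> Perm π -> ∑ rooted (indᵇ ∘ canonical) ≡ ∑ rooted (\ x -> indᵇ (canonical (conj2 (lift π) x)))
   relabel {π} p = ∑-bij rooted-unique rooted-unique (conj2 (lift π)) (conj2 (inv (lift π)))
    (rooted-conj (Perm-lift p)) (rooted-conj (Perm-inv (Perm-lift p)))
    (\ {x} _ -> cong₂ _,_ (inv-conj (Perm-lift p) (proj₁ x)) (inv-conj (Perm-lift p) (proj₂ x)))
    (\ {x} _ -> cong₂ _,_ (conj-inv (Perm-lift p) (proj₁ x)) (conj-inv (Perm-lift p) (proj₂ x))) (indᵇ ∘ canonical)

-- Polynomials as coefficient lists

module Polynomials (J : NumberField) where

 open FieldProperties J
 open Sums J
 open Series J
 open ≡-Reasoning

 Poly : Set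
 Poly = List F

 eval : Poly -> F -> F
 eval [] x = 0#
 eval (a ∷ p) x = a + x * eval p x

 coef : Poly -> Ser
 coef [] k = 0#
 coef (a ∷ p) zero = a
 coef (a ∷ p) (suc k) = coef p k

 addₚ : Poly -> Poly -> Poly
 addₚ [] q = q
 addₚ (a ∷ p) [] = a ∷ p
 addₚ (a ∷ p) (b ∷ q) = (a + b) ∷ addₚ p q

 scaleₚ : F -> Poly -> Poly
 scaleₚ r = List.map (r *_)

 mulₚ : Poly -> Poly -> Poly
 mulₚ [] q = []
 mulₚ (a ∷ p) q = addₚ (scaleₚ a q) (0# ∷ mulₚ p q)

 shiftₚ : ℕ -> Poly -> Poly
 shiftₚ zero p = p
 shiftₚ (suc k) p = 0# ∷ shiftₚ k p

 -- p(x²)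
 spreadₚ : Poly -> Poly
 spreadₚ [] = []
 spreadₚ (a ∷ p) = a ∷ 0# ∷ spreadₚ p

 sumToₚ : ℕ -> (ℕ -> Poly) -> Poly
 sumToₚ zero f = f 0
 sumToₚ (suc k) f = addₚ (sumToₚ k f) (f (suc k))

 ∑ₚ : ∀ {A : Set} -> List A -> (A -> Poly) -> Poly
 ∑ₚ [] f = []
 ∑ₚ (x ∷ xs) f = addₚ (f x) (∑ₚ xs f)

 power : F -> ℕ -> F
 power x zero = 1#
 power x (suc k) = x * power x k

 power-+ : ∀ x j k -> power x (j N.+ k) ≡ power x j * power x k
 power-+ x zero k = sym (*-idˡ _)
 power-+ x (suc j) k = by (cong (x *_) (power-+ x j k)) (sym (*-assoc x _ _))

 power-cancel : ∀ {x y} -> x * y ≡ 1# -> ∀ k -> power x k * power y k ≡ 1#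
 power-cancel e zero = *-idˡ 1#
 power-cancel {x} {y} e (suc k) = by (solve 4 (\ x y a b -> (x :* a) :* (y :* b) := (x :* y) :* (a :* b)) refl x y (power x k) (power y k))
  (by (cong₂ _*_ e (power-cancel e k)) (*-idˡ 1#))
  where open Solver

 power-nat : ∀ N k -> nat (N N.^ k) ≡ power (nat N) k
 power-nat N zero = int-1
 power-nat N (suc k) = by (nat-* N (N N.^ k)) (cong (nat N *_) (power-nat N k))

 eval-add : ∀ p q x -> eval (addₚ p q) x ≡ eval p x + eval q x
 eval-add [] q x = sym (+-idˡ _)
 eval-add (a ∷ p) [] x = sym (+-idʳ _)
 eval-add (a ∷ p) (b ∷ q) x = by (cong (\ r -> a + b + x * r) (eval-add p q x))
  (solve 5 (\ a b x p q -> a :+ b :+ x :* (p :+ q) := (a :+ x :* p) :+ (b :+ x :* q)) refl a b x (eval p x) (eval q x))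
  where open Solver

 eval-scale : ∀ r p x -> eval (scaleₚ r p) x ≡ r * eval p x
 eval-scale r [] x = sym (zeroʳ r)
 eval-scale r (a ∷ p) x = by (cong (\ e -> r * a + x * e) (eval-scale r p x))
  (solve 4 (\ r a x p -> r :* a :+ x :* (r :* p) := r :* (a :+ x :* p)) refl r a x (eval p x))
  where open Solver

 eval-mul : ∀ p q x -> eval (mulₚ p q) x ≡ eval p x * eval q x
 eval-mul [] q x = sym (zeroˡ _)
 eval-mul (a ∷ p) q x = by (eval-add (scaleₚ a q) (0# ∷ mulₚ p q) x)
  (by (cong₂ _+_ (eval-scale a q x) (by (+-idˡ _) (cong (x *_) (eval-mul p q x))))
  (solve 4 (\ a q x p -> a :* q :+ x :* (p :* q) := (a :+ x :* p) :* q) refl a (eval q x) x (eval p x)))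
  where open Solver

 eval-shift : ∀ k p x -> eval (shiftₚ k p) x ≡ power x k * eval p x
 eval-shift zero p x = sym (*-idˡ _)
 eval-shift (suc k) p x = by (+-idˡ _) (by (cong (x *_) (eval-shift k p x)) (sym (*-assoc x _ _)))

 eval-spread : ∀ p x -> eval (spreadₚ p) x ≡ eval p (x * x)
 eval-spread [] x = refl
 eval-spread (a ∷ p) x = cong (a +_) (by (cong (x *_) (+-idˡ _)) (by (sym (*-assoc x x _)) (cong (x * x *_) (eval-spread p x))))

 eval-sumTo : ∀ k f x -> eval (sumToₚ k f) x ≡ sumTo k (\ j -> eval (f j) x)
 eval-sumTo zero f x = refl
 eval-sumTo (suc k) f x = by (eval-add (sumToₚ k f) (f (suc k)) x) (cong (_+ eval (f (suc k)) x) (eval-sumTo k f x))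

 eval-∑ : ∀ {A : Set} (xs : List A) f x -> eval (∑ₚ xs f) x ≡ ∑ xs (\ y -> eval (f y) x)
 eval-∑ [] f x = refl
 eval-∑ (y ∷ xs) f x = by (eval-add (f y) (∑ₚ xs f) x) (cong (eval (f y) x +_) (eval-∑ xs f x))

 coef-add : ∀ p q -> coef (addₚ p q) ≈ coef p ⊕ coef q
 coef-add [] q k = sym (+-idˡ _)
 coef-add (a ∷ p) [] zero = sym (+-idʳ _)
 coef-add (a ∷ p) [] (suc k) = sym (+-idʳ _)
 coef-add (a ∷ p) (b ∷ q) zero = refl
 coef-add (a ∷ p) (b ∷ q) (suc k) = coef-add p q k

 coef-scale : ∀ r p k -> coef (scaleₚ r p) k ≡ r * coef p k
 coef-scale r [] k = sym (zeroʳ r)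
 coef-scale r (a ∷ p) zero = refl
 coef-scale r (a ∷ p) (suc k) = coef-scale r p k

 coef-mul : ∀ p q -> coef (mulₚ p q) ≈ coef p · coef q
 coef-mul [] q k = sym (sumTo-0 k (\ j _ -> zeroˡ (coef q (k ∸ j))))
 coef-mul (a ∷ p) q zero = by (coef-add (scaleₚ a q) (0# ∷ mulₚ p q) 0) (by (+-idʳ _) (coef-scale a q 0))
 coef-mul (a ∷ p) q (suc k) = by (coef-add (scaleₚ a q) (0# ∷ mulₚ p q) (suc k))
  (by (cong₂ _+_ (coef-scale a q (suc k)) (coef-mul p q k)) (sym (·-suc (coef (a ∷ p)) (coef q) k)))

 coef-shift : ∀ j p k -> coef (shiftₚ j p) (j N.+ k) ≡ coef p k
 coef-shift zero p k = refl
 coef-shift (suc j) p k = coef-shift j p k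

 coef-monomial : ∀ j k -> coef (shiftₚ j (1# ∷ [])) k ≡ ind (j N.≟ k)
 coef-monomial zero zero = refl
 coef-monomial zero (suc k) = refl
 coef-monomial (suc j) zero = refl
 coef-monomial (suc j) (suc k) = by (coef-monomial j k) (ind-cong (j N.≟ k) (suc j N.≟ suc k) (cong suc) NP.suc-injective)

 coef-spread : ∀ p k -> coef (spreadₚ p) (2 N.* k) ≡ coef p k
 coef-spread [] k = refl
 coef-spread (a ∷ p) zero = refl
 coef-spread (a ∷ p) (suc k) = by (cong (coef (a ∷ 0# ∷ spreadₚ p) ∘ suc) (NP.+-suc k (k N.+ 0))) (coef-spread p k)

 coef-sumTo : ∀ k f i -> coef (sumToₚ k f) i ≡ sumTo k (\ j -> coef (f j) i)
 coef-sumTo zero f i = refl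
 coef-sumTo (suc k) f i = by (coef-add (sumToₚ k f) (f (suc k)) i) (cong (_+ coef (f (suc k)) i) (coef-sumTo k f i))

 coef-∑ : ∀ {A : Set} (xs : List A) f i -> coef (∑ₚ xs f) i ≡ ∑ xs (\ y -> coef (f y) i)
 coef-∑ [] f i = refl
 coef-∑ (y ∷ xs) f i = by (coef-add (f y) (∑ₚ xs f) i) (cong (coef (f y) i +_) (coef-∑ xs f i))

 eval-0 : ∀ p x -> (∀ k -> coef p k ≡ 0#) -> eval p x ≡ 0#
 eval-0 [] x z = refl
 eval-0 (a ∷ p) x z = by (cong₂ (\ u v -> u + x * v) (z 0) (eval-0 p x (z ∘ suc))) (by (+-idˡ _) (zeroʳ x))

 -- (a + x p(x) - a - r p(r)) / (x - r)
 quotient : F -> Poly -> Poly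
 quotient r [] = []
 quotient r (b ∷ p) = eval (b ∷ p) r ∷ quotient r p

 eval-quotient : ∀ a p r x -> eval (a ∷ p) x - eval (a ∷ p) r ≡ (x - r) * eval (quotient r p) x
 eval-quotient a [] r x = by (cong₂ (\ u v -> (a + u) - (a + v)) (zeroʳ x) (zeroʳ r)) (by (-‿inverseʳ _) (sym (zeroʳ _)))
 eval-quotient a (b ∷ p) r x = begin
  (a + x * P x) - (a + r * P r)
  ≡⟨ solve 5 (\ a x r p q -> (a :+ x :* p) :- (a :+ r :* q) := (x :- r) :* q :+ x :* (p :- q)) refl a x r (P x) (P r) ⟩
  (x - r) * P r + x * (P x - P r)
  ≡⟨ cong (\ u -> (x - r) * P r + x * u) (eval-quotient b p r x) ⟩ _
  ≡⟨ solve 4 (\ x r q e -> (x :- r) :* q :+ x :* ((x :- r) :* e) := (x :- r) :* (q :+ x :* e)) refl x r (P r) (eval (quotient r p) x) ⟩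
  (x - r) * (P r + x * eval (quotient r p) x) ∎
  where
  open Solver
  P = eval (b ∷ p)

 length-quotient : ∀ r p -> length (quotient r p) ≡ length p
 length-quotient r [] = refl
 length-quotient r (b ∷ p) = cong suc (length-quotient r p)

 -- Dividing by x - x₀ shows that the value is 0 everywhere, in particular at 0. The constant term
 -- is thus gone, and cancelling the nonzero x_i passes to the remaining coefficients.
 infinitely-many-roots : ∀ n p -> length p ≡ n -> (x : ℕ -> F) -> (∀ {i j} -> x i ≡ x j -> i ≡ j) -> (∀ i -> ¬ x i ≡ 0#) ->
  (∀ i -> eval p (x i) ≡ 0#) -> ∀ k -> coef p k ≡ 0#
 infinitely-many-roots n [] l x inj nz roots k = refl
 infinitely-many-roots (suc n) (a ∷ p) l x inj nz roots = go
  where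
  q = quotient (x 0) p
  q-0 : ∀ k -> coef q k ≡ 0#
  q-0 = infinitely-many-roots n q (by (length-quotient (x 0) p) (NP.suc-injective l)) (x ∘ suc) (NP.suc-injective ∘ inj) (nz ∘ suc) (\ i ->
   cancel-≢0 (x (suc i) - x 0) (\ e -> NP.1+n≢0 (inj (x-y≡0⇒x≡y e)))
   (by (sym (eval-quotient a p (x 0) (x (suc i)))) (by (cong₂ _-_ (roots (suc i)) (roots 0)) (by (-‿inverseʳ 0#) (sym (zeroʳ _))))))
  everywhere : ∀ y -> eval (a ∷ p) y ≡ 0#
  everywhere y = by (x-y≡0⇒x≡y (by (eval-quotient a p (x 0) y) (by (cong ((y - x 0) *_) (eval-0 q y q-0)) (zeroʳ _)))) (roots 0)
  a-0 : a ≡ 0#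
  a-0 = by (sym (by (cong (a +_) (zeroˡ _)) (+-idʳ a))) (everywhere 0#)
  go : ∀ k -> coef (a ∷ p) k ≡ 0#
  go zero = a-0
  go (suc k) = infinitely-many-roots n p (NP.suc-injective l) x inj nz (\ i -> cancel-≢0 (x i) (nz i)
   (by (sym (by (cong (_+ x i * eval p (x i)) a-0) (+-idˡ _))) (by (everywhere (x i)) (sym (zeroʳ _))))) k

-- Expansion in powers of N⁻²

z-≤ : ∀ {n} (σ : Word n) -> D.z σ N.≤ n
z-≤ {n} σ = subst (D.z σ N.≤_) (LP.length-tabulate {n = n} id) (LP.length-filter (Data.Bool.Properties.T? ∘ isCycleMin σ) (allFin n))

module GenusExpansion (J : NumberField) where

 open FieldProperties J
 open Sums J
 open PermSums J
 open Series J
 open Polynomials J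
 open Toda J using (rf)
 open Exponential J using (logZ; ϑ-Z; connected; weight)
 open ≡-Reasoning

 -- c_{g,n}, with the convention c_{g,0} = 0.
 rooted# : ℕ -> ℕ -> F
 rooted# g zero = 0#
 rooted# g (suc m) = rf m * nat (countPairs g (suc m))

 x : ℕ -> F
 x M = proj₁ (inverse (nat (suc M)) (nat-suc≢0 M))

 N*x : ∀ M -> nat (suc M) * x M ≡ 1#
 N*x M = proj₂ (inverse (nat (suc M)) (nat-suc≢0 M))

 1≢0 : ¬ 1# ≡ 0#
 1≢0 e = nat-suc≢0 0 (by int-1 e)

 x≢0 : ∀ M -> ¬ x M ≡ 0#
 x≢0 M e = 1≢0 (by (sym (N*x M)) (by (cong (nat (suc M) *_) e) (zeroʳ _)))

 x-injective : ∀ {i j} -> x i ≡ x j -> i ≡ j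
 x-injective {i} {j} e = NP.suc-injective (nat-injective (cancel-≢0 (x i) (x≢0 i)
  (by (*-comm _ _) (by (N*x i) (sym (by (cong (_* nat (suc j)) e) (by (*-comm _ _) (N*x j))))))))

 -- p is the genus expansion of the n-th coefficient in the variable N⁻².
 Expands : Poly -> ℕ -> Set
 Expands p n = ∀ M -> power (x M) (2 N.+ n) * logZ (suc M) n ≡ eval p (x M * x M)

 cycles : ∀ {n} -> Word n × Word n -> ℕ
 cycles (σ0 , σ1) = D.z σ0 N.+ D.z σ1 N.+ D.z (compose σ0 σ1)

 weight-cycles : ∀ N {n} {σ0 σ1 : Word n} -> Perm σ0 -> Perm σ1 -> weight N σ0 σ1 ≡ power (nat N) (cycles (σ0 , σ1))
 weight-cycles N {n} {σ0} {σ1} p q = begin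
  weight N σ0 σ1
  ≡⟨ cong₂ _*_ (cong₂ _*_ (fix-power p) (fix-power q)) (fix-power (Perm-compose {σ = σ0} p q)) ⟩ _
  ≡⟨ cong (_* power (nat N) (D.z (compose σ0 σ1))) (power-+ (nat N) (D.z σ0) (D.z σ1)) ⟨ _
  ≡⟨ power-+ (nat N) (D.z σ0 N.+ D.z σ1) (D.z (compose σ0 σ1)) ⟨
  power (nat N) (cycles (σ0 , σ1)) ∎
  where
  open Insertion J N using (fix)
  fix-power : ∀ {σ : Word n} -> Perm σ -> fix σ ≡ power (nat N) (D.z σ)
  fix-power {σ} p = by (FixCycles.fix-z J N p) (power-nat N (D.z σ))

 module _ (m : ℕ) where

  private
   n = suc m
   B = n N.+ n N.+ n

  isTransitive : Word n × Word n -> Bool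
  isTransitive (σ0 , σ1) = transitive σ0 σ1

  cycles-≤ : ∀ s -> cycles {n} s N.≤ B
  cycles-≤ (σ0 , σ1) = NP.+-mono-≤ (NP.+-mono-≤ (z-≤ σ0) (z-≤ σ1)) (z-≤ (compose σ0 σ1))

  connected-pairs : ∀ N -> connected N n ≡ ∑ (pairs n) (\ s -> indᵇ (isTransitive s) * power (nat N) (cycles s))
  connected-pairs N = by (∑-cong-∈ (perms n) (\ {σ0} σ0∈ -> ∑-cong-∈ (perms n) (\ {σ1} σ1∈ ->
   cong (indᵇ (transitive σ0 σ1) *_) (weight-cycles N (∈-perms⁻ σ0∈) (∈-perms⁻ σ1∈)))))
   (sym (∑-pairList (perms n) (perms n) _))

  -- The exponent n + 2 - cycles of N⁻¹ is not yet known to be nonnegative or even. Adding B = 3n, a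
  -- bound for the number of cycles, makes it a natural number.
  deficit : Word n × Word n -> ℕ
  deficit s = (B N.+ (2 N.+ n)) ∸ cycles s

  cycles+deficit : ∀ s -> cycles s N.+ deficit s ≡ B N.+ (2 N.+ n)
  cycles+deficit s = NP.m+[n∸m]≡n (NP.≤-trans (cycles-≤ s) (NP.m≤m+n B (2 N.+ n)))

  contribution : Word n × Word n -> Poly
  contribution s = scaleₚ (indᵇ (isTransitive s)) (shiftₚ (deficit s) (1# ∷ []))

  census : Poly
  census = scaleₚ (rf m) (∑ₚ (pairs n) contribution)

  eval-census : ∀ M -> eval census (x M) ≡ power (x M) B * (power (x M) (2 N.+ n) * logZ (suc M) n)
  eval-census M = begin
   eval census y
   ≡⟨ by (eval-scale (rf m) (∑ₚ (pairs n) contribution) y) (cong (rf m *_) (eval-∑ (pairs n) contribution y)) ⟩ _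
   ≡⟨ cong (rf m *_) (∑-cong (pairs n) term) ⟩ _
   ≡⟨ cong (rf m *_) (by (∑-*ˡ (pairs n) _ _) (cong (power y (B N.+ (2 N.+ n)) *_) (sym (connected-pairs (suc M))))) ⟩ _
   ≡⟨ cong (\ u -> rf m * (u * connected (suc M) n)) (power-+ y B (2 N.+ n)) ⟩ _
   ≡⟨ solve 4 (\ r a b c -> r :* (a :* b :* c) := a :* (b :* (r :* c))) refl (rf m) (power y B) (power y (2 N.+ n)) (connected (suc M) n) ⟩
   power y B * (power y (2 N.+ n) * logZ (suc M) n) ∎
   where
   open Solver
   y = x M
   N = nat (suc M)
   term : ∀ s -> eval (contribution s) y ≡ power y (B N.+ (2 N.+ n)) * (indᵇ (isTransitive s) * power N (cycles s))
   term s = by (eval-scale (indᵇ (isTransitive s)) (shiftₚ (deficit s) (1# ∷ [])) y) (by (cong (indᵇ (isTransitive s) *_) (by (eval-shift (deficit s) (1# ∷ []) y)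
    (by (cong (power y (deficit s) *_) (by (cong (1# +_) (zeroʳ y)) (+-idʳ 1#))) (*-idʳ _))))
    (sym (by (cong (\ k -> power y k * (indᵇ (isTransitive s) * power N (cycles s))) (sym (cycles+deficit s)))
    (by (cong (_* (indᵇ (isTransitive s) * power N (cycles s))) (power-+ y (cycles s) (deficit s)))
    (by (solve 4 (\ a b i c -> a :* b :* (i :* c) := (c :* a) :* (i :* b)) refl (power y (cycles s)) (power y (deficit s)) (indᵇ (isTransitive s)) (power N (cycles s)))
    (by (cong (_* (indᵇ (isTransitive s) * power y (deficit s))) (power-cancel (N*x M) (cycles s))) (*-idˡ _)))))))

  coef-census : ∀ g -> coef census (B N.+ 2 N.* g) ≡ rf m * nat (countPairs g n)
  coef-census g = by (coef-scale (rf m) (∑ₚ (pairs n) contribution) (B N.+ 2 N.* g)) (cong (rf m *_) (by (coef-∑ (pairs n) contribution (B N.+ 2 N.* g))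
   (by (∑-cong (pairs n) term) (by (sym (∑-filterᵇ (good g n) (pairs n) (\ _ -> 1#))) (∑-length (filterᵇ (good g n) (pairs n)))))))
   where
   bool : ∀ (P : Set) (d : Dec P) a b -> (P -> True b) -> (True b -> P) -> indᵇ a * ind d ≡ indᵇ (a ∧ b) * 1#
   bool P d false b f h = by (zeroˡ _) (sym (zeroˡ _))
   bool P d true true f h = cong (1# *_) (ind-yes d (h _))
   bool P d true false f h = by (cong (1# *_) (ind-no d f)) (by (zeroʳ _) (sym (zeroˡ _)))
   fwd : ∀ s -> deficit s ≡ B N.+ 2 N.* g -> cycles s N.+ 2 N.* g ≡ n N.+ 2
   fwd s e = NP.+-cancelˡ-≡ B _ _ (by (sym (NP.+-assoc B (cycles s) (2 N.* g))) (by (cong (N._+ 2 N.* g) (NP.+-comm B (cycles s)))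
    (by (NP.+-assoc (cycles s) B (2 N.* g)) (by (cong (cycles s N.+_) (sym e)) (by (cycles+deficit s) (cong (B N.+_) (NP.+-comm 2 n)))))))
   bwd : ∀ s -> cycles s N.+ 2 N.* g ≡ n N.+ 2 -> deficit s ≡ B N.+ 2 N.* g
   bwd s e = NP.+-cancelˡ-≡ (cycles s) _ _ (by (cycles+deficit s) (by (cong (B N.+_) (by (NP.+-comm 2 n) (sym e)))
    (by (sym (NP.+-assoc B (cycles s) (2 N.* g))) (by (cong (N._+ 2 N.* g) (NP.+-comm B (cycles s))) (NP.+-assoc (cycles s) B (2 N.* g))))))
   term : ∀ s -> coef (contribution s) (B N.+ 2 N.* g) ≡ indᵇ (good g n s) * 1#
   term s = by (coef-scale (indᵇ (isTransitive s)) (shiftₚ (deficit s) (1# ∷ [])) (B N.+ 2 N.* g)) (by (cong (indᵇ (isTransitive s) *_) (coef-monomial (deficit s) (B N.+ 2 N.* g)))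
    (bool (deficit s ≡ B N.+ 2 N.* g) (deficit s N.≟ (B N.+ 2 N.* g)) (isTransitive s) ((cycles s N.+ 2 N.* g) ≡ᵇ (n N.+ 2))
    (\ e -> NP.≡⇒≡ᵇ _ _ (fwd s e)) (\ t -> bwd s (NP.≡ᵇ⇒≡ _ _ t))))

  -- Both sides, multiplied by N^{-B}, are polynomials in N⁻¹ that agree at all N ≥ 1.
  expansion-unique : ∀ p -> Expands p n -> ∀ g -> coef p g ≡ rooted# g n
  expansion-unique p good g = x-y≡0⇒x≡y (begin
   coef p g - rooted# g n
   ≡⟨ cong₂ _-_ (by (coef-shift B (spreadₚ p) (2 N.* g)) (coef-spread p g)) (coef-census g) ⟨ _
   ≡⟨ cong (coef (shiftₚ B (spreadₚ p)) k +_) (solve 1 (\ c -> con (Z.- (Z.+ 1)) :* c := :- c) refl (coef census k)) ⟨ _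
   ≡⟨ by (coef-add (shiftₚ B (spreadₚ p)) (scaleₚ (int (Z.- (Z.+ 1))) census) k) (cong (coef (shiftₚ B (spreadₚ p)) k +_) (coef-scale (int (Z.- (Z.+ 1))) census k)) ⟨
   coef difference k
   ≡⟨ infinitely-many-roots (length difference) difference refl x x-injective x≢0 root k ⟩
   0# ∎)
   where
   open Solver
   k = B N.+ 2 N.* g
   difference = addₚ (shiftₚ B (spreadₚ p)) (scaleₚ (int (Z.- (Z.+ 1))) census)
   root : ∀ M -> eval difference (x M) ≡ 0#
   root M = by (eval-add (shiftₚ B (spreadₚ p)) (scaleₚ (int (Z.- (Z.+ 1))) census) (x M)) (by (cong₂ _+_
    (by (eval-shift B (spreadₚ p) (x M)) (cong (power (x M) B *_) (by (eval-spread p (x M)) (sym (good M)))))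
    (by (eval-scale (int (Z.- (Z.+ 1))) census (x M)) (cong (int (Z.- (Z.+ 1)) *_) (eval-census M))))
    (by (solve 1 (\ a -> a :+ con (Z.- (Z.+ 1)) :* a := con (Z.+ 0)) refl (power (x M) B * (power (x M) (2 N.+ n) * logZ (suc M) n))) int-0))

 module CoefficientForm (M : ℕ) where

  private
   module R = ℤ-AlgebraProperties serAlg
   module K = KP J
   open Chain K.seriesDifferential using (Kform)
   N = nat (suc M)
   n = K.nn logZ ϑ-Z (suc M)
   σ = logZ (suc M)
   a = ϑ σ
   G H : Ser
   G = R.κ 3 · (n · (n · a)) ⊕ a ⊕ R.κ 2 · ϑ a ⊕ ϑ (ϑ a) ⊕ (R.κ 4 · (σ · a) ⊕ R.κ 6 · (a · a))
   H = R.κ 3 · (n · (R.κ 2 · a ⊕ σ)) ⊕ R.κ 2 · (n · (n · n))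

   mixed : Ser
   mixed = R.κ 2 · a ⊕ σ

   arranged : X · (X · G) ⊕ X · H ≈ a ⊕ σ
   arranged = R.x-y≈0⇒x≈y (R.tra (R.Solver.solve 6 (\ s n σ a a1 a2 -> let open R.Solver in
     s :* (s :* (con (Z.+ 3) :* (n :* (n :* a)) :+ a :+ con (Z.+ 2) :* a1 :+ a2 :+ (con (Z.+ 4) :* (σ :* a) :+ con (Z.+ 6) :* (a :* a))))
      :+ s :* (con (Z.+ 3) :* (n :* (con (Z.+ 2) :* a :+ σ)) :+ con (Z.+ 2) :* (n :* (n :* n))) :- (a :+ σ)
    := s :* s :* (con (Z.+ 3) :* (n :* n :* a) :+ a :+ con (Z.+ 2) :* a1 :+ a2 :+ con (Z.+ 4) :* (σ :* a) :+ con (Z.+ 6) :* (a :* a))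
     :+ con (Z.+ 3) :* (n :* s :* (con (Z.+ 2) :* a :+ σ)) :+ con (Z.+ 2) :* (n :* n :* n :* s) :- a :- σ)
     R.rfl X n σ a (ϑ a) (ϑ (ϑ a))) (K.K≈0 logZ ϑ-Z M))

   n· : ∀ b k -> (n · b) k ≡ N * b k
   n· b k = by (R.*-cong (K.nn-ν logZ ϑ-Z (suc M)) (R.rfl {b}) k) (·-const N b k)

   ι· : ∀ i b k -> (R.ι i · b) k ≡ int i * b k
   ι· i b k = ·-const (int i) b k

   n-0 : n 0 ≡ N
   n-0 = K.nn-ν logZ ϑ-Z (suc M) 0

   n-suc : ∀ k -> n (suc k) ≡ 0#
   n-suc k = K.nn-ν logZ ϑ-Z (suc M) (suc k)

  coefficient-1 : nat 2 * σ 1 ≡ nat 2 * (N * (N * N))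
  coefficient-1 = begin
   nat 2 * σ 1 ≡⟨ by (solve 1 (\ c -> con (Z.+ 2) :* c := con (Z.+ 1) :* c :+ c) refl (σ 1)) refl ⟩
   (a ⊕ σ) 1 ≡⟨ arranged 1 ⟨
   (X · (X · G) ⊕ X · H) 1 ≡⟨ cong₂ _+_ (by (X·-suc (X · G) 0) (X·-zero G)) (X·-suc H 0) ⟩
   0# + H 0 ≡⟨ +-idˡ _ ⟩
   H 0 ≡⟨ cong₂ _+_ (by (ι· (Z.+ 3) (n · mixed) 0) (by (cong (nat 3 *_) (by (n· mixed 0) (by (cong (N *_) low) (zeroʳ N)))) (zeroʳ _)))
   (by (ι· (Z.+ 2) (n · (n · n)) 0) (cong (nat 2 *_) (by (n· (n · n) 0) (cong (N *_) (by (n· n 0) (cong (N *_) n-0)))))) ⟩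
   0# + nat 2 * (N * (N * N)) ≡⟨ +-idˡ _ ⟩
   nat 2 * (N * (N * N)) ∎
   where
   open Solver
   low : (R.κ 2 · a ⊕ σ) 0 ≡ 0#
   low = by (+-idʳ _) (by (ι· (Z.+ 2) a 0) (by (cong (nat 2 *_) (zeroʳ _)) (zeroʳ _)))

  quadratic : ℕ -> F
  quadratic k = sumTo k (\ j -> (nat 4 + nat 6 * nat j) * nat (k ∸ j) * (σ j * σ (k ∸ j)))

  cubic : ℕ -> F
  cubic k = nat k + nat 2 * (nat k * nat k) + nat k * (nat k * nat k)

  coefficient-2 : ∀ k -> nat (3 N.+ k) * σ (2 N.+ k) ≡
   nat 3 * (N * ((nat 2 * nat (suc k) + nat 1) * σ (suc k))) + (nat 3 * (N * (N * (nat k * σ k))) + cubic k * σ k + quadratic k)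
  coefficient-2 k = begin
   nat (3 N.+ k) * σ (2 N.+ k)
   ≡⟨ by (cong (_* σ (2 N.+ k)) (nat-+ 1 (2 N.+ k))) (solve 2 (\ u c -> (con (Z.+ 1) :+ u) :* c := u :* c :+ c) refl (nat (2 N.+ k)) (σ (2 N.+ k))) ⟩
   (a ⊕ σ) (2 N.+ k)
   ≡⟨ arranged (2 N.+ k) ⟨ _
   ≡⟨ cong₂ _+_ (by (X·-suc (X · G) (suc k)) (X·-suc G k)) (X·-suc H (suc k)) ⟩
   G k + H (suc k)
   ≡⟨ cong₂ _+_ G-k H-k ⟩ _
   ≡⟨ solve 6 (\ N f c q h w -> con (Z.+ 3) :* (N :* (N :* (f :* c))) :+ f :* c :+ con (Z.+ 2) :* (f :* (f :* c)) :+ f :* (f :* (f :* c)) :+ q :+ con (Z.+ 3) :* (N :* (con (Z.+ 2) :* (w :* h) :+ h))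
   := con (Z.+ 3) :* (N :* ((con (Z.+ 2) :* w :+ con (Z.+ 1)) :* h)) :+ (con (Z.+ 3) :* (N :* (N :* (f :* c))) :+ (f :+ con (Z.+ 2) :* (f :* f) :+ f :* (f :* f)) :* c :+ q))
   refl N (nat k) (σ k) (quadratic k) (σ (suc k)) (nat (suc k)) ⟩
   _ ∎
   where
   open Solver
   H-k : H (suc k) ≡ nat 3 * (N * (nat 2 * (nat (suc k) * σ (suc k)) + σ (suc k)))
   H-k = by (cong₂ _+_ (by (ι· (Z.+ 3) (n · mixed) (suc k)) (cong (nat 3 *_) (by (n· mixed (suc k)) (cong (\ u -> N * (u + σ (suc k))) (ι· (Z.+ 2) a (suc k))))))
    (by (ι· (Z.+ 2) (n · (n · n)) (suc k)) (by (cong (nat 2 *_) (by (n· (n · n) (suc k)) (by (cong (N *_) (by (n· n (suc k)) (by (cong (N *_) (n-suc k)) (zeroʳ N)))) (zeroʳ N)))) (zeroʳ _))))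
    (+-idʳ _)
   products : nat 4 * (σ · a) k + nat 6 * (a · a) k ≡ quadratic k
   products = by (cong₂ _+_ (sym (sumTo-*ˡ k (nat 4) _)) (sym (sumTo-*ˡ k (nat 6) _))) (by (sym (sumTo-+ k _ _))
    (sumTo-cong k (\ j _ -> solve 4 (\ j r u v -> con (Z.+ 4) :* (u :* (r :* v)) :+ con (Z.+ 6) :* ((j :* u) :* (r :* v)) := (con (Z.+ 4) :+ con (Z.+ 6) :* j) :* r :* (u :* v)) refl (nat j) (nat (k ∸ j)) (σ j) (σ (k ∸ j)))))
   G-k : G k ≡ nat 3 * (N * (N * (nat k * σ k))) + nat k * σ k + nat 2 * (nat k * (nat k * σ k)) + nat k * (nat k * (nat k * σ k)) + quadratic k
   G-k = cong₂ _+_ (cong₂ (\ u v -> u + nat k * σ k + v + nat k * (nat k * (nat k * σ k)))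
    (by (ι· (Z.+ 3) (n · (n · a)) k) (cong (nat 3 *_) (by (n· (n · a) k) (cong (N *_) (n· a k))))) (ι· (Z.+ 2) (ϑ a) k))
    (by (cong₂ _+_ (ι· (Z.+ 4) (σ · a) k) (ι· (Z.+ 6) (a · a) k)) products)

 module _ (k : ℕ) (p : ℕ -> Poly) where

  private
   w1 r : F
   w1 = nat 2 * nat (suc k) + nat 1
   r = nat k + nat 2 * (nat k * nat k) + nat k * (nat k * nat k)
   w : ℕ -> F
   w j = (nat 4 + nat 6 * nat j) * nat (k ∸ j)
   d = inverse (nat (3 N.+ k)) (nat-suc≢0 (2 N.+ k))
   q1 q2 q3 : Poly
   q1 = scaleₚ (nat 3 * w1) (p (suc k))
   q2 = scaleₚ (nat 3 * nat k) (p k)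
   q3 = 0# ∷ scaleₚ r (p k)
   q4 : ℕ -> Poly
   q4 j = scaleₚ (w j) (mulₚ (p j) (p (k ∸ j)))

  -- The recursion of `coefficient-2` in the variable N⁻². The scaling by N^(-n-2) turns every
  -- factor N into 1, while the cubic term, lacking two such factors, acquires N⁻²: this is the
  -- shift in `q3`. Hence only even powers of N⁻¹ with nonnegative exponents occur, that is,
  -- integral genus at least 0.
  next : Poly
  next = scaleₚ (proj₁ d) (addₚ q1 (addₚ (addₚ q2 q3) (sumToₚ k q4)))

  private
   cancel : ∀ u -> nat (3 N.+ k) * (proj₁ d * u) ≡ u
   cancel u = by (sym (*-assoc _ _ _)) (by (cong (_* u) (proj₂ d)) (*-idˡ u))

  next-expands : (∀ j -> j N.≤ suc k -> Expands (p j) j) -> Expands next (2 N.+ k)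
  next-expands ex M = cancel-≢0 (nat (3 N.+ k)) (nat-suc≢0 (2 N.+ k)) (begin
   nat (3 N.+ k) * (power y (4 N.+ k) * σ (2 N.+ k))
   ≡⟨ solve 3 (\ a b c -> a :* (b :* c) := b :* (a :* c)) refl (nat (3 N.+ k)) (power y (4 N.+ k)) (σ (2 N.+ k)) ⟩ _
   ≡⟨ cong (power y (4 N.+ k) *_) (coefficient-2 k) ⟩ _
   ≡⟨ solve 9 (\ y P N w c1 f c r q -> y :* (y :* (y :* (y :* P))) :* (con (Z.+ 3) :* (N :* (w :* c1)) :+ (con (Z.+ 3) :* (N :* (N :* (f :* c))) :+ r :* c :+ q))
   := (N :* y) :* (con (Z.+ 3) :* w :* (y :* (y :* (y :* P)) :* c1)) :+ ((N :* y) :* ((N :* y) :* (con (Z.+ 3) :* f :* (y :* (y :* P) :* c))) :+ y :* y :* (r :* (y :* (y :* P) :* c)) :+ (y :* (y :* (y :* (y :* P)))) :* q))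
   refl y (power y k) N w1 (σ (suc k)) (nat k) (σ k) (cubic k) (quadratic k) ⟩ _
   ≡⟨ cong (\ u -> u * (nat 3 * w1 * E1) + (u * (u * (nat 3 * nat k * E0)) + y * y * (r * E0) + power y (4 N.+ k) * quadratic k)) (N*x M) ⟩ _
   ≡⟨ cong₂ _+_ (*-idˡ _) (cong₂ (\ u v -> u + y * y * (r * E0) + v) (by (*-idˡ _) (*-idˡ _)) sums) ⟩ _
   ≡⟨ cong₂ (\ u v -> nat 3 * w1 * u + (nat 3 * nat k * v + y * y * (r * v) + S)) (ex (suc k) NP.≤-refl M) (ex k (NP.n≤1+n k) M) ⟩ _
   ≡⟨ evaluated ⟨
   nat (3 N.+ k) * eval next (y * y) ∎)
   where
   open Solver
   open CoefficientForm M
   y = x M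
   N = nat (suc M)
   σ = logZ (suc M)
   e : ℕ -> F
   e j = eval (p j) (y * y)
   E1 = power y (3 N.+ k) * σ (suc k)
   E0 = power y (2 N.+ k) * σ k
   S = sumTo k (\ j -> w j * (e j * e (k ∸ j)))
   sums : power y (4 N.+ k) * quadratic k ≡ S
   sums = by (sym (sumTo-*ˡ k (power y (4 N.+ k)) _)) (sumTo-cong k (\ j j≤k -> begin
    power y (4 N.+ k) * (w j * (σ j * σ (k ∸ j)))
    ≡⟨ cong (\ i -> y * (y * (y * (y * power y i))) * (w j * (σ j * σ (k ∸ j)))) (sym (NP.m+[n∸m]≡n j≤k)) ⟩ _
    ≡⟨ cong (\ u -> y * (y * (y * (y * u))) * (w j * (σ j * σ (k ∸ j)))) (power-+ y j (k ∸ j)) ⟩ _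
    ≡⟨ solve 6 (\ y a b w u v -> y :* (y :* (y :* (y :* (a :* b)))) :* (w :* (u :* v)) := w :* ((y :* (y :* a) :* u) :* (y :* (y :* b) :* v))) refl
    y (power y j) (power y (k ∸ j)) (w j) (σ j) (σ (k ∸ j)) ⟩ _
    ≡⟨ cong (w j *_) (cong₂ _*_ (ex j (NP.m≤n⇒m≤1+n j≤k) M) (ex (k ∸ j) (NP.m≤n⇒m≤1+n (NP.m∸n≤m k j)) M)) ⟩
    w j * (e j * e (k ∸ j)) ∎))
   evaluated : nat (3 N.+ k) * eval next (y * y) ≡ nat 3 * w1 * e (suc k) + (nat 3 * nat k * e k + y * y * (r * e k) + S)
   evaluated = begin
    nat (3 N.+ k) * eval next (y * y)
    ≡⟨ cong (nat (3 N.+ k) *_) (eval-scale (proj₁ d) (addₚ q1 (addₚ (addₚ q2 q3) (sumToₚ k q4))) (y * y)) ⟩ _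
    ≡⟨ cancel (eval (addₚ q1 (addₚ (addₚ q2 q3) (sumToₚ k q4))) (y * y)) ⟩ _
    ≡⟨ by (eval-add q1 (addₚ (addₚ q2 q3) (sumToₚ k q4)) (y * y)) (cong (eval q1 (y * y) +_)
    (by (eval-add (addₚ q2 q3) (sumToₚ k q4) (y * y)) (cong₂ _+_ (eval-add q2 q3 (y * y)) (eval-sumTo k q4 (y * y))))) ⟩ _
    ≡⟨ cong₂ _+_ (eval-scale (nat 3 * w1) (p (suc k)) (y * y)) (cong₂ _+_
    (cong₂ _+_ (eval-scale (nat 3 * nat k) (p k) (y * y)) (by (+-idˡ _) (cong (y * y *_) (eval-scale r (p k) (y * y)))))
    (sumTo-cong k (\ j _ -> by (eval-scale (w j) (mulₚ (p j) (p (k ∸ j))) (y * y)) (cong (w j *_) (eval-mul (p j) (p (k ∸ j)) (y * y)))))) ⟩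
    nat 3 * w1 * e (suc k) + (nat 3 * nat k * e k + y * y * (r * e k) + S) ∎

  coef-next : ∀ g -> nat (3 N.+ k) * coef next g ≡
   nat 3 * w1 * coef (p (suc k)) g + (nat 3 * nat k * coef (p k) g + coef (0# ∷ scaleₚ r (p k)) g + sumTo k (\ j -> w j * (coef (p j) · coef (p (k ∸ j))) g))
  coef-next g = begin
   nat (3 N.+ k) * coef next g
   ≡⟨ cong (nat (3 N.+ k) *_) (coef-scale (proj₁ d) (addₚ q1 (addₚ (addₚ q2 q3) (sumToₚ k q4))) g) ⟩ _
   ≡⟨ cancel (coef (addₚ q1 (addₚ (addₚ q2 q3) (sumToₚ k q4))) g) ⟩ _
   ≡⟨ by (coef-add q1 (addₚ (addₚ q2 q3) (sumToₚ k q4)) g) (cong (coef q1 g +_)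
   (by (coef-add (addₚ q2 q3) (sumToₚ k q4) g) (cong₂ _+_ (coef-add q2 q3 g) (coef-sumTo k q4 g)))) ⟩ _
   ≡⟨ cong₂ _+_ (coef-scale (nat 3 * w1) (p (suc k)) g) (cong₂ _+_
   (cong (_+ coef q3 g) (coef-scale (nat 3 * nat k) (p k) g))
   (sumTo-cong k (\ j _ -> by (coef-scale (w j) (mulₚ (p j) (p (k ∸ j))) g) (cong (w j *_) (coef-mul (p j) (p (k ∸ j)) g))))) ⟩
   nat 3 * w1 * coef (p (suc k)) g + (nat 3 * nat k * coef (p k) g + coef (0# ∷ scaleₚ r (p k)) g + sumTo k (\ j -> w j * (coef (p j) · coef (p (k ∸ j))) g)) ∎

 expands-0 : Expands [] 0
 expands-0 M = zeroʳ _

 expands-1 : Expands (1# ∷ []) 1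
 expands-1 M = begin
  power (x M) 3 * logZ (suc M) 1
  ≡⟨ cong (power (x M) 3 *_) (cancel-≢0 (nat 2) (nat-suc≢0 1) (CoefficientForm.coefficient-1 M)) ⟩
  x M * (x M * (x M * 1#)) * (N * (N * N))
  ≡⟨ solve 3 (\ x N o -> x :* (x :* (x :* o)) :* (N :* (N :* N)) := (N :* x) :* ((N :* x) :* ((N :* x) :* o))) refl (x M) N 1# ⟩ _
  ≡⟨ cong (\ u -> u * (u * (u * 1#))) (N*x M) ⟩
  1# * (1# * (1# * 1#))
  ≡⟨ by (*-idˡ _) (by (*-idˡ _) (*-idˡ _)) ⟩
  1#
  ≡⟨ by (cong (1# +_) (zeroʳ _)) (+-idʳ _) ⟨
  eval (1# ∷ []) (x M * x M) ∎
  where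
  open Solver
  N = nat (suc M)

 Valid : Poly -> ℕ -> Set
 Valid p n = Expands p n × (∀ g -> coef p g ≡ rooted# g n)

 Expansions : ℕ -> Set
 Expansions n = ∃ \ (p : ℕ -> Poly) -> ∀ j -> j N.≤ n -> Valid (p j) j

 extend : ∀ k -> Expansions (suc k) -> Expansions (2 N.+ k)
 extend k (p , old) = p' , valid
  where
  ex = next-expands k p (\ j j≤ -> proj₁ (old j j≤))
  p' : ℕ -> Poly
  p' j with j N.≟ suc (suc k)
  ... | yes _ = next k p
  ... | no _ = p j
  valid : ∀ j -> j N.≤ suc (suc k) -> Valid (p' j) j
  valid j j≤ with j N.≟ suc (suc k)
  ... | yes refl = ex , expansion-unique (suc k) (next k p) ex
  ... | no ne = old j (NP.≤-pred (NP.≤∧≢⇒< j≤ ne))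

 expansions : ∀ n -> Expansions (suc n)
 expansions zero = (\ { zero -> [] ; (suc _) -> 1# ∷ [] }) , \
  { zero _ -> expands-0 , \ g -> refl
  ; (suc .0) (s≤s z≤n) -> expands-1 , expansion-unique 0 (1# ∷ []) expands-1 }
 expansions (suc k) = extend k (expansions k)

 rooted#-1 : ∀ g -> rooted# g 1 ≡ coef (1# ∷ []) g
 rooted#-1 g = sym (expansion-unique 0 (1# ∷ []) expands-1 g)

 lower : ℕ -> ℕ -> F
 lower k zero = 0#
 lower k (suc g) = (nat k + nat 2 * (nat k * nat k) + nat k * (nat k * nat k)) * rooted# g k

 -- Obtained by comparing coefficients of N^(-2g). Only `lower` passes to genus g - 1, and in the
 -- quadratic term the genera add up.
 rooted#-recursion : ∀ g k -> nat (3 N.+ k) * rooted# g (2 N.+ k) ≡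
  nat 3 * (nat 2 * nat (suc k) + nat 1) * rooted# g (suc k)
  + (nat 3 * nat k * rooted# g k + lower k g
  + sumTo k (\ j -> (nat 4 + nat 6 * nat j) * nat (k ∸ j) * sumTo g (\ i -> rooted# i j * rooted# (g ∸ i) (k ∸ j))))
 rooted#-recursion g k = by (cong (nat (3 N.+ k) *_) (sym (expansion-unique (suc k) (next k p) (next-expands k p (\ j j≤ -> proj₁ (old j j≤))) g)))
  (by (coef-next k p g) (cong₂ _+_ (cong (nat 3 * (nat 2 * nat (suc k) + nat 1) *_) (proj₂ (old (suc k) NP.≤-refl) g))
  (cong₂ _+_ (cong₂ _+_ (cong (nat 3 * nat k *_) (proj₂ (old k (NP.n≤1+n k)) g)) (low g))
  (sumTo-cong k (\ j j≤k -> cong ((nat 4 + nat 6 * nat j) * nat (k ∸ j) *_) (sumTo-cong g (\ i _ ->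
  cong₂ _*_ (proj₂ (old j (NP.m≤n⇒m≤1+n j≤k)) i) (proj₂ (old (k ∸ j) (NP.m≤n⇒m≤1+n (NP.m∸n≤m k j))) (g ∸ i)))))))))
  where
  p = proj₁ (expansions k)
  old = proj₂ (expansions k)
  r = nat k + nat 2 * (nat k * nat k) + nat k * (nat k * nat k)
  low : ∀ g -> coef (0# ∷ scaleₚ r (p k)) g ≡ lower k g
  low zero = refl
  low (suc g) = by (coef-scale r (p k) g) (cong (r *_) (proj₂ (old k (NP.n≤1+n k)) g))

-- Power series in the genus variable

module Families (A : ℤ-Algebra) where

 open ℤ-AlgebraProperties A
 open SetoidReasoning setoid

 -- Sequences indexed by genus, multiplied as power series in ε = N⁻². The coefficient ring is left
 -- general and will be the ring of series in t.
 Fam : Set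
 Fam = ℕ -> Carrier

 sumTo : ℕ -> Fam -> Carrier
 sumTo zero f = f 0
 sumTo (suc k) f = sumTo k f + f (suc k)

 infix 4 _≋_
 _≋_ : Fam -> Fam -> Set
 u ≋ v = ∀ g -> u g ≈ v g

 infixl 6 _⊞_
 infixl 7 _⊛_
 infix 8 ⊟_
 _⊞_ _⊛_ : Fam -> Fam -> Fam
 (u ⊞ v) g = u g + v g
 (u ⊛ v) g = sumTo g (\ i -> u i * v (g ∸ i))

 ⊟_ : Fam -> Fam
 (⊟ u) g = - u g

 fam : Carrier -> Fam
 fam x zero = x
 fam x (suc g) = 0#

 zeroᶠ oneᶠ ε : Fam
 zeroᶠ g = 0#
 oneᶠ = fam 1#
 ε zero = 0#
 ε (suc g) = oneᶠ g

 tailᶠ : Fam -> Fam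
 tailᶠ u g = u (suc g)

 sumTo-cong : ∀ k {f h : Fam} -> (∀ j -> j N.≤ k -> f j ≈ h j) -> sumTo k f ≈ sumTo k h
 sumTo-cong zero q = q 0 z≤n
 sumTo-cong (suc k) q = +-cong (sumTo-cong k (\ j j≤k -> q j (NP.m≤n⇒m≤1+n j≤k))) (q (suc k) NP.≤-refl)

 sumTo-+ : ∀ k (f h : Fam) -> sumTo k (\ j -> f j + h j) ≈ sumTo k f + sumTo k h
 sumTo-+ zero f h = rfl
 sumTo-+ (suc k) f h = tra (+-cong (sumTo-+ k f h) rfl)
  (solve 4 (\ a b c d -> (a :+ b) :+ (c :+ d) := (a :+ c) :+ (b :+ d)) rfl (sumTo k f) (sumTo k h) (f (suc k)) (h (suc k)))
  where open Solver

 sumTo-*ˡ : ∀ k q (f : Fam) -> sumTo k (\ j -> q * f j) ≈ q * sumTo k f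
 sumTo-*ˡ zero q f = rfl
 sumTo-*ˡ (suc k) q f = tra (+-cong (sumTo-*ˡ k q f) rfl) (≈-sym (distribˡ q _ _))

 sumTo-0 : ∀ k {f : Fam} -> (∀ j -> f j ≈ 0#) -> sumTo k f ≈ 0#
 sumTo-0 zero q = q 0
 sumTo-0 (suc k) q = tra (+-cong (sumTo-0 k q) (q (suc k))) (+-idˡ 0#)

 sumTo-suc : ∀ k (f : Fam) -> sumTo (suc k) f ≈ f 0 + sumTo k (f ∘ suc)
 sumTo-suc zero f = rfl
 sumTo-suc (suc k) f = tra (+-cong (sumTo-suc k f) rfl) (+-assoc _ _ _)

 ⊛-suc : ∀ u v k -> (u ⊛ v) (suc k) ≈ u 0 * v (suc k) + (tailᶠ u ⊛ v) k
 ⊛-suc u v k = sumTo-suc k (\ j -> u j * v (suc k ∸ j))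

 ⊛-sucʳ : ∀ u v k -> (u ⊛ v) (suc k) ≈ (u ⊛ tailᶠ v) k + u (suc k) * v 0
 ⊛-sucʳ u v k = +-cong (sumTo-cong k (\ j j≤k -> *-cong rfl (reflexive (≡.cong v (NP.+-∸-assoc 1 j≤k)))))
  (*-cong rfl (reflexive (≡.cong v (NP.n∸n≡0 k))))

 ⊛-cong : ∀ {u u' v v'} -> u ≋ u' -> v ≋ v' -> u ⊛ v ≋ u' ⊛ v'
 ⊛-cong p q k = sumTo-cong k (\ j _ -> *-cong (p j) (q (k ∸ j)))

 ⊛-comm : ∀ u v -> u ⊛ v ≋ v ⊛ u
 ⊛-comm u v zero = *-comm (u 0) (v 0)
 ⊛-comm u v (suc k) = tra (⊛-suc u v k) (tra (+-cong rfl (⊛-comm (tailᶠ u) v k))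
  (tra (tra (+-comm _ _) (+-cong rfl (*-comm _ _))) (≈-sym (⊛-sucʳ v u k))))

 ⊛-distribʳ : ∀ w u v -> (u ⊞ v) ⊛ w ≋ u ⊛ w ⊞ v ⊛ w
 ⊛-distribʳ w u v k = tra (sumTo-cong k (\ j _ -> distribʳ (w (k ∸ j)) (u j) (v j))) (sumTo-+ k _ _)

 ⊛-scale : ∀ q u v k -> ((\ j -> q * u j) ⊛ v) k ≈ q * (u ⊛ v) k
 ⊛-scale q u v k = tra (sumTo-cong k (\ j _ -> *-assoc q (u j) _)) (sumTo-*ˡ k q _)

 ⊛-assoc : ∀ u v w -> (u ⊛ v) ⊛ w ≋ u ⊛ (v ⊛ w)
 ⊛-assoc u v w zero = *-assoc (u 0) (v 0) (w 0)
 ⊛-assoc u v w (suc k) = begin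
  ((u ⊛ v) ⊛ w) (suc k)
  ≈⟨ ⊛-suc (u ⊛ v) w k ⟩ _
  ≈⟨ +-cong rfl (tra (⊛-cong {v = w} (⊛-suc u v) (\ _ -> rfl) k)
  (tra (⊛-distribʳ w (\ j -> u 0 * v (suc j)) (tailᶠ u ⊛ v) k) (+-cong (⊛-scale (u 0) (tailᶠ v) w k) (⊛-assoc (tailᶠ u) v w k)))) ⟩ _
  ≈⟨ solve 5 (\ a b c d e -> a :* b :* c :+ (a :* d :+ e) := a :* (b :* c :+ d) :+ e) rfl (u 0) (v 0) (w (suc k)) ((tailᶠ v ⊛ w) k) ((tailᶠ u ⊛ (v ⊛ w)) k) ⟩ _
  ≈⟨ +-cong (*-cong rfl (⊛-suc v w k)) rfl ⟨ _
  ≈⟨ ⊛-suc u (v ⊛ w) k ⟨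
  (u ⊛ (v ⊛ w)) (suc k) ∎
  where open Solver

 fam-⊛ : ∀ x u -> fam x ⊛ u ≋ (\ g -> x * u g)
 fam-⊛ x u zero = rfl
 fam-⊛ x u (suc k) = tra (⊛-suc (fam x) u k) (tra (+-cong rfl (sumTo-0 k (\ j -> zeroˡ _))) (+-idʳ _))

 ⊛-identityˡ : ∀ u -> oneᶠ ⊛ u ≋ u
 ⊛-identityˡ u k = tra (fam-⊛ 1# u k) (*-idˡ (u k))

 familyRing : CommutativeRing 0ℓ 0ℓ
 familyRing = record
  { Carrier = Fam ; _≈_ = _≋_ ; _+_ = _⊞_ ; _*_ = _⊛_ ; -_ = ⊟_ ; 0# = zeroᶠ ; 1# = oneᶠ
  ; isCommutativeRing = record
   { isRing = record
    { +-isAbelianGroup = record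
     { isGroup = record
      { isMonoid = record
       { isSemigroup = record
        { isMagma = record
         { isEquivalence = record
          { refl = \ _ -> rfl
          ; sym = \ p k -> ≈-sym (p k)
          ; trans = \ p q k -> tra (p k) (q k) }
         ; ∙-cong = \ p q k -> +-cong (p k) (q k) }
        ; assoc = \ a b c k -> +-assoc (a k) (b k) (c k) }
       ; identity = (\ a k -> +-idˡ (a k)) , (\ a k -> +-idʳ (a k)) }
      ; inverse = (\ a k -> -‿inverseˡ (a k)) , (\ a k -> -‿inverseʳ (a k))
      ; ⁻¹-cong = \ p k -> -‿cong (p k) }
     ; comm = \ a b k -> +-comm (a k) (b k) }
    ; *-cong = \ {a} {a'} {b} {b'} -> ⊛-cong {a} {a'} {b} {b'}
    ; *-assoc = ⊛-assoc
    ; *-identity = ⊛-identityˡ , (\ a k -> tra (⊛-comm a oneᶠ k) (⊛-identityˡ a k))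
    ; distrib = (\ c a b k -> tra (⊛-comm c (a ⊞ b) k) (tra (⊛-distribʳ c a b k)
     (+-cong (⊛-comm a c k) (⊛-comm b c k)))) , ⊛-distribʳ }
   ; *-comm = ⊛-comm } }

 familyAlgebra : ℤ-Algebra
 familyAlgebra = record
  { commutativeRing = familyRing
  ; fromℤ-homo = record
   { ⟦_⟧ = \ i -> fam (ι i)
   ; +-homo = \ { i j zero -> +-homo i j ; i j (suc k) -> ≈-sym (+-idˡ 0#) }
   ; *-homo = \ { i j zero -> *-homo i j ; i j (suc k) -> ≈-sym (tra (fam-⊛ (ι i) (fam (ι j)) (suc k)) (zeroʳ _)) }
   ; -‿homo = \ { i zero -> -‿homo i ; i (suc k) -> ≈-sym -0≈0 }
   ; 0-homo = \ { zero -> 0-homo ; (suc k) -> rfl }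
   ; 1-homo = \ { zero -> 1-homo ; (suc k) -> rfl } } }
  where
  -0≈0 : - 0# ≈ 0#
  -0≈0 = tra (≈-sym (+-idˡ _)) (-‿inverseʳ 0#)

 ε-⊛-zero : ∀ u -> (ε ⊛ u) 0 ≈ 0#
 ε-⊛-zero u = zeroˡ (u 0)

 ε-⊛-suc : ∀ u k -> (ε ⊛ u) (suc k) ≈ u k
 ε-⊛-suc u k = tra (⊛-suc ε u k) (tra (+-cong (zeroˡ (u (suc k))) (⊛-identityˡ u k)) (+-idˡ (u k)))

 head-tail : ∀ u -> u ≋ fam (u 0) ⊞ ε ⊛ tailᶠ u
 head-tail u zero = ≈-sym (tra (+-cong rfl (ε-⊛-zero (tailᶠ u))) (+-idʳ _))
 head-tail u (suc k) = ≈-sym (tra (+-cong rfl (ε-⊛-suc (tailᶠ u) k)) (+-idˡ _))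

module DifferentialFamilies (D : DifferentialAlgebra) where

 open DifferentialAlgebra D using (algebra; θ; θ-cong; θ-+; θ-*; θ-ι)
 open ℤ-AlgebraProperties algebra
 open Families algebra

 θ-sumTo : ∀ k (f : Fam) -> θ (sumTo k f) ≈ sumTo k (θ ∘ f)
 θ-sumTo zero f = rfl
 θ-sumTo (suc k) f = tra (θ-+ _ _) (+-cong (θ-sumTo k f) rfl)

 familyDifferential : DifferentialAlgebra
 familyDifferential = record
  { algebra = familyAlgebra
  ; θ = \ u g -> θ (u g)
  ; θ-cong = \ q g -> θ-cong (q g)
  ; θ-+ = \ u v g -> θ-+ (u g) (v g)
  ; θ-* = \ u v g -> tra (θ-sumTo g _) (tra (sumTo-cong g (\ i _ -> θ-* (u i) (v (g ∸ i)))) (sumTo-+ g _ _))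
  ; θ-ι = \ { i zero -> θ-ι i ; i (suc g) -> tra (θ-cong (≈-sym ι-0)) (θ-ι (Z.+ 0)) }
  }

-- The substitution s = t(1-2t)

module Substitution (J : NumberField) where

 open Series J
 private module J = FieldProperties J
 open J using (F; nat; int; int-0; int-1; nat-suc)
 open ℤ-AlgebraProperties serAlg hiding (_≈_; ≈⇒-≈0) renaming (_+_ to _+ₛ_; _*_ to _*ₛ_)
 open ℤ-AlgebraProperties serAlg using (≈⇒-≈0)
 open Solver

 -- S is the series of s in t, y is s/t and z is ds/dt.
 y z S : Ser
 y = κ 1 - κ 2 · X
 z = κ 1 - κ 4 · X
 S = X · y

 ·-local : ∀ a {u v} k -> (∀ j -> j N.≤ k -> u j ≡ v j) -> (a · u) k ≡ (a · v) k
 ·-local a k q = sumTo-cong k (\ j _ -> cong (a j J.*_) (q (k ∸ j) (NP.m∸n≤m k j)))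

 S·-zero : ∀ u -> (S · u) 0 ≡ J.0#
 S·-zero u = by (·-assoc X y u 0) (X·-zero (y · u))

 S·-suc : ∀ u k -> (S · u) (suc k) ≡ (y · u) k
 S·-suc u k = by (·-assoc X y u (suc k)) (X·-suc (y · u) k)

 S·-local : ∀ {u v} k -> (∀ j -> j N.< k -> u j ≡ v j) -> (S · u) k ≡ (S · v) k
 S·-local {u} {v} zero q = by (S·-zero u) (sym (S·-zero v))
 S·-local {u} {v} (suc k) q = by (S·-suc u k) (by (·-local y k (\ j j≤k -> q j (s≤s j≤k))) (sym (S·-suc v k)))

 Spow : ℕ -> Ser
 Spow zero = 𝟙
 Spow (suc n) = S · Spow n

 Spow-low : ∀ n k -> k N.< n -> Spow n k ≡ J.0#
 Spow-low (suc n) k (s≤s k≤n) = by (S·-local k (\ j j<k -> Spow-low n j (NP.<-≤-trans j<k k≤n))) (zeroʳ S k)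

 Spow-leading : ∀ n -> Spow n n ≡ J.1#
 Spow-leading zero = refl
 Spow-leading (suc n) = by (S·-suc (Spow n) n) (by (arranged n) (by (cong₂ J._+_ (Spow-leading n) (by (cong J.-_ (shifted n)) neg0)) (J.+-idʳ _)))
  where
  arranged : y · Spow n ≈ Spow n - κ 2 · (X · Spow n)
  arranged = solve 2 (\ x s -> (con (Z.+ 1) :- con (Z.+ 2) :* x) :* s := s :- con (Z.+ 2) :* (x :* s)) rfl X (Spow n)
  shifted : ∀ n -> (κ 2 · (X · Spow n)) n ≡ J.0#
  shifted n = by (·-const (int (Z.+ 2)) (X · Spow n) n) (by (cong (int (Z.+ 2) J.*_) (at n)) (J.zeroʳ _))
   where
   at : ∀ n -> (X · Spow n) n ≡ J.0#
   at zero = X·-zero 𝟙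
   at (suc n) = by (X·-suc (Spow (suc n)) n) (Spow-low (suc n) n NP.≤-refl)
  neg0 : J.- J.0# ≡ J.0#
  neg0 = by (sym (J.+-idˡ _)) (J.-‿inverseʳ J.0#)

 -- The sum may stop at n = k because the n-th power of S begins at tⁿ.
 substitute : Ser -> Ser
 substitute f k = sumTo k (\ n -> f n J.* Spow n k)

 sumTo-extend : ∀ k d {f : ℕ -> F} -> (∀ n -> k N.< n -> f n ≡ J.0#) -> sumTo (d N.+ k) f ≡ sumTo k f
 sumTo-extend k zero q = refl
 sumTo-extend k (suc d) q = by (cong₂ J._+_ (sumTo-extend k d q) (q (suc (d N.+ k)) (s≤s (NP.m≤n+m k d)))) (J.+-idʳ _)

 ·-sumTo : ∀ a K (G : ℕ -> Ser) k -> (a · (\ i -> sumTo K (\ n -> G n i))) k ≡ sumTo K (\ n -> (a · G n) k)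
 ·-sumTo a zero G k = refl
 ·-sumTo a (suc K) G k = by (distribˡ a (\ i -> sumTo K (\ n -> G n i)) (G (suc K)) k) (cong (J._+ (a · G (suc K)) k) (·-sumTo a K G k))

 subst-cong : ∀ {f h} -> f ≈ h -> substitute f ≈ substitute h
 subst-cong q k = sumTo-cong k (\ n _ -> cong (J._* Spow n k) (q n))

 subst-⊕ : ∀ f h -> substitute (f ⊕ h) ≈ substitute f ⊕ substitute h
 subst-⊕ f h k = by (sumTo-cong k (\ n _ -> J.distribʳ (Spow n k) (f n) (h n))) (sumTo-+ k _ _)

 subst-scale : ∀ q f -> substitute (\ k -> q J.* f k) ≈ const q · substitute f
 subst-scale q f k = by (sumTo-cong k (\ n _ -> J.*-assoc q (f n) _)) (by (sumTo-*ˡ k q _) (sym (·-const q (substitute f) k)))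

 -- S has no constant term, so the factor S in front of the tail makes each coefficient depend on
 -- lower ones only. The product rule and the chain rule are proved by induction through this
 -- formula.
 horner : ∀ f -> substitute f ≈ const (f 0) ⊕ S · substitute (tail f)
 horner f zero = by (J.*-idʳ (f 0)) (sym (by (cong (f 0 J.+_) (S·-zero (substitute (tail f)))) (J.+-idʳ _)))
 horner f (suc k) = begin
  sumTo (suc k) (\ n -> f n J.* Spow n (suc k))
  ≡⟨ sumTo-suc k _ ⟩ _
  ≡⟨ cong₂ J._+_ (J.zeroʳ (f 0)) (sumTo-cong k (\ n _ -> by (sym (·-const (f (suc n)) (S · Spow n) (suc k))) (exchange n))) ⟩ _
  ≡⟨ cong (J.0# J.+_) (·-sumTo S k (\ n i -> f (suc n) J.* Spow n i) (suc k)) ⟨ _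
  ≡⟨ cong (J.0# J.+_) (S·-local (suc k) truncate) ⟩
  J.0# J.+ (S · substitute (tail f)) (suc k) ∎
  where
  open ≡-Reasoning
  exchange : ∀ n -> (const (f (suc n)) · (S · Spow n)) (suc k) ≡ (S · (\ i -> f (suc n) J.* Spow n i)) (suc k)
  exchange n = by (solve 3 (\ c s p -> c :* (s :* p) := s :* (c :* p)) rfl (const (f (suc n))) S (Spow n) (suc k))
   (*-cong (rfl {S}) (·-const (f (suc n)) (Spow n)) (suc k))
  truncate : ∀ j -> j N.< suc k -> sumTo k (\ n -> f (suc n) J.* Spow n j) ≡ sumTo j (\ n -> f (suc n) J.* Spow n j)
  truncate j (s≤s j≤k) = by (cong (\ K -> sumTo K (\ n -> f (suc n) J.* Spow n j)) (sym (NP.m∸n+n≡m j≤k)))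
   (sumTo-extend j (k ∸ j) (\ n j<n -> by (cong (f (suc n) J.*_) (Spow-low n j j<n)) (J.zeroʳ _)))

 const-· : ∀ p q -> const (p J.* q) ≈ const p · const q
 const-· p q zero = refl
 const-· p q (suc k) = sym (by (·-const p (const q) (suc k)) (J.zeroʳ p))

 -- In the Horner form of the product, the remaining product stands behind a factor S. The bound K
 -- in `go` is the induction variable, since the series themselves change at each step.
 subst-· : ∀ f h -> substitute (f · h) ≈ substitute f · substitute h
 subst-· f h k = go (suc k) f h k NP.≤-refl
  where
  go : ∀ K f h k -> k N.< K -> substitute (f · h) k ≡ (substitute f · substitute h) k
  go (suc K) f h k (s≤s k≤K) = by (horner (f · h) k) (by (cong (const (f 0 J.* h 0) k J.+_) (S·-local k inner))
   (by (+-cong (const-· (f 0) (h 0)) (rfl {S · (const (f 0) · substitute (tail h) ⊕ substitute (tail f) · substitute h)}) k)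
   (by (+-cong (rfl {const (f 0) · const (h 0)}) (*-cong (rfl {S}) (+-cong (rfl {const (f 0) · substitute (tail h)}) (*-cong (rfl {substitute (tail f)}) (horner h)))) k)
   (by (solve 5 (\ s c d u v -> c :* d :+ s :* (c :* v :+ u :* (d :+ s :* v)) := (c :+ s :* u) :* (d :+ s :* v)) rfl S (const (f 0)) (const (h 0)) (substitute (tail f)) (substitute (tail h)) k)
   (*-cong (≈-sym (horner f)) (≈-sym (horner h)) k)))))
   where
   inner : ∀ j -> j N.< k -> substitute (tail (f · h)) j ≡ (const (f 0) · substitute (tail h) ⊕ substitute (tail f) · substitute h) j
   inner j j<k = by (subst-cong (·-suc f h) j) (by (subst-⊕ (\ i -> f 0 J.* h (suc i)) (tail f · h) j)
    (cong₂ J._+_ (subst-scale (f 0) (tail h) j) (go K (tail f) h j (NP.<-≤-trans j<k k≤K))))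

 subst-const : ∀ q -> substitute (const q) ≈ const q
 subst-const q = tra (horner (const q)) (tra (+-cong (rfl {const q}) (tra (*-cong (rfl {S}) vanish) (zeroʳ S))) (+-idʳ _))
  where
  vanish : substitute (tail (const q)) ≈ 𝟘
  vanish k = sumTo-0 k (\ n _ -> J.zeroˡ _)

 subst-X : substitute X ≈ S
 subst-X = tra (horner X) (tra (+-cong const0 (tra (*-cong (rfl {S}) (tra (subst-cong (\ _ -> refl)) (subst-const J.1#))) (*-idʳ S))) (+-idˡ S))
  where
  const0 : const J.0# ≈ 𝟘
  const0 zero = refl
  const0 (suc k) = refl

 ϑ-ι : ∀ i -> ϑ (ι i) ≈ 𝟘
 ϑ-ι i = ϑ-const (int i)

 ϑ-neg : ∀ a -> ϑ (- a) ≈ - ϑ a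
 ϑ-neg a k = J.Solver.solve 2 (\ n a -> n J.Solver.:* J.Solver.:- a J.Solver.:= J.Solver.:- (n J.Solver.:* a)) refl (nat k) (a k)

 ϑ-linear : ∀ i j -> ϑ (ι i - ι j · X) ≈ - (ι j · X)
 ϑ-linear i j = tra (ϑ-⊕ (ι i) (- (ι j · X))) (tra (+-cong (ϑ-ι i) (tra (ϑ-neg (ι j · X)) (-‿cong (tra (ϑ-· (ι j) X)
  (tra (+-cong (tra (*-cong (ϑ-ι j) (rfl {X})) (zeroˡ X)) (*-cong (rfl {ι j}) ϑ-X)) (+-idˡ _)))))) (+-idˡ _))

 ϑ-S : ϑ S ≈ X · z
 ϑ-S = tra (ϑ-· X y) (tra (+-cong (*-cong ϑ-X (rfl {y})) (*-cong (rfl {X}) (ϑ-linear (Z.+ 1) (Z.+ 2))))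
  (solve 1 (\ x -> x :* (con (Z.+ 1) :- con (Z.+ 2) :* x) :+ x :* (:- (con (Z.+ 2) :* x)) := x :* (con (Z.+ 1) :- con (Z.+ 4) :* x)) rfl X))

 tail-ϑ : ∀ f -> tail (ϑ f) ≈ tail f ⊕ ϑ (tail f)
 tail-ϑ f k = by (cong (J._* f (suc k)) (nat-suc k)) (by (J.distribʳ (f (suc k)) J.1# (nat k)) (cong (J._+ nat k J.* f (suc k)) (J.*-idˡ _)))

 -- The chain rule for s d/ds with denominators cleared, resting on S = t y and ϑ S = t z.
 chain : ∀ f -> y · ϑ (substitute f) ≈ z · substitute (ϑ f)
 chain f k = go (suc k) f k NP.≤-refl
  where
  go : ∀ K f k -> k N.< K -> (y · ϑ (substitute f)) k ≡ (z · substitute (ϑ f)) k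
  go (suc K) f k (s≤s k≤K) = by (left k) (by (cong ((z · (S · u)) k J.+_) (S·-local k (\ j j<k -> go K (tail f) j (NP.<-≤-trans j<k k≤K)))) (≈-sym right k))
   where
   u = substitute (tail f)
   left : y · ϑ (substitute f) ≈ z · (S · u) ⊕ S · (y · ϑ u)
   left = tra (*-cong (rfl {y}) (tra (ϑ-cong (horner f)) (tra (ϑ-⊕ (const (f 0)) (S · u)) (tra (+-cong (ϑ-const (f 0)) (tra (ϑ-· S u) (+-cong (*-cong ϑ-S (rfl {u})) (rfl {S · ϑ u})))) (+-idˡ _)))))
    (solve 5 (\ x y z u v -> y :* (x :* z :* u :+ x :* y :* v) := z :* (x :* y :* u) :+ x :* y :* (y :* v)) rfl X y z u (ϑ u))
   right : z · substitute (ϑ f) ≈ z · (S · u) ⊕ S · (z · substitute (ϑ (tail f)))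
   right = tra (*-cong (rfl {z}) (tra (horner (ϑ f)) (tra (+-cong zero-head (*-cong (rfl {S}) (tra (subst-cong (tail-ϑ f)) (subst-⊕ (tail f) (ϑ (tail f)))))) (+-idˡ _))))
    (solve 4 (\ z s u v -> z :* (s :* (u :+ v)) := z :* (s :* u) :+ s :* (z :* v)) rfl z S u (substitute (ϑ (tail f))))
    where
    zero-head : const (ϑ f 0) ≈ 𝟘
    zero-head zero = by (cong (J._* f 0) int-0) (J.zeroˡ _)
    zero-head (suc k) = refl

 geometric : ℤ -> Ser
 geometric c zero = J.1#
 geometric c (suc k) = int c J.* geometric c k

 geometric-inverse : ∀ c -> (κ 1 - ι c · X) · geometric c ≈ 𝟙
 geometric-inverse c = tra (solve 3 (\ c x g -> (con (Z.+ 1) :- c :* x) :* g := g :- c :* (x :* g)) rfl (ι c) X (geometric c)) at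
  where
  at : geometric c - ι c · (X · geometric c) ≈ 𝟙
  at zero = by (cong (\ e -> J.1# J.+ J.- e) (by (·-const (int c) (X · geometric c) 0) (by (cong (int c J.*_) (X·-zero (geometric c))) (J.zeroʳ _))))
   (by (cong (J.1# J.+_) (by (sym (J.+-idˡ _)) (J.-‿inverseʳ J.0#))) (J.+-idʳ J.1#))
  at (suc k) = by (cong (\ e -> int c J.* geometric c k J.+ J.- e) (by (·-const (int c) (X · geometric c) (suc k)) (cong (int c J.*_) (X·-suc (geometric c) k))))
   (J.-‿inverseʳ _)

 w2 w4 : Ser
 w2 = geometric (Z.+ 2)
 w4 = geometric (Z.+ 4)

 y·w2 : y · w2 ≈ 𝟙
 y·w2 = geometric-inverse (Z.+ 2)

 z·w4 : z · w4 ≈ 𝟙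
 z·w4 = geometric-inverse (Z.+ 4)

 ϑ-inverse : ∀ c {w} -> (κ 1 - ι c · X) · w ≈ 𝟙 -> ϑ w ≈ ι c · X · (w · w)
 ϑ-inverse c {w} inv = tra (tra (≈-sym (*-idˡ (ϑ w))) (tra (*-cong (≈-sym inv) (rfl {ϑ w}))
  (solve 4 (\ c x w v -> (con (Z.+ 1) :- c :* x) :* w :* v := w :* ((:- (c :* x)) :* w :+ (con (Z.+ 1) :- c :* x) :* v) :+ c :* x :* (w :* w)) rfl (ι c) X w (ϑ w))))
  (tra (+-cong (tra (*-cong (rfl {w}) derived) (zeroʳ w)) (rfl {ι c · X · (w · w)})) (+-idˡ _))
  where
  derived : (- (ι c · X)) · w ⊕ (κ 1 - ι c · X) · ϑ w ≈ 𝟘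
  derived = tra (+-cong (*-cong (≈-sym (ϑ-linear (Z.+ 1) c)) (rfl {w})) (rfl {(κ 1 - ι c · X) · ϑ w}))
   (tra (≈-sym (ϑ-· (κ 1 - ι c · X) w)) (tra (ϑ-cong inv) (ϑ-const J.1#)))

 -- The derivation s d/ds in the variable t, where s = t (1 - 2t).
 Θ : Ser -> Ser
 Θ u = y · w4 · ϑ u

 substDifferential : DifferentialAlgebra
 substDifferential = record
  { algebra = serAlg
  ; θ = Θ
  ; θ-cong = \ q -> *-cong (rfl {y · w4}) (ϑ-cong q)
  ; θ-+ = \ u v -> tra (*-cong (rfl {y · w4}) (ϑ-⊕ u v)) (distribˡ (y · w4) (ϑ u) (ϑ v))
  ; θ-* = \ u v -> tra (*-cong (rfl {y · w4}) (ϑ-· u v))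
   (solve 5 (\ q u v a b -> q :* (a :* v :+ u :* b) := q :* a :* v :+ u :* (q :* b)) rfl (y · w4) u v (ϑ u) (ϑ v))
  ; θ-ι = \ i -> tra (*-cong (rfl {y · w4}) (ϑ-ι i)) (zeroʳ (y · w4))
  }

 subst-ϑ : ∀ f -> substitute (ϑ f) ≈ Θ (substitute f)
 subst-ϑ f = tra (≈-sym (tra (*-cong (tra (*-comm w4 z) z·w4) (rfl {substitute (ϑ f)})) (*-idˡ _)))
  (tra (*-assoc w4 z (substitute (ϑ f))) (tra (*-cong (rfl {w4}) (≈-sym (chain f)))
  (solve 3 (\ y w u -> w :* (y :* u) := y :* w :* u) rfl y w4 (ϑ (substitute f)))))

 Θ-S : Θ S ≈ S
 Θ-S = tra (*-cong (rfl {y · w4}) ϑ-S) (tra (solve 4 (\ x y z w -> y :* w :* (x :* z) := (z :* w) :* (x :* y)) rfl X y z w4)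
  (tra (*-cong z·w4 (rfl {S})) (*-idˡ S)))

-- Generating series of fixed genus

module GenusSeries (J : NumberField) where

 open Series J
 private module J = FieldProperties J
 open J using (F; nat; int; int-0; int-1; nat-suc; nat-+; nat-*; nat-suc≢0; cancel-≢0)
 open GenusExpansion J using (rooted#; rooted#-1; rooted#-recursion; lower)

 private
  infixl 6 _+_
  infixl 7 _*_
  _+_ _*_ : F -> F -> F
  _+_ = J._+_
  _*_ = J._*_

 coupled : ℕ -> ℕ -> F
 coupled g k = sumTo k (\ j -> (nat 4 + nat 6 * nat j) * nat (k ∸ j) * sumTo g (\ i -> rooted# i j * rooted# (g ∸ i) (k ∸ j)))

 VanishesBelow : ℕ -> Set
 VanishesBelow n = ∀ g -> n N.≤ 2 N.* g -> rooted# g n ≡ J.0#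

 -- Genera and numbers of darts both add up in a product. If j > 2i, then k - j ≤ 2 (g - i), so one
 -- of the two factors always vanishes.
 coupled-0 : ∀ g k -> (∀ j -> j N.≤ k -> VanishesBelow j) -> k N.≤ suc (2 N.* g) -> coupled g k ≡ J.0#
 coupled-0 g k low k≤ = sumTo-0 k (\ j j≤k -> by (cong ((nat 4 + nat 6 * nat j) * nat (k ∸ j) *_) (sumTo-0 g (\ i i≤g -> split j i j≤k i≤g (j N.≤? 2 N.* i)))) (J.zeroʳ _))
  where
  split : ∀ j i -> j N.≤ k -> i N.≤ g -> Dec (j N.≤ 2 N.* i) -> rooted# i j * rooted# (g ∸ i) (k ∸ j) ≡ J.0#
  split j i j≤k i≤g (yes l) = by (cong (_* rooted# (g ∸ i) (k ∸ j)) (low j j≤k i l)) (J.zeroˡ _)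
  split j i j≤k i≤g (no ¬l) = by (cong (rooted# i j *_) (low (k ∸ j) (NP.m∸n≤m k j) (g ∸ i) bound)) (J.zeroʳ _)
   where
   bound : k ∸ j N.≤ 2 N.* (g ∸ i)
   bound = NP.≤-trans (NP.∸-mono k≤ (NP.≰⇒> ¬l)) (NP.≤-reflexive (sym (NP.*-distribˡ-∸ 2 g i)))

 double-suc : ∀ g -> 2 N.* suc g ≡ suc (suc (2 N.* g))
 double-suc g = cong suc (NP.+-suc g (g N.+ 0))

 -- The bound n ≥ 2g + 1 follows from the recursion: a drop of the genus by one goes along with a
 -- drop by two darts, and products are covered by `coupled-0`.
 rooted#-low : ∀ n -> VanishesBelow n
 rooted#-low = NI.<-rec VanishesBelow step
  where
  step : ∀ n -> (∀ {m} -> m N.< n -> VanishesBelow m) -> VanishesBelow n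
  step zero low g l = refl
  step (suc zero) low (suc g) l = rooted#-1 (suc g)
  step (suc (suc k)) low g l = cancel-≢0 (nat (3 N.+ k)) (nat-suc≢0 (2 N.+ k)) (by (rooted#-recursion g k)
   (by (cong₂ _+_ (by (cong (nat 3 * (nat 2 * nat (suc k) + nat 1) *_) (low NP.≤-refl g (NP.≤-trans (NP.n≤1+n (suc k)) l))) (J.zeroʳ _))
   (by (cong₂ _+_ (by (cong₂ _+_ (by (cong (nat 3 * nat k *_) (low (NP.n≤1+n (suc k)) g (NP.≤-trans (NP.≤-trans (NP.n≤1+n k) (NP.n≤1+n (suc k))) l))) (J.zeroʳ _))
   (lower-0 g l)) (J.+-idʳ _))
   (coupled-0 g k (\ j j≤k -> low (s≤s (NP.≤-trans j≤k (NP.n≤1+n k)))) (NP.≤-trans (NP.≤-trans (NP.n≤1+n k) (NP.n≤1+n (suc k))) (NP.≤-trans l (NP.n≤1+n _))))) (J.+-idʳ _)))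
   (by (J.+-idʳ _) (sym (J.zeroʳ _)))))
   where
   lower-0 : ∀ g -> suc (suc k) N.≤ 2 N.* g -> lower k g ≡ J.0#
   lower-0 (suc g) l = by (cong ((nat k + nat 2 * (nat k * nat k) + nat k * (nat k * nat k)) *_)
    (low (NP.n≤1+n (suc k)) g (NP.≤-pred (NP.≤-pred (subst (suc (suc k) N.≤_) (double-suc g) l))))) (J.zeroʳ _)

 -- For genus g + 1 and 2g + 3 darts only `lower` survives. With k = 2g + 1 it says (2g + 4)
 -- c_{g+1,2g+3} = k (k + 1)² c_{g,k}, which is the step from (2g)!/(g + 1) to (2g + 2)!/(g + 2).
 rooted#-leading : ∀ g -> nat (suc g) * rooted# g (suc (2 N.* g)) ≡ nat ((2 N.* g) !)
 rooted#-leading zero = by (cong (nat 1 *_) (rooted#-1 0)) (J.*-idʳ _)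
 rooted#-leading (suc g) = cancel-≢0 (nat 2) (nat-suc≢0 1) (begin
  nat 2 * (nat (suc (suc g)) * rooted# (suc g) (suc (2 N.* suc g)))
  ≡⟨ by (sym (J.*-assoc _ _ _)) (cong (_* rooted# (suc g) (suc (2 N.* suc g))) (sym (nat-* 2 (suc (suc g))))) ⟩ _
  ≡⟨ cong₂ (\ m n -> nat m * rooted# (suc g) n) (by (double-suc (suc g)) (cong (2 N.+_) (double-suc g))) (cong suc (double-suc g)) ⟩ _
  ≡⟨ rooted#-recursion (suc g) k ⟩ _
  ≡⟨ cong₂ _+_ (by (cong (nat 3 * (nat 2 * nat (suc k) + nat 1) *_) (rooted#-low (suc k) (suc g) (NP.≤-reflexive (sym (double-suc g))))) (J.zeroʳ _))
  (cong₂ _+_ (cong (_+ lower k (suc g)) (by (cong (nat 3 * nat k *_) (rooted#-low k (suc g) (NP.≤-trans (NP.n≤1+n k) (NP.≤-reflexive (sym (double-suc g)))))) (J.zeroʳ _)))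
  (coupled-0 (suc g) k (\ j _ -> rooted#-low j) (NP.≤-trans (NP.n≤1+n k) (NP.≤-trans (NP.≤-reflexive (sym (double-suc g))) (NP.n≤1+n _))))) ⟩ _
  ≡⟨ by (J.+-idˡ _) (by (J.+-idʳ _) (J.+-idˡ _)) ⟩ _
  ≡⟨ cong (\ u -> (u + nat 2 * (u * u) + u * (u * u)) * rooted# g k) (by (nat-+ 1 (2 N.* g)) (cong (nat 1 +_) (nat-* 2 g))) ⟩ _
   ≡⟨ solve 2 (\ g r -> let k = con (Z.+ 1) :+ con (Z.+ 2) :* g in
      (k :+ con (Z.+ 2) :* (k :* k) :+ k :* (k :* k)) :* r := con (Z.+ 2) :* ((con (Z.+ 2) :+ con (Z.+ 2) :* g) :* ((con (Z.+ 1) :+ con (Z.+ 2) :* g) :* ((con (Z.+ 1) :+ g) :* r))))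
      refl (nat g) (rooted# g k) ⟩ _
   ≡⟨ cong (nat 2 *_) (cong₂ _*_ (by (cong (nat 2 +_) (sym (nat-* 2 g))) (sym (nat-+ 2 (2 N.* g))))
    (cong₂ _*_ (by (cong (nat 1 +_) (sym (nat-* 2 g))) (sym (nat-+ 1 (2 N.* g)))) (by (cong (_* rooted# g k) (sym (nat-+ 1 g))) (rooted#-leading g)))) ⟩ _
   ≡⟨ cong (nat 2 *_) (by (cong (nat (2 N.+ 2 N.* g) *_) (sym (nat-* (1 N.+ 2 N.* g) ((2 N.* g) !)))) (by (sym (nat-* (2 N.+ 2 N.* g) _)) (cong (\ m -> nat (m !)) (sym (double-suc g))))) ⟩
  nat 2 * nat ((2 N.* suc g) !) ∎)
  where
  open ≡-Reasoning
  open J.Solver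
  k = suc (2 N.* g)

 open ℤ-AlgebraProperties serAlg hiding (_≈_; _+_; _*_)
 open Families serAlg using () renaming (sumTo to sumS; sumTo-cong to sumS-cong)

 L : (Ser -> Ser) -> (ℕ -> Ser) -> ℕ -> Ser
 L θ a zero = 𝟘
 L θ a (suc g) = a g ⊕ κ 2 · θ (a g) ⊕ θ (θ (a g))

 source : ℕ -> Ser
 source zero = κ 2
 source (suc g) = 𝟘

 convolution : (ℕ -> Ser) -> (ℕ -> Ser) -> ℕ -> Ser
 convolution c a g = sumS g (\ i -> (κ 4 · c i ⊕ κ 6 · a i) · a (g ∸ i))

 -- The coefficient of ε^g in the equation K = 0, scaled so that N disappears. The inhomogeneous
 -- term 2s is present in genus 0 only, and `L` takes its argument from genus g - 1.
 GenusEquation : (Ser -> Ser) -> Ser -> (ℕ -> Ser) -> ℕ -> Set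
 GenusEquation θ s c g = c g ⊕ θ (c g) ≈
  s · (κ 3 · (κ 2 · θ (c g) ⊕ c g) ⊕ source g) ⊕ s · (s · (κ 3 · θ (c g) ⊕ L θ (θ ∘ c) g ⊕ convolution c (θ ∘ c) g))

 A : ℕ -> Ser
 A = rooted#

 sumS-at : ∀ g (f : ℕ -> Ser) k -> sumS g f k ≡ sumTo g (\ i -> f i k)
 sumS-at zero f k = refl
 sumS-at (suc g) f k = cong (_+ f (suc g) k) (sumS-at g f k)

 sumTo-swap : ∀ g k (f : ℕ -> ℕ -> F) -> sumTo g (\ i -> sumTo k (f i)) ≡ sumTo k (\ j -> sumTo g (\ i -> f i j))
 sumTo-swap zero k f = refl
 sumTo-swap (suc g) k f = by (cong (_+ sumTo k (f (suc g))) (sumTo-swap g k f)) (sym (sumTo-+ k _ _))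

 convolution-at : ∀ g k -> convolution A (ϑ ∘ A) g k ≡ coupled g k
 convolution-at g k = by (sumS-at g _ k) (by (sumTo-cong g (\ i _ -> ·-cong {b = ϑ (A (g ∸ i))} (\ j -> cong₂ _+_ (·-const (nat 4) (A i) j) (·-const (nat 6) (ϑ (A i)) j)) (\ _ -> refl) k))
  (by (sumTo-swap g k _) (sumTo-cong k (\ j _ -> by (sumTo-cong g (\ i _ ->
   J.Solver.solve 4 (\ j r u v -> let open J.Solver in (con (Z.+ 4) :* u :+ con (Z.+ 6) :* (j :* u)) :* (r :* v) := (con (Z.+ 4) :+ con (Z.+ 6) :* j) :* r :* (u :* v)) refl (nat j) (nat (k ∸ j)) (A i j) (A (g ∸ i) (k ∸ j))))
   (sumTo-*ˡ g ((nat 4 + nat 6 * nat j) * nat (k ∸ j)) _)))))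

 source-at : ∀ g k -> source g (suc k) ≡ J.0#
 source-at zero k = refl
 source-at (suc g) k = refl

 L-at : ∀ g k -> L ϑ (ϑ ∘ A) g k ≡ lower k g
 L-at zero k = refl
 L-at (suc g) k = by (cong (\ e -> nat k * A g k + e + nat k * (nat k * (nat k * A g k))) (·-const (nat 2) (ϑ (ϑ (A g))) k))
  (solve 2 (\ k r -> k :* r :+ con (Z.+ 2) :* (k :* (k :* r)) :+ k :* (k :* (k :* r)) := (k :+ con (Z.+ 2) :* (k :* k) :+ k :* (k :* k)) :* r) refl (nat k) (A g k))
  where open J.Solver

 A-equation : ∀ g -> GenusEquation ϑ X A g
 A-equation g zero = by (cong (J.0# +_) (J.zeroʳ _)) (sym (cong₂ _+_ (X·-zero (κ 3 · (κ 2 · ϑ (A g) ⊕ A g) ⊕ source g)) (X·-zero (X · (κ 3 · ϑ (A g) ⊕ L ϑ (ϑ ∘ A) g ⊕ convolution A (ϑ ∘ A) g)))))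
 A-equation g (suc zero) = by (lhs g) (sym (by (cong₂ _+_ (by (X·-suc G 0) (by (cong (_+ source g 0) G0) (J.+-idˡ _))) (by (X·-suc (X · H) 0) (X·-zero H))) (J.+-idʳ _)))
  where
  G = κ 3 · (κ 2 · ϑ (A g) ⊕ A g) ⊕ source g
  H = κ 3 · ϑ (A g) ⊕ L ϑ (ϑ ∘ A) g ⊕ convolution A (ϑ ∘ A) g
  G0 : (κ 3 · (κ 2 · ϑ (A g) ⊕ A g)) 0 ≡ J.0#
  G0 = by (·-const (nat 3) (κ 2 · ϑ (A g) ⊕ A g) 0) (by (cong (nat 3 *_) (by (J.+-idʳ _) (by (·-const (nat 2) (ϑ (A g)) 0) (by (cong (nat 2 *_) (J.zeroʳ _)) (J.zeroʳ _))))) (J.zeroʳ _))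
  lhs : ∀ g -> A g 1 + nat 1 * A g 1 ≡ source g 0
  lhs zero    = by (J.Solver.solve 1 (\ c -> let open J.Solver in c :+ con (Z.+ 1) :* c := con (Z.+ 2) :* c) refl (A 0 1)) (by (cong (nat 2 *_) (rooted#-1 0)) (J.*-idʳ _))
  lhs (suc g) = by (cong₂ (\ u v -> u + nat 1 * v) (rooted#-1 (suc g)) (rooted#-1 (suc g))) (by (J.+-idˡ _) (J.zeroʳ _))
 A-equation g (suc (suc k)) = begin
  A g (2 N.+ k) + nat (2 N.+ k) * A g (2 N.+ k)
  ≡⟨ by (cong (_* A g (2 N.+ k)) (nat-+ 1 (2 N.+ k))) (solve 2 (\ u c -> (con (Z.+ 1) :+ u) :* c := c :+ u :* c) refl (nat (2 N.+ k)) (A g (2 N.+ k))) ⟨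
  nat (3 N.+ k) * A g (2 N.+ k)
  ≡⟨ rooted#-recursion g k ⟩ _
  ≡⟨ cong₂ _+_ (solve 2 (\ f c -> con (Z.+ 3) :* (con (Z.+ 2) :* f :+ con (Z.+ 1)) :* c := con (Z.+ 3) :* (con (Z.+ 2) :* (f :* c) :+ c)) refl (nat (suc k)) (A g (suc k)))
  (cong (\ u -> u + lower k g + coupled g k) (J.*-assoc _ _ _)) ⟩ _
  ≡⟨ cong₂ _+_ first (cong₂ _+_ (cong₂ _+_ (·-const (nat 3) (ϑ (A g)) k) (L-at g k)) (convolution-at g k)) ⟨
  G (suc k) + H k
  ≡⟨ cong₂ _+_ (X·-suc G (suc k)) (by (X·-suc (X · H) (suc k)) (X·-suc H k)) ⟨
  (X · G ⊕ X · (X · H)) (2 N.+ k) ∎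
  where
  open ≡-Reasoning
  open J.Solver
  G = κ 3 · (κ 2 · ϑ (A g) ⊕ A g) ⊕ source g
  H = κ 3 · ϑ (A g) ⊕ L ϑ (ϑ ∘ A) g ⊕ convolution A (ϑ ∘ A) g
  first : G (suc k) ≡ nat 3 * (nat 2 * (nat (suc k) * A g (suc k)) + A g (suc k))
  first = by (cong ((κ 3 · (κ 2 · ϑ (A g) ⊕ A g)) (suc k) +_) (source-at g k)) (by (J.+-idʳ _)
   (by (·-const (nat 3) (κ 2 · ϑ (A g) ⊕ A g) (suc k)) (cong (\ u -> nat 3 * (u + A g (suc k))) (·-const (nat 2) (ϑ (A g)) (suc k)))))

 open Substitution J

 C : ℕ -> Ser
 C g = substitute (A g)

 subst-ι· : ∀ i f -> substitute (ι i · f) ≈ ι i · substitute f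
 subst-ι· i f = tra (subst-cong (·-const (int i) f)) (subst-scale (int i) f)

 subst-𝟘 : substitute 𝟘 ≈ 𝟘
 subst-𝟘 k = sumTo-0 k (\ n _ -> J.zeroˡ _)

 subst-sumS : ∀ g f -> substitute (sumS g f) ≈ sumS g (substitute ∘ f)
 subst-sumS zero f = rfl
 subst-sumS (suc g) f = tra (subst-⊕ (sumS g f) (f (suc g))) (+-cong (subst-sumS g f) (rfl {substitute (f (suc g))}))

 subst-ϑϑ : ∀ f -> substitute (ϑ (ϑ f)) ≈ Θ (Θ (substitute f))
 subst-ϑϑ f = tra (subst-ϑ (ϑ f)) (*-cong (rfl {y · w4}) (ϑ-cong (subst-ϑ f)))

 C-equation : ∀ g -> GenusEquation Θ S C g
 C-equation g = tra (+-cong (rfl {C g}) (≈-sym (subst-ϑ (A g)))) (tra (≈-sym (subst-⊕ (A g) (ϑ (A g)))) (tra (subst-cong (A-equation g))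
  (tra (subst-⊕ (X · G) (X · (X · H))) (+-cong (tra (subst-· X G) (*-cong subst-X G-eq))
  (tra (subst-· X (X · H)) (*-cong subst-X (tra (subst-· X H) (*-cong subst-X H-eq))))))))
  where
  G = κ 3 · (κ 2 · ϑ (A g) ⊕ A g) ⊕ source g
  H = κ 3 · ϑ (A g) ⊕ L ϑ (ϑ ∘ A) g ⊕ convolution A (ϑ ∘ A) g
  source-eq : ∀ g -> substitute (source g) ≈ source g
  source-eq zero = subst-const (int (Z.+ 2))
  source-eq (suc g) = subst-𝟘
  L-eq : ∀ g -> substitute (L ϑ (ϑ ∘ A) g) ≈ L Θ (Θ ∘ C) g
  L-eq zero = subst-𝟘
  L-eq (suc g) = tra (subst-⊕ (ϑ (A g) ⊕ κ 2 · ϑ (ϑ (A g))) (ϑ (ϑ (ϑ (A g))))) (+-cong (tra (subst-⊕ (ϑ (A g)) (κ 2 · ϑ (ϑ (A g))))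
   (+-cong (subst-ϑ (A g)) (tra (subst-ι· (Z.+ 2) (ϑ (ϑ (A g)))) (*-cong (rfl {ι (Z.+ 2)}) (subst-ϑϑ (A g))))))
   (tra (subst-ϑϑ (ϑ (A g))) (*-cong (rfl {y · w4}) (ϑ-cong (*-cong (rfl {y · w4}) (ϑ-cong (subst-ϑ (A g))))))))
  conv-eq : substitute (convolution A (ϑ ∘ A) g) ≈ convolution C (Θ ∘ C) g
  conv-eq = tra (subst-sumS g _) (sumS-cong g (\ i _ -> tra (subst-· (κ 4 · A i ⊕ κ 6 · ϑ (A i)) (ϑ (A (g ∸ i))))
   (*-cong (tra (subst-⊕ (κ 4 · A i) (κ 6 · ϑ (A i))) (+-cong (subst-ι· (Z.+ 4) (A i)) (tra (subst-ι· (Z.+ 6) (ϑ (A i))) (*-cong (rfl {ι (Z.+ 6)}) (subst-ϑ (A i))))))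
   (subst-ϑ (A (g ∸ i))))))
  G-eq : substitute G ≈ κ 3 · (κ 2 · Θ (C g) ⊕ C g) ⊕ source g
  G-eq = tra (subst-⊕ (κ 3 · (κ 2 · ϑ (A g) ⊕ A g)) (source g)) (+-cong (tra (subst-ι· (Z.+ 3) (κ 2 · ϑ (A g) ⊕ A g))
   (*-cong (rfl {ι (Z.+ 3)}) (tra (subst-⊕ (κ 2 · ϑ (A g)) (A g)) (+-cong (tra (subst-ι· (Z.+ 2) (ϑ (A g))) (*-cong (rfl {ι (Z.+ 2)}) (subst-ϑ (A g)))) (rfl {C g}))))) (source-eq g))
  H-eq : substitute H ≈ κ 3 · Θ (C g) ⊕ L Θ (Θ ∘ C) g ⊕ convolution C (Θ ∘ C) g
  H-eq = tra (subst-⊕ (κ 3 · ϑ (A g) ⊕ L ϑ (ϑ ∘ A) g) (convolution A (ϑ ∘ A) g)) (+-cong (tra (subst-⊕ (κ 3 · ϑ (A g)) (L ϑ (ϑ ∘ A) g))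
   (+-cong (tra (subst-ι· (Z.+ 3) (ϑ (A g))) (*-cong (rfl {ι (Z.+ 3)}) (subst-ϑ (A g)))) (L-eq g))) conv-eq)

-- Genus zero and the integral recursion

module RationalForm (J : NumberField) where

 open Series J
 private module J = FieldProperties J
 open J using (F; nat; int; int-0; int-1; nat-suc; nat-suc≢0; cancel-≢0)
 open Toda J using (deriv; ϑ-deriv)
 open GenusSeries J
 open Substitution J
 open ℤ-AlgebraProperties serAlg hiding (_≈_; _+_; _*_)
 open DifferentialProperties substDifferential using () renaming (θ-+ to Θ-+; θ-* to Θ-*; θ-ι to Θ-ι; θ-cong to Θ-cong; θ-constˡ to Θ-constˡ; θ-- to Θ--)
 open Families serAlg using () renaming (sumTo to sumS; sumTo-cong to sumS-cong; sumTo-suc to sumS-suc)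
 open Solver

 pattern # n = con (Z.+ n)

 -- An identity involving w2 = 1/(1-2t) is a polynomial identity modulo the relation y · w2 = 1.
 -- With the cofactor s of that relation given explicitly, the ring solver can check it.
 modulo-y : ∀ {p q} s -> p ≈ q ⊕ s · (y · w2 - κ 1) -> p ≈ q
 modulo-y {p} {q} s e = tra e (tra (+-cong (rfl {q}) (tra (*-cong (rfl {s}) (tra (+-cong (tra y·w2 (≈-sym ι-1)) (rfl { - κ 1})) (-‿inverseʳ (κ 1)))) (zeroʳ s))) (+-idʳ q))

 modulo-z : ∀ {p q} s -> p ≈ q ⊕ s · (z · w4 - κ 1) -> p ≈ q
 modulo-z {p} {q} s e = tra e (tra (+-cong (rfl {q}) (tra (*-cong (rfl {s}) (tra (+-cong (tra z·w4 (≈-sym ι-1)) (rfl { - κ 1})) (-‿inverseʳ (κ 1)))) (zeroʳ s))) (+-idʳ q))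

 d1 : Ser
 d1 = κ 1 - X

 ϑ-w2 : ϑ w2 ≈ κ 2 · X · (w2 · w2)
 ϑ-w2 = ϑ-inverse (Z.+ 2) {w2} y·w2

 ϑ-w4 : ϑ w4 ≈ κ 4 · X · (w4 · w4)
 ϑ-w4 = ϑ-inverse (Z.+ 4) {w4} z·w4

 -- The claimed closed form of C₀ and its image under s d/ds.
 c0 a0 : Ser
 c0 = X · (κ 1 - κ 3 · X) · (w2 · w2)
 a0 = X · (w2 · w2)

 Θ-c0 : Θ c0 ≈ a0
 Θ-c0 = tra (*-cong (rfl {y · w4}) derivative) (modulo-z a0 (modulo-y (κ 4 · (X · X) · r · (w2 · w2) · w4)
   (solve 3 (\ x w v -> let y = # 1 :- # 2 :* x ; z = # 1 :- # 4 :* x ; r = # 1 :- # 3 :* x in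
     (y :* v) :* ((x :* r :+ x :* (:- (# 3 :* x))) :* (w :* w) :+ (x :* r) :* (# 2 :* x :* (w :* w) :* w :+ w :* (# 2 :* x :* (w :* w))))
    := x :* (w :* w) :+ (x :* (w :* w)) :* (z :* v :- # 1) :+ (# 4 :* (x :* x) :* r :* (w :* w) :* v) :* (y :* w :- # 1))
    rfl X w2 w4)))
  where
  r = κ 1 - κ 3 · X
  derivative : ϑ c0 ≈ (X · r ⊕ X · (- (κ 3 · X))) · (w2 · w2) ⊕ (X · r) · (κ 2 · X · (w2 · w2) · w2 ⊕ w2 · (κ 2 · X · (w2 · w2)))
  derivative = tra (ϑ-· (X · r) (w2 · w2)) (+-cong
   (*-cong (tra (ϑ-· X r) (+-cong (*-cong ϑ-X (rfl {r})) (*-cong (rfl {X}) (ϑ-linear (Z.+ 1) (Z.+ 3))))) (rfl {w2 · w2}))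
   (*-cong (rfl {X · r}) (tra (ϑ-· w2 w2) (+-cong (*-cong ϑ-w2 (rfl {w2})) (*-cong (rfl {w2}) ϑ-w2)))))

 c0-equation : GenusEquation Θ S (\ _ -> c0) 0
 c0-equation = tra (+-cong (rfl {c0}) Θ-c0) (≈-sym (tra (+-cong
  (*-cong (rfl {S}) (+-cong (*-cong (rfl {ι (Z.+ 3)}) (+-cong (*-cong (rfl {ι (Z.+ 2)}) Θ-c0) (rfl {c0}))) (rfl {ι (Z.+ 2)})))
  (*-cong (rfl {S}) (*-cong (rfl {S}) (+-cong (+-cong (*-cong (rfl {ι (Z.+ 3)}) Θ-c0) (≈-sym ι-0)) (*-cong (+-cong (rfl {ι (Z.+ 4) · c0}) (*-cong (rfl {ι (Z.+ 6)}) Θ-c0)) Θ-c0)))))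
  (modulo-y _ (solve 2 (\ x w -> let y = # 1 :- # 2 :* x ; s = x :* y ; a = x :* (w :* w) ; c = x :* (# 1 :- # 3 :* x) :* (w :* w) ; p₀ = # 2 :* s ; p2 = # 9 :* (x :* x) :* (# 1 :- x) :* y :+ # 3 :* (x :* x :* x) :* (y :* y) :- x :* (# 2 :- # 3 :* x) ; s0 = :- p₀ ; s1 = y :* s0 ; s2 = y :* s1 :- p2 ; s3 = y :* s2 in
    s :* (# 3 :* (# 2 :* a :+ c) :+ # 2) :+ s :* (s :* (# 3 :* a :+ # 0 :+ (# 4 :* c :+ # 6 :* a) :* a))
   := (c :+ a) :+ (s0 :+ s1 :* w :+ s2 :* (w :* w) :+ s3 :* (w :* w :* w)) :* (y :* w :- # 1)) rfl X w2))))

 -- At tᵏ the left side is (k + 1) e_k, whereas the factor X on the right leaves only lower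
 -- coefficients.
 linear-uniqueness : ∀ u v e -> e ⊕ ϑ e ≈ X · (u · e ⊕ v · ϑ e) -> e ≈ 𝟘
 linear-uniqueness u v e q = NI.<-rec (\ k -> e k ≡ J.0#) step
  where
  combine : ∀ k -> e k J.+ nat k J.* e k ≡ nat (suc k) J.* e k
  combine k = by (cong (J._+ nat k J.* e k) (sym (J.*-idˡ (e k)))) (by (sym (J.distribʳ (e k) J.1# (nat k))) (cong (J._* e k) (sym (nat-suc k))))
  rhs : ∀ k -> (∀ {j} -> j N.< k -> e j ≡ J.0#) -> (X · (u · e ⊕ v · ϑ e)) k ≡ J.0#
  rhs zero low = X·-zero (u · e ⊕ v · ϑ e)
  rhs (suc k) low = by (X·-suc (u · e ⊕ v · ϑ e) k) (by (cong₂ J._+_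
   (by (·-local u {e} {𝟘} k (\ j j≤k -> low (s≤s j≤k))) (zeroʳ u k))
   (by (·-local v {ϑ e} {𝟘} k (\ j j≤k -> by (cong (nat j J.*_) (low (s≤s j≤k))) (J.zeroʳ _))) (zeroʳ v k))) (J.+-idˡ _))
  step : ∀ k -> (∀ {j} -> j N.< k -> e j ≡ J.0#) -> e k ≡ J.0#
  step k low = cancel-≢0 (nat (suc k)) (nat-suc≢0 k) (by (sym (combine k)) (by (q k) (by (rhs k low) (sym (J.zeroʳ _)))))

 -- The genus 0 equation is nonlinear, but the difference of two of its solutions satisfies a linear
 -- one of the form treated by `linear-uniqueness`.
 C-0 : C 0 ≈ c0
 C-0 = x-y≈0⇒x≈y (linear-uniqueness _ _ e (tra arranged (tra (+-cong (rfl {B}) (*-cong (rfl {z}) (≈⇒-≈0 difference))) (tra (+-cong (rfl {B}) (zeroʳ z)) (+-idʳ B)))))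
  where
  e = C 0 - c0
  d = Θ e
  a = Θ (C 0)
  U = κ 3 ⊕ κ 4 · (S · a)
  V = κ 6 ⊕ S · (κ 3 ⊕ κ 6 · a ⊕ κ 4 · c0 ⊕ κ 6 · Θ c0)
  d-eq : d ≈ a - Θ c0
  d-eq = Θ-- (C 0) c0
  difference : e ⊕ d ≈ S · (U · e ⊕ V · d)
  difference = tra (+-cong (rfl {e}) d-eq) (tra
   (solve 4 (\ c h a b -> (c :- h) :+ (a :- b) := (c :+ a) :- (h :+ b)) rfl (C 0) c0 a (Θ c0))
   (tra (+-cong (C-equation 0) (-‿cong c0-equation))
   (tra (solve 6 (\ s c h a b o ->
   (s :* (# 3 :* (# 2 :* a :+ c) :+ # 2) :+ s :* (s :* (# 3 :* a :+ o :+ (# 4 :* c :+ # 6 :* a) :* a)))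
   :- (s :* (# 3 :* (# 2 :* b :+ h) :+ # 2) :+ s :* (s :* (# 3 :* b :+ o :+ (# 4 :* h :+ # 6 :* b) :* b)))
   := s :* ((# 3 :+ # 4 :* (s :* a)) :* (c :- h) :+ (# 6 :+ s :* (# 3 :+ # 6 :* a :+ # 4 :* h :+ # 6 :* b)) :* (a :- b)))
   rfl S (C 0) c0 a (Θ c0) 𝟘)
   (*-cong (rfl {S}) (+-cong (rfl {U · e}) (*-cong (rfl {V}) (≈-sym d-eq)))))))
  B = X · ((κ 4 ⊕ y · (z · U)) · e ⊕ (κ 2 ⊕ y · (V · y)) · ϑ e)
  arranged : e ⊕ ϑ e ≈ B ⊕ z · ((e ⊕ d) - S · (U · e ⊕ V · d))
  arranged = modulo-z ((y · ϑ e) · (S · V - κ 1)) (solve 6 (\ x e t v U V -> let y = # 1 :- # 2 :* x ; z = # 1 :- # 4 :* x ; s = x :* y ; d = y :* v :* t in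
    e :+ t := x :* ((# 4 :+ y :* (z :* U)) :* e :+ (# 2 :+ y :* (V :* y)) :* t) :+ z :* ((e :+ d) :- s :* (U :* e :+ V :* d)) :+ ((y :* t) :* (s :* V :- # 1)) :* (z :* v :- # 1))
   rfl X e (ϑ e) w4 U V)

 Θ-C-0 : Θ (C 0) ≈ a0
 Θ-C-0 = tra (Θ-cong C-0) Θ-c0

 sumBelow : ℕ -> (ℕ -> Ser) -> Ser
 sumBelow zero f = 𝟘
 sumBelow (suc n) f = f 0 ⊕ sumBelow n (f ∘ suc)

 sumBelow-cong : ∀ n {f h : ℕ -> Ser} -> (∀ j -> f j ≈ h j) -> sumBelow n f ≈ sumBelow n h
 sumBelow-cong zero q = rfl
 sumBelow-cong (suc n) q = +-cong (q 0) (sumBelow-cong n (q ∘ suc))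

 sumBelow-· : ∀ n s f -> sumBelow n (\ j -> s · f j) ≈ s · sumBelow n f
 sumBelow-· zero s f = ≈-sym (zeroʳ s)
 sumBelow-· (suc n) s f = tra (+-cong (rfl {s · f 0}) (sumBelow-· n s (f ∘ suc))) (≈-sym (distribˡ s (f 0) (sumBelow n (f ∘ suc))))

 sumS-last : ∀ n (f : ℕ -> Ser) -> sumS n f ≈ sumBelow n f ⊕ f n
 sumS-last zero f = ≈-sym (+-idˡ (f 0))
 sumS-last (suc n) f = tra (sumS-suc n f) (tra (+-cong (rfl {f 0}) (sumS-last n (f ∘ suc))) (≈-sym (+-assoc (f 0) (sumBelow n (f ∘ suc)) (f (suc n)))))

 sumS-ends : ∀ n (f : ℕ -> Ser) -> sumS (suc n) f ≈ f 0 ⊕ sumBelow n (f ∘ suc) ⊕ f (suc n)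
 sumS-ends n f = sumS-last (suc n) f

 interior : ℕ -> Ser
 interior h = sumBelow h (\ j -> (κ 4 · C (suc j) ⊕ κ 6 · Θ (C (suc j))) · Θ (C (suc h ∸ suc j)))

 -- In positive genus C_g meets only genus 0 series in the convolution, namely in its two end terms;
 -- with C₀ known, the equation becomes linear of first order, and `interior` involves lower genera.
 C-linear : ∀ h -> d1 · d1 · z · Θ (C (suc h)) ⊕ d1 · (κ 1 - κ 2 · X ⊕ κ 4 · (X · X)) · C (suc h)
  ≈ S · (S · (L Θ (Θ ∘ C) (suc h) ⊕ interior h))
 C-linear h = x-y≈0⇒x≈y (modulo-y _ (tra (solve 6 (\ x w c a l b -> let y = # 1 :- # 2 :* x ; z = # 1 :- # 4 :* x ; s = x :* y ; d = # 1 :- x ; a0 = x :* (w :* w) ; c0 = x :* (# 1 :- # 3 :* x) :* (w :* w) ; q = # 4 :* (x :* x :* x) :* (# 1 :- # 3 :* x) :* a :+ # 12 :* (x :* x :* x) :* a :+ # 4 :* (x :* x :* x) :* c in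
    d :* d :* z :* a :+ d :* (# 1 :- # 2 :* x :+ # 4 :* (x :* x)) :* c :- s :* (s :* (l :+ b))
   := (c :+ a) :- (s :* (# 3 :* (# 2 :* a :+ c) :+ # 0) :+ s :* (s :* (# 3 :* a :+ l :+ ((# 4 :* c0 :+ # 6 :* a0) :* a :+ b :+ (# 4 :* c :+ # 6 :* a) :* a0)))) :+ (q :* (y :* w :+ # 1)) :* (y :* w :- # 1))
   rfl X w2 c a l b) (+-cong (tra (≈⇒-≈0 equation) (rfl {𝟘})) (rfl))))
  where
  c = C (suc h)
  a = Θ c
  l = L Θ (Θ ∘ C) (suc h)
  b = interior h
  f : ℕ -> Ser
  f i = (κ 4 · C i ⊕ κ 6 · Θ (C i)) · Θ (C (suc h ∸ i))
  equation : c ⊕ a ≈ S · (κ 3 · (κ 2 · a ⊕ c) ⊕ κ 0) ⊕ S · (S · (κ 3 · a ⊕ l ⊕ ((κ 4 · c0 ⊕ κ 6 · a0) · a ⊕ b ⊕ (κ 4 · c ⊕ κ 6 · a) · a0)))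
  equation = tra (C-equation (suc h)) (+-cong (*-cong (rfl {S}) (+-cong (rfl {ι (Z.+ 3) · (κ 2 · a ⊕ c)}) (≈-sym ι-0)))
   (*-cong (rfl {S}) (*-cong (rfl {S}) (+-cong (rfl {ι (Z.+ 3) · a ⊕ l}) (tra (sumS-ends h f) (+-cong (+-cong
   (*-cong (+-cong (*-cong (rfl {ι (Z.+ 4)}) C-0) (*-cong (rfl {ι (Z.+ 6)}) Θ-C-0)) (rfl {a})) (rfl {b}))
   (*-cong (rfl {ι (Z.+ 4) · c ⊕ κ 6 · a}) (tra (Θ-cong (\ k -> cong (\ i -> C i k) (NP.n∸n≡0 h))) Θ-C-0))))))))

 Dₜ : Ser -> Ser
 Dₜ u = S · S · (w4 · w4 · w4) · deriv (deriv (deriv u))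
  ⊕ S · (κ 5 - κ 28 · X ⊕ κ 56 · (X · X)) · (w4 · w4 · (w4 · w4)) · deriv (deriv u)
  ⊕ (κ 4 - κ 44 · X ⊕ κ 232 · (X · X) - κ 576 · (X · X · X) ⊕ κ 576 · (X · X · (X · X)))
  · (w4 · w4 · (w4 · w4) · w4) · deriv u

 module _ (u : Ser) where

  private
   e₁ = deriv u
   e₂ = deriv e₁
   e3 = deriv e₂
   q = κ 1 - κ 4 · X ⊕ κ 8 · (X · X)
   p1 = X · y · w4
   p2 = X · y · q · (w4 · w4 · w4)
   p3 = X · X · (y · y) · (w4 · w4)

   ϑ-y : ϑ y ≈ - (κ 2 · X)
   ϑ-y = ϑ-linear (Z.+ 1) (Z.+ 2)

   ϑ-XX : ϑ (X · X) ≈ X · X ⊕ X · X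
   ϑ-XX = tra (ϑ-· X X) (+-cong (*-cong ϑ-X (rfl {X})) (*-cong (rfl {X}) ϑ-X))

   ϑ-q : ϑ q ≈ - (κ 4 · X) ⊕ κ 8 · (X · X ⊕ X · X)
   ϑ-q = tra (ϑ-⊕ (κ 1 - κ 4 · X) (κ 8 · (X · X))) (+-cong (ϑ-linear (Z.+ 1) (Z.+ 4))
    (tra (ϑ-· (κ 8) (X · X)) (tra (+-cong (tra (*-cong (ϑ-ι (Z.+ 8)) (rfl {X · X})) (zeroˡ (X · X))) (*-cong (rfl {ι (Z.+ 8)}) ϑ-XX)) (+-idˡ _))))

   ϑ-ww : ϑ (w4 · w4) ≈ κ 8 · X · (w4 · w4 · w4)
   ϑ-ww = tra (ϑ-· w4 w4) (tra (+-cong (*-cong ϑ-w4 (rfl {w4})) (*-cong (rfl {w4}) ϑ-w4))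
    (solve 2 (\ x v -> # 4 :* x :* (v :* v) :* v :+ v :* (# 4 :* x :* (v :* v)) := # 8 :* x :* (v :* v :* v)) rfl X w4))

   ϑ-www : ϑ (w4 · w4 · w4) ≈ κ 12 · X · (w4 · w4 · (w4 · w4))
   ϑ-www = tra (ϑ-· (w4 · w4) w4) (tra (+-cong (*-cong ϑ-ww (rfl {w4})) (*-cong (rfl {w4 · w4}) ϑ-w4))
    (solve 2 (\ x v -> # 8 :* x :* (v :* v :* v) :* v :+ v :* v :* (# 4 :* x :* (v :* v)) := # 12 :* x :* (v :* v :* (v :* v))) rfl X w4))

   ϑ-p1 : ϑ p1 ≈ X · q · (w4 · w4)
   ϑ-p1 = tra (ϑ-· (X · y) w4) (tra (+-cong (*-cong ϑ-S (rfl {w4})) (*-cong (rfl {X · y}) ϑ-w4))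
    (modulo-z _ (solve 2 (\ x v -> let y = # 1 :- # 2 :* x ; z = # 1 :- # 4 :* x ; q = # 1 :- # 4 :* x :+ # 8 :* (x :* x) in
     x :* z :* v :+ x :* y :* (# 4 :* x :* (v :* v)) := x :* q :* (v :* v) :+ (:- (x :* z :* v)) :* (z :* v :- # 1)) rfl X w4)))

   ϑ-p2 : ϑ p2 ≈ (X · z · q ⊕ X · y · (- (κ 4 · X) ⊕ κ 8 · (X · X ⊕ X · X))) · (w4 · w4 · w4) ⊕ X · y · q · (κ 12 · X · (w4 · w4 · (w4 · w4)))
   ϑ-p2 = tra (ϑ-· (X · y · q) (w4 · w4 · w4)) (+-cong (*-cong (tra (ϑ-· (X · y) q) (+-cong (*-cong ϑ-S (rfl {q})) (*-cong (rfl {X · y}) ϑ-q))) (rfl {w4 · w4 · w4}))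
    (*-cong (rfl {X · y · q}) ϑ-www))

   ϑ-p3 : ϑ p3 ≈ ((X · X ⊕ X · X) · (y · y) ⊕ X · X · ((- (κ 2 · X)) · y ⊕ y · (- (κ 2 · X)))) · (w4 · w4) ⊕ X · X · (y · y) · (κ 8 · X · (w4 · w4 · w4))
   ϑ-p3 = tra (ϑ-· (X · X · (y · y)) (w4 · w4)) (+-cong (*-cong (tra (ϑ-· (X · X) (y · y)) (+-cong (*-cong ϑ-XX (rfl {y · y})) (*-cong (rfl {X · X})
    (tra (ϑ-· y y) (+-cong (*-cong ϑ-y (rfl {y})) (*-cong (rfl {y}) ϑ-y)))))) (rfl {w4 · w4})) (*-cong (rfl {X · X · (y · y)}) ϑ-ww))

  Θ-deriv : Θ u ≈ p1 · e₁
  Θ-deriv = tra (*-cong (rfl {y · w4}) (ϑ-deriv u)) (solve 4 (\ x y v e -> y :* v :* (x :* e) := x :* y :* v :* e) rfl X y w4 e₁)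

  ΘΘ-deriv : Θ (Θ u) ≈ p2 · e₁ ⊕ p3 · e₂
  ΘΘ-deriv = tra (Θ-cong Θ-deriv) (tra (*-cong (rfl {y · w4}) (tra (ϑ-· p1 e₁) (+-cong (*-cong ϑ-p1 (rfl {e₁})) (*-cong (rfl {p1}) (ϑ-deriv e₁)))))
   (solve 6 (\ x y v q e f -> y :* v :* (x :* q :* (v :* v) :* e :+ x :* y :* v :* (x :* f)) := x :* y :* q :* (v :* v :* v) :* e :+ x :* x :* (y :* y) :* (v :* v) :* f) rfl X y w4 q e₁ e₂))

  -- The origin of the operator D_t: it is Θ (Θ + 1)² divided by s, written out in d/dt, where Θ = s
  -- d/ds.
  Dₜ-Θ : Θ u ⊕ κ 2 · Θ (Θ u) ⊕ Θ (Θ (Θ u)) ≈ S · Dₜ u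
  Dₜ-Θ = tra (+-cong (+-cong Θ-deriv (*-cong (rfl {ι (Z.+ 2)}) ΘΘ-deriv)) (tra (Θ-cong ΘΘ-deriv) (*-cong (rfl {y · w4})
   (tra (ϑ-⊕ (p2 · e₁) (p3 · e₂)) (+-cong
   (tra (ϑ-· p2 e₁) (+-cong (*-cong ϑ-p2 (rfl {e₁})) (*-cong (rfl {p2}) (ϑ-deriv e₁))))
   (tra (ϑ-· p3 e₂) (+-cong (*-cong ϑ-p3 (rfl {e₂})) (*-cong (rfl {p3}) (ϑ-deriv e₂)))))))))
   (modulo-z _ (solve 5 (\ x v e f g -> let y = # 1 :- # 2 :* x ; z = # 1 :- # 4 :* x ; q = # 1 :- # 4 :* x :+ # 8 :* (x :* x) ; s = x :* y
                                                 ; r = # 4 :- # 44 :* x :+ # 232 :* (x :* x) :- # 576 :* (x :* x :* x) :+ # 576 :* (x :* x :* (x :* x))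
                                                 ; t = # 5 :- # 28 :* x :+ # 56 :* (x :* x)
                                                 ; p1 = x :* y :* v ; p2 = x :* y :* q :* (v :* v :* v) ; p3 = x :* x :* (y :* y) :* (v :* v)
                                                 ; q' = :- (# 4 :* x) :+ # 8 :* (x :* x :+ x :* x) ; y' = :- (# 2 :* x)
                                                 ; P4 = y :* (x :* z :* q :+ x :* y :* q')
                                                 ; s1 = :- s ; s2 = z :* s1 ; s3 = z :* s2 :- # 2 :* s :* q ; s4 = z :* s3 :- P4
                                                 ; t2 = :- (# 2 :* (s :* s)) ; t3 = z :* t2 :- y :* ((x :* x :+ x :* x) :* (y :* y) :+ x :* x :* (y' :* y :+ y :* y')) in
     (p1 :* e :+ # 2 :* (p2 :* e :+ p3 :* f)) :+ y :* v :* (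
      (((x :* z :* q :+ x :* y :* q') :* (v :* v :* v) :+ x :* y :* q :* (# 12 :* x :* (v :* v :* (v :* v)))) :* e :+ p2 :* (x :* f))
      :+ ((((x :* x :+ x :* x) :* (y :* y) :+ x :* x :* (y' :* y :+ y :* y')) :* (v :* v) :+ x :* x :* (y :* y) :* (# 8 :* x :* (v :* v :* v))) :* f :+ p3 :* (x :* g)))
    := s :* (s :* s :* (v :* v :* v) :* g :+ s :* t :* (v :* v :* (v :* v)) :* f :+ r :* (v :* v :* (v :* v) :* v) :* e)
     :+ ((s1 :* v :+ s2 :* (v :* v) :+ s3 :* (v :* v :* v) :+ s4 :* (v :* v :* (v :* v))) :* e :+ (t2 :* (v :* v) :+ t3 :* (v :* v :* v)) :* f) :* (z :* v :- # 1))
    rfl X w4 e₁ e₂ e3))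

 quadraticPart : ℕ -> Ser
 quadraticPart h = sumBelow h (\ j -> (κ 4 · (z · C (suc j)) ⊕ κ 6 · (S · deriv (C (suc j)))) · deriv (C (suc h ∸ suc j)))

 interior-quadratic : ∀ h -> interior h ≈ S · (w4 · w4) · quadraticPart h
 interior-quadratic h = tra (sumBelow-cong h (\ j -> term (C (suc j)) (C (suc h ∸ suc j)))) (sumBelow-· h (S · (w4 · w4)) _)
  where
  term : ∀ c b -> (κ 4 · c ⊕ κ 6 · Θ c) · Θ b ≈ S · (w4 · w4) · ((κ 4 · (z · c) ⊕ κ 6 · (S · deriv c)) · deriv b)
  term c b = tra (*-cong (+-cong (rfl {ι (Z.+ 4) · c}) (*-cong (rfl {ι (Z.+ 6)}) (Θ-deriv c))) (Θ-deriv b))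
   (modulo-z _ (solve 5 (\ x v c d e -> let y = # 1 :- # 2 :* x ; z = # 1 :- # 4 :* x ; s = x :* y in
     (# 4 :* c :+ # 6 :* (s :* v :* d)) :* (s :* v :* e)
    := s :* (v :* v) :* ((# 4 :* (z :* c) :+ # 6 :* (s :* d)) :* e) :+ (:- (# 4 :* c :* (s :* v :* e))) :* (z :* v :- # 1)) rfl X w4 c (deriv c) (deriv b)))

 integrand : ℕ -> Ser
 integrand h = X · X · X · d1 · (Dₜ (C h) ⊕ w4 · w4 · quadraticPart h)

 -- t (1-t)³ / (1-2t)² is an integrating factor for C-linear.
 recursion : ∀ h U -> U 0 ≡ J.0# -> (∀ k -> nat (suc k) J.* U (suc k) ≡ integrand h k) ->
  X · (d1 · d1 · d1) · C (suc h) ≈ y · y · U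
 recursion h U U0 U' = tra (≈-sym (modulo-y _ (solve 3 (\ x w k -> let y = # 1 :- # 2 :* x in
    y :* y :* (w :* w :* k) := k :+ (k :* (y :* w :+ # 1)) :* (y :* w :- # 1)) rfl X w2 Y))) (*-cong (rfl {y · y}) potential)
  where
  c = C (suc h)
  e = deriv c
  Y = X · (d1 · d1 · d1) · c
  I = Dₜ (C h) ⊕ w4 · w4 · quadraticPart h
  ϑ-d1 : ϑ d1 ≈ - X
  ϑ-d1 = tra (ϑ-⊕ (κ 1) (- X)) (tra (+-cong (ϑ-ι (Z.+ 1)) (tra (ϑ-neg X) (-‿cong ϑ-X))) (+-idˡ _))
  linear : d1 · d1 · (X · y) · e ⊕ d1 · (κ 1 - κ 2 · X ⊕ κ 4 · (X · X)) · c ≈ S · (S · (S · I))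
  linear = tra (modulo-z (- (d1 · d1 · (X · y) · e)) (solve 4 (\ x v e c -> let y = # 1 :- # 2 :* x ; z = # 1 :- # 4 :* x ; d = # 1 :- x in
     d :* d :* (x :* y) :* e :+ d :* (# 1 :- # 2 :* x :+ # 4 :* (x :* x)) :* c
    := (d :* d :* z :* (x :* y :* v :* e) :+ d :* (# 1 :- # 2 :* x :+ # 4 :* (x :* x)) :* c) :+ (:- (d :* d :* (x :* y) :* e)) :* (z :* v :- # 1)) rfl X w4 e c))
   (tra (+-cong (*-cong (rfl {d1 · d1 · z}) (≈-sym (Θ-deriv c))) (rfl {d1 · (κ 1 - κ 2 · X ⊕ κ 4 · (X · X)) · c}))
   (tra (C-linear h) (*-cong (rfl {S}) (*-cong (rfl {S}) (tra (+-cong (Dₜ-Θ (C h)) (interior-quadratic h))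
    (solve 4 (\ s a v b -> s :* a :+ s :* (v :* v) :* b := s :* (a :+ v :* v :* b)) rfl S (Dₜ (C h)) w4 (quadraticPart h)))))))
  derivative : ϑ (w2 · w2 · Y) ≈ X · integrand h
  derivative = tra (tra (ϑ-· (w2 · w2) Y) (+-cong (*-cong (tra (ϑ-· w2 w2) (+-cong (*-cong ϑ-w2 (rfl {w2})) (*-cong (rfl {w2}) ϑ-w2))) (rfl {Y}))
   (*-cong (rfl {w2 · w2}) (tra (ϑ-· (X · (d1 · d1 · d1)) c) (+-cong (*-cong (tra (ϑ-· X (d1 · d1 · d1)) (+-cong (*-cong ϑ-X (rfl {d1 · d1 · d1}))
   (*-cong (rfl {X}) (tra (ϑ-· (d1 · d1) d1) (+-cong (*-cong (tra (ϑ-· d1 d1) (+-cong (*-cong ϑ-d1 (rfl {d1})) (*-cong (rfl {d1}) ϑ-d1))) (rfl {d1})) (*-cong (rfl {d1 · d1}) ϑ-d1))))))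
   (rfl {c})) (*-cong (rfl {X · (d1 · d1 · d1)}) (ϑ-deriv c)))))))
   (tra (modulo-y _ (solve 4 (\ x w c e -> let y = # 1 :- # 2 :* x ; d = # 1 :- x ; r = # 1 :- # 2 :* x :+ # 4 :* (x :* x)
                                                      ; g = (x :* (d :* d :* d) :+ x :* (((:- x) :* d :+ d :* (:- x)) :* d :+ d :* d :* (:- x))) :* c :+ x :* (d :* d :* d) :* (x :* e) in
     (# 2 :* x :* (w :* w) :* w :+ w :* (# 2 :* x :* (w :* w))) :* (x :* (d :* d :* d) :* c) :+ w :* w :* g
    := w :* w :* w :* (x :* d) :* (d :* d :* (x :* y) :* e :+ d :* r :* c) :+ (:- (w :* w :* g)) :* (y :* w :- # 1)) rfl X w2 c e))
   (tra (*-cong (rfl {w2 · w2 · w2 · (X · d1)}) linear)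
   (modulo-y _ (solve 3 (\ x w i -> let y = # 1 :- # 2 :* x ; d = # 1 :- x ; s = x :* y ; o = y :* w ; k = x :* (x :* x :* x :* d :* i) in
     w :* w :* w :* (x :* d) :* (s :* (s :* (s :* i))) := k :+ (k :* (o :* o :+ o :+ # 1)) :* (y :* w :- # 1)) rfl X w2 I))))
  -- Both sides vanish at t = 0 and have the same derivative, the one by `derivative`, the other by
  -- the hypothesis on U.
  potential : w2 · w2 · Y ≈ U
  potential zero = by (solve 4 (\ x w d c -> w :* w :* (x :* (d :* d :* d) :* c) := x :* (w :* w :* (d :* d :* d) :* c)) rfl X w2 d1 c 0) (by (X·-zero (w2 · w2 · (d1 · d1 · d1) · c)) (sym U0))
  potential (suc k) = cancel-≢0 (nat (suc k)) (nat-suc≢0 k) (by (derivative (suc k)) (by (X·-suc (integrand h) k) (sym (U' k))))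

-- The potential with the genus variable

module Potential (D : DifferentialAlgebra) where

 open DifferentialProperties D
 open Solver

 module _ (s ε : Carrier) (θ-s : θ s ≈ s) (θ-ε : θ ε ≈ 0#) where

  -- These are `Kform` and `Pform` after s is replaced by s/N and σ by N² σ, divided by N² and N⁴
  -- respectively; ε is N⁻².
  Residual Potential : Carrier -> Carrier
  Residual σ = let a = θ σ in
   s * (κ 3 * (κ 2 * a + σ) + κ 2) + s * (s * (κ 3 * a + ε * (a + κ 2 * θ a + θ (θ a)) + (κ 4 * σ + κ 6 * a) * a)) - (σ + a)
  Potential σ = let a = θ σ ; α = s * a ; p = s * (a + θ a) ; w = a + σ in
   ε * (p * p) + κ 4 * (α * α * w) + κ 3 * (α * α) + κ 4 * α + κ 6 * (α * w) - w * w

  θ-Potential : ∀ σ -> θ (Potential σ) ≈ κ 2 * ((θ σ + θ (θ σ)) * Residual σ)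
  θ-Potential σ = tra expand (solve 6 (\ s ε σ a a1 a2 ->
    let α = s :* a ; p = s :* (a :+ a1) ; w = a :+ σ ; p' = p :+ s :* (a1 :+ a2) ; w' = a1 :+ a in
    ε :* (con (Z.+ 2) :* (p :* p')) :+ con (Z.+ 4) :* (con (Z.+ 2) :* (α :* p) :* w :+ α :* α :* w') :+ con (Z.+ 3) :* (con (Z.+ 2) :* (α :* p)) :+ con (Z.+ 4) :* p :+ con (Z.+ 6) :* (p :* w :+ α :* w') :- con (Z.+ 2) :* (w :* w')
   := con (Z.+ 2) :* ((a :+ a1) :* (s :* (con (Z.+ 3) :* (con (Z.+ 2) :* a :+ σ) :+ con (Z.+ 2)) :+ s :* (s :* (con (Z.+ 3) :* a :+ ε :* (a :+ con (Z.+ 2) :* a1 :+ a2) :+ (con (Z.+ 4) :* σ :+ con (Z.+ 6) :* a) :* a)) :- (σ :+ a))))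
   rfl s ε σ a a1 (θ a1))
   where
   a = θ σ
   a1 = θ a
   α = s * a
   p = s * (a + a1)
   w = a + σ
   p' = p + s * (a1 + θ a1)
   w' = a1 + a
   θα : θ α ≈ p
   θα = tra (θ-* s a) (tra (+-cong (*-cong θ-s rfl) rfl) (≈-sym (distribˡ s a a1)))
   θp : θ p ≈ p'
   θp = tra (θ-* s (a + a1)) (+-cong (*-cong θ-s rfl) (*-cong rfl (θ-+ a a1)))
   θαα : θ (α * α) ≈ κ 2 * (α * p)
   θαα = tra (θ-sq α) (*-cong rfl (*-cong rfl θα))
   expand : θ (Potential σ) ≈ ε * (κ 2 * (p * p')) + κ 4 * (κ 2 * (α * p) * w + α * α * w') + κ 3 * (κ 2 * (α * p)) + κ 4 * p + κ 6 * (p * w + α * w') - κ 2 * (w * w')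
   expand = tra (θ-- _ (w * w)) (+-cong (tra (θ-+ _ _) (+-cong (tra (θ-+ _ _) (+-cong (tra (θ-+ _ _) (+-cong (tra (θ-+ _ _) (+-cong
    (tra (θ-constˡ θ-ε _) (*-cong rfl (tra (θ-sq p) (*-cong rfl (*-cong rfl θp)))))
    (tra (θ-constˡ (θ-ι (Z.+ 4)) _) (*-cong rfl (tra (θ-* (α * α) w) (+-cong (*-cong θαα rfl) (*-cong rfl (θ-+ a σ))))))))
    (tra (θ-constˡ (θ-ι (Z.+ 3)) _) (*-cong rfl θαα))))
    (tra (θ-constˡ (θ-ι (Z.+ 4)) _) (*-cong rfl θα))))
    (tra (θ-constˡ (θ-ι (Z.+ 6)) _) (*-cong rfl (tra (θ-* α w) (+-cong (*-cong θα rfl) (*-cong rfl (θ-+ a σ))))))))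
    (-‿cong (tra (θ-sq w) (*-cong rfl (*-cong rfl (θ-+ a σ))))))

-- Vanishing of the potential in every genus

module GenusRecursion (J : NumberField) where

 open Series J
 private module J = FieldProperties J
 open J using (F; nat; int; int-0; int-1; nat-suc; nat-suc≢0; cancel-≢0)
 open GenusSeries J
 open Substitution J
 open RationalForm J
 open DifferentialProperties substDifferential using () renaming (θ-+ to Θ-+; θ-* to Θ-*; θ-ι to Θ-ι; θ-cong to Θ-cong)
 private module R = ℤ-AlgebraProperties serAlg
 open Families serAlg
  renaming (sumTo to sumS; sumTo-cong to sumS-cong; sumTo-+ to sumS-+; sumTo-*ˡ to sumS-*ˡ; sumTo-0 to sumS-0; sumTo-suc to sumS-suc)
 open DifferentialFamilies substDifferential using (familyDifferential)
 private module F = DifferentialProperties familyDifferential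
 open Potential familyDifferential

 fam-cong : ∀ {u v} -> u ≈ v -> fam u ≋ fam v
 fam-cong q zero = q
 fam-cong q (suc g) = R.rfl

 fam-+ : ∀ u v -> fam (u ⊕ v) ≋ fam u ⊞ fam v
 fam-+ u v zero = R.rfl
 fam-+ u v (suc g) = R.≈-sym (R.+-idˡ 𝟘)

 fam-* : ∀ u v -> fam (u · v) ≋ fam u ⊛ fam v
 fam-* u v zero = R.rfl
 fam-* u v (suc g) = R.≈-sym (R.tra (fam-⊛ u (fam v) (suc g)) (R.zeroʳ u))

 fam-neg : ∀ u -> fam (⊝ u) ≋ ⊟ fam u
 fam-neg u zero = R.rfl
 fam-neg u (suc g) = R.≈-sym (R.tra (R.≈-sym (R.+-idˡ (⊝ 𝟘))) (R.-‿inverseʳ 𝟘))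

 a : Fam
 a g = Θ (C g)

 famS : Fam
 famS = fam S

 θ-famS : F.θ famS ≋ famS
 θ-famS zero = Θ-S
 θ-famS (suc g) = R.tra (Θ-cong (R.≈-sym R.ι-0)) (Θ-ι (Z.+ 0))

 θ-ε : F.θ ε ≋ zeroᶠ
 θ-ε zero = R.tra (Θ-cong (R.≈-sym R.ι-0)) (Θ-ι (Z.+ 0))
 θ-ε (suc zero) = R.tra (Θ-cong (R.≈-sym R.ι-1)) (Θ-ι (Z.+ 1))
 θ-ε (suc (suc g)) = R.tra (Θ-cong (R.≈-sym R.ι-0)) (Θ-ι (Z.+ 0))

 residual : Residual famS ε θ-famS θ-ε C ≋ zeroᶠ
 residual g = R.tra (R.+-cong (R.tra (R.+-cong (R.tra (fam-⊛ S u1 g) (R.*-cong (R.rfl {S}) (R.+-cong (R.tra (fam-⊛ (R.κ 3) u2 g)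
  (R.*-cong (R.rfl {R.ι (Z.+ 3)}) (R.+-cong (fam-⊛ (R.κ 2) a g) (R.rfl {C g})))) (source-eq g))))
  (R.tra (fam-⊛ S (famS ⊛ v) g) (R.*-cong (R.rfl {S}) (R.tra (fam-⊛ S v g) (R.*-cong (R.rfl {S}) (R.+-cong (R.+-cong (fam-⊛ (R.κ 3) a g) (L-eq g)) conv-eq))))))
  (R.≈-sym (C-equation g))) (R.rfl { ⊝ (C g ⊕ a g)})) (R.-‿inverseʳ (C g ⊕ a g))
  where
  u2 = F.κ 2 ⊛ a ⊞ C
  u1 = F.κ 3 ⊛ u2 ⊞ F.κ 2
  v = F.κ 3 ⊛ a ⊞ ε ⊛ (a ⊞ F.κ 2 ⊛ F.θ a ⊞ F.θ (F.θ a)) ⊞ (F.κ 4 ⊛ C ⊞ F.κ 6 ⊛ a) ⊛ a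
  source-eq : ∀ g -> F.κ 2 g ≈ source g
  source-eq zero = R.rfl
  source-eq (suc g) = R.rfl
  L-eq : ∀ g -> (ε ⊛ (a ⊞ F.κ 2 ⊛ F.θ a ⊞ F.θ (F.θ a))) g ≈ L Θ a g
  L-eq zero = ε-⊛-zero (a ⊞ F.κ 2 ⊛ F.θ a ⊞ F.θ (F.θ a))
  L-eq (suc g) = R.tra (ε-⊛-suc (a ⊞ F.κ 2 ⊛ F.θ a ⊞ F.θ (F.θ a)) g) (R.+-cong (R.+-cong (R.rfl {a g}) (fam-⊛ (R.κ 2) (F.θ a) g)) (R.rfl {Θ (Θ (a g))}))
  conv-eq : ((F.κ 4 ⊛ C ⊞ F.κ 6 ⊛ a) ⊛ a) g ≈ convolution C a g
  conv-eq = sumS-cong g (\ i _ -> R.*-cong (R.+-cong (fam-⊛ (R.κ 4) C i) (fam-⊛ (R.κ 6) a i)) (R.rfl {a (g ∸ i)}))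

 record Null (u : Fam) : Set where
  field at-0 : ∀ g -> u g 0 ≡ J.0#

 open Null

 null-⊞ : ∀ {u v} -> Null u -> Null v -> Null (u ⊞ v)
 at-0 (null-⊞ p q) g = by (cong₂ J._+_ (at-0 p g) (at-0 q g)) (J.+-idˡ _)

 null-⊟ : ∀ {u} -> Null u -> Null (⊟ u)
 at-0 (null-⊟ p) g = by (cong J.-_ (at-0 p g)) (by (sym (J.+-idˡ _)) (J.-‿inverseʳ J.0#))

 null-⊛ˡ : ∀ {u} v -> Null u -> Null (u ⊛ v)
 at-0 (null-⊛ˡ {u} v p) g = by (sumS-at g (\ i -> u i · v (g ∸ i)) 0) (sumTo-0 g (\ i _ -> by (cong (J._* v (g ∸ i) 0) (at-0 p i)) (J.zeroˡ _)))

 null-⊛ʳ : ∀ u {v} -> Null v -> Null (u ⊛ v)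
 at-0 (null-⊛ʳ u {v} p) g = by (sumS-at g (\ i -> u i · v (g ∸ i)) 0) (sumTo-0 g (\ i _ -> by (cong (u i 0 J.*_) (at-0 p (g ∸ i))) (J.zeroʳ _)))

 -- The vanishing residual makes the potential constant, and at t = 0 every term contains a
 -- vanishing factor, s or w. The result is a relation free of integrals, which is what gives access
 -- to rationality.
 potential : Potential famS ε θ-famS θ-ε C ≋ zeroᶠ
 potential g zero = at-0 (null-⊞ (null-⊞ (null-⊞ (null-⊞ (null-⊞ (null-⊛ʳ ε (null-⊛ˡ p nS)) (null-⊛ʳ (F.κ 4) (null-⊛ˡ w (null-⊛ˡ α nα)))) (null-⊛ʳ (F.κ 3) (null-⊛ˡ α nα))) (null-⊛ʳ (F.κ 4) nα))
  (null-⊛ʳ (F.κ 6) (null-⊛ˡ w nα))) (null-⊟ (null-⊛ˡ w nw))) g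
  where
  α = famS ⊛ a
  p = famS ⊛ (a ⊞ F.θ a)
  w = a ⊞ C
  nfS : Null famS
  at-0 nfS zero = X·-zero y
  at-0 nfS (suc g) = refl
  nS : Null p
  nS = null-⊛ˡ (a ⊞ F.θ a) nfS
  nα : Null α
  nα = null-⊛ˡ a nfS
  nw : Null w
  at-0 nw g = by (cong₂ J._+_ (by (cong ((y · w4) 0 J.*_) (by (cong (J._* C g 0) int-0) (J.zeroˡ _))) (J.zeroʳ _)) (J.zeroˡ _)) (J.+-idˡ _)
 potential g (suc k) = cancel-≢0 (nat (suc k)) (nat-suc≢0 k) (by (constant (suc k)) (sym (J.zeroʳ _)))
  where
  u = Potential famS ε θ-famS θ-ε C g
  flat : Θ u ≈ 𝟘
  flat = F.tra (θ-Potential famS ε θ-famS θ-ε C) (F.tra (F.*-cong (F.rfl {F.ι (Z.+ 2)}) (F.tra (F.*-cong (F.rfl {a ⊞ F.θ a}) residual) (F.zeroʳ (a ⊞ F.θ a)))) (F.zeroʳ (F.κ 2))) g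
  open R.Solver
  constant : ϑ u ≈ 𝟘
  constant = R.≈-sym (R.tra (R.≈-sym (R.tra (R.*-cong (R.rfl {z · w2}) flat) (R.zeroʳ (z · w2)))) (modulo-z (ϑ u) (modulo-y (z · w4 · ϑ u) (R.Solver.solve 4 (\ x w v t -> let y = con (Z.+ 1) :- con (Z.+ 2) :* x ; z = con (Z.+ 1) :- con (Z.+ 4) :* x in
   z :* w :* (y :* v :* t) := t :+ t :* (z :* v :- con (Z.+ 1)) :+ (z :* v :* t) :* (y :* w :- con (Z.+ 1))) R.rfl X w2 w4 (ϑ u)))))

-- Pole orders and degrees of numerators

module PoleOrders (J : NumberField) where

 open Series J
 private module J = FieldProperties J
 open J using (F; nat; int; int-0; int-1; nat-suc; nat-suc≢0; nat-+; cancel-≢0)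
 open Substitution J
 open RationalForm J using (d1; modulo-z)
 open ℤ-AlgebraProperties serAlg hiding (_≈_; _+_; _*_)
 open Families serAlg hiding (sumTo-cong; sumTo-+; sumTo-*ˡ; sumTo-0; sumTo-suc) renaming (sumTo to sumS)

 IsPoly : ℕ -> Ser -> Set
 IsPoly e f = ∀ k -> e N.< k -> f k ≡ J.0#

 poly-⊕ : ∀ {e f h} -> IsPoly e f -> IsPoly e h -> IsPoly e (f ⊕ h)
 poly-⊕ p q k l = by (cong₂ J._+_ (p k l) (q k l)) (J.+-idˡ _)

 poly-⊝ : ∀ {e f} -> IsPoly e f -> IsPoly e (⊝ f)
 poly-⊝ p k l = by (cong J.-_ (p k l)) (by (sym (J.+-idˡ _)) (J.-‿inverseʳ J.0#))

 poly-· : ∀ {d e f h} -> IsPoly d f -> IsPoly e h -> IsPoly (d N.+ e) (f · h)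
 poly-· {d} {e} {f} {h} p q k l = sumTo-0 k (\ j _ -> go j (j N.≤? d))
  where
  go : ∀ j -> Dec (j N.≤ d) -> f j J.* h (k ∸ j) ≡ J.0#
  go j (no a) = by (cong (J._* h (k ∸ j)) (p j (NP.≰⇒> a))) (J.zeroˡ _)
  go j (yes a) = by (cong (f j J.*_) (q (k ∸ j) (NP.<-≤-trans (NP.m<n+m e (s≤s z≤n)) (NP.≤-trans (NP.≤-reflexive (sym (NP.m+n∸m≡n d (suc e))))
   (NP.≤-trans (NP.∸-monoˡ-≤ d (subst (N._≤ k) (sym (NP.+-suc d e)) l)) (NP.∸-monoʳ-≤ k a)))))) (J.zeroʳ _)

 poly-≤ : ∀ {d e f} -> d N.≤ e -> IsPoly d f -> IsPoly e f
 poly-≤ d≤e p k l = p k (NP.≤-<-trans d≤e l)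

 poly-cong : ∀ {e f h} -> f ≈ h -> IsPoly e f -> IsPoly e h
 poly-cong q p k l = by (sym (q k)) (p k l)

 poly-const : ∀ c -> IsPoly 0 (const c)
 poly-const c (suc k) l = refl

 poly-X : IsPoly 1 X
 poly-X (suc zero) (s≤s ())
 poly-X (suc (suc k)) l = refl

 poly-ϑ : ∀ {e f} -> IsPoly e f -> IsPoly e (ϑ f)
 poly-ϑ p k l = by (cong (nat k J.*_) (p k l)) (J.zeroʳ _)

 poly-linear : ∀ i j -> IsPoly 1 (ι i - ι j · X)
 poly-linear i j = poly-⊕ {1} {ι i} (poly-≤ {0} {1} {ι i} z≤n (poly-const (int i))) (poly-⊝ {1} {ι j · X} (poly-· {0} {1} {ι j} {X} (poly-const (int j)) poly-X))

 poly-d1 : IsPoly 1 d1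
 poly-d1 = poly-⊕ {1} {ι (Z.+ 1)} (poly-≤ {0} {1} {ι (Z.+ 1)} z≤n (poly-const (int (Z.+ 1)))) (poly-⊝ {1} {X} poly-X)

 pow : Ser -> ℕ -> Ser
 pow f zero = 𝟙
 pow f (suc n) = f · pow f n

 pow-+ : ∀ f m n -> pow f (m N.+ n) ≈ pow f m · pow f n
 pow-+ f zero n = ≈-sym (*-idˡ (pow f n))
 pow-+ f (suc m) n = tra (*-cong (rfl {f}) (pow-+ f m n)) (≈-sym (*-assoc f (pow f m) (pow f n)))

 -- f = p / ((1-t)^m (1-4t)^n) with p a polynomial of degree at most e.
 record Rational (m n e : ℕ) (f : Ser) : Set where
  constructor rational
  field numerator : IsPoly e (pow d1 m · (pow z n · f))

 open Rational public

 rational-cong : ∀ {m n e f h} -> f ≈ h -> Rational m n e f -> Rational m n e h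
 numerator (rational-cong {m} {n} q r) = poly-cong (*-cong (rfl {pow d1 m}) (*-cong (rfl {pow z n}) q)) (numerator r)

 rational-𝟘 : ∀ {m n e f} -> f ≈ 𝟘 -> Rational m n e f
 numerator (rational-𝟘 {m} {n} q) k l = tra (*-cong (rfl {pow d1 m}) (tra (*-cong (rfl {pow z n}) q) (zeroʳ (pow z n)))) (zeroʳ (pow d1 m)) k

 rational-⊕ : ∀ {m n e f h} -> Rational m n e f -> Rational m n e h -> Rational m n e (f ⊕ h)
 numerator (rational-⊕ {m} {n} {e} {f} {h} r s) = poly-cong (Solver.solve 4 (\ a b f h -> let open Solver in a :* (b :* f) :+ a :* (b :* h) := a :* (b :* (f :+ h))) rfl (pow d1 m) (pow z n) f h)
  (poly-⊕ {e} {pow d1 m · (pow z n · f)} (numerator r) (numerator s))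

 rational-⊝ : ∀ {m n e f} -> Rational m n e f -> Rational m n e (⊝ f)
 numerator (rational-⊝ {m} {n} {e} {f} r) = poly-cong (Solver.solve 3 (\ a b f -> let open Solver in :- (a :* (b :* f)) := a :* (b :* (:- f))) rfl (pow d1 m) (pow z n) f)
  (poly-⊝ {e} {pow d1 m · (pow z n · f)} (numerator r))

 rational-· : ∀ {m n e f m' n' e' f'} -> Rational m n e f -> Rational m' n' e' f' -> Rational (m N.+ m') (n N.+ n') (e N.+ e') (f · f')
 numerator (rational-· {m} {n} {e} {f} {m'} {n'} {e'} {f'} r s) = poly-cong
  (tra (Solver.solve 6 (\ a b f c d g -> let open Solver in (a :* (b :* f)) :* (c :* (d :* g)) := (a :* c) :* ((b :* d) :* (f :* g))) rfl (pow d1 m) (pow z n) f (pow d1 m') (pow z n') f')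
   (*-cong (≈-sym (pow-+ d1 m m')) (*-cong (≈-sym (pow-+ z n n')) (rfl {f · f'}))))
  (poly-· {e} {e'} {pow d1 m · (pow z n · f)} (numerator r) (numerator s))

 rational-poly : ∀ {e f} -> IsPoly e f -> Rational 0 0 e f
 numerator (rational-poly {f = f} p) = poly-cong (≈-sym (tra (*-idˡ (𝟙 · f)) (*-idˡ f))) p

 rational-≤ : ∀ {m n d e f} -> d N.≤ e -> Rational m n d f -> Rational m n e f
 numerator (rational-≤ {m} {n} {f = f} l r) = poly-≤ {f = pow d1 m · (pow z n · f)} l (numerator r)

 -- Brings summands to common orders: i and j enlarge the denominator, which costs i + j in degree,
 -- and l is slack in the degree.
 rational-up : ∀ {m n e f} i j l -> Rational m n e f -> Rational (i N.+ m) (j N.+ n) (i N.+ j N.+ l N.+ e) f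
 numerator (rational-up {m} {n} {e} {f} i j l r) = poly-≤ {f = pow d1 (i N.+ m) · (pow z (j N.+ n) · f)} (NP.+-monoˡ-≤ e (NP.m≤m+n (i N.+ j) l)) (poly-cong
  (tra (Solver.solve 5 (\ a b f c d -> let open Solver in (c :* d) :* (a :* (b :* f)) := (c :* a) :* ((d :* b) :* f)) rfl (pow d1 m) (pow z n) f (pow d1 i) (pow z j))
   (*-cong (≈-sym (pow-+ d1 i m)) (*-cong (≈-sym (pow-+ z j n)) (rfl {f}))))
  (poly-· {i N.+ j} {e} {pow d1 i · pow z j} (poly-· {i} {j} {pow d1 i} (poly-pow d1 poly-d1 i) (poly-pow z (poly-linear (Z.+ 1) (Z.+ 4)) j)) (numerator r)))
  where
  poly-pow : ∀ f -> IsPoly 1 f -> ∀ i -> IsPoly i (pow f i)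
  poly-pow f p zero = poly-const J.1#
  poly-pow f p (suc i) = poly-· {1} {i} {f} p (poly-pow f p i)

 rational-d1 : ∀ {m n e f} -> Rational (suc m) n e f -> Rational m n e (d1 · f)
 numerator (rational-d1 {m} {n} {e} {f} r) = poly-cong (Solver.solve 4 (\ d a b f -> let open Solver in (d :* a) :* (b :* f) := a :* (b :* (d :* f))) rfl d1 (pow d1 m) (pow z n) f) (numerator r)

 rational-z : ∀ {m n e f} -> Rational m (suc n) e f -> Rational m n e (z · f)
 numerator (rational-z {m} {n} {e} {f} r) = poly-cong (Solver.solve 4 (\ z a b f -> let open Solver in a :* ((z :* b) :* f) := a :* (b :* (z :* f))) rfl z (pow d1 m) (pow z n) f) (numerator r)

 rational-w4 : ∀ {m n e f} -> Rational m n e f -> Rational m (suc n) e (w4 · f)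
 numerator (rational-w4 {m} {n} {e} {f} r) = poly-cong (≈-sym (tra (Solver.solve 5 (\ z w a b f -> let open Solver in a :* ((z :* b) :* (w :* f)) := (z :* w) :* (a :* (b :* f))) rfl z w4 (pow d1 m) (pow z n) f)
  (tra (*-cong z·w4 (rfl {pow d1 m · (pow z n · f)})) (*-idˡ (pow d1 m · (pow z n · f)))))) (numerator r)

 ϑ-pow : ∀ f n -> f · ϑ (pow f n) ≈ const (nat n) · ϑ f · pow f n
 ϑ-pow f zero = tra (*-cong (rfl {f}) (ϑ-const J.1#)) (tra (zeroʳ f) (≈-sym (tra (*-cong (tra (*-cong (ι-0) (rfl {ϑ f})) (zeroˡ (ϑ f))) (rfl {𝟙})) (zeroˡ 𝟙))))
 ϑ-pow f (suc n) = tra (*-cong (rfl {f}) (tra (ϑ-· f (pow f n)) (+-cong (rfl {ϑ f · pow f n}) (ϑ-pow f n))))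
  (tra (Solver.solve 4 (\ f g p n -> let open Solver in f :* (g :* p :+ n :* g :* p) := (con (Z.+ 1) :+ n) :* g :* (f :* p)) rfl f (ϑ f) (pow f n) (const (nat n)))
   (*-cong (*-cong (\ { zero -> sym (nat-+ 1 n) ; (suc k) -> J.+-idˡ _ }) (rfl {ϑ f})) (rfl {f · pow f n})))

 ϑ-d1 : ϑ d1 ≈ - X
 ϑ-d1 = tra (ϑ-⊕ (κ 1) (- X)) (tra (+-cong (ϑ-ι (Z.+ 1)) (tra (ϑ-neg X) (-‿cong ϑ-X))) (+-idˡ _))

 module _ (m n : ℕ) (f : Ser) where

  private
   D = pow d1 m
   E = pow z n
   P = D · (E · f)
   M N : Ser
   M = const (nat m)
   N = const (nat n)

  -- The numerator of Θ f in terms of the numerator P of f.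
  Θ-numerator : pow d1 (suc m) · (pow z (2 N.+ n) · Θ f) ≈ y · (d1 · z · ϑ P ⊕ X · (M · z ⊕ κ 4 · N · d1) · P)
  Θ-numerator = ≈-sym (tra (*-cong (rfl {y}) (tra (+-cong (*-cong (rfl {d1 · z}) (tra (ϑ-· D (E · f)) (+-cong (rfl {ϑ D · (E · f)}) (*-cong (rfl {D}) (ϑ-· E f))))) (rfl {X · (M · z ⊕ κ 4 · N · d1) · P}))
   (tra (Solver.solve 11 (\ x d z D E f D' E' f' M N -> let open Solver in
     d :* z :* (D' :* (E :* f) :+ D :* (E' :* f :+ E :* f')) :+ x :* (M :* z :+ con (Z.+ 4) :* N :* d) :* (D :* (E :* f))
    := z :* (d :* D') :* (E :* f) :+ d :* (z :* E') :* (D :* f) :+ d :* z :* (D :* (E :* f')) :+ x :* (M :* z :+ con (Z.+ 4) :* N :* d) :* (D :* (E :* f)))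
    rfl X d1 z D E f (ϑ D) (ϑ E) (ϑ f) M N)
   (tra (+-cong (+-cong (+-cong (*-cong (*-cong (rfl {z}) (tra (ϑ-pow d1 m) (*-cong (*-cong (rfl {M}) ϑ-d1) (rfl {D})))) (rfl {E · f}))
    (*-cong (*-cong (rfl {d1}) (tra (ϑ-pow z n) (*-cong (*-cong (rfl {N}) (ϑ-linear (Z.+ 1) (Z.+ 4))) (rfl {E})))) (rfl {D · f}))) (rfl {d1 · z · (D · (E · ϑ f))})) (rfl {X · (M · z ⊕ κ 4 · N · d1) · P}))
   (Solver.solve 9 (\ x d z D E f f' M N -> let open Solver in
     z :* (M :* (:- x) :* D) :* (E :* f) :+ d :* (N :* (:- (con (Z.+ 4) :* x)) :* E) :* (D :* f) :+ d :* z :* (D :* (E :* f')) :+ x :* (M :* z :+ con (Z.+ 4) :* N :* d) :* (D :* (E :* f))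
    := d :* z :* (D :* (E :* f'))) rfl X d1 z D E f (ϑ f) M N)))))
   (≈-sym (modulo-z (y · (d1 · z · (D · (E · ϑ f)))) (Solver.solve 6 (\ x v d D E f' -> let open Solver ; y = con (Z.+ 1) :- con (Z.+ 2) :* x ; z = con (Z.+ 1) :- con (Z.+ 4) :* x ; k = y :* (d :* z :* (D :* (E :* f'))) in
     d :* D :* (z :* (z :* E) :* (y :* v :* f')) := k :+ k :* (z :* v :- con (Z.+ 1))) rfl X w4 d1 D E (ϑ f)))))

  -- Since Θ is (1-2t)/(1-4t) times t d/dt, the pole at t = 1 gains one order, and the pole at t =
  -- 1/4 gains two, one by differentiation and one from the factor 1/(1-4t).
  Θ-rational : ∀ {e} -> Rational m n e f -> Rational (suc m) (2 N.+ n) (3 N.+ e) (Θ f)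
  numerator (Θ-rational {e} r) = poly-cong (≈-sym Θ-numerator) (poly-· {1} {2 N.+ e} {y} py
   (poly-⊕ {2 N.+ e} {d1 · z · ϑ P} (poly-· {2} {e} {d1 · z} (poly-· {1} {1} {d1} poly-d1 pz) (poly-ϑ {e} {P} (numerator r)))
   (poly-· {2} {e} {X · (M · z ⊕ κ 4 · N · d1)} (poly-· {1} {1} {X} poly-X (poly-⊕ {1} {M · z} (poly-· {0} {1} {M} (poly-const _) pz)
   (poly-· {0} {1} {ι (Z.+ 4) · N} (poly-· {0} {0} {ι (Z.+ 4)} (poly-const _) (poly-const _)) poly-d1))) (numerator r))))
   where
   py = poly-linear (Z.+ 1) (Z.+ 2)
   pz = poly-linear (Z.+ 1) (Z.+ 4)

  -- If f = O(1/t) at infinity then (Θ + 1/2) f = O(1/t²); here q = 1/16.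
  Θ½-rational : ∀ {e q} -> nat 16 J.* q ≡ J.1# -> suc e ≡ m N.+ n -> Rational m n e f ->
   Rational (suc m) (2 N.+ n) (2 N.+ e) (Θ f ⊕ κ 8 · const q · f)
  numerator (Θ½-rational {e} {q} q16 mn r) = poly-cong (≈-sym expanded) (poly-⊕ {2 N.+ e} {U} pU pV)
   where
   Q = const q
   U V : Ser
   U = (κ 1 - κ 7 · X ⊕ κ 14 · (X · X)) · ϑ P
    ⊕ ((M ⊕ κ 4 · N) · X - (κ 6 · M ⊕ κ 12 · N) · (X · X)) · P
    ⊕ (κ 8 · Q · (κ 1 - κ 9 · X ⊕ κ 24 · (X · X))) · P
   V = κ 8 · ((M ⊕ N) · P) - κ 8 · ϑ P - κ 8 · (κ 16 · Q · P)
   expanded : pow d1 (suc m) · (pow z (2 N.+ n) · (Θ f ⊕ κ 8 · Q · f)) ≈ U ⊕ X · (X · (X · V))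
   expanded = tra (Solver.solve 6 (\ d z D E t f -> let open Solver in
      (d :* D) :* (z :* (z :* E) :* (t :+ f)) := (d :* D) :* (z :* (z :* E) :* t) :+ d :* (z :* (z :* (D :* (E :* f))))) rfl d1 z D E (Θ f) (κ 8 · Q · f))
    (tra (+-cong Θ-numerator (Solver.solve 6 (\ d z D E f q -> let open Solver in d :* (z :* (z :* (D :* (E :* (con (Z.+ 8) :* q :* f))))) := con (Z.+ 8) :* q :* (d :* (z :* (z :* (D :* (E :* f)))))) rfl d1 z D E f Q))
    (Solver.solve 6 (\ x p p' M N q -> let open Solver ; y = con (Z.+ 1) :- con (Z.+ 2) :* x ; z = con (Z.+ 1) :- con (Z.+ 4) :* x ; d = con (Z.+ 1) :- x in
      y :* (d :* z :* p' :+ x :* (M :* z :+ con (Z.+ 4) :* N :* d) :* p) :+ con (Z.+ 8) :* q :* (d :* (z :* (z :* p)))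
     := (con (Z.+ 1) :- con (Z.+ 7) :* x :+ con (Z.+ 14) :* (x :* x)) :* p'
      :+ ((M :+ con (Z.+ 4) :* N) :* x :- (con (Z.+ 6) :* M :+ con (Z.+ 12) :* N) :* (x :* x)) :* p
      :+ (con (Z.+ 8) :* q :* (con (Z.+ 1) :- con (Z.+ 9) :* x :+ con (Z.+ 24) :* (x :* x))) :* p
      :+ x :* (x :* (x :* (con (Z.+ 8) :* ((M :+ N) :* p) :- con (Z.+ 8) :* p' :- con (Z.+ 8) :* (con (Z.+ 16) :* q :* p)))))
     rfl X P (ϑ P) M N Q))
   c : ∀ i -> IsPoly 0 (ι i)
   c i = poly-const (int i)
   pXX : IsPoly 2 (X · X)
   pXX = poly-· {1} {1} {X} poly-X poly-X
   quadratic : ∀ i j k -> IsPoly 2 (ι i - ι j · X ⊕ ι k · (X · X))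
   quadratic i j k = poly-⊕ {2} {ι i - ι j · X} (poly-≤ {1} {2} {ι i - ι j · X} (s≤s z≤n) (poly-linear i j)) (poly-· {0} {2} {ι k} (c k) pXX)
   pU : IsPoly (2 N.+ e) U
   pU = poly-⊕ {2 N.+ e} {(κ 1 - κ 7 · X ⊕ κ 14 · (X · X)) · ϑ P ⊕ ((M ⊕ κ 4 · N) · X - (κ 6 · M ⊕ κ 12 · N) · (X · X)) · P}
    (poly-⊕ {2 N.+ e} {(κ 1 - κ 7 · X ⊕ κ 14 · (X · X)) · ϑ P}
    (poly-· {2} {e} {ι (Z.+ 1) - κ 7 · X ⊕ κ 14 · (X · X)} (quadratic _ _ _) (poly-ϑ {e} {P} (numerator r)))
    (poly-· {2} {e} {(M ⊕ κ 4 · N) · X - (κ 6 · M ⊕ κ 12 · N) · (X · X)}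
    (poly-⊕ {2} {(M ⊕ κ 4 · N) · X} (poly-≤ {1} {2} {(M ⊕ κ 4 · N) · X} (s≤s z≤n) (poly-· {0} {1} {M ⊕ κ 4 · N} (poly-⊕ {0} {M} (poly-const _) (poly-· {0} {0} {ι (Z.+ 4)} (c _) (poly-const _))) poly-X))
    (poly-⊝ {2} {(κ 6 · M ⊕ κ 12 · N) · (X · X)} (poly-· {0} {2} {ι (Z.+ 6) · M ⊕ κ 12 · N} (poly-⊕ {0} {ι (Z.+ 6) · M} (poly-· {0} {0} {ι (Z.+ 6)} (c _) (poly-const _)) (poly-· {0} {0} {ι (Z.+ 12)} (c _) (poly-const _))) pXX)))
    (numerator r)))
    (poly-· {2} {e} {ι (Z.+ 8) · Q · (κ 1 - κ 9 · X ⊕ κ 24 · (X · X))}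
    (poly-· {0} {2} {ι (Z.+ 8) · Q} (poly-· {0} {0} {ι (Z.+ 8)} (c _) (poly-const _)) (quadratic _ _ _)) (numerator r))
   -- `V` collects the part of the numerator that could exceed the claimed degree. Its coefficient
   -- at tᵏ carries the factor m + n - k - 1, which vanishes at the top degree k = e.
   V-at : ∀ k -> V k ≡ (nat 8 J.* (nat (m N.+ n) J.+ J.- nat k J.+ J.- (nat 16 J.* q))) J.* P k
   V-at k = by (cong₂ J._+_ (cong₂ (\ u v -> u J.+ J.- v) (by (·-const (nat 8) ((M ⊕ N) · P) k) (cong (nat 8 J.*_) (by (*-cong mnc (rfl {P}) k) (·-const (nat (m N.+ n)) P k))))
    (·-const (nat 8) (ϑ P) k)) (cong J.-_ (by (·-const (nat 8) (κ 16 · Q · P) k) (cong (nat 8 J.*_) (by (*-assoc (κ 16) Q P k) (by (·-const (nat 16) (Q · P) k) (cong (nat 16 J.*_) (·-const q P k))))))))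
    (J.Solver.solve 4 (\ s k q p -> let open J.Solver in con (Z.+ 8) :* (s :* p) :+ :- (con (Z.+ 8) :* (k :* p)) :+ :- (con (Z.+ 8) :* (con (Z.+ 16) :* (q :* p))) := (con (Z.+ 8) :* (s :+ :- k :+ :- (con (Z.+ 16) :* q))) :* p) refl (nat (m N.+ n)) (nat k) q (P k))
    where
    mnc : M ⊕ N ≈ const (nat (m N.+ n))
    mnc zero = sym (nat-+ m n)
    mnc (suc k) = J.+-idˡ _
   V-top : ∀ k -> e N.≤ k -> V k ≡ J.0#
   V-top k e≤k with e N.≟ k
   ... | no ne = by (V-at k) (by (cong (\ u -> (nat 8 J.* (nat (m N.+ n) J.+ J.- nat k J.+ J.- (nat 16 J.* q))) J.* u) (numerator r k (NP.≤∧≢⇒< e≤k ne))) (J.zeroʳ _))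
   ... | yes refl = by (V-at k) (by (cong (J._* P k) (by (cong (nat 8 J.*_) (by (cong₂ (\ u v -> u J.+ J.- nat k J.+ J.- v) (by (cong nat (sym mn)) (nat-suc k)) q16)
     (by (J.Solver.solve 2 (\ o k -> let open J.Solver in o :+ k :+ :- k :+ :- o := con (Z.+ 0)) refl J.1# (nat k)) int-0))) (J.zeroʳ _))) (J.zeroˡ _))
   pV : IsPoly (2 N.+ e) (X · (X · (X · V)))
   pV (suc (suc (suc k))) (s≤s (s≤s (s≤s l))) = by (X·-suc (X · (X · V)) (suc (suc k))) (by (X·-suc (X · V) (suc k)) (by (X·-suc V k) (V-top k l)))

 -- Pole orders growing linearly with the index.
 record Graded (b μ ν η : ℕ) (u : Fam) : Set where
  field at : ∀ h -> h N.≤ b -> Rational (4 N.* h N.+ μ) (5 N.* h N.+ ν) (9 N.* h N.+ η) (u h)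

 open Graded public

 rational-≡ : ∀ {m n e m' n' e' f} -> m ≡ m' -> n ≡ n' -> e ≡ e' -> Rational m n e f -> Rational m' n' e' f
 rational-≡ refl refl refl r = r

 private
  open Data.Nat.Solver.+-*-Solver using () renaming (solve to solveℕ; _:=_ to _:≡_; _:*_ to _:×_; _:+_ to _:⊹_; con to conℕ)

  interchange : ∀ c i j p q -> c N.* i N.+ p N.+ (c N.* j N.+ q) ≡ c N.* (i N.+ j) N.+ (p N.+ q)
  interchange = solveℕ 5 (\ c i j p q -> c :× i :⊹ p :⊹ (c :× j :⊹ q) :≡ c :× (i :⊹ j) :⊹ (p :⊹ q)) refl

  step : ∀ c h p -> c N.* h N.+ (c N.+ p) ≡ c N.* suc h N.+ p
  step = solveℕ 3 (\ c h p -> c :× h :⊹ (c :⊹ p) :≡ c :× (conℕ 1 :⊹ h) :⊹ p) refl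

  raise : ∀ i p q -> i N.+ (p N.+ q) ≡ p N.+ (i N.+ q)
  raise = solveℕ 3 (\ i p q -> i :⊹ (p :⊹ q) :≡ p :⊹ (i :⊹ q)) refl

 graded-⊞ : ∀ {b μ ν η u v} -> Graded b μ ν η u -> Graded b μ ν η v -> Graded b μ ν η (u ⊞ v)
 at (graded-⊞ p q) h l = rational-⊕ (at p h l) (at q h l)

 graded-⊟ : ∀ {b μ ν η u} -> Graded b μ ν η u -> Graded b μ ν η (⊟ u)
 at (graded-⊟ p) h l = rational-⊝ (at p h l)

 rational-sumS : ∀ {m n e} k f -> (∀ j -> j N.≤ k -> Rational m n e (f j)) -> Rational m n e (sumS k f)
 rational-sumS zero f r = r 0 z≤n
 rational-sumS (suc k) f r = rational-⊕ (rational-sumS k f (\ j l -> r j (NP.m≤n⇒m≤1+n l))) (r (suc k) NP.≤-refl)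

 graded-⊛ : ∀ {b μ ν η u μ' ν' η' u'} -> Graded b μ ν η u -> Graded b μ' ν' η' u' -> Graded b (μ N.+ μ') (ν N.+ ν') (η N.+ η') (u ⊛ u')
 at (graded-⊛ {b} {μ} {ν} {η} {u} {μ'} {ν'} {η'} {u'} p q) h l = rational-sumS h _ (\ i i≤h -> rational-≡ (sums 4 i i≤h μ μ') (sums 5 i i≤h ν ν') (sums 9 i i≤h η η')
  (rational-· {f = u i} {f' = u' (h ∸ i)} (at p i (NP.≤-trans i≤h l)) (at q (h ∸ i) (NP.≤-trans (NP.m∸n≤m h i) l))))
  where
  sums : ∀ c i -> i N.≤ h -> ∀ p q -> c N.* i N.+ p N.+ (c N.* (h ∸ i) N.+ q) ≡ c N.* h N.+ (p N.+ q)
  sums c i i≤h p q = by (interchange c i (h ∸ i) p q) (cong (\ k -> c N.* k N.+ (p N.+ q)) (NP.m+[n∸m]≡n i≤h))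

 graded-cong : ∀ {b μ ν η u v} -> u ≋ v -> Graded b μ ν η u -> Graded b μ ν η v
 at (graded-cong q p) h l = rational-cong (q h) (at p h l)

 graded-up : ∀ {b μ ν η u} i j l -> Graded b μ ν η u -> Graded b (i N.+ μ) (j N.+ ν) (i N.+ j N.+ l N.+ η) u
 at (graded-up {μ = μ} {ν} {η} i j l p) h h≤b = rational-≡ (raise i (4 N.* h) μ) (raise j (5 N.* h) ν) (raise (i N.+ j N.+ l) (9 N.* h) η) (rational-up i j l (at p h h≤b))

 graded-fam : ∀ {b m n e f} -> Rational m n e f -> Graded b m n e (fam f)
 at (graded-fam r) zero l = r
 at (graded-fam r) (suc h) l = rational-𝟘 rfl

 -- A factor ε moves the index down by one, which is worth 4, 5 and 9 in the three bounds. The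
 -- slopes belong to the orders 4g - 3, 5g - 3 and 9g - 7.
 graded-ε : ∀ {b μ ν η u} -> Graded b (4 N.+ μ) (5 N.+ ν) (9 N.+ η) u -> Graded b μ ν η (ε ⊛ u)
 at (graded-ε {u = u} p) zero l = rational-𝟘 (ε-⊛-zero u)
 at (graded-ε {μ = μ} {ν} {η} {u} p) (suc h) l = rational-cong (≈-sym (ε-⊛-suc u h)) (rational-≡ (step 4 h μ) (step 5 h ν) (step 9 h η) (at p h (NP.≤-trans (NP.n≤1+n h) l)))

 graded-d1 : ∀ {b μ ν η u} -> Graded b (suc μ) ν η u -> Graded b μ ν η (fam d1 ⊛ u)
 at (graded-d1 {μ = μ} {u = u} p) h l = rational-cong (≈-sym (fam-⊛ d1 u h)) (rational-d1 (rational-≡ (NP.+-suc (4 N.* h) μ) refl refl (at p h l)))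

 graded-z : ∀ {b μ ν η u} -> Graded b μ (suc ν) η u -> Graded b μ ν η (fam z ⊛ u)
 at (graded-z {ν = ν} {u = u} p) h l = rational-cong (≈-sym (fam-⊛ z u h)) (rational-z (rational-≡ refl (NP.+-suc (5 N.* h) ν) refl (at p h l)))

 graded-w4 : ∀ {b μ ν η u} -> Graded b μ ν η u -> Graded b μ (suc ν) η (fam w4 ⊛ u)
 at (graded-w4 {ν = ν} {u = u} p) h l = rational-cong (≈-sym (fam-⊛ w4 u h)) (rational-≡ refl (sym (NP.+-suc (5 N.* h) ν)) refl (rational-w4 (at p h l)))

-- Solving the potential for C_g

module GenusTail (J : NumberField) where

 open Series J
 private module J = FieldProperties J
 open J using (F; nat; int; int-0; int-1; nat-suc; nat-suc≢0; cancel-≢0)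
 open GenusSeries J hiding (A)
 open Substitution J
 open RationalForm J
 open GenusRecursion J
 open DifferentialProperties substDifferential using () renaming (θ-+ to Θ-+; θ-* to Θ-*; θ-ι to Θ-ι; θ-cong to Θ-cong)
 private module R = ℤ-AlgebraProperties serAlg
 open Families serAlg
  renaming (sumTo to sumS; sumTo-cong to sumS-cong; sumTo-+ to sumS-+; sumTo-*ˡ to sumS-*ˡ; sumTo-0 to sumS-0; sumTo-suc to sumS-suc)
 open DifferentialFamilies substDifferential using (familyDifferential)
 private module F = DifferentialProperties familyDifferential
 open Potential familyDifferential
 open PoleOrders J

 pattern ♯ n = F.Solver.con (Z.+ n)

 -- The number 1/16. It is minus the value at t = ∞ of C₁ = t³/((1-t)(1-4t)²), so C₁ + q vanishes
 -- there.
 q : F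
 q = proj₁ (J.inverse (nat 16) (nat-suc≢0 15))

 q16 : nat 16 J.* q ≡ J.1#
 q16 = proj₂ (J.inverse (nat 16) (nat-suc≢0 15))

 x v w Q Y d : Fam
 x = fam X
 v = fam w2
 w = fam w4
 Q = fam (const q)
 Y = F.κ 1 F.- F.κ 2 ⊛ x
 d = F.κ 1 F.- x

 fam-linear : ∀ i j -> fam (R.ι i R.- R.ι j · X) ≋ F.ι i F.- F.ι j ⊛ x
 fam-linear i j = F.tra (fam-+ (R.ι i) (⊝ (R.ι j · X))) (F.+-cong (F.rfl {F.ι i}) (F.tra (fam-neg (R.ι j · X)) (F.-‿cong (fam-* (R.ι j) X))))

 d-linear : fam d1 ≋ d
 d-linear = F.tra (fam-+ (R.κ 1) (⊝ X)) (F.+-cong (F.rfl {F.ι (Z.+ 1)}) (fam-neg X))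

 fam-one : fam 𝟙 ≋ F.κ 1
 fam-one = fam-cong (R.≈-sym R.ι-1)

 Y⊛v : Y ⊛ v ≋ F.κ 1
 Y⊛v = F.tra (F.*-cong (F.≈-sym (fam-linear (Z.+ 1) (Z.+ 2))) (F.rfl {v})) (F.tra (F.≈-sym (fam-* y w2)) (F.tra (fam-cong y·w2) fam-one))

 z⊛w : (F.κ 1 F.- F.κ 4 ⊛ x) ⊛ w ≋ F.κ 1
 z⊛w = F.tra (F.*-cong (F.≈-sym (fam-linear (Z.+ 1) (Z.+ 4))) (F.rfl {w})) (F.tra (F.≈-sym (fam-* z w4)) (F.tra (fam-cong z·w4) fam-one))

 16⊛Q : F.κ 16 ⊛ Q ≋ F.κ 1
 16⊛Q = F.tra (F.≈-sym (fam-* (R.κ 16) (const q))) (F.tra (fam-cong (\ { zero -> q16 ; (suc k) -> by (·-const (nat 16) (const q) (suc k)) (J.zeroʳ _) })) fam-one)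

 moduloF : ∀ {r} -> r ≋ F.κ 1 -> ∀ {p p'} s -> p ≋ p' ⊞ s ⊛ (r F.- F.κ 1) -> p ≋ p'
 moduloF {r} e {p} {p'} s t = F.tra t (F.tra (F.+-cong (F.rfl {p'}) (F.tra (F.*-cong (F.rfl {s}) (F.≈⇒-≈0 e)) (F.zeroʳ s))) (F.+-idʳ p'))

 Θ-a0 : a0 ⊕ Θ a0 ≈ R.κ 2 · X · d1 · (w2 · w2) · w4
 Θ-a0 = R.tra (R.+-cong (R.rfl {a0}) (R.*-cong (R.rfl {y · w4}) (R.tra (ϑ-· X (w2 · w2)) (R.+-cong (R.*-cong ϑ-X (R.rfl {w2 · w2}))
  (R.*-cong (R.rfl {X}) (R.tra (ϑ-· w2 w2) (R.+-cong (R.*-cong ϑ-w2 (R.rfl {w2})) (R.*-cong (R.rfl {w2}) ϑ-w2))))))))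
  (modulo-z (⊝ (X · (w2 · w2))) (modulo-y (R.κ 4 · (X · X) · (w2 · w2) · w4) (R.Solver.solve 3 (\ x w v -> let open R.Solver ; y = # 1 :- # 2 :* x ; z = # 1 :- # 4 :* x ; d = # 1 :- x ; a = x :* (w :* w) in
    a :+ y :* v :* (x :* (w :* w) :+ x :* (# 2 :* x :* (w :* w) :* w :+ w :* (# 2 :* x :* (w :* w))))
   := # 2 :* x :* d :* (w :* w) :* v :+ (:- a) :* (z :* v :- # 1) :+ (# 4 :* (x :* x) :* (w :* w) :* v) :* (y :* w :- # 1)) R.rfl X w2 w4)))

 -- Index h stands for genus h + 1, and the constant 1/16 enters ĉ at h = 0 only. At t = ∞ both ĉ
 -- and A = Θ ĉ are O(1/t), while b̂ = (Θ + 1/2) A is O(1/t²).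
 A ĉ ΘA b̂ : Fam
 A = tailᶠ a
 ĉ = tailᶠ C ⊞ Q
 ΘA = F.θ A
 b̂ = ΘA ⊞ F.κ 8 ⊛ Q ⊛ A

 private
  -- The quantities α, w and p of the potential with their powers of 1/(1-2t) split off: the
  -- exponents are 1, 2 and 1.
  αᵣ ωᵣ πᵣ : Fam
  αᵣ = x ⊛ x ⊞ x ⊛ (Y ⊛ Y) ⊛ (ε ⊛ A)
  ωᵣ = x ⊛ (F.κ 2 F.- F.κ 3 ⊛ x) ⊞ Y ⊛ Y ⊛ (ε ⊛ (A ⊞ (ĉ F.- Q)))
  πᵣ = F.κ 2 ⊛ (x ⊛ x) ⊛ d ⊛ w ⊞ x ⊛ (Y ⊛ Y) ⊛ (ε ⊛ (A ⊞ ΘA))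

  famS-eq : famS ≋ x ⊛ Y
  famS-eq = F.tra (fam-* X y) (F.*-cong (F.rfl {x}) (fam-linear (Z.+ 1) (Z.+ 2)))

  a-eq : a ≋ x ⊛ (v ⊛ v) ⊞ ε ⊛ A
  a-eq = F.tra (head-tail a) (F.+-cong (F.tra (fam-cong Θ-C-0) (F.tra (fam-* X (w2 · w2)) (F.*-cong (F.rfl {x}) (fam-* w2 w2)))) (F.rfl {ε ⊛ A}))

  C-eq : C ≋ x ⊛ (F.κ 1 F.- F.κ 3 ⊛ x) ⊛ (v ⊛ v) ⊞ ε ⊛ (ĉ F.- Q)
  C-eq = F.tra (head-tail C) (F.+-cong (F.tra (fam-cong C-0) (F.tra (fam-* (X · (R.κ 1 R.- R.κ 3 · X)) (w2 · w2))
   (F.*-cong (F.tra (fam-* X (R.κ 1 R.- R.κ 3 · X)) (F.*-cong (F.rfl {x}) (fam-linear (Z.+ 1) (Z.+ 3)))) (fam-* w2 w2))))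
   (F.*-cong (F.rfl {ε}) (F.Solver.solve 2 (\ t q -> let open F.Solver in t := t :+ q :- q) F.rfl (tailᶠ C) Q)))

  aΘ-eq : a ⊞ F.θ a ≋ F.κ 2 ⊛ x ⊛ d ⊛ (v ⊛ v) ⊛ w ⊞ ε ⊛ (A ⊞ ΘA)
  aΘ-eq = F.tra (head-tail (a ⊞ F.θ a)) (F.+-cong (F.tra (fam-cong (R.tra (R.+-cong Θ-C-0 (Θ-cong Θ-C-0)) Θ-a0))
   (F.tra (fam-* (R.κ 2 · X · d1 · (w2 · w2)) w4) (F.*-cong (F.tra (fam-* (R.κ 2 · X · d1) (w2 · w2)) (F.*-cong (F.tra (fam-* (R.κ 2 · X) d1)
   (F.*-cong (fam-* (R.κ 2) X) d-linear)) (fam-* w2 w2))) (F.rfl {w}))))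
   (F.rfl {ε ⊛ (A ⊞ ΘA)}))

  α-eq : famS ⊛ a ≋ v ⊛ αᵣ
  α-eq = F.tra (F.*-cong famS-eq a-eq) (moduloF Y⊛v (x ⊛ x ⊛ v F.- x ⊛ Y ⊛ (ε ⊛ A)) (F.Solver.solve 3 (\ x v e -> let open F.Solver ; y = ♯ 1 :- ♯ 2 :* x in
    x :* y :* (x :* (v :* v) :+ e) := v :* (x :* x :+ x :* (y :* y) :* e) :+ (x :* x :* v :- x :* y :* e) :* (y :* v :- ♯ 1)) F.rfl x v (ε ⊛ A)))

  ω-eq : a ⊞ C ≋ v ⊛ v ⊛ ωᵣ
  ω-eq = F.tra (F.+-cong a-eq C-eq) (moduloF Y⊛v (F.- ((Y ⊛ v ⊞ F.κ 1) ⊛ (ε ⊛ (A ⊞ (ĉ F.- Q))))) (F.Solver.solve 5 (\ x v e A c -> let open F.Solver ; y = ♯ 1 :- ♯ 2 :* x in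
    (x :* (v :* v) :+ e :* A) :+ (x :* (♯ 1 :- ♯ 3 :* x) :* (v :* v) :+ e :* c)
   := v :* v :* (x :* (♯ 2 :- ♯ 3 :* x) :+ y :* y :* (e :* (A :+ c))) :+ (:- ((y :* v :+ ♯ 1) :* (e :* (A :+ c)))) :* (y :* v :- ♯ 1)) F.rfl x v ε A (ĉ F.- Q)))

  π-eq : famS ⊛ (a ⊞ F.θ a) ≋ v ⊛ πᵣ
  π-eq = F.tra (F.*-cong famS-eq aΘ-eq) (moduloF Y⊛v (F.κ 2 ⊛ (x ⊛ x) ⊛ d ⊛ w ⊛ v F.- x ⊛ Y ⊛ (ε ⊛ (A ⊞ ΘA))) (F.Solver.solve 5 (\ x v d w e -> let open F.Solver ; y = ♯ 1 :- ♯ 2 :* x in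
    x :* y :* (♯ 2 :* x :* d :* (v :* v) :* w :+ e) := v :* (♯ 2 :* (x :* x) :* d :* w :+ x :* (y :* y) :* e) :+ (♯ 2 :* (x :* x) :* d :* w :* v :- x :* y :* e) :* (y :* v :- ♯ 1)) F.rfl x v d w (ε ⊛ (A ⊞ ΘA))))

  homogeneous : Fam
  homogeneous = Y ⊛ Y ⊛ (ε ⊛ (πᵣ ⊛ πᵣ)) ⊞ F.κ 4 ⊛ (αᵣ ⊛ αᵣ ⊛ ωᵣ) ⊞ F.κ 3 ⊛ (Y ⊛ Y) ⊛ (αᵣ ⊛ αᵣ) ⊞ F.κ 4 ⊛ (Y ⊛ Y ⊛ Y) ⊛ αᵣ
   ⊞ F.κ 6 ⊛ Y ⊛ (αᵣ ⊛ ωᵣ) F.- ωᵣ ⊛ ωᵣ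

  -- Multiplication by (1-2t)⁴ clears the powers of 1/(1-2t).
  homogeneous-0 : homogeneous ≋ zeroᶠ
  homogeneous-0 = F.≈-sym (F.tra (F.≈-sym (F.tra (F.*-cong (F.rfl {Y ⊛ Y ⊛ (Y ⊛ Y)}) substituted) (F.zeroʳ (Y ⊛ Y ⊛ (Y ⊛ Y)))))
   (moduloF Y⊛v cofactor (F.Solver.solve 6 (\ x v e α ω π -> let open F.Solver ; y = ♯ 1 :- ♯ 2 :* x ; o = y :* v in
     y :* y :* (y :* y) :* (e :* ((v :* π) :* (v :* π)) :+ ♯ 4 :* ((v :* α) :* (v :* α) :* (v :* v :* ω)) :+ ♯ 3 :* ((v :* α) :* (v :* α)) :+ ♯ 4 :* (v :* α)
      :+ ♯ 6 :* ((v :* α) :* (v :* v :* ω)) :- (v :* v :* ω) :* (v :* v :* ω))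
    := (y :* y :* (e :* (π :* π)) :+ ♯ 4 :* (α :* α :* ω) :+ ♯ 3 :* (y :* y) :* (α :* α) :+ ♯ 4 :* (y :* y :* y) :* α :+ ♯ 6 :* y :* (α :* ω) :- ω :* ω)
     :+ (♯ 4 :* α :* (y :* y :* y) :+ (e :* (π :* π) :+ ♯ 3 :* (α :* α)) :* (y :* y) :* (o :+ ♯ 1) :+ ♯ 6 :* (α :* ω) :* y :* (o :* o :+ o :+ ♯ 1)
     :+ (♯ 4 :* (α :* α :* ω) :- ω :* ω) :* (o :* o :* o :+ o :* o :+ o :+ ♯ 1)) :* (y :* v :- ♯ 1))
    F.rfl x v ε αᵣ ωᵣ πᵣ)))
   where
   o = Y ⊛ v
   cofactor = F.κ 4 ⊛ αᵣ ⊛ (Y ⊛ Y ⊛ Y) ⊞ (ε ⊛ (πᵣ ⊛ πᵣ) ⊞ F.κ 3 ⊛ (αᵣ ⊛ αᵣ)) ⊛ (Y ⊛ Y) ⊛ (o ⊞ F.κ 1) ⊞ F.κ 6 ⊛ (αᵣ ⊛ ωᵣ) ⊛ Y ⊛ (o ⊛ o ⊞ o ⊞ F.κ 1)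
    ⊞ (F.κ 4 ⊛ (αᵣ ⊛ αᵣ ⊛ ωᵣ) F.- ωᵣ ⊛ ωᵣ) ⊛ (o ⊛ o ⊛ o ⊞ o ⊛ o ⊞ o ⊞ F.κ 1)
   substituted : ε ⊛ ((v ⊛ πᵣ) ⊛ (v ⊛ πᵣ)) ⊞ F.κ 4 ⊛ ((v ⊛ αᵣ) ⊛ (v ⊛ αᵣ) ⊛ (v ⊛ v ⊛ ωᵣ)) ⊞ F.κ 3 ⊛ ((v ⊛ αᵣ) ⊛ (v ⊛ αᵣ)) ⊞ F.κ 4 ⊛ (v ⊛ αᵣ)
    ⊞ F.κ 6 ⊛ ((v ⊛ αᵣ) ⊛ (v ⊛ v ⊛ ωᵣ)) F.- (v ⊛ v ⊛ ωᵣ) ⊛ (v ⊛ v ⊛ ωᵣ) ≋ zeroᶠ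
   substituted = F.tra (F.≈-sym (F.+-cong (F.+-cong (F.+-cong (F.+-cong (F.+-cong
    (F.*-cong (F.rfl {ε}) (F.*-cong π-eq π-eq))
    (F.*-cong (F.rfl {F.ι (Z.+ 4)}) (F.*-cong (F.*-cong α-eq α-eq) ω-eq)))
    (F.*-cong (F.rfl {F.ι (Z.+ 3)}) (F.*-cong α-eq α-eq)))
    (F.*-cong (F.rfl {F.ι (Z.+ 4)}) α-eq))
    (F.*-cong (F.rfl {F.ι (Z.+ 6)}) (F.*-cong α-eq ω-eq)))
    (F.-‿cong (F.*-cong ω-eq ω-eq)))) potential

  reduced : Fam
  reduced = πᵣ ⊛ πᵣ F.- F.κ 4 ⊛ x ⊛ ((F.κ 1 F.- x) ⊛ (F.κ 1 F.- x) ⊛ (F.κ 1 F.- x)) ⊛ (ĉ F.- Q)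
   ⊞ Y ⊛ Y ⊛ (ε ⊛ (F.κ 4 ⊛ (x ⊛ x) ⊛ (Y ⊛ Y) ⊛ (ε ⊛ (A ⊛ A ⊛ (A ⊞ (ĉ F.- Q))))
   F.- (F.κ 1 F.- x) ⊛ (F.κ 1 F.- x) ⊛ (F.κ 1 F.- F.κ 4 ⊛ x) ⊛ (A ⊛ A)
   F.- F.κ 2 ⊛ (F.κ 1 F.- x) ⊛ (F.κ 1 F.- F.κ 2 ⊛ x ⊞ F.κ 4 ⊛ (x ⊛ x)) ⊛ (A ⊛ (ĉ F.- Q))
   F.- (ĉ F.- Q) ⊛ (ĉ F.- Q)))

  -- The genus 0 part vanishes, and so do the terms linear in A: for ε = 0 the derivative of the
  -- potential in θσ is twice the residual, which is zero on the genus 0 solution. Hence the highest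
  -- genus enters through -4t(1-t)³ (ĉ - Q) alone, without derivatives.
  factored : homogeneous ≋ ε ⊛ (Y ⊛ Y ⊛ reduced)
  factored = F.Solver.solve 5 (\ x e A c π -> let open F.Solver ; y = ♯ 1 :- ♯ 2 :* x ; d = ♯ 1 :- x ; z = ♯ 1 :- ♯ 4 :* x
                                                     ; α = x :* x :+ x :* (y :* y) :* (e :* A) ; ω = x :* (♯ 2 :- ♯ 3 :* x) :+ y :* y :* (e :* (A :+ c)) in
    y :* y :* (e :* (π :* π)) :+ ♯ 4 :* (α :* α :* ω) :+ ♯ 3 :* (y :* y) :* (α :* α) :+ ♯ 4 :* (y :* y :* y) :* α :+ ♯ 6 :* y :* (α :* ω) :- ω :* ω
   := e :* (y :* y :* (π :* π :- ♯ 4 :* x :* (d :* d :* d) :* c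
    :+ y :* y :* (e :* (♯ 4 :* (x :* x) :* (y :* y) :* (e :* (A :* A :* (A :+ c))) :- d :* d :* z :* (A :* A)
    :- ♯ 2 :* d :* (♯ 1 :- ♯ 2 :* x :+ ♯ 4 :* (x :* x)) :* (A :* c) :- c :* c)))))
   F.rfl x ε A (ĉ F.- Q) πᵣ

  reduced-0 : reduced ≋ zeroᶠ
  reduced-0 = F.≈-sym (F.tra (F.≈-sym (F.tra (F.*-cong (F.rfl {v ⊛ v}) tail-0) (F.zeroʳ (v ⊛ v)))) (moduloF Y⊛v (reduced ⊛ (Y ⊛ v ⊞ F.κ 1)) (F.Solver.solve 3 (\ x v m -> let open F.Solver ; y = ♯ 1 :- ♯ 2 :* x in
    v :* v :* (y :* y :* m) := m :+ (m :* (y :* v :+ ♯ 1)) :* (y :* v :- ♯ 1)) F.rfl x v reduced)))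
   where
   tail-0 : Y ⊛ Y ⊛ reduced ≋ zeroᶠ
   tail-0 g = R.tra (R.≈-sym (ε-⊛-suc (Y ⊛ Y ⊛ reduced) g)) (F.tra (F.≈-sym factored) homogeneous-0 (suc g))

  r s t1 t2 t3 t₅ t₆ t₇ t₈ t₉ forcing : Fam
  r = F.κ 1 F.- F.κ 2 ⊛ x ⊞ F.κ 4 ⊛ (x ⊛ x)
  s = F.κ 1 F.- F.κ 6 ⊛ x ⊞ F.κ 12 ⊛ (x ⊛ x)
  t1 = F.κ 4 ⊛ (x ⊛ x ⊛ x) ⊛ (Y ⊛ Y) ⊛ (d ⊛ (w ⊛ b̂))
  t2 = F.κ 2 ⊛ Q ⊛ (Y ⊛ Y) ⊛ d ⊛ s ⊛ (w ⊛ A)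
  t3 = x ⊛ x ⊛ (Y ⊛ Y ⊛ (Y ⊛ Y)) ⊛ (b̂ ⊛ b̂ ⊞ b̂ ⊛ A ⊞ F.κ 4 ⊛ (A ⊛ A ⊛ A ⊞ A ⊛ A ⊛ ĉ))
  t₅ = Y ⊛ Y ⊛ (d ⊛ (d ⊛ ((F.κ 1 F.- F.κ 4 ⊛ x) ⊛ (A ⊛ A))))
  t₆ = F.κ 2 ⊛ (Y ⊛ Y) ⊛ r ⊛ (d ⊛ (A ⊛ ĉ))
  t₇ = Y ⊛ Y ⊛ (ĉ ⊛ ĉ)
  t₈ = F.κ 2 ⊛ Q ⊛ (Y ⊛ Y) ⊛ ĉ
  t₉ = Q ⊛ Q ⊛ (Y ⊛ Y)
  forcing = t1 ⊞ t2 ⊞ ε ⊛ t3 ⊞ ⊟ t₅ ⊞ ⊟ t₆ ⊞ ⊟ t₇ ⊞ t₈ ⊞ ⊟ t₉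

  -- Writing C₁ = ĉ₀ - 1/16 makes the leading terms at infinity cancel: (Θ + 1)² - 1/4 = (Θ + 1/2) (Θ + 3/2).
  genus-tail : F.κ 4 ⊛ x ⊛ (d ⊛ d ⊛ d) ⊛ ĉ ≋ (F.κ 4 ⊛ (x ⊛ x ⊛ (x ⊛ x)) ⊛ (d ⊛ d) ⊛ (w ⊛ w) ⊞ F.κ 4 ⊛ x ⊛ (d ⊛ d ⊛ d) ⊛ Q) ⊞ ε ⊛ forcing
  genus-tail = F.tra (F.≈-sym (F.tra (F.+-cong (F.rfl {F.ι (Z.+ 4) ⊛ x ⊛ (d ⊛ d ⊛ d) ⊛ ĉ}) reduced-0) (F.+-idʳ (F.κ 4 ⊛ x ⊛ (d ⊛ d ⊛ d) ⊛ ĉ))))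
   (moduloF z⊛w (F.- (F.κ 2 ⊛ Q ⊛ (Y ⊛ Y) ⊛ d ⊛ r ⊛ (ε ⊛ A)))
   (moduloF 16⊛Q (F.- (F.κ 4 ⊛ (x ⊛ x ⊛ x) ⊛ d ⊛ (Y ⊛ Y) ⊛ w ⊛ (ε ⊛ A) ⊞ x ⊛ x ⊛ (Y ⊛ Y ⊛ (Y ⊛ Y)) ⊛ (ε ⊛ ε) ⊛ (b̂ ⊛ A ⊞ A ⊛ A ⊛ (F.κ 1 F.- F.κ 4 ⊛ Q))))
   (F.Solver.solve 7 (\ x w e A c t q -> let open F.Solver ; y = ♯ 1 :- ♯ 2 :* x ; d = ♯ 1 :- x ; z = ♯ 1 :- ♯ 4 :* x ; b = t :+ ♯ 8 :* q :* A
                                                ; r = ♯ 1 :- ♯ 2 :* x :+ ♯ 4 :* (x :* x) ; s = ♯ 1 :- ♯ 6 :* x :+ ♯ 12 :* (x :* x)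
                                                ; π = ♯ 2 :* (x :* x) :* d :* w :+ x :* (y :* y) :* (e :* (A :+ t)) in
     ♯ 4 :* x :* (d :* d :* d) :* c
      :+ (π :* π :- ♯ 4 :* x :* (d :* d :* d) :* (c :- q)
      :+ y :* y :* (e :* (♯ 4 :* (x :* x) :* (y :* y) :* (e :* (A :* A :* (A :+ (c :- q)))) :- d :* d :* z :* (A :* A) :- ♯ 2 :* d :* r :* (A :* (c :- q)) :- (c :- q) :* (c :- q))))
    := ((♯ 4 :* (x :* x :* (x :* x)) :* (d :* d) :* (w :* w) :+ ♯ 4 :* x :* (d :* d :* d) :* q)
     :+ e :* (♯ 4 :* (x :* x :* x) :* (y :* y) :* (d :* (w :* b)) :+ ♯ 2 :* q :* (y :* y) :* d :* s :* (w :* A)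
     :+ e :* (x :* x :* (y :* y :* (y :* y)) :* (b :* b :+ b :* A :+ ♯ 4 :* (A :* A :* A :+ A :* A :* c)))
     :+ :- (y :* y :* (d :* (d :* (z :* (A :* A))))) :+ :- (♯ 2 :* (y :* y) :* r :* (d :* (A :* c))) :+ :- (y :* y :* (c :* c)) :+ ♯ 2 :* q :* (y :* y) :* c :+ :- (q :* q :* (y :* y))))
     :+ (:- (♯ 2 :* q :* (y :* y) :* d :* r :* (e :* A))) :* (z :* w :- ♯ 1)
     :+ (:- (♯ 4 :* (x :* x :* x) :* d :* (y :* y) :* w :* (e :* A) :+ x :* x :* (y :* y :* (y :* y)) :* (e :* e) :* (b :* A :+ A :* A :* (♯ 1 :- ♯ 4 :* q)))) :* (♯ 16 :* q :- ♯ 1))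
    F.rfl x w ε A ĉ ΘA Q)))

  P K : Ser
  P = R.κ 4 · X · (d1 · d1 · d1)
  K = R.κ 4 · (X · X · (X · X)) · (d1 · d1) · (w4 · w4) ⊕ P · const q

  P-fam : F.κ 4 ⊛ x ⊛ (d ⊛ d ⊛ d) ≋ fam P
  P-fam = F.≈-sym (F.tra (fam-* (R.κ 4 · X) (d1 · d1 · d1)) (F.*-cong (fam-* (R.κ 4) X)
   (F.tra (fam-* (d1 · d1) d1) (F.*-cong (F.tra (fam-* d1 d1) (F.*-cong d-linear d-linear)) d-linear))))

  K-fam : F.κ 4 ⊛ (x ⊛ x ⊛ (x ⊛ x)) ⊛ (d ⊛ d) ⊛ (w ⊛ w) ⊞ F.κ 4 ⊛ x ⊛ (d ⊛ d ⊛ d) ⊛ Q ≋ fam K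
  K-fam = F.≈-sym (F.tra (fam-+ (R.κ 4 · (X · X · (X · X)) · (d1 · d1) · (w4 · w4)) (P · const q)) (F.+-cong
   (F.tra (fam-* (R.κ 4 · (X · X · (X · X)) · (d1 · d1)) (w4 · w4)) (F.*-cong (F.tra (fam-* (R.κ 4 · (X · X · (X · X))) (d1 · d1))
   (F.*-cong (F.tra (fam-* (R.κ 4) (X · X · (X · X))) (F.*-cong (F.rfl {F.ι (Z.+ 4)}) (F.tra (fam-* (X · X) (X · X)) (F.*-cong (fam-* X X) (fam-* X X)))))
   (F.tra (fam-* d1 d1) (F.*-cong d-linear d-linear)))) (fam-* w4 w4)))
   (F.tra (fam-* P (const q)) (F.*-cong (F.≈-sym P-fam) (F.rfl {Q})))))

  genus-tail-at : ∀ g -> P · ĉ g ≈ fam K g ⊕ (ε ⊛ forcing) g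
  genus-tail-at g = R.tra (R.≈-sym (fam-⊛ P ĉ g)) (F.tra (F.*-cong (F.≈-sym P-fam) (F.rfl {ĉ})) (F.tra genus-tail (F.+-cong K-fam (F.rfl {ε ⊛ forcing}))) g)

 X-cancel : ∀ {f h} -> X · f ≈ X · h -> f ≈ h
 X-cancel {f} {h} e k = by (sym (X·-suc f k)) (by (e (suc k)) (X·-suc h k))

 w1 : Ser
 w1 = geometric (Z.+ 1)

 d1·w1 : d1 · w1 ≈ R.κ 1
 d1·w1 = R.tra (R.Solver.solve 2 (\ x w -> let open R.Solver in (# 1 :- x) :* w := (# 1 :- # 1 :* x) :* w) R.rfl X w1) (R.tra (geometric-inverse (Z.+ 1)) (R.≈-sym R.ι-1))

 -- The solved potential at index 0, where ε forces the remaining terms to be absent; the multiples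
 -- of 1/16 on both sides cancel.
 genus-one : d1 · (z · z) · C 1 ≈ X · X · X
 genus-one = R.x-y≈0⇒x≈y (R.tra (R.≈-sym unscaled) (R.tra (R.*-cong (R.rfl {w1 · w1 · (z · z)}) cancelled) (R.zeroʳ (w1 · w1 · (z · z)))))
  where
  m = d1 · d1 · (d1 · C 1 R.- X · X · X · (w4 · w4))
  cancelled : m ≈ 𝟘
  cancelled k = cancel-≢0 (nat 4) (nat-suc≢0 3) (by (sym (·-const (nat 4) m k)) (by (X-cancel {R.ι (Z.+ 4) · m} {𝟘} (R.tra
   (R.tra (R.Solver.solve 5 (\ x d w c q -> let open R.Solver in
     x :* (# 4 :* (d :* d :* (d :* c :- x :* x :* x :* (w :* w)))) := # 4 :* x :* (d :* d :* d) :* (c :+ q) :- (# 4 :* (x :* x :* (x :* x)) :* (d :* d) :* (w :* w) :+ # 4 :* x :* (d :* d :* d) :* q))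
     R.rfl X d1 w4 (C 1) (const q))
    (R.≈⇒-≈0 (R.tra (genus-tail-at 0) (R.tra (R.+-cong (R.rfl {K}) (ε-⊛-zero forcing)) (R.+-idʳ K)))))
   (R.≈-sym (R.zeroʳ X))) k) (sym (J.zeroʳ _))))
  unscaled : w1 · w1 · (z · z) · m ≈ d1 · (z · z) · C 1 R.- X · X · X
  unscaled = modulo-z (⊝ (X · X · X · (z · w4 ⊕ R.κ 1))) (R.tra (R.Solver.solve 5 (\ x d w z c -> let open R.Solver in
    w :* w :* (z :* z) :* (d :* d :* c) := (z :* z :* c) :+ (z :* z :* c :* (d :* w :+ # 1)) :* (d :* w :- # 1)) R.rfl X d1 w1 z (d1 · C 1 R.- X · X · X · (w4 · w4)))
   (R.tra (R.+-cong (R.rfl {z · z · (d1 · C 1 R.- X · X · X · (w4 · w4))}) (R.tra (R.*-cong (R.rfl {z · z · (d1 · C 1 R.- X · X · X · (w4 · w4)) · (d1 · w1 ⊕ R.κ 1)}) (R.≈⇒-≈0 d1·w1)) (R.zeroʳ _)))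
   (R.tra (R.+-idʳ _) (R.Solver.solve 5 (\ x d v z c -> let open R.Solver in
    z :* z :* (d :* c :- x :* x :* x :* (v :* v)) := (d :* (z :* z) :* c :- x :* x :* x) :+ (:- (x :* x :* x :* (z :* v :+ # 1))) :* (z :* v :- # 1)) R.rfl X d1 w4 z (C 1)))))

 private
  open Data.Nat.Solver.+-*-Solver using () renaming (solve to solveℕ; _:=_ to _:≡_; _:*_ to _:×_; _:+_ to _:⊹_; con to conℕ)

  16Q : R.κ 16 · const q ≈ R.κ 1
  16Q = 16⊛Q 0

  -- The cubic terms cancel in 16t³ + (1-t)(1-4t)² = 1 - 9t + 24t², so the numerator of C₁ + 1/16
  -- has degree 2 instead of 3.
  ĉ-0 : Rational 1 2 2 (ĉ 0)
  numerator ĉ-0 = poly-cong (R.≈-sym (R.tra rearranged (R.tra (R.+-cong genus-one (R.rfl {d1 · (z · z) · const q})) shape)))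
   (poly-· {0} {2} {const q} (poly-const q) quadratic)
   where
   rearranged : (d1 · 𝟙) · (z · (z · 𝟙) · ĉ 0) ≈ d1 · (z · z) · C 1 ⊕ d1 · (z · z) · const q
   rearranged = R.tra (R.*-cong (R.*-idʳ d1) (R.*-cong (R.*-cong (R.rfl {z}) (R.*-idʳ z)) (R.rfl {ĉ 0})))
    (R.Solver.solve 4 (\ d z c q -> let open R.Solver in d :* (z :* z :* (c :+ q)) := d :* (z :* z) :* c :+ d :* (z :* z) :* q) R.rfl d1 z (C 1) (const q))
   quadratic : IsPoly 2 (R.κ 1 R.- R.κ 9 · X ⊕ R.κ 24 · (X · X))
   quadratic = poly-⊕ {2} {R.ι (Z.+ 1) R.- R.κ 9 · X} (poly-≤ {1} {2} {R.ι (Z.+ 1) R.- R.κ 9 · X} (s≤s z≤n) (poly-linear (Z.+ 1) (Z.+ 9)))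
    (poly-· {0} {2} {R.ι (Z.+ 24)} (poly-const _) (poly-· {1} {1} {X} poly-X poly-X))
   shape : X · X · X ⊕ d1 · (z · z) · const q ≈ const q · (R.κ 1 R.- R.κ 9 · X ⊕ R.κ 24 · (X · X))
   shape = R.tra (R.Solver.solve 2 (\ x q -> let open R.Solver ; z = # 1 :- # 4 :* x in
      x :* x :* x :+ (# 1 :- x) :* (z :* z) :* q := q :* (# 1 :- # 9 :* x :+ # 24 :* (x :* x)) :+ (:- (x :* x :* x)) :* (# 16 :* q :- # 1)) R.rfl X (const q))
    (R.tra (R.+-cong (R.rfl {const q · (R.κ 1 R.- R.κ 9 · X ⊕ R.κ 24 · (X · X))}) (R.tra (R.*-cong (R.rfl {⊝ (X · X · X)}) (R.≈⇒-≈0 16Q)) (R.zeroʳ (⊝ (X · X · X))))) (R.+-idʳ _))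

  Θ-ĉ : ∀ g -> Θ (ĉ g) ≈ A g
  Θ-ĉ g = R.tra (Θ-+ (C (suc g)) (Q g)) (R.tra (R.+-cong (R.rfl {A g}) (vanish g)) (R.+-idʳ (A g)))
   where
   vanish : ∀ g -> Θ (Q g) ≈ 𝟘
   vanish zero = R.tra (R.*-cong (R.rfl {y · w4}) (ϑ-const q)) (R.zeroʳ (y · w4))
   vanish (suc g) = R.tra (Θ-cong (R.≈-sym R.ι-0)) (Θ-ι (Z.+ 0))

  module _ {b : ℕ} (gc : Graded b 1 2 2 ĉ) where

   gA : Graded b 2 4 5 A
   at gA h l = rational-cong (Θ-ĉ h) (rational-≡ (solveℕ 1 (\ h -> conℕ 1 :⊹ (conℕ 4 :× h :⊹ conℕ 1) :≡ conℕ 4 :× h :⊹ conℕ 2) refl h)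
    (solveℕ 1 (\ h -> conℕ 2 :⊹ (conℕ 5 :× h :⊹ conℕ 2) :≡ conℕ 5 :× h :⊹ conℕ 4) refl h) (solveℕ 1 (\ h -> conℕ 3 :⊹ (conℕ 9 :× h :⊹ conℕ 2) :≡ conℕ 9 :× h :⊹ conℕ 5) refl h)
    (Θ-rational (4 N.* h N.+ 1) (5 N.* h N.+ 2) (ĉ h) (at gc h l)))

   gb : Graded b 3 6 7 b̂
   at gb h l = rational-cong (R.+-cong (R.rfl {ΘA h}) (R.≈-sym (R.tra (F.*-assoc (F.κ 8) Q A h) (R.tra (fam-⊛ (R.κ 8) (Q ⊛ A) h) (R.tra (R.*-cong (R.rfl {R.ι (Z.+ 8)}) (fam-⊛ (const q) A h)) (R.≈-sym (R.*-assoc (R.κ 8) (const q) (A h))))))))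
    (rational-≡ (solveℕ 1 (\ h -> conℕ 1 :⊹ (conℕ 4 :× h :⊹ conℕ 2) :≡ conℕ 4 :× h :⊹ conℕ 3) refl h)
    (solveℕ 1 (\ h -> conℕ 2 :⊹ (conℕ 5 :× h :⊹ conℕ 4) :≡ conℕ 5 :× h :⊹ conℕ 6) refl h) (solveℕ 1 (\ h -> conℕ 2 :⊹ (conℕ 9 :× h :⊹ conℕ 5) :≡ conℕ 9 :× h :⊹ conℕ 7) refl h)
    (Θ½-rational (4 N.* h N.+ 2) (5 N.* h N.+ 4) (A h) q16
    (solveℕ 1 (\ h -> conℕ 1 :⊹ (conℕ 9 :× h :⊹ conℕ 5) :≡ (conℕ 4 :× h :⊹ conℕ 2) :⊹ (conℕ 5 :× h :⊹ conℕ 4)) refl h) (at gA h l)))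

   gι : ∀ i -> Graded b 0 0 0 (F.ι i)
   gι i = graded-fam (rational-poly (poly-const (int i)))

   gQ : Graded b 0 0 0 Q
   gQ = graded-fam (rational-poly (poly-const q))

   gx : Graded b 0 0 1 x
   gx = graded-fam (rational-poly poly-X)

   glin : ∀ i j -> Graded b 0 0 1 (F.ι i F.- F.ι j ⊛ x)
   glin i j = graded-⊞ (graded-up 0 0 1 (gι i)) (graded-⊟ (graded-⊛ (gι j) gx))

   gYY : Graded b 0 0 2 (Y ⊛ Y)
   gYY = graded-⊛ (glin _ _) (glin _ _)

   gd : Graded b 0 0 1 d
   gd = graded-⊞ (graded-up 0 0 1 (gι (Z.+ 1))) (graded-⊟ gx)

   gquad : ∀ i j k -> Graded b 0 0 2 (F.ι i F.- F.ι j ⊛ x ⊞ F.ι k ⊛ (x ⊛ x))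
   gquad i j k = graded-⊞ (graded-up 0 0 1 (glin i j)) (graded-⊛ (gι k) (graded-⊛ gx gx))

   graded-d : ∀ {μ ν η u} -> Graded b (suc μ) ν η u -> Graded b μ ν η (d ⊛ u)
   graded-d {u = u} p = graded-cong (F.*-cong d-linear (F.rfl {u})) (graded-d1 p)

   -- The bounds 2, 7 and 12 are dictated by `t1`, by the cube of A in `t3` and by `t₅`; the other
   -- terms are raised to them. With Θ A in place of b̂ the bound for `t1` would be 13 in degree.
   gforcing : Graded b 2 7 12 forcing
   gforcing = graded-⊞ (graded-⊞ (graded-⊞ (graded-⊞ (graded-⊞ (graded-⊞ (graded-⊞ g1 g2) g3) (graded-⊟ g₅)) (graded-⊟ g₆)) (graded-⊟ g₇)) g₈) (graded-⊟ g₉)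
    where
    g1 : Graded b 2 7 12 t1
    g1 = graded-⊛ (graded-⊛ (graded-⊛ (gι _) (graded-⊛ (graded-⊛ gx gx) gx)) gYY) (graded-d (graded-w4 gb))
    g2 : Graded b 2 7 12 t2
    g2 = graded-up 0 2 0 (graded-⊛ (graded-⊛ (graded-⊛ (graded-⊛ (graded-⊛ (gι _) gQ) gYY) gd) (gquad _ _ _)) (graded-w4 gA))
    g3 : Graded b 2 7 12 (ε ⊛ t3)
    g3 = graded-ε (graded-⊛ (graded-⊛ (graded-⊛ gx gx) (graded-⊛ gYY gYY)) (graded-⊞ (graded-⊞ (graded-up 0 0 1 (graded-⊛ gb gb)) (graded-up 1 2 0 (graded-⊛ gb gA)))
     (graded-⊛ (gι _) (graded-⊞ (graded-⊛ (graded-⊛ gA gA) gA) (graded-up 1 2 0 (graded-⊛ (graded-⊛ gA gA) gc))))))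
    g₅ : Graded b 2 7 12 t₅
    g₅ = graded-⊛ gYY (graded-d (graded-d (graded-cong (F.*-cong (fam-linear (Z.+ 1) (Z.+ 4)) (F.rfl {A ⊛ A})) (graded-z (graded-⊛ gA gA)))))
    g₆ : Graded b 2 7 12 t₆
    g₆ = graded-up 0 1 0 (graded-⊛ (graded-⊛ (graded-⊛ (gι _) gYY) (gquad _ _ _)) (graded-d (graded-⊛ gA gc)))
    g₇ : Graded b 2 7 12 t₇
    g₇ = graded-up 0 3 3 (graded-⊛ gYY (graded-⊛ gc gc))
    g₈ : Graded b 2 7 12 t₈
    g₈ = graded-up 1 5 2 (graded-⊛ (graded-⊛ (graded-⊛ (gι _) gQ) gYY) gc)
    g₉ : Graded b 2 7 12 t₉
    g₉ = graded-up 2 7 1 (graded-⊛ (graded-⊛ gQ gQ) gYY)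

  -- Division by 4t(1-t)³ raises the order of the pole at t = 1 by three and lowers the degree of
  -- the numerator by one.
  ĉ-suc : ∀ k -> Rational (4 N.* k N.+ 2) (5 N.* k N.+ 7) (9 N.* k N.+ 12) (forcing k) -> Rational (4 N.* suc k N.+ 1) (5 N.* suc k N.+ 2) (9 N.* suc k N.+ 2) (ĉ (suc k))
  ĉ-suc k f = rational-≡ (solveℕ 1 (\ h -> conℕ 3 :⊹ (conℕ 4 :× h :⊹ conℕ 2) :≡ conℕ 4 :× (conℕ 1 :⊹ h) :⊹ conℕ 1) refl k)
   (solveℕ 1 (\ h -> conℕ 5 :× h :⊹ conℕ 7 :≡ conℕ 5 :× (conℕ 1 :⊹ h) :⊹ conℕ 2) refl k) (solveℕ 1 (\ h -> conℕ 9 :× h :⊹ conℕ 11 :≡ conℕ 9 :× (conℕ 1 :⊹ h) :⊹ conℕ 2) refl k) (rational num)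
   where
   m = 4 N.* k N.+ 2
   n = 5 N.* k N.+ 7
   D = pow d1 m
   E = pow z n
   N = (d1 · (d1 · (d1 · D))) · (E · ĉ (suc k))
   P-forcing : P · ĉ (suc k) ≈ forcing k
   P-forcing = R.tra (genus-tail-at (suc k)) (R.tra (R.+-idˡ ((ε ⊛ forcing) (suc k))) (ε-⊛-suc forcing k))
   scaled : D · (E · forcing k) ≈ X · (R.κ 4 · N)
   scaled = R.tra (R.*-cong (R.rfl {D}) (R.*-cong (R.rfl {E}) (R.≈-sym P-forcing))) (R.Solver.solve 5 (\ x d D E c -> let open R.Solver in
    D :* (E :* (# 4 :* x :* (d :* d :* d) :* c)) := x :* (# 4 :* ((d :* (d :* (d :* D))) :* (E :* c)))) R.rfl X d1 D E (ĉ (suc k)))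
   num : IsPoly (9 N.* k N.+ 11) N
   num j l = cancel-≢0 (nat 4) (nat-suc≢0 3) (by (sym (·-const (nat 4) N j)) (by (sym (X·-suc (R.κ 4 · N) j)) (by (sym (scaled (suc j)))
    (by (numerator f (suc j) (subst (N._< suc j) (sym (NP.+-suc (9 N.* k) 11)) (s≤s l))) (sym (J.zeroʳ _))))))

  -- The forcing at index b involves ĉ up to index b only and determines ĉ at b + 1; therefore
  -- gradings are stated up to a bound.
  ĉ-graded : ∀ b -> Graded b 1 2 2 ĉ
  at (ĉ-graded zero) .0 z≤n = ĉ-0
  at (ĉ-graded (suc b)) h l = last h (NP.m≤n⇒m<n∨m≡n l)
   where
   last : ∀ h -> h N.< suc b ⊎ h ≡ suc b -> Rational (4 N.* h N.+ 1) (5 N.* h N.+ 2) (9 N.* h N.+ 2) (ĉ h)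
   last h (inj₁ (s≤s l)) = at (ĉ-graded b) h l
   last .(suc b) (inj₂ refl) = ĉ-suc b (at (gforcing (ĉ-graded b)) b NP.≤-refl)

 C-rational : ∀ k -> Rational (4 N.* suc k N.+ 1) (5 N.* suc k N.+ 2) (9 N.* suc k N.+ 2) (C (2 N.+ k))
 C-rational k = rational-cong (R.+-idʳ (C (2 N.+ k))) (at (ĉ-graded (suc k)) (suc k) NP.≤-refl)

-- Integrality, order and leading coefficient of the numerators

module Numerators (J : NumberField) where

 open Series J
 private module J = FieldProperties J
 open J using (F; nat; int; int-0; int-1; int-+; int-*; int-neg; nat-*)
 open GenusExpansion J using (rooted#)
 open GenusSeries J
 open Substitution J
 open RationalForm J using (d1)
 open PoleOrders J

 open Toda J using (rf)
 open ℤ-AlgebraProperties serAlg using (ι; κ)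

 rf-! : ∀ n -> rf n J.* nat (n !) ≡ J.1#
 rf-! n = by (cong (rf n J.*_) (sym (Relabelling.permCount-! J 0 0 n))) (KP.rf-permCount J n)

 IsIntegral : F -> Set
 IsIntegral x = ∃ \ i -> x ≡ int i

 integral-+ : ∀ {x y} -> IsIntegral x -> IsIntegral y -> IsIntegral (x J.+ y)
 integral-+ (i , p) (j , q) = i Z.+ j , by (cong₂ J._+_ p q) (sym (int-+ i j))

 integral-* : ∀ {x y} -> IsIntegral x -> IsIntegral y -> IsIntegral (x J.* y)
 integral-* (i , p) (j , q) = i Z.* j , by (cong₂ J._*_ p q) (sym (int-* i j))

 integral-neg : ∀ {x} -> IsIntegral x -> IsIntegral (J.- x)
 integral-neg (i , p) = Z.- i , by (cong J.-_ p) (sym (int-neg i))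

 integral-0 : IsIntegral J.0#
 integral-0 = Z.+ 0 , sym int-0

 integral-sumTo : ∀ k {f : ℕ -> F} -> (∀ j -> IsIntegral (f j)) -> IsIntegral (sumTo k f)
 integral-sumTo zero p = p 0
 integral-sumTo (suc k) p = integral-+ (integral-sumTo k p) (p (suc k))

 Integral : Ser -> Set
 Integral f = ∀ k -> IsIntegral (f k)

 Integral-· : ∀ {f h} -> Integral f -> Integral h -> Integral (f · h)
 Integral-· p q k = integral-sumTo k (\ j -> integral-* (p j) (q (k ∸ j)))

 Integral-⊕ : ∀ {f h} -> Integral f -> Integral h -> Integral (f ⊕ h)
 Integral-⊕ p q k = integral-+ (p k) (q k)

 Integral-⊝ : ∀ {f} -> Integral f -> Integral (⊝ f)
 Integral-⊝ p k = integral-neg (p k)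

 Integral-ι : ∀ i -> Integral (ι i)
 Integral-ι i zero = i , refl
 Integral-ι i (suc k) = integral-0

 Integral-𝟙 : Integral 𝟙
 Integral-𝟙 zero = Z.+ 1 , sym int-1
 Integral-𝟙 (suc k) = integral-0

 Integral-X : Integral X
 Integral-X zero = integral-0
 Integral-X (suc k) = Integral-𝟙 k

 Integral-linear : ∀ i j -> Integral (ι i ⊕ ⊝ (ι j · X))
 Integral-linear i j = Integral-⊕ {ι i} (Integral-ι i) (Integral-⊝ {ι j · X} (Integral-· {ι j} (Integral-ι j) Integral-X))

 Integral-d1 : Integral d1
 Integral-d1 = Integral-⊕ {ι (Z.+ 1)} (Integral-ι (Z.+ 1)) (Integral-⊝ {X} Integral-X)

 Integral-pow : ∀ {f} -> Integral f -> ∀ n -> Integral (pow f n)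
 Integral-pow p zero = Integral-𝟙
 Integral-pow {f} p (suc n) = Integral-· {f} p (Integral-pow p n)

 -- The quotient by (n-1)! is an integer because root-preserving relabellings act freely.
 Integral-A : ∀ g -> Integral (A g)
 Integral-A g zero = integral-0
 Integral-A g (suc m) = let (k , e) = Relabelling.countPairs-divisible J g m in
  Z.+ k , by (cong (\ n -> rf m J.* nat n) e) (by (cong (rf m J.*_) (nat-* (m !) k)) (by (sym (J.*-assoc (rf m) (nat (m !)) (nat k)))
   (by (cong (J._* nat k) (rf-! m)) (J.*-idˡ (nat k)))))

 Integral-Spow : ∀ n -> Integral (Spow n)
 Integral-Spow zero = Integral-𝟙
 Integral-Spow (suc n) = Integral-· {S} (Integral-· {X} Integral-X (Integral-linear (Z.+ 1) (Z.+ 2))) (Integral-Spow n)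

 Integral-C : ∀ g -> Integral (C g)
 Integral-C g k = integral-sumTo k (\ n -> integral-* (Integral-A g n) (Integral-Spow n k))

 C-low : ∀ g k -> k N.< suc (2 N.* g) -> C g k ≡ J.0#
 C-low g k (s≤s k≤) = sumTo-0 k (\ n n≤k -> by (cong (J._* Spow n k) (rooted#-low n g (NP.≤-trans n≤k k≤))) (J.zeroˡ _))

 C-leading : ∀ g -> C g (suc (2 N.* g)) ≡ A g (suc (2 N.* g))
 C-leading g = by (cong₂ J._+_ (sumTo-0 (2 N.* g) (\ n n≤ -> by (cong (J._* Spow n (suc (2 N.* g))) (rooted#-low n g n≤)) (J.zeroˡ _)))
  (by (cong (A g (suc (2 N.* g)) J.*_) (Spow-leading (suc (2 N.* g)))) (J.*-idʳ _)))
  (J.+-idˡ _)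

 ·-below : ∀ a {b} m -> (∀ k -> k N.< m -> b k ≡ J.0#) -> ∀ k -> k N.< m -> (a · b) k ≡ J.0#
 ·-below a m low k l = sumTo-0 k (\ j _ -> by (cong (a j J.*_) (low (k ∸ j) (NP.≤-<-trans (NP.m∸n≤m k j) l))) (J.zeroʳ _))

 ·-leading : ∀ a {b} m -> (∀ k -> k N.< suc m -> b k ≡ J.0#) -> (a · b) (suc m) ≡ a 0 J.* b (suc m)
 ·-leading a {b} m low = by (·-suc a b m) (by (cong (a 0 J.* b (suc m) J.+_) (·-below (tail a) {b} (suc m) low m NP.≤-refl)) (J.+-idʳ _))

 pow-head : ∀ {f} -> f 0 ≡ J.1# -> ∀ n -> pow f n 0 ≡ J.1#
 pow-head e zero = refl
 pow-head e (suc n) = by (cong₂ J._*_ e (pow-head e n)) (J.*-idˡ _)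

 d1-head : d1 0 ≡ J.1#
 d1-head = by (cong₂ J._+_ int-1 (by (sym (J.+-idˡ _)) (J.-‿inverseʳ J.0#))) (J.+-idʳ _)

 z-head : z 0 ≡ J.1#
 z-head = by (cong₂ J._+_ int-1 (by (cong J.-_ (J.zeroʳ _)) (by (sym (J.+-idˡ _)) (J.-‿inverseʳ J.0#)))) (J.+-idʳ _)

 module _ (g m n : ℕ) where

  clear : Ser
  clear = pow d1 m · (pow z n · C g)

  clear-integral : Integral clear
  clear-integral = Integral-· {pow d1 m} (Integral-pow Integral-d1 m) (Integral-· {pow z n} (Integral-pow (Integral-linear (Z.+ 1) (Z.+ 4)) n) (Integral-C g))

  clear-low : ∀ k -> k N.< suc (2 N.* g) -> clear k ≡ J.0#
  clear-low = ·-below (pow d1 m) {pow z n · C g} (suc (2 N.* g)) (·-below (pow z n) {C g} (suc (2 N.* g)) (C-low g))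

  -- The factors 1-t and 1-4t have constant term 1, and so does s/t, so the lowest coefficient
  -- passes unchanged from the series in s to the numerator.
  clear-leading : clear (suc (2 N.* g)) ≡ A g (suc (2 N.* g))
  clear-leading = by (·-leading (pow d1 m) {pow z n · C g} (2 N.* g) (·-below (pow z n) {C g} (suc (2 N.* g)) (C-low g)))
   (by (cong₂ J._*_ (pow-head {d1} d1-head m) (by (·-leading (pow z n) {C g} (2 N.* g) (C-low g)) (by (cong (J._* C g (suc (2 N.* g))) (pow-head {z} z-head n)) (J.*-idˡ _))))
   (by (J.*-idˡ _) (C-leading g)))

-- The results in the form of the statement

module Presentation (J : NumberField) where

 open Series J
 private module J = FieldProperties J
 open J using (F; nat; int; int-*; int-injective)
 open GenusSeries J
 open Substitution J
 open RationalForm J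
 open PoleOrders J
 open GenusTail J using (genus-one; C-rational)
 open Numerators J
 open Toda J using (deriv)
 private module R = ℤ-AlgebraProperties serAlg
 open R.Solver using (solve; con; _:+_; _:*_; _:-_; :-_; _:=_)

 -- The Horner form, built from X and ring operations so that the ring solver applies; `poly-≃`
 -- identifies it with the coefficientwise form.
 poly : List ℤ -> Ser
 poly [] = 𝟘
 poly (c ∷ cs) = R.ι c ⊕ X · poly cs

 T : Ser
 T = poly (Z.+ 0 ∷ Z.+ 1 ∷ [])

 private
  last : ∀ i -> R.ι i ⊕ X · 𝟘 ≈ R.ι i
  last i = R.tra (R.+-cong (R.rfl {R.ι i}) (R.zeroʳ X)) (R.+-idʳ (R.ι i))

  next : ∀ i {f g} -> f ≈ g -> R.ι i ⊕ X · f ≈ R.ι i ⊕ X · g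
  next i e = R.+-cong (R.rfl {R.ι i}) (R.*-cong (R.rfl {X}) e)

 poly-T : T ≈ X
 poly-T = R.tra (next (Z.+ 0) (last (Z.+ 1))) (solve 1 (\ x -> # 0 :+ x :* # 1 := x) R.rfl X)

 poly-linear' : ∀ i j -> poly (i ∷ Z.- j ∷ []) ≈ R.ι i R.- R.ι j · X
 poly-linear' i j = R.tra (next i (R.tra (last (Z.- j)) (R.-‿homo j))) (solve 3 (\ i j x -> i :+ x :* (:- j) := i :- j :* x) R.rfl (R.ι i) (R.ι j) X)

 poly-y : poly (Z.+ 1 ∷ Z.- (Z.+ 2) ∷ []) ≈ y
 poly-y = poly-linear' (Z.+ 1) (Z.+ 2)

 poly-z : poly (Z.+ 1 ∷ Z.- (Z.+ 4) ∷ []) ≈ z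
 poly-z = poly-linear' (Z.+ 1) (Z.+ 4)

 poly-d : poly (Z.+ 1 ∷ Z.- (Z.+ 1) ∷ []) ≈ d1
 poly-d = R.tra (poly-linear' (Z.+ 1) (Z.+ 1)) (solve 1 (\ x -> # 1 :- # 1 :* x := # 1 :- x) R.rfl X)

 poly-S : poly (Z.+ 0 ∷ Z.+ 1 ∷ Z.- (Z.+ 2) ∷ []) ≈ S
 poly-S = R.tra (next (Z.+ 0) poly-y) (solve 1 (\ x -> # 0 :+ x :* (# 1 :- # 2 :* x) := x :* (# 1 :- # 2 :* x)) R.rfl X)

 pow-cong : ∀ {f g} -> f ≈ g -> ∀ n -> pow f n ≈ pow g n
 pow-cong e zero = R.rfl
 pow-cong e (suc n) = R.*-cong e (pow-cong e n)

 pow-S : ∀ n -> pow (poly (Z.+ 0 ∷ Z.+ 1 ∷ Z.- (Z.+ 2) ∷ [])) n ≈ Spow n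
 pow-S zero = R.rfl
 pow-S (suc n) = R.*-cong poly-S (pow-S n)

 pow-2 : ∀ f -> pow f 2 ≈ f · f
 pow-2 f = R.*-cong (R.rfl {f}) (R.*-idʳ f)

 pow-3 : ∀ f -> pow f 3 ≈ f · f · f
 pow-3 f = R.tra (R.*-cong (R.rfl {f}) (pow-2 f)) (R.≈-sym (R.*-assoc f f f))

 pow-4 : ∀ f -> pow f 4 ≈ f · f · (f · f)
 pow-4 f = R.tra (R.*-cong (R.rfl {f}) (R.*-cong (R.rfl {f}) (pow-2 f))) (R.≈-sym (R.*-assoc f f (f · f)))

 pow-5 : ∀ f -> pow f 5 ≈ f · f · (f · f) · f
 pow-5 f = R.tra (R.*-cong (R.rfl {f}) (pow-4 f)) (R.*-comm f (f · f · (f · f)))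

 genus-0 : pow (poly (Z.+ 1 ∷ Z.- (Z.+ 2) ∷ [])) 2 · C 0 ≈ poly (Z.+ 0 ∷ Z.+ 1 ∷ Z.- (Z.+ 3) ∷ [])
 genus-0 = R.tra (R.*-cong (R.tra (pow-cong poly-y 2) (pow-2 y)) C-0) (R.tra
  (modulo-y (X · (R.κ 1 R.- R.κ 3 · X) · (y · w2 ⊕ R.κ 1)) (solve 2 (\ x w -> let y = # 1 :- # 2 :* x ; p = x :* (# 1 :- # 3 :* x) in
   y :* y :* (p :* (w :* w)) := p :+ (p :* (y :* w :+ # 1)) :* (y :* w :- # 1)) R.rfl X w2))
  (R.≈-sym (R.tra (next (Z.+ 0) (poly-linear' (Z.+ 1) (Z.+ 3))) (solve 1 (\ x -> # 0 :+ x :* (# 1 :- # 3 :* x) := x :* (# 1 :- # 3 :* x)) R.rfl X))))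

 genus-1 : poly (Z.+ 1 ∷ Z.- (Z.+ 1) ∷ []) · pow (poly (Z.+ 1 ∷ Z.- (Z.+ 4) ∷ [])) 2 · C 1 ≈ pow T 3
 genus-1 = R.tra (R.*-cong (R.*-cong poly-d (R.tra (pow-cong poly-z 2) (pow-2 z))) (R.rfl {C 1})) (R.tra genus-one (R.≈-sym (R.tra (pow-cong poly-T 3) (pow-3 X))))

 Dop : Ser -> Ser
 Dop a =
  (pow T 2 · pow (poly (Z.+ 1 ∷ Z.- (Z.+ 2) ∷ [])) 2 · pow w4 3 · deriv (deriv (deriv a)))
  ⊕ (T · poly (Z.+ 1 ∷ Z.- (Z.+ 2) ∷ []) · poly (Z.+ 5 ∷ Z.- (Z.+ 28) ∷ Z.+ 56 ∷ []) · pow w4 4 · deriv (deriv a))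
  ⊕ (poly (Z.+ 4 ∷ Z.- (Z.+ 44) ∷ Z.+ 232 ∷ Z.- (Z.+ 576) ∷ Z.+ 576 ∷ []) · pow w4 5 · deriv a)

 Dop-Dₜ : ∀ u -> Dop u ≈ Dₜ u
 Dop-Dₜ u = R.+-cong (R.+-cong
  (R.*-cong (R.tra (R.*-cong (R.*-cong (R.tra (pow-cong poly-T 2) (pow-2 X)) (R.tra (pow-cong poly-y 2) (pow-2 y))) (pow-3 w4))
  (solve 3 (\ x y w -> x :* x :* (y :* y) :* w := (x :* y) :* (x :* y) :* w) R.rfl X y (w4 · w4 · w4))) (R.rfl {deriv (deriv (deriv u))}))
  (R.*-cong (R.*-cong (R.*-cong (R.*-cong poly-T poly-y) quadratic) (pow-4 w4)) (R.rfl {deriv (deriv u)})))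
  (R.*-cong (R.*-cong quartic (pow-5 w4)) (R.rfl {deriv u}))
  where
  quadratic : poly (Z.+ 5 ∷ Z.- (Z.+ 28) ∷ Z.+ 56 ∷ []) ≈ R.κ 5 R.- R.κ 28 · X ⊕ R.κ 56 · (X · X)
  quadratic = R.tra (next (Z.+ 5) (next (Z.- (Z.+ 28)) (last (Z.+ 56))))
   (solve 1 (\ x -> # 5 :+ x :* (con (Z.- (Z.+ 28)) :+ x :* # 56) := # 5 :- # 28 :* x :+ # 56 :* (x :* x)) R.rfl X)
  quartic : poly (Z.+ 4 ∷ Z.- (Z.+ 44) ∷ Z.+ 232 ∷ Z.- (Z.+ 576) ∷ Z.+ 576 ∷ [])
   ≈ R.κ 4 R.- R.κ 44 · X ⊕ R.κ 232 · (X · X) R.- R.κ 576 · (X · X · X) ⊕ R.κ 576 · (X · X · (X · X))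
  quartic = R.tra (next (Z.+ 4) (next (Z.- (Z.+ 44)) (next (Z.+ 232) (next (Z.- (Z.+ 576)) (last (Z.+ 576))))))
   (solve 1 (\ x -> # 4 :+ x :* (con (Z.- (Z.+ 44)) :+ x :* (# 232 :+ x :* (con (Z.- (Z.+ 576)) :+ x :* # 576)))
   := # 4 :- # 44 :* x :+ # 232 :* (x :* x) :- # 576 :* (x :* x :* x) :+ # 576 :* (x :* x :* (x :* x))) R.rfl X)

 recIntegrand : ℕ -> Ser
 recIntegrand h = pow T 3 · poly (Z.+ 1 ∷ Z.- (Z.+ 1) ∷ []) · (Dop (C h) ⊕ pow w4 2 · sumBelow h (\ j ->
  ((poly (Z.+ 4 ∷ Z.- (Z.+ 16) ∷ []) · C (suc j)) ⊕ (poly (Z.+ 0 ∷ Z.+ 6 ∷ Z.- (Z.+ 12) ∷ []) · deriv (C (suc j)))) · deriv (C (suc h ∸ suc j))))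

 recIntegrand-integrand : ∀ h -> recIntegrand h ≈ integrand h
 recIntegrand-integrand h = R.*-cong (R.*-cong (R.tra (pow-cong poly-T 3) (pow-3 X)) poly-d) (R.+-cong (Dop-Dₜ (C h)) (R.*-cong (pow-2 w4) (sumBelow-cong h (\ j ->
  R.*-cong (R.+-cong (R.tra (R.*-cong linear (R.rfl {C (suc j)})) (R.*-assoc (R.κ 4) z (C (suc j))))
  (R.tra (R.*-cong quadratic (R.rfl {deriv (C (suc j))})) (R.*-assoc (R.κ 6) S (deriv (C (suc j)))))) (R.rfl {deriv (C (suc h ∸ suc j))})))))
  where
  linear : poly (Z.+ 4 ∷ Z.- (Z.+ 16) ∷ []) ≈ R.κ 4 · z
  linear = R.tra (poly-linear' (Z.+ 4) (Z.+ 16)) (solve 1 (\ x -> # 4 :- # 16 :* x := # 4 :* (# 1 :- # 4 :* x)) R.rfl X)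
  quadratic : poly (Z.+ 0 ∷ Z.+ 6 ∷ Z.- (Z.+ 12) ∷ []) ≈ R.κ 6 · S
  quadratic = R.tra (next (Z.+ 0) (next (Z.+ 6) (last (Z.- (Z.+ 12))))) (solve 1 (\ x -> # 0 :+ x :* (# 6 :+ x :* con (Z.- (Z.+ 12))) := # 6 :* (x :* (# 1 :- # 2 :* x))) R.rfl X)

 recursion' : ∀ h U -> U 0 ≡ J.0# -> (∀ k -> nat (suc k) J.* U (suc k) ≡ recIntegrand h k) ->
  T · pow (poly (Z.+ 1 ∷ Z.- (Z.+ 1) ∷ [])) 3 · C (suc h) ≈ pow (poly (Z.+ 1 ∷ Z.- (Z.+ 2) ∷ [])) 2 · U
 recursion' h U U0 U' = R.tra (R.*-cong (R.*-cong poly-T (R.tra (pow-cong poly-d 3) (pow-3 d1))) (R.rfl {C (suc h)}))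
  (R.tra (recursion h U U0 (\ k -> by (U' k) (recIntegrand-integrand h k))) (R.*-cong (R.≈-sym (R.tra (pow-cong poly-y 2) (pow-2 y))) (R.rfl {U})))

 module _ (k : ℕ) where

  private
   open Data.Nat.Solver.+-*-Solver using () renaming (solve to solveℕ; _:=_ to _:≡_; _:*_ to _:⋆_; _:+_ to _:⊹_; con to conℕ)
   -- Writing g as 2 + k makes the truncated subtractions in the exponents exact.
   g = 2 N.+ k
   m = 4 N.* suc k N.+ 1
   n = 5 N.* suc k N.+ 2

   4g∸3 : 4 N.* g ∸ 3 ≡ m
   4g∸3 = by (cong (_∸ 3) (solveℕ 1 (\ k -> conℕ 4 :⋆ (conℕ 2 :⊹ k) :≡ conℕ 3 :⊹ (conℕ 4 :⋆ (conℕ 1 :⊹ k) :⊹ conℕ 1)) refl k)) (NP.m+n∸m≡n 3 m)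

   5g∸3 : 5 N.* g ∸ 3 ≡ n
   5g∸3 = by (cong (_∸ 3) (solveℕ 1 (\ k -> conℕ 5 :⋆ (conℕ 2 :⊹ k) :≡ conℕ 3 :⊹ (conℕ 5 :⋆ (conℕ 1 :⊹ k) :⊹ conℕ 2)) refl k)) (NP.m+n∸m≡n 3 n)

   9g∸7 : 9 N.* g ∸ 7 ≡ 9 N.* suc k N.+ 2
   9g∸7 = by (cong (_∸ 7) (solveℕ 1 (\ k -> conℕ 9 :⋆ (conℕ 2 :⊹ k) :≡ conℕ 7 :⊹ (conℕ 9 :⋆ (conℕ 1 :⊹ k) :⊹ conℕ 2)) refl k)) (NP.m+n∸m≡n 7 (9 N.* suc k N.+ 2))

   p : ℕ -> ℤ
   p i = proj₁ (clear-integral g m n i)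

   p-clear : ∀ i -> int (p i) ≡ clear g m n i
   p-clear i = sym (proj₂ (clear-integral g m n i))

  numerators : ∃ \ (p : ℕ -> ℤ) ->
   (∀ i -> (i N.< 2 N.* g N.+ 1 ⊎ 9 N.* g ∸ 7 N.< i) -> p i ≡ Z.+ 0)
   × (p (2 N.* g N.+ 1) Z.* Z.+ (g N.+ 1) ≡ Z.+ ((2 N.* g) !))
   × (pow (poly (Z.+ 1 ∷ Z.- (Z.+ 1) ∷ [])) (4 N.* g ∸ 3) · pow (poly (Z.+ 1 ∷ Z.- (Z.+ 4) ∷ [])) (5 N.* g ∸ 3) · C g ≈ (\ k -> int (p k)))
  numerators = p , vanish , leading , series
   where
   zero-p : ∀ i -> clear g m n i ≡ J.0# -> p i ≡ Z.+ 0
   zero-p i e = int-injective (by (p-clear i) (by e (sym J.int-0)))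
   vanish : ∀ i -> (i N.< 2 N.* g N.+ 1 ⊎ 9 N.* g ∸ 7 N.< i) -> p i ≡ Z.+ 0
   vanish i (inj₁ l) = zero-p i (clear-low g m n i (subst (i N.<_) (NP.+-comm (2 N.* g) 1) l))
   vanish i (inj₂ l) = zero-p i (numerator (C-rational k) i (subst (N._< i) 9g∸7 l))
   leading : p (2 N.* g N.+ 1) Z.* Z.+ (g N.+ 1) ≡ Z.+ ((2 N.* g) !)
   leading = int-injective (by (int-* (p (2 N.* g N.+ 1)) (Z.+ (g N.+ 1))) (by (cong₂ J._*_
    (by (cong (\ i -> int (p i)) (NP.+-comm (2 N.* g) 1)) (by (p-clear (suc (2 N.* g))) (clear-leading g m n))) (cong nat (NP.+-comm g 1)))
    (by (J.*-comm (A g (suc (2 N.* g))) (nat (suc g))) (rooted#-leading g))))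
   series : pow (poly (Z.+ 1 ∷ Z.- (Z.+ 1) ∷ [])) (4 N.* g ∸ 3) · pow (poly (Z.+ 1 ∷ Z.- (Z.+ 4) ∷ [])) (5 N.* g ∸ 3) · C g ≈ (\ k -> int (p k))
   series = R.tra (R.*-cong (R.*-cong (R.tra (pow-cong poly-d (4 N.* g ∸ 3)) (\ i -> cong (\ e -> pow d1 e i) 4g∸3)) (R.tra (pow-cong poly-z (5 N.* g ∸ 3)) (\ i -> cong (\ e -> pow z e i) 5g∸3))) (R.rfl {C g}))
    (R.tra (R.*-assoc (pow d1 m) (pow z n) (C g)) (\ i -> sym (p-clear i)))

-- Transfer to the definitions of the statement

*-/ : ∀ i n .{{_ : NonZero n}} -> D.ℕtoℚ n ℚ.* (i ℚ./ n) ≡ D.ℤtoℚ i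
*-/ i (suc d) = ℚP.toℚᵘ-injective (begin
 ℚ.toℚᵘ (D.ℕtoℚ (suc d) ℚ.* (i ℚ./ suc d)) ≈⟨ ℚP.toℚᵘ-homo-* (D.ℕtoℚ (suc d)) (i ℚ./ suc d) ⟩
 ℚ.toℚᵘ (D.ℕtoℚ (suc d)) ℚᵘ.* ℚ.toℚᵘ (i ℚ./ suc d) ≈⟨ ℚᵘP.*-cong (toℚᵘ-ℤtoℚ (Z.+ suc d)) (ℚP.toℚᵘ-fromℚᵘ (ℚᵘ.mkℚᵘ i d)) ⟩
 ℚᵘ.mkℚᵘ (Z.+ suc d) 0 ℚᵘ.* ℚᵘ.mkℚᵘ i d ≈⟨ ℚᵘ.*≡* (by (ZP.*-identityʳ _) (by (ZP.*-comm (Z.+ suc d) i) (cong (\ n -> i Z.* (Z.+ suc n)) (sym (NP.+-identityʳ d))))) ⟩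
 ℚᵘ.mkℚᵘ i 0 ≈⟨ toℚᵘ-ℤtoℚ i ⟨
 ℚ.toℚᵘ (D.ℤtoℚ i) ∎)
 where open ℚᵘP.≃-Reasoning

private
 module J = FieldProperties ℚ-field
 module Σ = Series ℚ-field
 module G = GenusSeries ℚ-field
 module Sb = Substitution ℚ-field
 module W = Presentation ℚ-field

open PoleOrders ℚ-field using (pow)
open RationalForm ℚ-field using (sumBelow)
open Toda ℚ-field using (rf; deriv)
open Numerators ℚ-field using (rf-!)
open GenusExpansion ℚ-field using (rooted#)

c-rooted# : ∀ g m -> D.c g (suc m) ≡ rooted# g (suc m)
c-rooted# g m = J.cancel-≢0 (J.nat (m !)) m!≢0 (by (*-/ (Z.+ D.countPairs g (suc m)) (m !) {{m NP.!≢0}})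
 (sym (by (sym (J.*-assoc (J.nat (m !)) (rf m) (J.nat (D.countPairs g (suc m))))) (by (cong (J._* J.nat (D.countPairs g (suc m))) (by (J.*-comm (J.nat (m !)) (rf m)) (rf-! m)))
 (J.*-idˡ (J.nat (D.countPairs g (suc m))))))))
 where
 m!≢0 : ¬ J.nat (m !) ≡ J.0#
 m!≢0 e = GenusExpansion.1≢0 ℚ-field (by (sym (rf-! m)) (by (cong (rf m J.*_) e) (J.zeroʳ (rf m))))

Cs-rooted# : ∀ g n -> D.Cs g n ≡ rooted# g n
Cs-rooted# g n = decide n (suc (2 N.* g) ≤ᵇ n) refl
 where
 decide : ∀ n b -> (suc (2 N.* g) ≤ᵇ n) ≡ b -> (if b then D.c g n else ℚ.0ℚ) ≡ rooted# g n
 decide n false e = sym (G.rooted#-low n g (NP.≤-pred (NP.≰⇒> (\ l -> subst True e (NP.≤⇒≤ᵇ l)))))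
 decide (suc m) true e = c-rooted# g m

sumTo-≡ : ∀ k (f : ℕ -> ℚ) -> D.sumTo k f ≡ Σ.sumTo k f
sumTo-≡ zero f = refl
sumTo-≡ (suc k) f = cong (ℚ._+ f (suc k)) (sumTo-≡ k f)

-- Pointwise equality wrapped in a record, so that the two series can be read off from the type of a
-- proof when congruences are nested.
record _≃_ (a b : ℕ -> ℚ) : Set where
 field at : ∀ k -> a k ≡ b k
open _≃_
infix 4 _≃_

·-≃ : ∀ {a b a' b'} -> a ≃ a' -> b ≃ b' -> a D.⊗ b ≃ a' Σ.· b'
at (·-≃ {a} {b} p q) k = by (sumTo-≡ k (\ j -> a j ℚ.* b (k ∸ j))) (Σ.sumTo-cong k (\ j _ -> cong₂ ℚ._*_ (at p j) (at q (k ∸ j))))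

⊕-≃ : ∀ {a b a' b'} -> a ≃ a' -> b ≃ b' -> a D.⊕ b ≃ a' Σ.⊕ b'
at (⊕-≃ p q) k = cong₂ ℚ._+_ (at p k) (at q k)

poly-≃ : ∀ cs -> D.poly cs ≃ W.poly cs
at (poly-≃ []) k = refl
at (poly-≃ (c ∷ cs)) zero = sym (by (cong (D.ℤtoℚ c ℚ.+_) (Σ.X·-zero (W.poly cs))) (J.+-idʳ (D.ℤtoℚ c)))
at (poly-≃ (c ∷ cs)) (suc k) = by (at (poly-≃ cs) k) (sym (by (cong (J.0# ℚ.+_) (Σ.X·-suc (W.poly cs) k)) (J.+-idˡ (W.poly cs k))))

^-≃ : ∀ {a b} -> a ≃ b -> ∀ n -> (a D.^ n) ≃ (pow b n)
at (^-≃ p zero) zero = refl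
at (^-≃ p zero) (suc k) = refl
^-≃ {a} {b} p (suc n) = ·-≃ {a} {a D.^ n} {b} {pow b n} p (^-≃ p n)

Ct-≃ : ∀ g -> D.Ct g ≃ G.C g
at (Ct-≃ g) k = by (sumTo-≡ k (\ n -> D.Cs g n ℚ.* (D.S D.^ n) k)) (Σ.sumTo-cong k (\ n _ -> cong₂ ℚ._*_ (Cs-rooted# g n)
 (by (at (^-≃ (poly-≃ (Z.+ 0 ∷ Z.+ 1 ∷ Z.- (Z.+ 2) ∷ [])) n) k) (W.pow-S n k))))

inv1m4t-≃ : D.inv1m4t ≃ Sb.w4
at inv1m4t-≃ zero = refl
at inv1m4t-≃ (suc k) = by (J.nat-* 4 (4 N.^ k)) (cong (J.nat 4 ℚ.*_) (at inv1m4t-≃ k))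

deriv-≃ : ∀ {a b} -> a ≃ b -> D.deriv a ≃ deriv b
at (deriv-≃ p) k = cong (D.ℕtoℚ (suc k) ℚ.*_) (at p (suc k))

T-≃ : D.T ≃ W.T
T-≃ = poly-≃ (Z.+ 0 ∷ Z.+ 1 ∷ [])

Dop-≃ : ∀ {u v} -> u ≃ v -> D.Dop u ≃ W.Dop v
Dop-≃ e = ⊕-≃ (⊕-≃
 (·-≃ (·-≃ (·-≃ (^-≃ T-≃ 2) (^-≃ (poly-≃ (Z.+ 1 ∷ Z.- (Z.+ 2) ∷ [])) 2)) (^-≃ inv1m4t-≃ 3)) (deriv-≃ (deriv-≃ (deriv-≃ e))))
 (·-≃ (·-≃ (·-≃ (·-≃ T-≃ (poly-≃ (Z.+ 1 ∷ Z.- (Z.+ 2) ∷ []))) (poly-≃ (Z.+ 5 ∷ Z.- (Z.+ 28) ∷ Z.+ 56 ∷ []))) (^-≃ inv1m4t-≃ 4)) (deriv-≃ (deriv-≃ e))))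
 (·-≃ (·-≃ (poly-≃ (Z.+ 4 ∷ Z.- (Z.+ 44) ∷ Z.+ 232 ∷ Z.- (Z.+ 576) ∷ Z.+ 576 ∷ [])) (^-≃ inv1m4t-≃ 5)) (deriv-≃ e))

sum-≃ : ∀ n {f h : ℕ -> ℕ -> ℚ} -> (∀ j -> f j ≃ h j) -> D.sumPS (applyUpTo f n) ≃ sumBelow n h
at (sum-≃ zero e) k = refl
sum-≃ (suc n) e = ⊕-≃ (e 0) (sum-≃ n (\ j -> e (suc j)))

recIntegrand-≃ : ∀ h -> D.recIntegrand (suc h) ≃ W.recIntegrand h
recIntegrand-≃ h = ·-≃ (·-≃ (^-≃ T-≃ 3) (poly-≃ (Z.+ 1 ∷ Z.- (Z.+ 1) ∷ []))) (⊕-≃ (Dop-≃ (Ct-≃ h)) (·-≃ (^-≃ inv1m4t-≃ 2) (sum-≃ h (\ j ->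
 ·-≃ (⊕-≃ (·-≃ (poly-≃ (Z.+ 4 ∷ Z.- (Z.+ 16) ∷ [])) (Ct-≃ (suc j))) (·-≃ (poly-≃ (Z.+ 0 ∷ Z.+ 6 ∷ Z.- (Z.+ 12) ∷ [])) (deriv-≃ (Ct-≃ (suc j))))) (deriv-≃ (Ct-≃ (suc h ∸ suc j)))))))

integral-deriv : ∀ a k -> D.ℕtoℚ (suc k) ℚ.* D.integral a (suc k) ≡ a k
integral-deriv a k = by (cong (D.ℕtoℚ (suc k) ℚ.*_) (ℚP.*-comm (a k) (Z.+ 1 ℚ./ suc k))) (by (sym (ℚP.*-assoc (D.ℕtoℚ (suc k)) (Z.+ 1 ℚ./ suc k) (a k)))
 (by (cong (ℚ._* a k) (*-/ (Z.+ 1) (suc k))) (ℚP.*-identityˡ (a k))))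

≃-refl : ∀ {a} -> a ≃ a
at ≃-refl k = refl

transport : ∀ {a a' b b' : ℕ -> ℚ} -> a ≃ a' -> b ≃ b' -> a' Σ.≈ b' -> a D.≈ b
transport p q e k = by (at p k) (by (e k) (sym (at q k)))

part0 : D.poly (Z.+ 1 ∷ Z.- (Z.+ 2) ∷ []) D.^ 2 D.⊗ D.Ct 0 D.≈ D.poly (Z.+ 0 ∷ Z.+ 1 ∷ Z.- (Z.+ 3) ∷ [])
part0 = transport (·-≃ (^-≃ (poly-≃ (Z.+ 1 ∷ Z.- (Z.+ 2) ∷ [])) 2) (Ct-≃ 0)) (poly-≃ (Z.+ 0 ∷ Z.+ 1 ∷ Z.- (Z.+ 3) ∷ [])) W.genus-0

part1 : D.poly (Z.+ 1 ∷ Z.- (Z.+ 1) ∷ []) D.⊗ D.poly (Z.+ 1 ∷ Z.- (Z.+ 4) ∷ []) D.^ 2 D.⊗ D.Ct 1 D.≈ D.T D.^ 3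
part1 = transport (·-≃ (·-≃ (poly-≃ (Z.+ 1 ∷ Z.- (Z.+ 1) ∷ [])) (^-≃ (poly-≃ (Z.+ 1 ∷ Z.- (Z.+ 4) ∷ [])) 2)) (Ct-≃ 1)) (^-≃ T-≃ 3) W.genus-1

part2 : ∀ g -> 2 N.≤ g -> ∃ \ (p : ℕ -> ℤ) ->
 (∀ i -> (i N.< 2 N.* g N.+ 1 ⊎ 9 N.* g ∸ 7 N.< i) -> p i ≡ Z.+ 0)
 × (p (2 N.* g N.+ 1) Z.* Z.+ (g N.+ 1) ≡ Z.+ ((2 N.* g) !))
 × (D.poly (Z.+ 1 ∷ Z.- (Z.+ 1) ∷ []) D.^ (4 N.* g ∸ 3) D.⊗ D.poly (Z.+ 1 ∷ Z.- (Z.+ 4) ∷ []) D.^ (5 N.* g ∸ 3) D.⊗ D.Ct g D.≈ (\ k -> D.ℤtoℚ (p k)))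
part2 (suc (suc k)) (s≤s (s≤s z≤n)) = let (p , vanish , leading , series) = W.numerators k ; g = 2 N.+ k in
 p , vanish , leading , transport (·-≃ (·-≃ (^-≃ (poly-≃ (Z.+ 1 ∷ Z.- (Z.+ 1) ∷ [])) (4 N.* g ∸ 3)) (^-≃ (poly-≃ (Z.+ 1 ∷ Z.- (Z.+ 4) ∷ [])) (5 N.* g ∸ 3))) (Ct-≃ g)) ≃-refl series

part3 : ∀ g -> 1 N.≤ g -> D.T D.⊗ D.poly (Z.+ 1 ∷ Z.- (Z.+ 1) ∷ []) D.^ 3 D.⊗ D.Ct g
 D.≈ D.poly (Z.+ 1 ∷ Z.- (Z.+ 2) ∷ []) D.^ 2 D.⊗ D.integral (D.recIntegrand g)
part3 (suc h) (s≤s z≤n) = transport (·-≃ (·-≃ T-≃ (^-≃ (poly-≃ (Z.+ 1 ∷ Z.- (Z.+ 1) ∷ [])) 3)) (Ct-≃ (suc h)))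
 (·-≃ (^-≃ (poly-≃ (Z.+ 1 ∷ Z.- (Z.+ 2) ∷ [])) 2) (≃-refl {D.integral (D.recIntegrand (suc h))}))
 (W.recursion' h (D.integral (D.recIntegrand (suc h))) refl (\ k -> by (integral-deriv (D.recIntegrand (suc h)) k) (at (recIntegrand-≃ h) k)))

open import Defs
open import Data.Nat as ℕ using (_≤_)
open import Data.Integer as ℤ using (+_)
open import Data.Product using (Σ)

theorem1 :
    -- (1-2t)^2 C_0(t(1-2t)) = t(1-3t)
    (poly (+ 1 ∷ ℤ.- (+ 2) ∷ []) ^ 2 ⊗ Ct 0 ≈ poly (+ 0 ∷ + 1 ∷ ℤ.- (+ 3) ∷ []))
    -- (1-t)(1-4t)^2 C_1(t(1-2t)) = t^3
    × (poly (+ 1 ∷ ℤ.- (+ 1) ∷ []) ⊗ poly (+ 1 ∷ ℤ.- (+ 4) ∷ []) ^ 2 ⊗ Ct 1 ≈ T ^ 3)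
    -- g ≥ 2: (1-t)^(4g-3) (1-4t)^(5g-3) C_g(t(1-2t)) = P_g(t)
    × (∀ (g : ℕ) → 2 ≤ g →
         Σ (ℕ → ℤ) λ p →
           (∀ i → (i < 2 ℕ.* g ℕ.+ 1 ⊎ 9 ℕ.* g ∸ 7 < i) → p i ≡ + 0)
           × (p (2 ℕ.* g ℕ.+ 1) ℤ.* + (g ℕ.+ 1) ≡ + ((2 ℕ.* g) !))
           × (poly (+ 1 ∷ ℤ.- (+ 1) ∷ []) ^ (4 ℕ.* g ∸ 3)
                ⊗ poly (+ 1 ∷ ℤ.- (+ 4) ∷ []) ^ (5 ℕ.* g ∸ 3) ⊗ Ct g
              ≈ (λ k → ℤtoℚ (p k))))
    -- recursion, g ≥ 1 (denominator t(1-t)^3 cleared)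
    × (∀ (g : ℕ) → 1 ≤ g →
         T ⊗ poly (+ 1 ∷ ℤ.- (+ 1) ∷ []) ^ 3 ⊗ Ct g
         ≈ poly (+ 1 ∷ ℤ.- (+ 2) ∷ []) ^ 2 ⊗ integral (recIntegrand g))
theorem1 = part0 , part1 , part2 , part3
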